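{- There is an algorithm that, given a set of $n$ unit-length jobs with precedence constraints and a number $m$ of identical parallel machines (where $m$ is part of the input), computes the minimum makespan of a feasible schedule (i.e., solves $P\,|\,\mathrm{prec},p_j=1\,|\,C_{\max}$) in time $\mathcal{O}(1.997^n)$.
   Context: Problem $P\,|\,\mathrm{prec},p_j=1\,|\,C_{\max}$: the input is a finite set $V$ of $n$ jobs, each of unit length, a number $m$ of identical machines (part of the input), and a strict partial order $\prec$ on $V$ (the precedence constraints, given as a transitively closed directed acyclic graph $G=(V,A)$ with $(v,w)\in A$ iff $v\prec w$). A feasible schedule of makespan $M$ is a sequence $(T_1,\dots,T_M)$ of pairwise disjoint subsets of $V$ (timeslots) such that (i) $\bigcup_{i=1}^M T_i=V$, (ii) $|T_i|\le m$ for every $i$, and (iii) if $u\in T_i$, $v\in T_j$ and $u\prec v$, then $i<j$. The goal is to minimize the makespan $M$. -}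

module Defs where

open import Data.Bool using (Bool; true; false; if_then_else_)
open import Data.Fin using (Fin; fromℕ<; remQuot) renaming (_<_ to _<ᶠ_)
open import Data.Fin.Subset using (Subset; _∈_; _∩_; Empty; ∣_∣)
open import Data.Nat using (ℕ; zero; suc; _+_; _*_; _∸_; _^_; _≤_; _<_; _/_; _%_; NonZero; _≟_; _<?_)
open import Data.Nat.Properties using (m^n≢0)
open import Data.Product using (∃-syntax; _×_; _,_)
open import Level using (0ℓ)
open import Relation.Binary using (Rel; IsDecStrictPartialOrder)
open import Relation.Binary.PropositionalEquality using (_≡_; _≢_)
open import Relation.Nullary using (yes; no; does)

------------------------------------------------------------------------
-- The scheduling problem P | prec, p_j = 1 | C_max

-- The order is decidable because it is input data (a finite graph).
-- At least one machine is required; otherwise a nonempty set of jobs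
-- has no feasible schedule at all.
record Instance (n : ℕ) : Set₁ where
  field
    m                       : ℕ
    .{{m-nonZero}}          : NonZero m
    _≺_                     : Rel (Fin n) 0ℓ
    isDecStrictPartialOrder : IsDecStrictPartialOrder _≡_ _≺_

  open IsDecStrictPartialOrder isDecStrictPartialOrder public
    using () renaming (_<?_ to _≺?_)

-- Timeslots may be empty.
record Schedule {n : ℕ} (I : Instance n) (M : ℕ) : Set where
  open Instance I
  field
    T        : Fin M → Subset n
    disjoint : ∀ {i j} → i ≢ j → Empty (T i ∩ T j)
    covers   : ∀ v → ∃[ i ] v ∈ T i
    capacity : ∀ i → ∣ T i ∣ ≤ m
    respects : ∀ {u v i j} → u ∈ T i → v ∈ T j → u ≺ v → i <ᶠ j

IsMinMakespan : {n : ℕ} → Instance n → ℕ → Set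
IsMinMakespan I M = Schedule I M × (∀ M′ → Schedule I M′ → M ≤ M′)

------------------------------------------------------------------------
-- The machine model: a unit-cost word RAM with w-bit words, programmed
-- in structured form.  A program names finitely many registers; the
-- memory is addressed by words.

data BinOp : Set where
  add sub mul div mod lt eq : BinOp

data Expr : Set where
  lit  : ℕ → Expr
  reg  : ℕ → Expr
  load : Expr → Expr
  op   : BinOp → Expr → Expr → Expr

data Program : Set where
  skip         : Program
  _:=_         : ℕ → Expr → Program
  store        : Expr → Expr → Program      -- address, value
  _⨟_          : Program → Program → Program
  ifte         : Expr → Program → Program → Program
  while        : Expr → Program → Program

infix  6 _:=_
infixr 5 _⨟_

record State : Set where
  constructor ⟨_,_⟩
  field
    regs : ℕ → ℕ
    mem  : ℕ → ℕ

open State public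

_[_↦_] : (ℕ → ℕ) → ℕ → ℕ → (ℕ → ℕ)
(f [ a ↦ x ]) b = if does (b ≟ a) then x else f b

bit : Bool → ℕ
bit true  = 1
bit false = 0

wrap : ℕ → ℕ → ℕ
wrap w x = _%_ x (2 ^ w) {{m^n≢0 2 w}}

-- Subtraction is truncated at 0; x div 0 = 0 and x mod 0 = x.
⟦_⟧ᵒ : BinOp → ℕ → ℕ → ℕ
⟦ add ⟧ᵒ x y       = x + y
⟦ sub ⟧ᵒ x y       = x ∸ y
⟦ mul ⟧ᵒ x y       = x * y
⟦ div ⟧ᵒ x zero    = 0
⟦ div ⟧ᵒ x (suc y) = x / suc y
⟦ mod ⟧ᵒ x zero    = x
⟦ mod ⟧ᵒ x (suc y) = x % suc y
⟦ lt  ⟧ᵒ x y       = bit (does (x <? y))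
⟦ eq  ⟧ᵒ x y       = bit (does (x ≟ y))

-- Literals and results of operations are reduced modulo 2 ^ w, so from
-- a state holding only w-bit words all values and addresses are again
-- w-bit words.
eval : ℕ → Expr → State → ℕ
eval w (lit x)    σ = wrap w x
eval w (reg r)    σ = regs σ r
eval w (load e)   σ = mem σ (eval w e σ)
eval w (op o e f) σ = wrap w (⟦ o ⟧ᵒ (eval w e σ) (eval w f σ))

cost : Expr → ℕ
cost (lit _)    = 1
cost (reg _)    = 1
cost (load e)   = suc (cost e)
cost (op _ e f) = suc (cost e + cost f)

-- w ⊢ p , σ ⇓[ t ] σ′ : with word length w, program p started in state σ
-- halts in state σ′ after exactly t steps.
infix 4 _⊢_,_⇓[_]_

data _⊢_,_⇓[_]_ (w : ℕ) : Program → State → ℕ → State → Set where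
  skip⇓   : ∀ {σ} → w ⊢ skip , σ ⇓[ 1 ] σ
  assign⇓ : ∀ {r e σ} →
            w ⊢ r := e , σ ⇓[ suc (cost e) ] ⟨ regs σ [ r ↦ eval w e σ ] , mem σ ⟩
  store⇓  : ∀ {a e σ} →
            w ⊢ store a e , σ ⇓[ suc (cost a + cost e) ]
              ⟨ regs σ , mem σ [ eval w a σ ↦ eval w e σ ] ⟩
  seq⇓    : ∀ {p q σ σ′ σ″ s t} →
            w ⊢ p , σ ⇓[ s ] σ′ → w ⊢ q , σ′ ⇓[ t ] σ″ →
            w ⊢ p ⨟ q , σ ⇓[ s + t ] σ″
  then⇓   : ∀ {e p q σ σ′ t} → eval w e σ ≢ 0 →
            w ⊢ p , σ ⇓[ t ] σ′ →
            w ⊢ ifte e p q , σ ⇓[ suc (cost e + t) ] σ′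
  else⇓   : ∀ {e p q σ σ′ t} → eval w e σ ≡ 0 →
            w ⊢ q , σ ⇓[ t ] σ′ →
            w ⊢ ifte e p q , σ ⇓[ suc (cost e + t) ] σ′
  stop⇓   : ∀ {e p σ} → eval w e σ ≡ 0 →
            w ⊢ while e p , σ ⇓[ suc (cost e) ] σ
  loop⇓   : ∀ {e p σ σ′ σ″ s t} → eval w e σ ≢ 0 →
            w ⊢ p , σ ⇓[ s ] σ′ → w ⊢ while e p , σ′ ⇓[ t ] σ″ →
            w ⊢ while e p , σ ⇓[ suc (cost e + (s + t)) ] σ″

------------------------------------------------------------------------
-- Algorithms and their running time

-- Register 0 holds n, register 1 holds m, and memory cell n * i + j holds
-- the adjacency bit of (i , j).  Everything else is 0.
encode : {n : ℕ} → Instance n → State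
encode {n} I = ⟨ registers , matrix ⟩
  where
  open Instance I

  registers : ℕ → ℕ
  registers 0 = n
  registers 1 = m
  registers _ = 0

  matrix : ℕ → ℕ
  matrix a with a <? n * n
  ... | no  _    = 0
  ... | yes a<n² with remQuot {n} n (fromℕ< a<n²)
  ...   | i , j  = bit (does (i ≺? j))

-- The word length w ranges over everything that is at least k (n + 1), so
-- that exponentially large tables can be addressed, and large enough to
-- hold m.  The same program and time bound must work for every such w, in
-- particular for words of O(n + log m) bits, so nothing can be gained from
-- packing data into very long words.  The result is left in register 0.
ComputesMinMakespanInTime : Program → (ℕ → ℕ) → Set₁
ComputesMinMakespanInTime p time =
  ∃[ k ] ∀ n (I : Instance n) w → k * suc n ≤ w → Instance.m I < 2 ^ w →
    ∃[ t ] ∃[ σ ] (w ⊢ p , encode I ⇓[ t ] σ)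
                × t ≤ time n
                × IsMinMakespan I (regs σ 0)

-- f ∈O[ a / b ]^n means f n = O((a / b) ^ n); the inequality
-- f n ≤ c (a / b) ^ n is multiplied by b ^ n to stay within ℕ.
infix 4 _∈O[_/_]^n

_∈O[_/_]^n : (ℕ → ℕ) → ℕ → (b : ℕ) → .{{NonZero b}} → Set
f ∈O[ a / b ]^n = ∃[ c ] ∃[ n₀ ] ∀ n → n₀ ≤ n → f n * b ^ n ≤ c * a ^ n

{-# OPTIONS --safe #-}
module Submission where

-- Let C be the set of endpoints of a maximal matching of comparable jobs.
-- Down-sets of jobs, the possible states of a schedule between two time
-- slots, are listed as bit masks, and a dynamic program finds out which of
-- them can be reached by which time.  If the matching is large, each
-- matched pair rules out one of its four labellings, so there are at most
-- (3/4)^(n/120) 2^n down-sets, and the jobs of a slot are added one at a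
-- time, at polynomial cost per set.
--
-- If C is small, the jobs outside C form an antichain, and given the slots
-- of the jobs in C they may be scheduled by earliest deadline, ties being
-- broken by release time and then by index.  The available jobs in a state
-- of such a schedule split into done and waiting ones, and two features of
-- them (being above a given job of C, being below one) can always be found
-- that peel off part of them consistently with the three priorities.  A
-- labelling that can be peeled completely never has the signs of a nonzero
-- linear relation between the feature vectors of the jobs, which have at
-- most 3 |C| + 2 coordinates.  So the peelable states shatter no more jobs
-- than that outside C, the Sauer–Shelah lemma bounds their number by
-- O(1.236^n), and all pairs of them can be inspected.

open import Defs
open import Data.Bool using (Bool; true; false; if_then_else_; _∧_; _∨_; not; T)
open import Data.Bool.Properties using (not-involutive; ∨-identityʳ; ∧-zeroʳ; ∧-identityʳ)
import Data.Bool.Properties as Bool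
import Data.Nat.Solver
open import Data.List using (List; []; _∷_; length; map)
open import Data.List.Membership.Propositional using (_∈_)
open import Data.List.Relation.Unary.All as All using (All; []; _∷_)
open import Data.List.Relation.Unary.Any using (here; there)
open import Data.Nat using (ℕ; zero; suc)
open import Data.Product using (∃-syntax; Σ-syntax; _×_; _,_; proj₁; proj₂)
open import Data.Sum using (_⊎_; inj₁; inj₂; [_,_]′)
open import Data.Unit using (⊤; tt)
open import Data.Vec using (Vec; []; _∷_; lookup; tabulate)
open import Data.Vec.Properties using ([]=⇒lookup; lookup⇒[]=; lookup∘tabulate)
open import Function using (_∘_)
open import Relation.Binary using (IsDecStrictPartialOrder)
open import Relation.Binary.Definitions using (tri<; tri≈; tri>)
open import Relation.Binary.PropositionalEquality
open import Relation.Nullary using (yes; no; does; contradiction; Dec; ¬_)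
open import Relation.Nullary.Decidable using (¬?; decidable-stable; dec-true; dec-false; toWitness; _⊎-dec_; _×-dec_; _→-dec_)

-- Counting, and finite sets as bit masks

module Counting where

  open import Data.Nat
  open import Data.Nat.Properties
  open import Data.Nat.DivMod

  sg : ℕ → ℕ
  sg zero    = 0
  sg (suc _) = 1

  Σ< : ℕ → (ℕ → ℕ) → ℕ
  Σ< zero    f = 0
  Σ< (suc n) f = Σ< n f + f n

  # : ℕ → (ℕ → ℕ) → ℕ
  # n f = Σ< n (λ i → sg (f i))

  sg≤1 : ∀ x → sg x ≤ 1
  sg≤1 zero    = z≤n
  sg≤1 (suc x) = ≤-refl

  sg-bit : ∀ b → sg (bit b) ≡ bit b
  sg-bit true  = refl
  sg-bit false = refl

  sg≢0 : ∀ {x} → x ≢ 0 → sg x ≡ 1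
  sg≢0 {zero}  x≢0 = contradiction refl x≢0
  sg≢0 {suc x} _   = refl

  upd-same : ∀ f a x → (f [ a ↦ x ]) a ≡ x
  upd-same f a x with a ≡ᵇ a | ≡⇒≡ᵇ a a refl
  ... | true | _ = refl

  upd-diff : ∀ f a x b → b ≢ a → (f [ a ↦ x ]) b ≡ f b
  upd-diff f a x b b≢a with b ≡ᵇ a | ≡ᵇ⇒≡ b a
  ... | true  | k = contradiction (k tt) b≢a
  ... | false | _ = refl

  Σ<-cong : ∀ n {f g} → (∀ i → i < n → f i ≡ g i) → Σ< n f ≡ Σ< n g
  Σ<-cong zero    e = refl
  Σ<-cong (suc n) e = cong₂ _+_ (Σ<-cong n (λ i i< → e i (m≤n⇒m≤1+n i<))) (e n ≤-refl)

  Σ<-mono : ∀ n {f g} → (∀ i → i < n → f i ≤ g i) → Σ< n f ≤ Σ< n g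
  Σ<-mono zero    e = z≤n
  Σ<-mono (suc n) e = +-mono-≤ (Σ<-mono n (λ i i< → e i (m≤n⇒m≤1+n i<))) (e n ≤-refl)

  +-swap-mid : ∀ a b c d → (a + b) + (c + d) ≡ (a + c) + (b + d)
  +-swap-mid a b c d = trans (+-assoc a b (c + d)) (trans (cong (a +_) (trans (sym (+-assoc b c d))
    (trans (cong (_+ d) (+-comm b c)) (+-assoc c b d)))) (sym (+-assoc a c (b + d))))

  Σ<-+ : ∀ n f g → Σ< n (λ i → f i + g i) ≡ Σ< n f + Σ< n g
  Σ<-+ zero    f g = refl
  Σ<-+ (suc n) f g = trans (cong (_+ (f n + g n)) (Σ<-+ n f g)) (+-swap-mid (Σ< n f) _ _ _)

  Σ<-append : ∀ a b f → Σ< (a + b) f ≡ Σ< a f + Σ< b (λ i → f (a + i))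
  Σ<-append a zero    f rewrite +-identityʳ a = sym (+-identityʳ _)
  Σ<-append a (suc b) f rewrite +-suc a b =
    trans (cong (_+ f (a + b)) (Σ<-append a b f)) (+-assoc (Σ< a f) _ _)

  Σ<-const : ∀ n c → Σ< n (λ _ → c) ≡ n * c
  Σ<-const zero    c = refl
  Σ<-const (suc n) c = trans (cong (_+ c) (Σ<-const n c)) (+-comm (n * c) c)

  Σ<-pick : ∀ n f u → u < n → Σ< n f ≡ f u + Σ< n (f [ u ↦ 0 ])
  Σ<-pick (suc n) f u u< with u ≟ n
  ... | yes refl = begin
    Σ< n f + f n                                   ≡⟨ +-comm _ (f n) ⟩
    f n + Σ< n f                                   ≡⟨ cong (f n +_) (+-identityʳ (Σ< n f)) ⟨
    f n + (Σ< n f + 0)                             ≡⟨ cong (f n +_) (cong₂ _+_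
        (Σ<-cong n (λ i i< → sym (upd-diff f n 0 i (<⇒≢ i<)))) (sym (upd-same f n 0))) ⟩
    f n + (Σ< n (f [ n ↦ 0 ]) + (f [ n ↦ 0 ]) n) ∎ where open ≡-Reasoning
  ... | no u≢n = begin
    Σ< n f + f n                                   ≡⟨ cong (_+ f n) (Σ<-pick n f u (≤∧≢⇒< (s≤s⁻¹ u<) u≢n)) ⟩
    f u + Σ< n (f [ u ↦ 0 ]) + f n                 ≡⟨ +-assoc (f u) _ _ ⟩
    f u + (Σ< n (f [ u ↦ 0 ]) + f n)               ≡⟨ cong (λ z → f u + (Σ< n (f [ u ↦ 0 ]) + z)) (upd-diff f u 0 n (u≢n ∘ sym)) ⟨
    f u + (Σ< n (f [ u ↦ 0 ]) + (f [ u ↦ 0 ]) n)   ∎ where open ≡-Reasoning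

  #-cong : ∀ n {f g} → (∀ i → i < n → f i ≡ g i) → # n f ≡ # n g
  #-cong n e = Σ<-cong n (λ i i< → cong sg (e i i<))

  #≤ : ∀ n f → # n f ≤ n
  #≤ zero    f = z≤n
  #≤ (suc n) f = ≤-trans (+-mono-≤ (#≤ n f) (sg≤1 (f n))) (≤-reflexive (+-comm n 1))

  #-mono : ∀ n {f g} → (∀ i → i < n → f i ≢ 0 → g i ≢ 0) → # n f ≤ # n g
  #-mono n {f} {g} e = Σ<-mono n le
    where
    le : ∀ i → i < n → sg (f i) ≤ sg (g i)
    le i i< with f i | g i | e i i<
    ... | zero  | _     | _ = z≤n
    ... | suc _ | suc _ | _ = ≤-refl
    ... | suc _ | zero  | k = contradiction refl (k (λ ()))

  #-mono-< : ∀ n {f g} → (∀ i → i < n → f i ≢ 0 → g i ≢ 0) → ∀ u → u < n → f u ≡ 0 → g u ≢ 0 → # n f < # n g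
  #-mono-< (suc n) {f} {g} e u u< fu gu with u ≟ n
  ... | yes refl rewrite fu | sg≢0 gu = ≤-trans (s≤s (≤-reflexive (+-identityʳ _)))
    (≤-trans (s≤s (#-mono n (λ i i< → e i (m≤n⇒m≤1+n i<)))) (≤-reflexive (+-comm 1 _)))
  ... | no u≢n = +-mono-<-≤ (#-mono-< n (λ i i< → e i (m≤n⇒m≤1+n i<)) u (≤∧≢⇒< (s≤s⁻¹ u<) u≢n) fu gu) (last n ≤-refl)
    where
    last : ∀ i → i < suc n → sg (f i) ≤ sg (g i)
    last i i< with f i | g i | e i i<
    ... | zero  | _     | _ = z≤n
    ... | suc _ | suc _ | _ = ≤-refl
    ... | suc _ | zero  | k = contradiction refl (k (λ ()))

  #≡0⇒ : ∀ n f → # n f ≡ 0 → ∀ i → i < n → f i ≡ 0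
  #≡0⇒ (suc n) f z i i< with i ≟ n
  ... | no i≢n   = #≡0⇒ n f (m+n≡0⇒m≡0 (# n f) z) i (≤∧≢⇒< (s≤s⁻¹ i<) i≢n)
  ... | yes refl with f n | m+n≡0⇒n≡0 (# n f) z
  ...   | zero | _ = refl

  ⇒#≡0 : ∀ n f → (∀ i → i < n → f i ≡ 0) → # n f ≡ 0
  ⇒#≡0 n f e = trans (#-cong n e) (trans (Σ<-const n 0) (*-zeroʳ n))

  #≢0⇒ : ∀ n f → # n f ≢ 0 → ∃[ i ] i < n × f i ≢ 0
  #≢0⇒ zero    f z = contradiction refl z
  #≢0⇒ (suc n) f z with f n in e
  ... | suc x = n , ≤-refl , (λ y → 1+n≢0 (trans (sym e) y))
  ... | zero with #≢0⇒ n f (λ y → z (trans (+-identityʳ _) y))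
  ...   | i , i< , fi = i , m≤n⇒m≤1+n i< , fi

  ⇒#≢0 : ∀ n f i → i < n → f i ≢ 0 → # n f ≢ 0
  ⇒#≢0 n f i i< fi z = fi (#≡0⇒ n f z i i<)

  #-inj : ∀ l N F (L : ℕ → ℕ) → (∀ i j → i < l → j < l → L i ≡ L j → i ≡ j) →
          (∀ i → i < l → L i < N × F (L i) ≢ 0) → l ≤ # N F
  #-inj zero    N F L inj ok = z≤n
  #-inj (suc l) N F L inj ok with ok l ≤-refl
  ... | Ll< , FLl = begin
    suc l                             ≤⟨ s≤s (#-inj l N (F [ L l ↦ 0 ]) L
                                           (λ i j i< j< → inj i j (m≤n⇒m≤1+n i<) (m≤n⇒m≤1+n j<)) ok′) ⟩
    suc (# N (F [ L l ↦ 0 ]))         ≡⟨ cong suc (Σ<-cong N (λ i i< → sg-upd i)) ⟩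
    1 + Σ< N ((sg ∘ F) [ L l ↦ 0 ])   ≡⟨ cong (_+ Σ< N ((sg ∘ F) [ L l ↦ 0 ])) (sg≢0 FLl) ⟨
    sg (F (L l)) + Σ< N ((sg ∘ F) [ L l ↦ 0 ]) ≡⟨ Σ<-pick N (sg ∘ F) (L l) Ll< ⟨
    # N F                             ∎
    where
    open ≤-Reasoning
    sg-upd : ∀ i → sg ((F [ L l ↦ 0 ]) i) ≡ ((sg ∘ F) [ L l ↦ 0 ]) i
    sg-upd i with i ≡ᵇ L l
    ... | true  = refl
    ... | false = refl
    ok′ : ∀ i → i < l → L i < N × (F [ L l ↦ 0 ]) (L i) ≢ 0
    ok′ i i< with ok i (m≤n⇒m≤1+n i<)
    ... | Li< , FLi = Li< , λ z → FLi (trans (sym (upd-diff F (L l) 0 (L i)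
      (λ e → <⇒≢ i< (inj i l (m≤n⇒m≤1+n i<) ≤-refl e)))) z)

  odd : ℕ → Bool
  odd zero    = false
  odd (suc n) = not (odd n)

  infix 5 _∋_
  _∋_ : ℕ → ℕ → Bool
  D ∋ zero  = odd D
  D ∋ suc v = ⌊ D /2⌋ ∋ v

  parity-half : ∀ D → D ≡ bit (odd D) + (⌊ D /2⌋ + ⌊ D /2⌋)
  parity-half zero          = refl
  parity-half (suc zero)    = refl
  parity-half (suc (suc D)) rewrite not-involutive (odd D) = begin
    2 + D                                     ≡⟨ cong (2 +_) (parity-half D) ⟩
    2 + (bit (odd D) + (⌊ D /2⌋ + ⌊ D /2⌋))   ≡⟨ cong suc (+-suc (bit (odd D)) _) ⟨
    suc (bit (odd D) + suc (⌊ D /2⌋ + ⌊ D /2⌋)) ≡⟨ +-suc (bit (odd D)) _ ⟨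
    bit (odd D) + (suc (suc (⌊ D /2⌋ + ⌊ D /2⌋))) ≡⟨ cong (λ z → bit (odd D) + suc z) (+-suc ⌊ D /2⌋ ⌊ D /2⌋) ⟨
    bit (odd D) + (suc ⌊ D /2⌋ + suc ⌊ D /2⌋) ∎ where open ≡-Reasoning

  odd-double : ∀ x → odd (x + x) ≡ false
  odd-double zero    = refl
  odd-double (suc x) rewrite +-suc x x = trans (not-involutive _) (odd-double x)

  odd-join : ∀ b x → odd (bit b + (x + x)) ≡ b
  odd-join true  x rewrite odd-double x = refl
  odd-join false x = odd-double x

  half-join : ∀ b x → ⌊ bit b + (x + x) /2⌋ ≡ x
  half-join false zero = refl
  half-join true  zero = refl
  half-join false (suc x) rewrite +-suc x x = cong suc (half-join false x)
  half-join true  (suc x) rewrite +-suc x x = cong suc (half-join true x)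

  join-inj< : ∀ b x p → x < 2 ^ p → bit b + (x + x) < 2 ^ suc p
  join-inj< b x p x< rewrite +-identityʳ (2 ^ p) = begin-strict
    bit b + (x + x)       <⟨ +-monoˡ-< (x + x) (s≤s (bit≤1 b)) ⟩
    suc (suc (x + x))     ≡⟨ cong suc (+-suc x x) ⟨
    suc x + suc x         ≤⟨ +-mono-≤ x< x< ⟩
    2 ^ p + 2 ^ p         ∎
    where
    open ≤-Reasoning
    bit≤1 : ∀ b → bit b ≤ 1
    bit≤1 true  = ≤-refl
    bit≤1 false = z≤n

  half< : ∀ D p → D < 2 ^ suc p → ⌊ D /2⌋ < 2 ^ p
  half< D p D< = ≰⇒> λ p≤ → <⇒≱ D< (begin
    2 ^ suc p               ≡⟨ cong (2 ^ p +_) (+-identityʳ _) ⟩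
    2 ^ p + 2 ^ p           ≤⟨ +-mono-≤ p≤ p≤ ⟩
    ⌊ D /2⌋ + ⌊ D /2⌋       ≤⟨ m≤n+m _ (bit (odd D)) ⟩
    bit (odd D) + (⌊ D /2⌋ + ⌊ D /2⌋) ≡⟨ parity-half D ⟨
    D                       ∎)
    where open ≤-Reasoning

  ∋-ext : ∀ n D D′ → D < 2 ^ n → D′ < 2 ^ n → (∀ v → v < n → D ∋ v ≡ D′ ∋ v) → D ≡ D′
  ∋-ext zero    D D′ D< D′< e = trans (n<1⇒n≡0 D<) (sym (n<1⇒n≡0 D′<))
  ∋-ext (suc n) D D′ D< D′< e = begin
    D                                            ≡⟨ parity-half D ⟩
    bit (odd D) + (⌊ D /2⌋ + ⌊ D /2⌋)            ≡⟨ cong₂ (λ b h → bit b + (h + h)) (e 0 (s≤s z≤n))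
        (∋-ext n _ _ (half< D n D<) (half< D′ n D′<) (λ v v< → e (suc v) (s≤s v<))) ⟩
    bit (odd D′) + (⌊ D′ /2⌋ + ⌊ D′ /2⌋)         ≡⟨ parity-half D′ ⟨
    D′                                           ∎ where open ≡-Reasoning

  set : ℕ → (ℕ → Bool) → ℕ
  set zero    f = 0
  set (suc n) f = bit (f 0) + (set n (f ∘ suc) + set n (f ∘ suc))

  set< : ∀ n f → set n f < 2 ^ n
  set< zero    f = s≤s z≤n
  set< (suc n) f = join-inj< (f 0) _ n (set< n (f ∘ suc))

  ∋-set : ∀ n f v → v < n → set n f ∋ v ≡ f v
  ∋-set (suc n) f zero    v<       = odd-join (f 0) (set n (f ∘ suc))
  ∋-set (suc n) f (suc v) (s≤s v<) rewrite half-join (f 0) (set n (f ∘ suc)) = ∋-set n (f ∘ suc) v v<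

  ∋-beyond : ∀ n D v → D < 2 ^ n → n ≤ v → D ∋ v ≡ false
  ∋-beyond zero    D v D< _ rewrite n<1⇒n≡0 D< = go v
    where
    go : ∀ v → 0 ∋ v ≡ false
    go zero    = refl
    go (suc v) = go v
  ∋-beyond (suc n) D (suc v) D< (s≤s n≤v) = ∋-beyond n ⌊ D /2⌋ v (half< D n D<) n≤v

  ∅∌ : ∀ v → 0 ∋ v ≡ false
  ∅∌ v = ∋-beyond 0 0 v (s≤s z≤n) z≤n

  add-bit : ∀ D v → D ∋ v ≡ false → ∀ u → D + 2 ^ v ∋ u ≡ does (u ≟ v) ∨ (D ∋ u)
  add-bit D zero v∉ u rewrite +-comm D 1 = go u
    where
    e : suc D ≡ bit true + (⌊ D /2⌋ + ⌊ D /2⌋)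
    e = cong suc (trans (parity-half D) (cong (λ b → bit b + (⌊ D /2⌋ + ⌊ D /2⌋)) v∉))
    go : ∀ u → suc D ∋ u ≡ does (u ≟ 0) ∨ (D ∋ u)
    go zero rewrite v∉ = refl
    go (suc u) = cong (_∋ u) (trans (cong ⌊_/2⌋ e) (half-join true ⌊ D /2⌋))
  add-bit D (suc v) v∉ u = trans (cong (_∋ u) e) (go u)
    where
    open ≡-Reasoning
    e : D + 2 ^ suc v ≡ bit (odd D) + ((⌊ D /2⌋ + 2 ^ v) + (⌊ D /2⌋ + 2 ^ v))
    e = begin
      D + (2 ^ v + (2 ^ v + 0))   ≡⟨ cong₂ (λ x y → x + (2 ^ v + y)) (parity-half D) (+-identityʳ _) ⟩
      bit (odd D) + (⌊ D /2⌋ + ⌊ D /2⌋) + (2 ^ v + 2 ^ v) ≡⟨ +-assoc (bit (odd D)) _ _ ⟩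
      bit (odd D) + ((⌊ D /2⌋ + ⌊ D /2⌋) + (2 ^ v + 2 ^ v)) ≡⟨ cong (bit (odd D) +_) (+-swap-mid ⌊ D /2⌋ _ _ _) ⟩
      bit (odd D) + ((⌊ D /2⌋ + 2 ^ v) + (⌊ D /2⌋ + 2 ^ v)) ∎
    go : ∀ u → bit (odd D) + ((⌊ D /2⌋ + 2 ^ v) + (⌊ D /2⌋ + 2 ^ v)) ∋ u ≡ does (u ≟ suc v) ∨ (D ∋ u)
    go zero = odd-join (odd D) (⌊ D /2⌋ + 2 ^ v)
    go (suc u) = trans (cong (_∋ u) (half-join (odd D) (⌊ D /2⌋ + 2 ^ v))) (add-bit ⌊ D /2⌋ v v∉ u)

  add-bit-same : ∀ D v → D ∋ v ≡ false → D + 2 ^ v ∋ v ≡ true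
  add-bit-same D v v∉ with add-bit D v v∉ v
  ... | e rewrite e with v ≡ᵇ v | ≡⇒≡ᵇ v v refl
  ... | true | _ = refl

  add-bit-other : ∀ D v → D ∋ v ≡ false → ∀ u → u ≢ v → D + 2 ^ v ∋ u ≡ (D ∋ u)
  add-bit-other D v v∉ u u≢v with add-bit D v v∉ u
  ... | e rewrite e with u ≡ᵇ v | ≡ᵇ⇒≡ u v
  ... | true  | k = contradiction (k tt) u≢v
  ... | false | _ = refl

  add-bit< : ∀ n D v → v < n → D < 2 ^ n → D ∋ v ≡ false → D + 2 ^ v < 2 ^ n
  add-bit< (suc n) D zero v< D< v∉ = subst (_< 2 ^ suc n) (sym (trans (+-comm D 1) (cong suc
      (trans (parity-half D) (cong (λ b → bit b + (⌊ D /2⌋ + ⌊ D /2⌋)) v∉)))))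
    (join-inj< true ⌊ D /2⌋ n (half< D n D<))
  add-bit< (suc n) D (suc v) (s≤s v<) D< v∉ = subst (_< 2 ^ suc n) (sym e)
    (join-inj< (odd D) _ n (add-bit< n ⌊ D /2⌋ v v< (half< D n D<) v∉))
    where
    open ≡-Reasoning
    e : D + 2 ^ suc v ≡ bit (odd D) + ((⌊ D /2⌋ + 2 ^ v) + (⌊ D /2⌋ + 2 ^ v))
    e = begin
      D + (2 ^ v + (2 ^ v + 0))   ≡⟨ cong₂ (λ x y → x + (2 ^ v + y)) (parity-half D) (+-identityʳ _) ⟩
      bit (odd D) + (⌊ D /2⌋ + ⌊ D /2⌋) + (2 ^ v + 2 ^ v) ≡⟨ +-assoc (bit (odd D)) _ _ ⟩
      bit (odd D) + ((⌊ D /2⌋ + ⌊ D /2⌋) + (2 ^ v + 2 ^ v)) ≡⟨ cong (bit (odd D) +_) (+-swap-mid ⌊ D /2⌋ _ _ _) ⟩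
      bit (odd D) + ((⌊ D /2⌋ + 2 ^ v) + (⌊ D /2⌋ + 2 ^ v)) ∎

  %2 : ∀ D → D % 2 ≡ bit (odd D)
  %2 D = trans (cong (_% 2) (trans (parity-half D) (cong (bit (odd D) +_) (trans (cong (⌊ D /2⌋ +_) (sym (+-identityʳ _))) (*-comm 2 ⌊ D /2⌋)))))
           (trans ([m+kn]%n≡m%n (bit (odd D)) ⌊ D /2⌋ 2) (go (odd D)))
    where
    go : ∀ b → bit b % 2 ≡ bit b
    go true  = refl
    go false = refl

  /2 : ∀ D → D / 2 ≡ ⌊ D /2⌋
  /2 D = *-cancelʳ-≡ _ _ 2 (+-cancelˡ-≡ (bit (odd D)) _ _ (begin
    bit (odd D) + D / 2 * 2       ≡⟨ cong (_+ D / 2 * 2) (%2 D) ⟨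
    D % 2 + D / 2 * 2             ≡⟨ m≡m%n+[m/n]*n D 2 ⟨
    D                             ≡⟨ parity-half D ⟩
    bit (odd D) + (⌊ D /2⌋ + ⌊ D /2⌋) ≡⟨ cong (bit (odd D) +_) (trans (cong (⌊ D /2⌋ +_) (sym (+-identityʳ _))) (*-comm 2 ⌊ D /2⌋)) ⟩
    bit (odd D) + ⌊ D /2⌋ * 2     ∎))
    where open ≡-Reasoning

  testbit : ∀ D v → ⟦ mod ⟧ᵒ (⟦ div ⟧ᵒ D (2 ^ v)) 2 ≡ bit (D ∋ v)
  testbit D v = trans (cong (λ x → x % 2) (trans (div≡ (2 ^ v) {{m^n≢0 2 v}}) refl)) (go D v)
    where
    div≡ : ∀ y .{{_ : NonZero y}} → ⟦ div ⟧ᵒ D y ≡ D / y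
    div≡ (suc y) = refl
    go : ∀ D v → ((D / 2 ^ v) {{m^n≢0 2 v}}) % 2 ≡ bit (D ∋ v)
    go D zero    = trans (cong (_% 2) (n/1≡n D)) (%2 D)
    go D (suc v) = trans (cong (_% 2) (trans (sym (m/n/o≡m/[n*o] D 2 (2 ^ v) {{_}} {{m^n≢0 2 v}} {{m^n≢0 2 (suc v)}}))
                     (cong (λ x → (x / 2 ^ v) {{m^n≢0 2 v}}) (/2 D)))) (go ⌊ D /2⌋ v)

  -- The Sauer–Shelah lemma

  2^suc : ∀ n → 2 ^ suc n ≡ 2 ^ n + 2 ^ n
  2^suc n = cong (2 ^ n +_) (+-identityʳ (2 ^ n))

  top : ℕ → ℕ → Bool → ℕ
  top n D true  = 2 ^ n + D
  top n D false = D

  ∋-top : ∀ n D b → D < 2 ^ n → top n D b ∋ n ≡ b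
  ∋-top n D true  D< = trans (cong (_∋ n) (+-comm (2 ^ n) D)) (add-bit-same D n (∋-beyond n D n D< ≤-refl))
  ∋-top n D false D< = ∋-beyond n D n D< ≤-refl

  ∋-below : ∀ n D b v → D < 2 ^ n → v < n → top n D b ∋ v ≡ (D ∋ v)
  ∋-below n D true v D< v<  = trans (cong (_∋ v) (+-comm (2 ^ n) D)) (add-bit-other D n (∋-beyond n D n D< ≤-refl) v (<⇒≢ v<))
  ∋-below n D false v D< v< = refl

  top< : ∀ n D b → D < 2 ^ n → top n D b < 2 ^ suc n
  top< n D true  D< = <-≤-trans (+-monoʳ-< (2 ^ n) D<) (≤-reflexive (sym (2^suc n)))
  top< n D false D< = <-≤-trans D< (^-monoʳ-≤ 2 (n≤1+n n))

  #-top : ∀ n F → # (2 ^ suc n) F ≡ # (2 ^ n) F + # (2 ^ n) (λ D → F (top n D true))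
  #-top n F = trans (cong (λ N → # N F) (2^suc n)) (Σ<-append (2 ^ n) (2 ^ n) (sg ∘ F))

  _[_↦ᵇ_] : (ℕ → Bool) → ℕ → Bool → (ℕ → Bool)
  (f [ a ↦ᵇ b ]) x = if does (x ≟ a) then b else f x

  updᵇ-same : ∀ f a b → (f [ a ↦ᵇ b ]) a ≡ b
  updᵇ-same f a b with a ≡ᵇ a | ≡⇒≡ᵇ a a refl
  ... | true | _ = refl

  updᵇ-diff : ∀ f a b x → x ≢ a → (f [ a ↦ᵇ b ]) x ≡ f x
  updᵇ-diff f a b x x≢a with x ≡ᵇ a | ≡ᵇ⇒≡ x a
  ... | true  | k = contradiction (k tt) x≢a
  ... | false | _ = refl

  card : ℕ → (ℕ → Bool) → ℕ
  card n S = # n (bit ∘ S)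

  -- F shatters no more than d coordinates outside C, even when the
  -- coordinates in C are prescribed.
  NoShatter : ℕ → (ℕ → ℕ) → (ℕ → Bool) → ℕ → Set
  NoShatter n F C d = ∀ (S : ℕ → Bool) → (∀ x → S x ≡ true → C x ≡ false) → d < card n S → ∀ (γ : ℕ → Bool) →
    Σ[ g ∈ (ℕ → Bool) ] (∀ x → C x ≡ true → g x ≡ γ x) ×
           (∀ D → D < 2 ^ n → F D ≢ 0 → ¬ (∀ x → x < n → C x ∨ S x ≡ true → D ∋ x ≡ g x))

  module _ (q : ℕ) where

    private
      bound : ℕ → (ℕ → Bool) → ℕ → ℕ
      bound n C d = 2 ^ card n C * (q ^ d * suc q ^ n)

    module _ {n F C d} (ns : NoShatter (suc n) F C d) where

      half-noshatter : C n ≡ true → ∀ b → NoShatter n (λ D → F (top n D b)) C d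
      half-noshatter Cn b S S∩C d< γ
        with ns (S [ n ↦ᵇ false ]) S∩C′ (<-≤-trans d< le) (γ [ n ↦ᵇ b ])
        where
        S∩C′ : ∀ x → (S [ n ↦ᵇ false ]) x ≡ true → C x ≡ false
        S∩C′ x e with x ≟ n
        ... | yes refl = contradiction (trans (sym (updᵇ-same S n false)) e) (λ ())
        ... | no x≢n   = S∩C x (trans (sym (updᵇ-diff S n false x x≢n)) e)
        le : card n S ≤ card (suc n) (S [ n ↦ᵇ false ])
        le = ≤-trans (≤-reflexive (#-cong n (λ i i< → cong bit (sym (updᵇ-diff S n false i (<⇒≢ i<)))))) (m≤m+n _ _)
      ... | g , gC , no-D = (g [ n ↦ᵇ γ n ]) , gC′ , no-D′
        where
        gC′ : ∀ x → C x ≡ true → (g [ n ↦ᵇ γ n ]) x ≡ γ x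
        gC′ x Cx with x ≟ n
        ... | yes refl = updᵇ-same g n (γ n)
        ... | no x≢n   = trans (updᵇ-diff g n (γ n) x x≢n) (trans (gC x Cx) (updᵇ-diff γ n b x x≢n))
        no-D′ : ∀ D → D < 2 ^ n → F (top n D b) ≢ 0 → ¬ (∀ x → x < n → C x ∨ S x ≡ true → D ∋ x ≡ (g [ n ↦ᵇ γ n ]) x)
        no-D′ D D< FD agree = no-D (top n D b) (top< n D b D<) FD agree′
          where
          agree′ : ∀ x → x < suc n → C x ∨ (S [ n ↦ᵇ false ]) x ≡ true → top n D b ∋ x ≡ g x
          agree′ x x< CS with x ≟ n
          ... | yes refl = trans (∋-top n D b D<) (sym (trans (gC n Cn) (updᵇ-same γ n b)))
          ... | no x≢n   = trans (∋-below n D b x D< x<n) (trans (agree x x<n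
              (trans (cong (C x ∨_) (sym (updᵇ-diff S n false x x≢n))) CS)) (updᵇ-diff g n (γ n) x x≢n))
            where x<n = ≤∧≢⇒< (s≤s⁻¹ x<) x≢n

      or-noshatter : C n ≡ false → NoShatter n (λ D → F D + F (top n D true)) C d
      or-noshatter Cn S S∩C d< γ with ns (S [ n ↦ᵇ false ]) S∩C′ (<-≤-trans d< le) γ
        where
        S∩C′ : ∀ x → (S [ n ↦ᵇ false ]) x ≡ true → C x ≡ false
        S∩C′ x e with x ≟ n
        ... | yes refl = contradiction (trans (sym (updᵇ-same S n false)) e) (λ ())
        ... | no x≢n   = S∩C x (trans (sym (updᵇ-diff S n false x x≢n)) e)
        le : card n S ≤ card (suc n) (S [ n ↦ᵇ false ])
        le = ≤-trans (≤-reflexive (#-cong n (λ i i< → cong bit (sym (updᵇ-diff S n false i (<⇒≢ i<)))))) (m≤m+n _ _)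
      ... | g , gC , no-D = g , gC , no-D′
        where
        no-D′ : ∀ D → D < 2 ^ n → F D + F (top n D true) ≢ 0 → ¬ (∀ x → x < n → C x ∨ S x ≡ true → D ∋ x ≡ g x)
        no-D′ D D< FD agree = absurd (F D ≟ 0)
          where
          agree′ : ∀ b x → x < suc n → C x ∨ (S [ n ↦ᵇ false ]) x ≡ true → top n D b ∋ x ≡ g x
          agree′ b x x< CS with x ≟ n
          ... | yes refl = contradiction (trans (sym CS) (cong₂ _∨_ Cn (updᵇ-same S n false))) (λ ())
          ... | no x≢n   = trans (∋-below n D b x D< x<n) (agree x x<n
              (trans (cong (C x ∨_) (sym (updᵇ-diff S n false x x≢n))) CS))
            where x<n = ≤∧≢⇒< (s≤s⁻¹ x<) x≢n
          absurd : Dec (F D ≡ 0) → _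
          absurd (no F≢0) = no-D D (top< n D false D<) F≢0 (agree′ false)
          absurd (yes F≡0) = no-D (top n D true) (top< n D true D<) (λ z → FD (cong₂ _+_ F≡0 z)) (agree′ true)

      and-label : C n ≡ false → ∀ (S : ℕ → Bool) → (∀ x → S x ≡ true → C x ≡ false) → d ≤ card n S → ∀ (γ : ℕ → Bool) →
        Σ[ g ∈ (ℕ → Bool) ] (∀ x → C x ≡ true → g x ≡ γ x) ×
               (∀ D → D < 2 ^ n → F D * F (top n D true) ≢ 0 → ¬ (∀ x → x < n → C x ∨ S x ≡ true → D ∋ x ≡ g x))
      and-label Cn S S∩C d≤ γ with ns (S [ n ↦ᵇ true ]) S∩C′ (≤-trans (s≤s d≤) (≤-reflexive le)) γ
        where
        S∩C′ : ∀ x → (S [ n ↦ᵇ true ]) x ≡ true → C x ≡ false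
        S∩C′ x e with x ≟ n
        ... | yes refl = Cn
        ... | no x≢n   = S∩C x (trans (sym (updᵇ-diff S n true x x≢n)) e)
        le : suc (card n S) ≡ card (suc n) (S [ n ↦ᵇ true ])
        le = trans (+-comm 1 (card n S)) (cong₂ _+_
          (#-cong n (λ i i< → cong bit (sym (updᵇ-diff S n true i (<⇒≢ i<))))) (cong (sg ∘ bit) (sym (updᵇ-same S n true))))
      ... | g , gC , no-D = g , gC , no-D′
        where
        no-D′ : ∀ D → D < 2 ^ n → F D * F (top n D true) ≢ 0 → ¬ (∀ x → x < n → C x ∨ S x ≡ true → D ∋ x ≡ g x)
        no-D′ D D< FD agree = no-D (top n D (g n)) (top< n D (g n) D<) (pick (g n)) agree′
          where
          pick : ∀ b → F (top n D b) ≢ 0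
          pick true  z = FD (trans (cong (F D *_) z) (*-zeroʳ (F D)))
          pick false z = FD (cong (_* F (top n D true)) z)
          agree′ : ∀ x → x < suc n → C x ∨ (S [ n ↦ᵇ true ]) x ≡ true → top n D (g n) ∋ x ≡ g x
          agree′ x x< CS with x ≟ n
          ... | yes refl = ∋-top n D (g n) D<
          ... | no x≢n   = trans (∋-below n D (g n) x D< x<n) (agree x x<n
              (trans (cong (C x ∨_) (sym (updᵇ-diff S n true x x≢n))) CS))
            where x<n = ≤∧≢⇒< (s≤s⁻¹ x<) x≢n

    sg-or-and : ∀ a b → sg a + sg b ≡ sg (a + b) + sg (a * b)
    sg-or-and zero    b       = sym (+-identityʳ _)
    sg-or-and (suc a) zero    rewrite *-zeroʳ a = refl
    sg-or-and (suc a) (suc b) = refl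

    open Data.Nat.Solver.+-*-Solver using (solve; con; _:+_; _:*_) renaming (_:=_ to _⊜_)

    -- The Sauer–Shelah lemma, with the binomial sum estimated by
    -- Σ_{i ≤ d} (n choose i) ≤ q^d (1 + 1/q)^n.
    sauer : 1 ≤ q → ∀ n F C d → NoShatter n F C d → # (2 ^ n) F * q ^ n ≤ 2 ^ card n C * (q ^ d * suc q ^ n)
    sauer 1≤q zero F C d ns = begin
      # 1 F * 1                ≡⟨ *-identityʳ _ ⟩
      # 1 F                    ≤⟨ #≤ 1 F ⟩
      1                        ≤⟨ m^n>0 q {{>-nonZero 1≤q}} d ⟩
      q ^ d                    ≡⟨ trans (*-identityʳ _) (*-identityʳ _) ⟨
      q ^ d * 1 * 1            ≡⟨ solve 1 (λ x → x :* con 1 :* con 1 ⊜ con 1 :* (x :* con 1)) refl (q ^ d) ⟩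
      1 * (q ^ d * 1)          ∎ where open ≤-Reasoning
    sauer 1≤q (suc n) F C d ns with C n in Cn
    ... | true = begin
      # (2 ^ suc n) F * q ^ suc n                 ≡⟨ cong (_* q ^ suc n) (#-top n F) ⟩
      (# (2 ^ n) F + # (2 ^ n) F₁) * (q * q ^ n)  ≡⟨ solve 4 (λ a b x y → (a :+ b) :* (x :* y) ⊜ x :* (a :* y :+ b :* y)) refl (# (2 ^ n) F) (# (2 ^ n) F₁) q (q ^ n) ⟩
      q * (# (2 ^ n) F * q ^ n + # (2 ^ n) F₁ * q ^ n)
        ≤⟨ *-mono-≤ (n≤1+n q) (+-mono-≤ (sauer 1≤q n F C d (half-noshatter ns Cn false))
                                        (sauer 1≤q n F₁ C d (half-noshatter ns Cn true))) ⟩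
      suc q * (c * (q ^ d * suc q ^ n) + c * (q ^ d * suc q ^ n))
        ≡⟨ solve 4 (λ s c x y → s :* (c :* (x :* y) :+ c :* (x :* y)) ⊜ (c :* con 2) :* (x :* (s :* y))) refl (suc q) c (q ^ d) (suc q ^ n) ⟩
      c * 2 * (q ^ d * suc q ^ suc n)             ≡⟨ cong (_* (q ^ d * suc q ^ suc n)) (^-distribˡ-+-* 2 (card n C) 1) ⟨
      2 ^ (card n C + 1) * (q ^ d * suc q ^ suc n) ∎
      where
      open ≤-Reasoning
      c = 2 ^ card n C
      F₁ = λ D → F (top n D true)
    ... | false = begin
      # (2 ^ suc n) F * q ^ suc n                 ≡⟨ cong (_* q ^ suc n) (trans (#-top n F) (trans (sym (Σ<-+ (2 ^ n) (sg ∘ F) (sg ∘ F₁)))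
                                                     (trans (Σ<-cong (2 ^ n) (λ D _ → sg-or-and (F D) (F₁ D))) (Σ<-+ (2 ^ n) _ _)))) ⟩
      (# (2 ^ n) F∨ + # (2 ^ n) F∧) * (q * q ^ n) ≡⟨ solve 4 (λ a b x y → (a :+ b) :* (x :* y) ⊜ x :* (a :* y) :+ x :* (b :* y)) refl (# (2 ^ n) F∨) (# (2 ^ n) F∧) q (q ^ n) ⟩
      q * (# (2 ^ n) F∨ * q ^ n) + q * (# (2 ^ n) F∧ * q ^ n)
        ≤⟨ +-mono-≤ (*-monoʳ-≤ q (sauer 1≤q n F∨ C d (or-noshatter ns Cn))) (and-bound d ns) ⟩
      q * (c * (q ^ d * suc q ^ n)) + c * (q ^ d * suc q ^ n)
        ≡⟨ solve 4 (λ z c x y → z :* (c :* (x :* y)) :+ c :* (x :* y) ⊜ c :* (x :* ((con 1 :+ z) :* y))) refl q c (q ^ d) (suc q ^ n) ⟩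
      c * (q ^ d * suc q ^ suc n)                 ≡⟨ cong (λ z → 2 ^ z * (q ^ d * suc q ^ suc n)) (+-identityʳ (card n C)) ⟨
      2 ^ (card n C + 0) * (q ^ d * suc q ^ suc n) ∎
      where
      open ≤-Reasoning
      c = 2 ^ card n C
      F₁ = λ D → F (top n D true)
      F∨ = λ D → F D + F (top n D true)
      F∧ = λ D → F D * F (top n D true)
      and-bound : ∀ d → NoShatter (suc n) F C d → q * (# (2 ^ n) F∧ * q ^ n) ≤ c * (q ^ d * suc q ^ n)
      and-bound zero ns = ≤-trans (≤-reflexive (trans (cong (λ z → q * (z * q ^ n)) (⇒#≡0 (2 ^ n) F∧ empty)) (*-zeroʳ q))) z≤n
        where
        empty : ∀ D → D < 2 ^ n → F∧ D ≡ 0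
        empty D D< with F∧ D ≟ 0
        ... | yes z = z
        ... | no nz with and-label ns Cn (λ _ → false) (λ x ()) z≤n (D ∋_)
        ...   | g , gC , no-D = contradiction (λ x x< CS → sym (gC x (trans (sym (∨-false (C x))) CS))) (no-D D D< nz)
          where
          ∨-false : ∀ b → b ∨ false ≡ b
          ∨-false true  = refl
          ∨-false false = refl
      and-bound (suc d) ns = begin
        q * (# (2 ^ n) F∧ * q ^ n)     ≤⟨ *-monoʳ-≤ q (sauer 1≤q n F∧ C d (λ S S∩C d< → and-label ns Cn S S∩C d<)) ⟩
        q * (c * (q ^ d * suc q ^ n))  ≡⟨ solve 4 (λ z c x y → z :* (c :* (x :* y)) ⊜ c :* ((z :* x) :* y)) refl q c (q ^ d) (suc q ^ n) ⟩
        c * (q ^ suc d * suc q ^ n)    ∎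

-- Linear relations between feature vectors

module LinearRelations where

  open Counting
  open import Data.Integer hiding (_≤?_; _<?_; suc; _≟_; _⊔_; _⊓_; NonZero)
  open import Data.Integer.Properties using (*-zeroʳ; *-comm; *-identityʳ; +-identityˡ; +-identityʳ; +-inverseʳ; ∣i∣≡0⇒i≡0; i*j≡0⇒i≡0∨j≡0; ≤-refl; ≤-reflexive; +-mono-≤; *-identityˡ; *-zeroˡ; *-monoʳ-≤-nonNeg; i-j≡0⇒i≡j; +-injective; i≤j⇒0≤j-i) renaming (_≟_ to _≟ℤ_)
  import Data.Integer.Solver
  open import Data.Nat as ℕ using (ℕ; zero; suc; _≡ᵇ_; _≟_; z≤n; s≤s; s≤s⁻¹; s<s⁻¹)
  import Data.Nat.Properties as ℕ
  open import Data.List.Properties using (length-map)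
  import Data.List.Relation.Unary.All.Properties as All

  Σℤ : ℕ → (ℕ → ℤ) → ℤ
  Σℤ zero    f = 0ℤ
  Σℤ (suc n) f = Σℤ n f + f n

  Σℤ-cong : ∀ n {f g} → (∀ x → x ℕ.< n → f x ≡ g x) → Σℤ n f ≡ Σℤ n g
  Σℤ-cong zero    e = refl
  Σℤ-cong (suc n) e = cong₂ _+_ (Σℤ-cong n (λ x x< → e x (ℕ.m≤n⇒m≤1+n x<))) (e n ℕ.≤-refl)

  Σℤ-0 : ∀ n {f} → (∀ x → x ℕ.< n → f x ≡ 0ℤ) → Σℤ n f ≡ 0ℤ
  Σℤ-0 zero    e = refl
  Σℤ-0 (suc n) e = cong₂ _+_ (Σℤ-0 n (λ x x< → e x (ℕ.m≤n⇒m≤1+n x<))) (e n ℕ.≤-refl)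

  open Data.Integer.Solver.+-*-Solver using (solve; con; _:+_; _:*_; _:-_; :-_) renaming (_:=_ to _⊜_)

  Σℤ-lin : ∀ n c d f g → Σℤ n (λ x → c * f x - d * g x) ≡ c * Σℤ n f - d * Σℤ n g
  Σℤ-lin zero c d f g = sym (trans (cong₂ _-_ (*-zeroʳ c) (*-zeroʳ d)) refl)
  Σℤ-lin (suc n) c d f g = trans (cong (_+ (c * f n - d * g n)) (Σℤ-lin n c d f g))
    (solve 6 (λ c d F G x y → (c :* F :- d :* G) :+ (c :* x :- d :* y) ⊜ c :* (F :+ x) :- d :* (G :+ y)) refl
      c d (Σℤ n f) (Σℤ n g) (f n) (g n))

  δ : ℕ → ℕ → ℤ
  δ p x = if x ≡ᵇ p then 1ℤ else 0ℤ

  δ-same : ∀ p → δ p p ≡ 1ℤ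
  δ-same p with p ≡ᵇ p | ℕ.≡⇒≡ᵇ p p refl
  ... | true | _ = refl

  δ-diff : ∀ p x → x ≢ p → δ p x ≡ 0ℤ
  δ-diff p x x≢ with x ≡ᵇ p | ℕ.≡ᵇ⇒≡ x p
  ... | true  | k = contradiction (k tt) x≢
  ... | false | _ = refl

  Σℤ-δ : ∀ n p (f : ℕ → ℤ) → p ℕ.< n → Σℤ n (λ x → f x * δ p x) ≡ f p
  Σℤ-δ (suc n) p f p< with p ≟ n
  ... | yes refl = trans (cong₂ _+_ (Σℤ-0 n (λ x x< → trans (cong (f x *_) (δ-diff p x (ℕ.<⇒≢ x<))) (*-zeroʳ (f x))))
                     (trans (cong (f p *_) (δ-same p)) (*-identityʳ (f p)))) (+-identityˡ (f p))
  ... | no p≢n   = trans (cong₂ _+_ (Σℤ-δ n p f (ℕ.≤∧≢⇒< (s≤s⁻¹ p<) p≢n))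
                     (trans (cong (f n *_) (δ-diff p n (λ e → p≢n (sym e)))) (*-zeroʳ (f n)))) (+-identityʳ (f p))

  ≢0-true : ∀ b {x} → bit b ℕ.* x ≢ 0 → b ≡ true
  ≢0-true true  _ = refl
  ≢0-true false z = contradiction refl z

  relation : ∀ n k (rows : List (ℕ → ℤ)) (S : ℕ → Bool) → length rows ≡ k → k ℕ.< card n S →
    Σ[ α ∈ (ℕ → ℤ) ] (∀ x → S x ≡ false → α x ≡ 0ℤ) × (∃[ x ] x ℕ.< n × α x ≢ 0ℤ) ×
      All (λ r → Σℤ n (λ x → r x * α x) ≡ 0ℤ) rows
  relation n zero [] S l≡ 0< with #≢0⇒ n _ (ℕ.m<n⇒n≢0 0<)
  ... | p , p< , Sp = δ p , supp , (p , p< , λ e → contradiction (trans (sym e) (δ-same p)) (λ ())) , []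
    where
    supp : ∀ x → S x ≡ false → δ p x ≡ 0ℤ
    supp x Sx = δ-diff p x λ { refl → Sp (cong bit Sx) }
  relation n (suc k) (r ∷ rows) S l≡ l< with # n (λ x → bit (S x) ℕ.* ∣ r x ∣) ≟ 0
  ... | yes none with relation n k rows S (ℕ.suc-injective l≡) (ℕ.<-trans (ℕ.n<1+n _) l<)
  ...   | α , supp , nz , ortho = α , supp , nz , Σℤ-0 n zeros ∷ ortho
    where
    zeros : ∀ x → x ℕ.< n → r x * α x ≡ 0ℤ
    zeros x x< with S x in Sx | #≡0⇒ n _ none x x<
    ... | false | _ = trans (cong (r x *_) (supp x Sx)) (*-zeroʳ (r x))
    ... | true  | e rewrite ∣i∣≡0⇒i≡0 {r x} (trans (sym (ℕ.+-identityʳ ∣ r x ∣)) e) = refl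
  relation n (suc k) (r ∷ rows) S l≡ l< | no some with #≢0⇒ n _ some
  ... | p , p< , Sp*rp = solved (relation n k rows′ (S [ p ↦ᵇ false ]) (trans (length-map row′ rows) (ℕ.suc-injective l≡)) l<′)
    where
    row′ : (ℕ → ℤ) → ℕ → ℤ
    row′ r′ x = r p * r′ x - r′ p * r x
    rows′ = map row′ rows
    Sp : S p ≡ true
    Sp = ≢0-true (S p) Sp*rp
    rp : r p ≢ 0ℤ
    rp e = Sp*rp (trans (cong (λ z → bit (S p) ℕ.* ∣ z ∣) e) (ℕ.*-zeroʳ (bit (S p))))
    l<′ : k ℕ.< card n (S [ p ↦ᵇ false ])
    l<′ = s<s⁻¹ (ℕ.<-≤-trans l< (ℕ.≤-reflexive
      (trans (Σ<-pick n _ p p<) (cong₂ ℕ._+_ (cong (λ b → sg (bit b)) Sp) (Σ<-cong n upd≡)))))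
      where
      upd≡ : ∀ i → i ℕ.< n → ((λ i → sg (bit (S i))) [ p ↦ 0 ]) i ≡ sg (bit ((S [ p ↦ᵇ false ]) i))
      upd≡ i _ with i ≡ᵇ p
      ... | true  = refl
      ... | false = refl
    solved : Σ[ α ∈ (ℕ → ℤ) ] (∀ x → (S [ p ↦ᵇ false ]) x ≡ false → α x ≡ 0ℤ) × (∃[ x ] x ℕ.< n × α x ≢ 0ℤ) ×
               All (λ r → Σℤ n (λ x → r x * α x) ≡ 0ℤ) rows′ → _
    solved (α′ , supp , (q , q< , αq) , ortho) = α , supp′ , (q , q< , αq′) ,
      trans (dot r) (trans (cong (λ z → z - K * r p) (*-comm (r p) K)) (+-inverseʳ (K * r p))) ∷
      All.map (λ {r′} e → trans (dot r′) (trans (sym (dot′ r′)) e)) (All.map⁻ ortho)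
      where
      K = Σℤ n (λ x → r x * α′ x)
      α : ℕ → ℤ
      α x = r p * α′ x - K * δ p x
      dot : ∀ (r′ : ℕ → ℤ) → Σℤ n (λ x → r′ x * α x) ≡ r p * Σℤ n (λ x → r′ x * α′ x) - K * r′ p
      dot r′ = trans (Σℤ-cong n (λ x _ → solve 5 (λ a b c d e → a :* (b :* c :- d :* e) ⊜ b :* (a :* c) :- d :* (a :* e)) refl (r′ x) (r p) (α′ x) K (δ p x)))
        (trans (Σℤ-lin n (r p) K (λ x → r′ x * α′ x) (λ x → r′ x * δ p x))
          (cong (λ z → r p * Σℤ n (λ x → r′ x * α′ x) - K * z) (Σℤ-δ n p r′ p<)))
      dot′ : ∀ (r′ : ℕ → ℤ) → Σℤ n (λ x → row′ r′ x * α′ x) ≡ r p * Σℤ n (λ x → r′ x * α′ x) - K * r′ p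
      dot′ r′ = trans (Σℤ-cong n (λ x _ → solve 5 (λ a b c d e → (a :* b :- c :* d) :* e ⊜ a :* (b :* e) :- c :* (d :* e)) refl (r p) (r′ x) (r′ p) (r x) (α′ x)))
        (trans (Σℤ-lin n (r p) (r′ p) (λ x → r′ x * α′ x) (λ x → r x * α′ x))
          (cong (λ z → r p * Σℤ n (λ x → r′ x * α′ x) - z) (*-comm (r′ p) K)))
      supp′ : ∀ x → S x ≡ false → α x ≡ 0ℤ
      supp′ x Sx = trans (cong₂ (λ y z → r p * y - K * z) (supp x (trans (updᵇ-diff S p false x x≢p) Sx)) (δ-diff p x x≢p))
                     (trans (cong₂ _-_ (*-zeroʳ (r p)) (*-zeroʳ K)) refl)
        where
        x≢p : x ≢ p
        x≢p refl = contradiction (trans (sym Sx) Sp) (λ ())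
      αq′ : α q ≢ 0ℤ
      αq′ e with i*j≡0⇒i≡0∨j≡0 (r p) (trans (sym (trans (cong (λ z → r p * α′ q - K * z) (δ-diff p q q≢p))
                   (trans (cong (λ z → r p * α′ q - z) (*-zeroʳ K)) (+-identityʳ (r p * α′ q))))) e)
        where
        q≢p : q ≢ p
        q≢p refl = αq (supp q (updᵇ-same S q false))
      ... | inj₁ z = rp z
      ... | inj₂ z = αq z

  nonneg-sum : ∀ n f → (∀ x → x ℕ.< n → 0ℤ ≤ f x) → 0ℤ ≤ Σℤ n f
  nonneg-sum zero    f f≥0 = ≤-refl
  nonneg-sum (suc n) f f≥0 = +-mono-≤ (nonneg-sum n f (λ x x< → f≥0 x (ℕ.m≤n⇒m≤1+n x<))) (f≥0 n ℕ.≤-refl)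

  both-zero : ∀ {a b} → 0ℤ ≤ a → 0ℤ ≤ b → a + b ≡ 0ℤ → a ≡ 0ℤ × b ≡ 0ℤ
  both-zero {+ zero}  {+ b} _ _ e = refl , trans (sym (+-identityˡ (+ b))) e
  both-zero {+ suc a} {+ b} _ _ ()

  nonneg-sum-0 : ∀ n f → (∀ x → x ℕ.< n → 0ℤ ≤ f x) → Σℤ n f ≡ 0ℤ → ∀ x → x ℕ.< n → f x ≡ 0ℤ
  nonneg-sum-0 (suc n) f f≥0 e x x<
    with both-zero (nonneg-sum n f (λ x x< → f≥0 x (ℕ.m≤n⇒m≤1+n x<))) (f≥0 n ℕ.≤-refl) e
  ... | e₁ , e₂ with x ≟ n
  ...   | yes refl = e₂
  ...   | no x≢n   = nonneg-sum-0 n f (λ x x< → f≥0 x (ℕ.m≤n⇒m≤1+n x<)) e₁ x (ℕ.≤∧≢⇒< (s≤s⁻¹ x<) x≢n)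

  b2z : Bool → ℤ
  b2z true  = 1ℤ
  b2z false = 0ℤ

  -- A pair of features that may be peeled off meets no linear relation
  -- whose signs agree with the labelling.
  peel-sound : ∀ n (p s : ℕ → Bool) (α : ℕ → ℤ) →
    (∀ v → v ℕ.< n → 0ℤ < α v → p v ≡ true → s v ≡ true) →
    (∀ u → u ℕ.< n → α u < 0ℤ → s u ≡ true → p u ≡ true) →
    (∀ v u → v ℕ.< n → u ℕ.< n → 0ℤ < α v → p v ≡ true → α u < 0ℤ → s u ≡ true → v ℕ.< u) →
    Σℤ n (λ x → b2z (p x) * α x) ≡ 0ℤ → Σℤ n (λ x → b2z (s x) * α x) ≡ 0ℤ →
    Σℤ n (λ x → b2z (p x) * + x * α x) ≡ 0ℤ →
    ∀ x → x ℕ.< n → p x ∨ s x ≡ true → α x ≡ 0ℤ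
  peel-sound n p s α p⇒s s⇒p ord Σp Σs Σpx = go
    where
    diff : ∀ x → x ℕ.< n → (1ℤ * (b2z (s x) * α x) - 1ℤ * (b2z (p x) * α x)) ≡ 0ℤ
    diff = nonneg-sum-0 n _ nn (trans (Σℤ-lin n 1ℤ 1ℤ _ _) (cong₂ (λ a b → 1ℤ * a - 1ℤ * b) Σs Σp))
      where
      nn : ∀ x → x ℕ.< n → 0ℤ ≤ 1ℤ * (b2z (s x) * α x) - 1ℤ * (b2z (p x) * α x)
      nn x x< with α x | s x | p x | p⇒s x x< | s⇒p x x<
      ... | a | true | true | _ | _ = ≤-reflexive (sym (+-inverseʳ (1ℤ * (1ℤ * a))))
      ... | a | false | false | _ | _ = ≤-refl
      ... | + a | true | false | _ | k rewrite *-identityˡ (1ℤ * + a) | *-identityˡ (+ a) | +-identityʳ (+ a) = +≤+ z≤n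
      ... | -[1+ a ] | true | false | _ | k = contradiction (k -<+ refl) λ ()
      ... | -[1+ a ] | false | true | k | _ = +≤+ z≤n
      ... | + zero | false | true | k | _ = +≤+ z≤n
      ... | + suc a | false | true | k | _ = contradiction (k (+<+ (s≤s z≤n)) refl) λ ()
    same : ∀ x → x ℕ.< n → α x ≢ 0ℤ → s x ≡ p x
    same x x< αx with s x | p x | diff x x<
    ... | true  | true  | _ = refl
    ... | false | false | _ = refl
    ... | true  | false | e = contradiction (trans (sym (trans (cong (_+ 0ℤ) (*-identityˡ (1ℤ * α x)))
                                (trans (+-identityʳ (1ℤ * α x)) (*-identityˡ (α x))))) e) αx
    ... | false | true  | e = contradiction (neg-0 (α x) e) αx
      where
      neg-0 : ∀ a → 1ℤ * 0ℤ - 1ℤ * (1ℤ * a) ≡ 0ℤ → a ≡ 0ℤ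
      neg-0 (+ zero)  _ = refl
      neg-0 (+ suc a) ()
      neg-0 -[1+ a ]  ()
    neg? : ℤ → ℕ
    neg? (+ _)    = 0
    neg? -[1+ _ ] = 1
    neg⇒ : ∀ {a} → neg? a ≢ 0 → a < 0ℤ
    neg⇒ { + _}      k = contradiction refl k
    neg⇒ { -[1+ _ ]} k = -<+
    -- θ is the least index of a negative coefficient on p, or n.
    least : ∀ k → k ℕ.≤ n → ∃[ θ ] (θ ℕ.≤ n × (∀ x → x ℕ.< k → x ℕ.< n → p x ≡ true → α x < 0ℤ → θ ℕ.≤ x) ×
              (∀ v → v ℕ.< n → 0ℤ < α v → p v ≡ true → v ℕ.< θ))
    least zero    k≤ = n , ℕ.≤-refl , (λ _ ()) , (λ v v< _ _ → v<)
    least (suc k) k≤ with least k (ℕ.≤-trans (ℕ.n≤1+n k) k≤)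
    ... | θ , θ≤ , low , up with p k in pk | neg? (α k) ≟ 0 | k ℕ.<? θ
    ...   | true | no neg | yes k<θ = k , ℕ.<⇒≤ k≤ , low′ , up′
      where
      low′ : ∀ x → x ℕ.< suc k → x ℕ.< n → p x ≡ true → α x < 0ℤ → k ℕ.≤ x
      low′ x x< x<n px αx with x ≟ k
      ... | yes refl = ℕ.≤-refl
      ... | no x≢k   = ℕ.≤-trans (ℕ.<⇒≤ k<θ) (low x (ℕ.≤∧≢⇒< (s≤s⁻¹ x<) x≢k) x<n px αx)
      up′ : ∀ v → v ℕ.< n → 0ℤ < α v → p v ≡ true → v ℕ.< k
      up′ v v< αv pv = ord v k v< k≤ αv pv (neg⇒ {α k} neg)
        (trans (same k k≤ (λ z → neg (cong neg? z))) pk)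
    ...   | true | no neg | no k≮θ = θ , θ≤ , low′ , up
      where
      low′ : ∀ x → x ℕ.< suc k → x ℕ.< n → p x ≡ true → α x < 0ℤ → θ ℕ.≤ x
      low′ x x< x<n px αx with x ≟ k
      ... | yes refl = ℕ.≮⇒≥ k≮θ
      ... | no x≢k   = low x (ℕ.≤∧≢⇒< (s≤s⁻¹ x<) x≢k) x<n px αx
    ...   | true | yes pos | _ = θ , θ≤ , low′ , up
      where
      nonneg : ∀ {a} → neg? a ≡ 0 → ¬ a < 0ℤ
      nonneg { + a} _ (+<+ ())
      low′ : ∀ x → x ℕ.< suc k → x ℕ.< n → p x ≡ true → α x < 0ℤ → θ ℕ.≤ x
      low′ x x< x<n px αx with x ≟ k
      ... | yes refl = contradiction αx (nonneg pos)
      ... | no x≢k   = low x (ℕ.≤∧≢⇒< (s≤s⁻¹ x<) x≢k) x<n px αx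
    ...   | false | _ | _ = θ , θ≤ , low′ , up
      where
      low′ : ∀ x → x ℕ.< suc k → x ℕ.< n → p x ≡ true → α x < 0ℤ → θ ℕ.≤ x
      low′ x x< x<n px αx with x ≟ k
      ... | yes refl = contradiction (trans (sym px) pk) λ ()
      ... | no x≢k   = low x (ℕ.≤∧≢⇒< (s≤s⁻¹ x<) x≢k) x<n px αx
    go : ∀ x → x ℕ.< n → p x ∨ s x ≡ true → α x ≡ 0ℤ
    go x x< px∨sx with least n ℕ.≤-refl
    ... | θ , _ , low , up = conclude px∨sx
      where
      moment : ∀ y → y ℕ.< n → + θ * (b2z (p y) * α y) - 1ℤ * (b2z (p y) * + y * α y) ≡ 0ℤ
      moment = nonneg-sum-0 n _ nn (trans (Σℤ-lin n (+ θ) 1ℤ _ _) (trans (cong₂ (λ a b → + θ * a - 1ℤ * b) Σp Σpx)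
                 (trans (cong (_+ 0ℤ) (*-zeroʳ (+ θ))) refl)))
        where
        term : ∀ y a → + θ * (1ℤ * a) - 1ℤ * (1ℤ * + y * a) ≡ (+ θ - + y) * a
        term y a = solve 3 (λ t y a → t :* (con 1ℤ :* a) :- con 1ℤ :* (con 1ℤ :* y :* a) ⊜ (t :- y) :* a) refl (+ θ) (+ y) a
        nn : ∀ y → y ℕ.< n → 0ℤ ≤ + θ * (b2z (p y) * α y) - 1ℤ * (b2z (p y) * + y * α y)
        nn y y< with p y in py
        ... | false = ≤-reflexive (sym (trans (cong (_+ 0ℤ) (*-zeroʳ (+ θ))) refl))
        ... | true rewrite term y (α y) with α y in αy
        ...   | + zero = ≤-reflexive (sym (*-zeroʳ (+ θ - + y)))
        ...   | + suc a = scaled (i≤j⇒0≤j-i (+≤+ (ℕ.<⇒≤ (up y y< (subst (0ℤ <_) (sym αy) (+<+ (s≤s z≤n))) py))))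
          where
          scaled : 0ℤ ≤ + θ - + y → 0ℤ ≤ (+ θ - + y) * + suc a
          scaled d = subst (_≤ (+ θ - + y) * + suc a) (*-zeroˡ (+ suc a)) (*-monoʳ-≤-nonNeg (+ suc a) d)
        ...   | -[1+ a ] = subst (0ℤ ≤_) (solve 3 (λ t y a → (y :- t) :* a ⊜ (t :- y) :* (:- a)) refl (+ θ) (+ y) (+ suc a))
                  (subst (_≤ (+ y - + θ) * + suc a) (*-zeroˡ (+ suc a))
                    (*-monoʳ-≤-nonNeg (+ suc a) (i≤j⇒0≤j-i (+≤+ (low y y< y< py (subst (_< 0ℤ) (sym αy) -<+))))))
      no-pos : ∀ y → y ℕ.< n → 0ℤ ≤ - (b2z (p y) * α y)
      no-pos y y< with p y in py | α y in αy | moment y y<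
      ... | false | _        | _ = ≤-refl
      ... | true  | + zero   | _ = ≤-refl
      ... | true  | -[1+ a ] | _ = +≤+ z≤n
      ... | true  | + suc a  | e with i*j≡0⇒i≡0∨j≡0 (+ θ - + y) (trans (sym (solve 3 (λ t y a → t :* (con 1ℤ :* a) :- con 1ℤ :* (con 1ℤ :* y :* a) ⊜ (t :- y) :* a) refl (+ θ) (+ y) (+ suc a))) e)
      ...   | inj₁ z = contradiction (+-injective (sym (i-j≡0⇒i≡j (+ θ) (+ y) z)))
                         (ℕ.<⇒≢ (up y y< (subst (0ℤ <_) (sym αy) (+<+ (s≤s z≤n))) py))
      ...   | inj₂ ()
      px-zero : ∀ y → y ℕ.< n → 0ℤ * (b2z (p y) * α y) - 1ℤ * (b2z (p y) * α y) ≡ 0ℤ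
      px-zero = nonneg-sum-0 n (λ y → 0ℤ * (b2z (p y) * α y) - 1ℤ * (b2z (p y) * α y)) (λ y y< → subst (0ℤ ≤_) (solve 1 (λ a → :- a ⊜ con 0ℤ :* a :- con 1ℤ :* a) refl (b2z (p y) * α y)) (no-pos y y<))
                  (trans (Σℤ-lin n 0ℤ 1ℤ (λ y → b2z (p y) * α y) (λ y → b2z (p y) * α y)) (cong (λ z → 0ℤ * z - 1ℤ * z) Σp))
      conclude : p x ∨ s x ≡ true → α x ≡ 0ℤ
      conclude ps with α x ≟ℤ 0ℤ
      ... | yes z = z
      ... | no nz with p x | s x | ps | same x x< nz | px-zero x x<
      ...   | true | _ | _ | _ | e = contradiction (neg-0 (α x) e) nz
        where
        neg-0 : ∀ a → 0ℤ * (1ℤ * a) - 1ℤ * (1ℤ * a) ≡ 0ℤ → a ≡ 0ℤ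
        neg-0 (+ zero)  _ = refl
        neg-0 (+ suc a) ()
        neg-0 -[1+ a ]  ()
      ...   | false | true | _ | e | _ = contradiction e (λ ())
      ...   | false | false | () | _ | _

open Counting
open LinearRelations
open import Data.Fin using (Fin; zero; suc; toℕ; fromℕ<; combine; remQuot)
open import Data.Fin.Properties using (toℕ<n; toℕ-injective; toℕ-fromℕ<; fromℕ<-toℕ; toℕ-combine; remQuot-combine)
open import Data.Fin.Subset using (Subset; ∣_∣) renaming (_∈_ to _∈ˢ_)
open import Data.Fin.Subset.Properties using (x∈p∩q⁻; p⊆q⇒∣p∣≤∣q∣)
open import Data.Integer using (ℤ; 0ℤ; 1ℤ; -[1+_]; +<+; -<+) renaming (_*_ to _*ℤ_; _<_ to _<ℤ_; +_ to int)
import Data.Integer.Properties as ℤ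
open import Data.Nat
open import Data.Nat.DivMod using (m%n<n; m%n≤m; m<n⇒m%n≡m; m/n≤m; m*n/n≡m; m/n*n≤m; /-monoˡ-≤; m≡m%n+[m/n]*n)
open import Data.Nat.Properties
open Data.Nat.Solver.+-*-Solver using (solve; con; _:+_; _:*_) renaming (_:=_ to _⊜_)

-- Sets avoiding one labelling of each pair

free : ℕ → (ℕ → Bool) → ℕ
free n X = card n (not ∘ X)

fixed-count : ∀ n F X (f : ℕ → Bool) →
  (∀ D → D < 2 ^ n → F D ≢ 0 → ∀ x → x < n → X x ≡ true → D ∋ x ≡ f x) → # (2 ^ n) F ≤ 2 ^ free n X
fixed-count zero    F X f fix = #≤ 1 F
fixed-count (suc n) F X f fix = begin
  # (2 ^ suc n) F                    ≡⟨ #-top n F ⟩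
  # (2 ^ n) F + # (2 ^ n) F₁         ≤⟨ split (X n) refl ⟩
  2 ^ (free n X + sg (bit (not (X n)))) ∎
  where
  open ≤-Reasoning
  F₁ = λ D → F (top n D true)
  restrict : ∀ b → ∀ D → D < 2 ^ n → F (top n D b) ≢ 0 → ∀ x → x < n → X x ≡ true → D ∋ x ≡ f x
  restrict b D D< FD x x< Xx = trans (sym (∋-below n D b x D< x<))
    (fix (top n D b) (top< n D b D<) FD x (m≤n⇒m≤1+n x<) Xx)
  empty : X n ≡ true → ∀ b → b ≢ f n → # (2 ^ n) (λ D → F (top n D b)) ≡ 0
  empty Xn b b≢ = ⇒#≡0 (2 ^ n) _ λ D D< → zero? (F (top n D b)) λ F≢0 →
    b≢ (trans (sym (∋-top n D b D<)) (fix (top n D b) (top< n D b D<) F≢0 n ≤-refl Xn))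
    where
    zero? : ∀ x → ¬ (x ≢ 0) → x ≡ 0
    zero? zero    _ = refl
    zero? (suc x) k = contradiction (λ ()) k
  split : ∀ b → X n ≡ b → # (2 ^ n) F + # (2 ^ n) F₁ ≤ 2 ^ (free n X + sg (bit (not b)))
  split false Xn = ≤-trans (+-mono-≤ (fixed-count n F X f (restrict false)) (fixed-count n F₁ X f (restrict true)))
    (≤-reflexive (trans (sym (2^suc (free n X))) (cong (2 ^_) (+-comm 1 (free n X)))))
  split true Xn rewrite +-identityʳ (free n X) with f n in fn
  ... | true  = ≤-trans (≤-reflexive (cong (_+ # (2 ^ n) F₁) (empty Xn false (λ e → contradiction (trans e fn) λ ()))))
                  (fixed-count n F₁ X f (restrict true))
  ... | false = ≤-trans (≤-reflexive (trans (cong (# (2 ^ n) F +_) (empty Xn true (λ e → contradiction (trans e fn) λ ()))) (+-identityʳ _)))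
                  (fixed-count n F X f (restrict false))

Disjoint : ℕ → (ℕ → Bool) → List (ℕ × ℕ) → Set
Disjoint n X []             = ⊤
Disjoint n X ((a , b) ∷ ps) =
  a < n × b < n × a ≢ b × X a ≡ false × X b ≡ false × Disjoint n ((X [ a ↦ᵇ true ]) [ b ↦ᵇ true ]) ps

below-upd : ∀ X a x → X x ≡ true → (X [ a ↦ᵇ true ]) x ≡ true
below-upd X a x Xx with x ≡ᵇ a
... | true  = refl
... | false = Xx

upd-mono : ∀ {X Y} → (∀ x → X x ≡ true → Y x ≡ true) → ∀ a x → (X [ a ↦ᵇ true ]) x ≡ true → (Y [ a ↦ᵇ true ]) x ≡ true
upd-mono X≤Y a x with x ≡ᵇ a
... | true  = λ _ → refl
... | false = X≤Y x

Disjoint-anti : ∀ n X Y ps → (∀ x → X x ≡ true → Y x ≡ true) → Disjoint n Y ps → Disjoint n X ps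
Disjoint-anti n X Y [] X≤Y d = tt
Disjoint-anti n X Y ((a , b) ∷ ps) X≤Y (a< , b< , a≢b , Ya , Yb , d) =
  a< , b< , a≢b , anti Ya , anti Yb ,
  Disjoint-anti n _ _ ps (upd-mono (upd-mono X≤Y a) b) d
  where
  anti : ∀ {x} → Y x ≡ false → X x ≡ false
  anti {x} Yx with X x in e
  ... | false = refl
  ... | true  = contradiction (trans (sym (X≤Y x e)) Yx) (λ ())

free-upd : ∀ n X a → a < n → X a ≡ false → free n X ≡ suc (free n (X [ a ↦ᵇ true ]))
free-upd n X a a< Xa = trans (Σ<-pick n _ a a<) (cong₂ _+_ (cong (λ b → sg (bit (not b))) Xa) (Σ<-cong n go))
  where
  go : ∀ i → i < n → ((λ i → sg (bit (not (X i)))) [ a ↦ 0 ]) i ≡ sg (bit (not ((X [ a ↦ᵇ true ]) i)))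
  go i _ with i ≡ᵇ a
  ... | true  = refl
  ... | false = refl

sg-split : ∀ x c → sg x ≡ sg (x * bit c) + sg (x * bit (not c))
sg-split x true  rewrite *-identityʳ x | *-zeroʳ x = sym (+-identityʳ _)
sg-split x false rewrite *-identityʳ x | *-zeroʳ x = refl

pair-count : ∀ n ps F X (f e : ℕ → Bool) → Disjoint n X ps →
  (∀ D → D < 2 ^ n → F D ≢ 0 → ∀ x → x < n → X x ≡ true → (D ∋ x) ≡ f x) →
  (∀ D → D < 2 ^ n → F D ≢ 0 → ∀ a b → (a , b) ∈ ps → (D ∋ b) ≡ true → (D ∋ a) ≡ e a) →
  # (2 ^ n) F * 4 ^ length ps ≤ 3 ^ length ps * 2 ^ free n X
pair-count n [] F X f e dis fix excl = begin
  # (2 ^ n) F * 1     ≡⟨ *-identityʳ _ ⟩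
  # (2 ^ n) F         ≤⟨ fixed-count n F X f fix ⟩
  2 ^ free n X        ≡⟨ *-identityˡ _ ⟨
  1 * 2 ^ free n X    ∎ where open ≤-Reasoning
pair-count n ((a , b) ∷ ps) F X f e (a< , b< , a≢b , Xa , Xb , dis) fix excl = begin
  # (2 ^ n) F * (4 * u)          ≡⟨ cong (_* (4 * u)) (trans (Σ<-cong (2 ^ n) (λ D _ → sg-split (F D) (c D))) (Σ<-+ (2 ^ n) _ _)) ⟩
  (# (2 ^ n) F₁ + # (2 ^ n) F₂) * (4 * u)
    ≡⟨ solve 3 (λ x y u → (x :+ y) :* (con 4 :* u) ⊜ con 4 :* (x :* u) :+ con 4 :* (y :* u)) refl (# (2 ^ n) F₁) (# (2 ^ n) F₂) u ⟩
  4 * (# (2 ^ n) F₁ * u) + 4 * (# (2 ^ n) F₂ * u)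
    ≤⟨ +-mono-≤ (*-monoʳ-≤ 4 (pair-count n ps F₁ X₁ (f [ a ↦ᵇ e a ]) e dis₁ fix₁ excl₁))
                (*-monoʳ-≤ 4 (pair-count n ps F₂ X₂ ((f [ a ↦ᵇ not (e a) ]) [ b ↦ᵇ false ]) e dis fix₂ excl₂)) ⟩
  4 * (t * 2 ^ free n X₁) + 4 * (t * 2 ^ free n X₂)
    ≡⟨ cong (λ z → 4 * (t * 2 ^ z) + 4 * (t * 2 ^ free n X₂)) free₁ ⟩
  4 * (t * (2 * 2 ^ free n X₂)) + 4 * (t * 2 ^ free n X₂)
    ≡⟨ solve 2 (λ t z → con 4 :* (t :* (con 2 :* z)) :+ con 4 :* (t :* z) ⊜ con 3 :* t :* (con 2 :* (con 2 :* z))) refl t (2 ^ free n X₂) ⟩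
  3 * t * (2 * (2 * 2 ^ free n X₂))
    ≡⟨ cong (λ z → 3 * t * 2 ^ z) (trans (cong suc (sym free₁)) (sym (free-upd n X a a< Xa))) ⟩
  3 * t * 2 ^ free n X           ∎
  where
  open ≤-Reasoning
  u = 4 ^ length ps
  t = 3 ^ length ps
  c : ℕ → Bool
  c D = does ((D ∋ a) Bool.≟ e a)
  F₁ F₂ : ℕ → ℕ
  F₁ D = F D * bit (c D)
  F₂ D = F D * bit (not (c D))
  X₁ = X [ a ↦ᵇ true ]
  X₂ = X₁ [ b ↦ᵇ true ]
  X₁b : X₁ b ≡ false
  X₁b = trans (updᵇ-diff X a true b (λ z → a≢b (sym z))) Xb
  free₁ : free n X₁ ≡ suc (free n X₂)
  free₁ = free-upd n X₁ b b< X₁b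
  dis₁ = Disjoint-anti n X₁ X₂ ps (below-upd X₁ b) dis
  F≢0 : ∀ {x y} → x * y ≢ 0 → x ≢ 0
  F≢0 xy refl = xy refl
  holds₁ : ∀ D → F₁ D ≢ 0 → (D ∋ a) ≡ e a
  holds₁ D FD with (D ∋ a) Bool.≟ e a
  ... | yes p = p
  ... | no _  = contradiction (*-zeroʳ (F D)) FD
  holds₂ : ∀ D → F₂ D ≢ 0 → (D ∋ a) ≢ e a
  holds₂ D FD with (D ∋ a) Bool.≟ e a
  ... | no p  = p
  ... | yes _ = contradiction (*-zeroʳ (F D)) FD
  fix₁ : ∀ D → D < 2 ^ n → F₁ D ≢ 0 → ∀ x → x < n → X₁ x ≡ true → (D ∋ x) ≡ (f [ a ↦ᵇ e a ]) x
  fix₁ D D< FD x x< Xx with x ≟ a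
  ... | yes refl = trans (holds₁ D FD) (sym (updᵇ-same f a (e a)))
  ... | no x≢    = trans (fix D D< (F≢0 FD) x x< (trans (sym (updᵇ-diff X a true x x≢)) Xx)) (sym (updᵇ-diff f a (e a) x x≢))
  fix₂ : ∀ D → D < 2 ^ n → F₂ D ≢ 0 → ∀ x → x < n → X₂ x ≡ true → (D ∋ x) ≡ ((f [ a ↦ᵇ not (e a) ]) [ b ↦ᵇ false ]) x
  fix₂ D D< FD x x< Xx with x ≟ b
  ... | yes refl = trans (nob (D ∋ b) refl) (sym (updᵇ-same (f [ a ↦ᵇ not (e a) ]) b false))
    where
    nob : ∀ v → (D ∋ b) ≡ v → v ≡ false
    nob false _ = refl
    nob true Db = contradiction (excl D D< (F≢0 FD) a b (here refl) Db) (holds₂ D FD)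
  ... | no x≢b with x ≟ a
  ...   | yes refl = trans (flip (D ∋ a) (e a) (holds₂ D FD))
                       (sym (trans (updᵇ-diff (f [ a ↦ᵇ not (e a) ]) b false a x≢b) (updᵇ-same f a (not (e a)))))
    where
    flip : ∀ x y → x ≢ y → x ≡ not y
    flip true  true  k = contradiction refl k
    flip true  false k = refl
    flip false true  k = refl
    flip false false k = contradiction refl k
  ...   | no x≢a = trans (fix D D< (F≢0 FD) x x< (trans (sym (trans (updᵇ-diff X₁ b true x x≢b) (updᵇ-diff X a true x x≢a))) Xx))
                     (sym (trans (updᵇ-diff (f [ a ↦ᵇ not (e a) ]) b false x x≢b) (updᵇ-diff f a (not (e a)) x x≢a)))
  excl₁ : ∀ D → D < 2 ^ n → F₁ D ≢ 0 → ∀ a′ b′ → (a′ , b′) ∈ ps → (D ∋ b′) ≡ true → (D ∋ a′) ≡ e a′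
  excl₁ D D< FD a′ b′ i = excl D D< (F≢0 FD) a′ b′ (there i)
  excl₂ : ∀ D → D < 2 ^ n → F₂ D ≢ 0 → ∀ a′ b′ → (a′ , b′) ∈ ps → (D ∋ b′) ≡ true → (D ∋ a′) ≡ e a′
  excl₂ D D< FD a′ b′ i = excl D D< (F≢0 FD) a′ b′ (there i)

-- Schedules

ind : ∀ {P : Set} → Dec P → ℕ
ind p = bit (does p)

ind-yes : ∀ {P : Set} (p : Dec P) → P → ind p ≡ 1
ind-yes (yes _) _  = refl
ind-yes (no ¬p) p = contradiction p ¬p

ind-no : ∀ {P : Set} (p : Dec P) → ¬ P → ind p ≡ 0
ind-no (yes p) ¬p = contradiction p ¬p
ind-no (no _)  _  = refl

ind⇒ : ∀ {P : Set} (p : Dec P) → ind p ≢ 0 → P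
ind⇒ (yes p) _ = p
ind⇒ (no _)  k = contradiction refl k

maxT : ℕ → (ℕ → ℕ) → ℕ
maxT zero    f = 0
maxT (suc n) f = maxT n f ⊔ f n

≤-maxT : ∀ n f i → i < n → f i ≤ maxT n f
≤-maxT (suc n) f i i< with i ≟ n
... | yes refl = m≤n⊔m (maxT n f) (f n)
... | no i≢n   = ≤-trans (≤-maxT n f i (≤∧≢⇒< (s≤s⁻¹ i<) i≢n)) (m≤m⊔n (maxT n f) (f n))

maxT-attained : ∀ n f → maxT n f ≡ 0 ⊎ (∃[ i ] i < n × f i ≡ maxT n f)
maxT-attained zero    f = inj₁ refl
maxT-attained (suc n) f with ⊔-sel (maxT n f) (f n)
... | inj₂ e = inj₂ (n , ≤-refl , sym e)
... | inj₁ e with maxT-attained n f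
...   | inj₁ z            = inj₁ (trans e z)
...   | inj₂ (i , i< , e′) = inj₂ (i , m≤n⇒m≤1+n i< , trans e′ (sym e))

minT : ℕ → ℕ → (ℕ → ℕ) → ℕ
minT zero    B f = B
minT (suc n) B f = minT n B f ⊓ f n

minT-≤ : ∀ n B f i → i < n → minT n B f ≤ f i
minT-≤ (suc n) B f i i< with i ≟ n
... | yes refl = m⊓n≤n (minT n B f) (f n)
... | no i≢n   = ≤-trans (m⊓n≤m (minT n B f) (f n)) (minT-≤ n B f i (≤∧≢⇒< (s≤s⁻¹ i<) i≢n))

minT≤B : ∀ n B f → minT n B f ≤ B
minT≤B zero    B f = ≤-refl
minT≤B (suc n) B f = ≤-trans (m⊓n≤m (minT n B f) (f n)) (minT≤B n B f)

minT-attained : ∀ n B f → minT n B f ≡ B ⊎ (∃[ i ] i < n × f i ≡ minT n B f)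
minT-attained zero    B f = inj₁ refl
minT-attained (suc n) B f with ⊓-sel (minT n B f) (f n)
... | inj₂ e = inj₂ (n , ≤-refl , sym e)
... | inj₁ e with minT-attained n B f
...   | inj₁ z             = inj₁ (trans e z)
...   | inj₂ (i , i< , e′) = inj₂ (i , m≤n⇒m≤1+n i< , trans e′ (sym e))

extremal : ∀ n (U f : ℕ → ℕ) → (∃[ x ] x < n × U x ≢ 0) →
           ∃[ x ] (x < n × U x ≢ 0 × (∀ y → y < n → U y ≢ 0 → f y ≤ f x))
extremal n U f (x₀ , x₀< , Ux₀) with maxT-attained n g
  where
  g : ℕ → ℕ
  g x = sg (U x) * suc (f x)
... | inj₁ z = contradiction (subst (g x₀ ≤_) z (≤-maxT n g x₀ x₀<))
                 (<⇒≱ (subst (λ s → 0 < s * suc (f x₀)) (sym (sg≢0 Ux₀)) (s≤s z≤n)))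
  where
  g : ℕ → ℕ
  g x = sg (U x) * suc (f x)
... | inj₂ (x , x< , e) = x , x< , Ux , max
  where
  g : ℕ → ℕ
  g x = sg (U x) * suc (f x)
  Ux : U x ≢ 0
  Ux z = <⇒≱ (subst (λ s → 0 < s * suc (f x₀)) (sym (sg≢0 Ux₀)) (s≤s z≤n))
           (≤-trans (≤-maxT n g x₀ x₀<) (≤-reflexive (trans (sym e) (cong (λ u → sg u * suc (f x)) z))))
  max : ∀ y → y < n → U y ≢ 0 → f y ≤ f x
  max y y< Uy = s≤s⁻¹ (begin
    suc (f y)        ≡⟨ trans (cong (_* suc (f y)) (sg≢0 Uy)) (*-identityˡ (suc (f y))) ⟨
    g y              ≤⟨ ≤-maxT n g y y< ⟩
    maxT n g         ≡⟨ e ⟨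
    g x              ≡⟨ trans (cong (_* suc (f x)) (sg≢0 Ux)) (*-identityˡ (suc (f x))) ⟩
    suc (f x)        ∎) where open ≤-Reasoning

lex : ∀ B {x x′ y y′} → y < B → y′ < B → x * B + y ≤ x′ * B + y′ → x ≤ x′ × (x ≡ x′ → y ≤ y′)
lex B {x} {x′} {y} {y′} y< y′< le = ≮⇒≥ (λ x′<x → <⇒≱ (big x′<x) le) , λ { refl → +-cancelˡ-≤ (x * B) y y′ le }
  where
  big : x′ < x → x′ * B + y′ < x * B + y
  big x′<x = begin-strict
    x′ * B + y′  <⟨ +-monoʳ-< (x′ * B) y′< ⟩
    x′ * B + B   ≡⟨ +-comm (x′ * B) B ⟩
    suc x′ * B   ≤⟨ *-monoˡ-≤ B x′<x ⟩
    x * B        ≤⟨ m≤m+n _ y ⟩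
    x * B + y    ∎ where open ≤-Reasoning

#-unique : ∀ n f → (∀ i j → i < n → j < n → f i ≢ 0 → f j ≢ 0 → i ≡ j) → # n f ≤ 1
#-unique zero    f u = z≤n
#-unique (suc n) f u with f n in e
... | zero  = ≤-trans (≤-reflexive (+-identityʳ _)) (#-unique n f (λ i j i< j< → u i j (m≤n⇒m≤1+n i<) (m≤n⇒m≤1+n j<)))
... | suc y = ≤-reflexive (cong (_+ 1) (⇒#≡0 n f zero′))
  where
  zero′ : ∀ i → i < n → f i ≡ 0
  zero′ i i< with f i ≟ 0
  ... | yes z = z
  ... | no nz = contradiction (u i n (m≤n⇒m≤1+n i<) ≤-refl nz (λ z → 1+n≢0 (trans (sym e) z))) (<⇒≢ i<)

sw : ℕ → ℕ → ℕ → ℕ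
sw u v x = if does (x ≟ u) then v else if does (x ≟ v) then u else x

sw-u : ∀ u v → sw u v u ≡ v
sw-u u v rewrite dec-true (u ≟ u) refl = refl

sw-v : ∀ u v → sw u v v ≡ u
sw-v u v with v ≟ u
... | yes refl rewrite dec-true (v ≟ v) refl = refl
... | no v≢u rewrite dec-false (v ≟ u) v≢u | dec-true (v ≟ v) refl = refl

sw-other : ∀ u v x → x ≢ u → x ≢ v → sw u v x ≡ x
sw-other u v x x≢u x≢v rewrite dec-false (x ≟ u) x≢u | dec-false (x ≟ v) x≢v = refl

Σ<-two : ∀ n f u v → u < n → v < n → u ≢ v → Σ< n f ≡ f u + (f v + Σ< n ((f [ u ↦ 0 ]) [ v ↦ 0 ]))
Σ<-two n f u v u< v< u≢v = trans (Σ<-pick n f u u<) (cong (f u +_) (trans (Σ<-pick n (f [ u ↦ 0 ]) v v<)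
  (cong (_+ Σ< n ((f [ u ↦ 0 ]) [ v ↦ 0 ])) (upd-diff f u 0 v (u≢v ∘ sym)))))

upd2-cong : ∀ (f g : ℕ → ℕ) u v x → (x ≢ u → x ≢ v → f x ≡ g x) →
            ((f [ u ↦ 0 ]) [ v ↦ 0 ]) x ≡ ((g [ u ↦ 0 ]) [ v ↦ 0 ]) x
upd2-cong f g u v x e with x ≟ v
... | yes refl = trans (upd-same (f [ u ↦ 0 ]) v 0) (sym (upd-same (g [ u ↦ 0 ]) v 0))
... | no x≢v with x ≟ u
...   | yes refl = trans (trans (upd-diff (f [ u ↦ 0 ]) v 0 x x≢v) (upd-same f u 0))
                     (sym (trans (upd-diff (g [ u ↦ 0 ]) v 0 x x≢v) (upd-same g u 0)))
...   | no x≢u = trans (trans (upd-diff (f [ u ↦ 0 ]) v 0 x x≢v) (upd-diff f u 0 x x≢u))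
                   (trans (e x≢u x≢v) (sym (trans (upd-diff (g [ u ↦ 0 ]) v 0 x x≢v) (upd-diff g u 0 x x≢u))))

Σ<-sw : ∀ n f u v → u < n → v < n → u ≢ v → Σ< n (f ∘ sw u v) ≡ Σ< n f
Σ<-sw n f u v u< v< u≢v = begin
  Σ< n (f ∘ sw u v)  ≡⟨ Σ<-two n (f ∘ sw u v) u v u< v< u≢v ⟩
  f (sw u v u) + (f (sw u v v) + Σ< n (((f ∘ sw u v) [ u ↦ 0 ]) [ v ↦ 0 ]))
    ≡⟨ cong₂ (λ a b → f a + (f b + Σ< n (((f ∘ sw u v) [ u ↦ 0 ]) [ v ↦ 0 ]))) (sw-u u v) (sw-v u v) ⟩
  f v + (f u + Σ< n (((f ∘ sw u v) [ u ↦ 0 ]) [ v ↦ 0 ]))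
    ≡⟨ cong (λ z → f v + (f u + z)) (Σ<-cong n (λ x _ → upd2-cong (f ∘ sw u v) f u v x (λ x≢u x≢v → cong f (sw-other u v x x≢u x≢v)))) ⟩
  f v + (f u + R)    ≡⟨ +-assoc (f v) (f u) R ⟨
  f v + f u + R      ≡⟨ cong (_+ R) (+-comm (f v) (f u)) ⟩
  f u + f v + R      ≡⟨ +-assoc (f u) (f v) R ⟩
  f u + (f v + R)    ≡⟨ Σ<-two n f u v u< v< u≢v ⟨
  Σ< n f             ∎
  where
  open ≡-Reasoning
  R = Σ< n ((f [ u ↦ 0 ]) [ v ↦ 0 ])

Σ<-two-< : ∀ n f g u v → u < n → v < n → u ≢ v → (∀ x → x ≢ u → x ≢ v → f x ≡ g x) →
           f u + f v < g u + g v → Σ< n f < Σ< n g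
Σ<-two-< n f g u v u< v< u≢v e l = begin-strict
  Σ< n f                ≡⟨ Σ<-two n f u v u< v< u≢v ⟩
  f u + (f v + R)       ≡⟨ +-assoc (f u) (f v) R ⟨
  f u + f v + R         <⟨ +-monoˡ-< R l ⟩
  g u + g v + R         ≡⟨ +-assoc (g u) (g v) R ⟩
  g u + (g v + R)       ≡⟨ cong (λ z → g u + (g v + z)) (Σ<-cong n (λ x _ → upd2-cong f g u v x (e x))) ⟩
  g u + (g v + _)       ≡⟨ Σ<-two n g u v u< v< u≢v ⟨
  Σ< n g                ∎
  where
  open ≤-Reasoning
  R = Σ< n ((f [ u ↦ 0 ]) [ v ↦ 0 ])

module Scheduling
  (n m : ℕ) (_≺_ : ℕ → ℕ → Set) (≺? : ∀ u v → Dec (u ≺ v))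
  (≺-bound : ∀ {u v} → u ≺ v → u < n × v < n) (≺-irrefl : ∀ {u} → ¬ (u ≺ u))
  (≺-trans : ∀ {u v x} → u ≺ v → v ≺ x → u ≺ x) (1≤m : 1 ≤ m) where

  record Feasible (M : ℕ) (τ : ℕ → ℕ) : Set where
    field
      in-range : ∀ x → x < n → τ x < M
      order    : ∀ {u v} → u ≺ v → τ u < τ v
      capacity : ∀ s → # n (λ x → ind (τ x ≟ s)) ≤ m
  open Feasible public

  record Prefix (t D : ℕ) : Set where
    field
      slot     : ℕ → ℕ
      in-range : ∀ x → x < n → (D ∋ x) ≡ true → slot x < t
      order    : ∀ {u v} → u ≺ v → (D ∋ v) ≡ true → (D ∋ u) ≡ true × slot u < slot v
      capacity : ∀ s → # n (λ x → bit (D ∋ x) * ind (slot x ≟ s)) ≤ m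

  record Step (D D′ : ℕ) : Set where
    field
      grows : ∀ v → v < n → (D ∋ v) ≡ true → (D′ ∋ v) ≡ true
      fits  : # n (λ v → bit (D′ ∋ v) * bit (not (D ∋ v))) ≤ m
      ready : ∀ {u v} → u ≺ v → (D′ ∋ v) ≡ true → (D ∋ v) ≡ false → (D ∋ u) ≡ true

  prefix-∅ : Prefix 0 0
  prefix-∅ = record
    { slot     = λ _ → 0
    ; in-range = λ x _ x∈ → contradiction (trans (sym x∈) (∅∌ x)) λ ()
    ; order    = λ {u} {v} _ v∈ → contradiction (trans (sym v∈) (∅∌ v)) λ ()
    ; capacity = λ s → ≤-trans (≤-reflexive (⇒#≡0 n _ (λ x _ → cong (λ b → bit b * ind (0 ≟ s)) (∅∌ x)))) z≤n
    }

  prefix-step : ∀ {t D D′} → Prefix t D → Step D D′ → Prefix (suc t) D′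
  prefix-step {t} {D} {D′} p st = record { slot = σ ; in-range = inr ; order = λ {u} {v} → ord {u} {v} ; capacity = cap }
    where
    open Prefix p renaming (slot to τ; in-range to τ<; order to τ≺; capacity to τcap)
    open Step st
    σ : ℕ → ℕ
    σ x = if D ∋ x then τ x else t
    inr : ∀ x → x < n → (D′ ∋ x) ≡ true → σ x < suc t
    inr x x< _ with D ∋ x in e
    ... | true  = m≤n⇒m≤1+n (τ< x x< e)
    ... | false = ≤-refl
    ord : ∀ {u v} → u ≺ v → (D′ ∋ v) ≡ true → (D′ ∋ u) ≡ true × σ u < σ v
    ord {u} {v} u≺v v∈ with D ∋ v in ev
    ... | true with τ≺ u≺v ev
    ...   | u∈ , l rewrite u∈ = grows u (proj₁ (≺-bound u≺v)) u∈ , l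
    ord {u} {v} u≺v v∈ | false with ready u≺v v∈ ev
    ... | u∈ rewrite u∈ = grows u (proj₁ (≺-bound u≺v)) u∈ , τ< u (proj₁ (≺-bound u≺v)) u∈
    cap : ∀ s → # n (λ x → bit (D′ ∋ x) * ind (σ x ≟ s)) ≤ m
    cap s with s ≟ t
    ... | yes refl = ≤-trans (#-mono n go) fits
      where
      go : ∀ x → x < n → bit (D′ ∋ x) * ind (σ x ≟ s) ≢ 0 → bit (D′ ∋ x) * bit (not (D ∋ x)) ≢ 0
      go x x< nz with D′ ∋ x | D ∋ x in e
      ... | true  | false = λ ()
      ... | false | _     = λ _ → nz refl
      ... | true  | true  = λ _ → nz (cong (_+ 0) (ind-no (τ x ≟ s) (<⇒≢ (τ< x x< e))))
    ... | no s≢t = ≤-trans (#-mono n go) (τcap s)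
      where
      go : ∀ x → x < n → bit (D′ ∋ x) * ind (σ x ≟ s) ≢ 0 → bit (D ∋ x) * ind (τ x ≟ s) ≢ 0
      go x x< nz z with D′ ∋ x | D ∋ x
      ... | false | _     = nz refl
      ... | true  | true  = nz z
      ... | true  | false = nz (cong (_+ 0) (ind-no (t ≟ s) (λ e → s≢t (sym e))))

  Full : ℕ → Set
  Full D = ∀ x → x < n → (D ∋ x) ≡ true

  prefix-full : ∀ {t D} → Full D → (p : Prefix t D) → Feasible t (Prefix.slot p)
  prefix-full full p = record
    { in-range = λ x x< → Prefix.in-range p x x< (full x x<)
    ; order    = λ {u} {v} u≺v → proj₂ (Prefix.order p u≺v (full v (proj₂ (≺-bound u≺v))))
    ; capacity = λ s → ≤-trans (≤-reflexive (#-cong n (λ x x< → sym (trans (cong (λ b → bit b * _) (full x x<)) (*-identityˡ _)))))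
                         (Prefix.capacity p s)
    }

  state : (ℕ → ℕ) → ℕ → ℕ
  state τ t = set n (λ v → does (τ v <? t))

  ∋-state : ∀ τ t v → v < n → (state τ t ∋ v) ≡ does (τ v <? t)
  ∋-state τ t v v< = ∋-set n _ v v<

  does-yes : ∀ {P : Set} (p : Dec P) → does p ≡ true → P
  does-yes (yes p) _ = p

  does-no : ∀ {P : Set} (p : Dec P) → does p ≡ false → ¬ P
  does-no (no p) _ = p

  state-step : ∀ {M τ} → Feasible M τ → ∀ t → Step (state τ t) (state τ (suc t))
  state-step {M} {τ} F t = record { grows = gr ; fits = ≤-trans (#-mono n fi) (capacity F t) ; ready = λ {u} {v} → re {u} {v} }
    where
    gr : ∀ v → v < n → (state τ t ∋ v) ≡ true → (state τ (suc t) ∋ v) ≡ true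
    gr v v< e rewrite ∋-state τ t v v< | ∋-state τ (suc t) v v< =
      dec-true (τ v <? suc t) (m≤n⇒m≤1+n (does-yes (τ v <? t) e))
    fi : ∀ x → x < n → bit (state τ (suc t) ∋ x) * bit (not (state τ t ∋ x)) ≢ 0 → ind (τ x ≟ t) ≢ 0
    fi x x< nz rewrite ∋-state τ t x x< | ∋-state τ (suc t) x x< = λ z → 1+n≢0 (trans (sym (ind-yes (τ x ≟ t) (eq′ (τ x <? suc t) (τ x <? t) nz))) z)
      where
      eq′ : (p : Dec (τ x < suc t)) (q : Dec (τ x < t)) → bit (does p) * bit (not (does q)) ≢ 0 → τ x ≡ t
      eq′ (yes p) (no q)  _  = ≤-antisym (s≤s⁻¹ p) (≮⇒≥ q)
      eq′ (yes p) (yes q) nz = contradiction refl nz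
      eq′ (no p)  _       nz = contradiction refl nz
    re : ∀ {u v} → u ≺ v → (state τ (suc t) ∋ v) ≡ true → (state τ t ∋ v) ≡ false → (state τ t ∋ u) ≡ true
    re {u} {v} u≺v v∈ v∉ rewrite ∋-state τ t u (proj₁ (≺-bound u≺v)) | ∋-state τ t v (proj₂ (≺-bound u≺v))
                               | ∋-state τ (suc t) v (proj₂ (≺-bound u≺v)) =
      dec-true (τ u <? t) (<-≤-trans (order F u≺v) (s≤s⁻¹ (does-yes (τ v <? suc t) v∈)))

  npred : ℕ → ℕ
  npred v = # n (λ u → ind (≺? u v))

  npred-mono : ∀ {u v} → u ≺ v → npred u < npred v
  npred-mono {u} {v} u≺v = #-mono-< n (λ a a< nz z → 1+n≢0 (trans (sym (ind-yes (≺? a v) (≺-trans (ind⇒ (≺? a u) nz) u≺v))) z))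
    u (proj₁ (≺-bound u≺v)) (ind-no (≺? u u) ≺-irrefl) (λ z → 1+n≢0 (trans (sym (ind-yes (≺? u v) u≺v)) z))

  sequential : ∃[ τ ] Feasible n τ
  sequential = τ , record { in-range = λ x x< → inr x x< ; order = λ {u} {v} → ord {u} {v} ; capacity = λ s → ≤-trans (#-unique n _ (uniq s)) 1≤m }
    where
    key : ℕ → ℕ
    key x = npred x * n + x
    key-inj : ∀ {x y} → x < n → y < n → key x ≡ key y → x ≡ y
    key-inj {x} {y} x< y< e with lex n {npred x} {npred y} x< y< (≤-reflexive e) | lex n {npred y} {npred x} y< x< (≤-reflexive (sym e))
    ... | le , k | ge , k′ = ≤-antisym (k (≤-antisym le ge)) (k′ (≤-antisym ge le))
    τ : ℕ → ℕ
    τ x = # n (λ u → ind (key u <? key x))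
    mono : ∀ {x y} → x < n → key x < key y → τ x < τ y
    mono {x} {y} x< l = #-mono-< n
      (λ a a< nz z → 1+n≢0 (trans (sym (ind-yes (key a <? key y) (<-trans (ind⇒ (key a <? key x) nz) l))) z))
      x x< (ind-no (key x <? key x) (<-irrefl refl)) (λ z → 1+n≢0 (trans (sym (ind-yes (key x <? key y) l)) z))
    inr : ∀ x → x < n → τ x < n
    inr x x< = <-≤-trans (#-mono-< n {g = λ _ → 1} (λ _ _ _ → λ ()) x x< (ind-no (key x <? key x) (<-irrefl refl)) (λ ())) (#≤ n (λ _ → 1))
    ord : ∀ {u v} → u ≺ v → τ u < τ v
    ord {u} {v} u≺v = mono (proj₁ (≺-bound u≺v)) (begin-strict
      npred u * n + u  <⟨ +-monoʳ-< (npred u * n) (proj₁ (≺-bound u≺v)) ⟩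
      npred u * n + n  ≡⟨ +-comm (npred u * n) n ⟩
      suc (npred u) * n ≤⟨ *-monoˡ-≤ n (npred-mono u≺v) ⟩
      npred v * n      ≤⟨ m≤m+n _ v ⟩
      npred v * n + v  ∎) where open ≤-Reasoning
    uniq : ∀ s i j → i < n → j < n → ind (τ i ≟ s) ≢ 0 → ind (τ j ≟ s) ≢ 0 → i ≡ j
    uniq s i j i< j< ei ej with <-cmp (key i) (key j)
    ... | tri≈ _ e _ = key-inj i< j< e
    ... | tri< l _ _ = contradiction (trans (ind⇒ (τ i ≟ s) ei) (sym (ind⇒ (τ j ≟ s) ej))) (<⇒≢ (mono {i} {j} i< l))
    ... | tri> _ _ l = contradiction (trans (ind⇒ (τ j ≟ s) ej) (sym (ind⇒ (τ i ≟ s) ei))) (<⇒≢ (mono {j} {i} j< l))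

  -- Features of a job: the jobs before it (P) or after it (S); the
  -- feature n belongs to every job, the feature n + 1 to none.
  PF SF : ℕ → ℕ → Set
  PF c x = c ≡ n ⊎ c ≺ x
  SF c x = c ≡ n ⊎ x ≺ c

  Peelable : (D : ℕ) (U : ℕ → ℕ) (c c′ : ℕ) → Set
  Peelable D U c c′ =
    (∀ v → v < n → U v ≢ 0 → (D ∋ v) ≡ true → PF c v → SF c′ v) ×
    (∀ u → u < n → U u ≢ 0 → (D ∋ u) ≡ false → SF c′ u → PF c u) ×
    (∀ v u → v < n → u < n → U v ≢ 0 → (D ∋ v) ≡ true → PF c v → U u ≢ 0 → (D ∋ u) ≡ false → SF c′ u → v < u)

  -- The jobs outside C are scheduled by earliest deadline, ties being
  -- broken by release time and then by index, where releases and
  -- deadlines refer to a fixed schedule τ₀ of C.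
  module Canonical (C : ℕ → Bool) (cover : ∀ {u v} → u ≺ v → C u ∨ C v ≡ true)
                   (M : ℕ) (τ₀ : ℕ → ℕ) (F₀ : Feasible M τ₀) where

    pos : ℕ → ℕ
    pos c = τ₀ c * n + c

    B : ℕ
    B = M * n

    pos< : ∀ {c} → c < n → pos c < B
    pos< {c} c< = begin-strict
      τ₀ c * n + c  <⟨ +-monoʳ-< (τ₀ c * n) c< ⟩
      τ₀ c * n + n  ≡⟨ +-comm (τ₀ c * n) n ⟩
      suc (τ₀ c) * n ≤⟨ *-monoˡ-≤ n (in-range F₀ c c<) ⟩
      M * n         ∎ where open ≤-Reasoning

    pos-≤ : ∀ {a c} → a < n → c < n → pos a ≤ pos c → τ₀ a ≤ τ₀ c
    pos-≤ a< c< le = proj₁ (lex n a< c< le)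

    pos-inj : ∀ {a c} → a < n → c < n → pos a ≡ pos c → a ≡ c
    pos-inj {a} {c} a< c< e with lex n {τ₀ a} {τ₀ c} a< c< (≤-reflexive e) | lex n {τ₀ c} {τ₀ a} c< a< (≤-reflexive (sym e))
    ... | le , k | ge , k′ = ≤-antisym (k (≤-antisym le ge)) (k′ (≤-antisym ge le))

    relᶠ dlᶠ : ℕ → ℕ → ℕ
    relᶠ v c = if does (≺? c v) then suc (pos c) else 0
    dlᶠ  v c = if does (≺? v c) then pos c else B

    rel dl : ℕ → ℕ
    rel v = maxT n (relᶠ v)
    dl  v = minT n B (dlᶠ v)

    rel-≥ : ∀ {c v} → c ≺ v → suc (pos c) ≤ rel v
    rel-≥ {c} {v} c≺v = subst (_≤ rel v) (cong (λ b → if b then suc (pos c) else 0) (dec-true (≺? c v) c≺v))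
                          (≤-maxT n (relᶠ v) c (proj₁ (≺-bound c≺v)))

    dl-≤ : ∀ {v c} → v ≺ c → dl v ≤ pos c
    dl-≤ {v} {c} v≺c = subst (dl v ≤_) (cong (λ b → if b then pos c else B) (dec-true (≺? v c) v≺c))
                         (minT-≤ n B (dlᶠ v) c (proj₂ (≺-bound v≺c)))

    rel-attained : ∀ v → rel v ≡ 0 ⊎ (∃[ c ] c ≺ v × rel v ≡ suc (pos c))
    rel-attained v with maxT-attained n (relᶠ v)
    ... | inj₁ z = inj₁ z
    ... | inj₂ (c , c< , e) with ≺? c v
    ...   | yes c≺v = inj₂ (c , c≺v , sym e)
    ...   | no _    = inj₁ (sym e)

    dl-attained : ∀ v → dl v ≡ B ⊎ (∃[ c ] v ≺ c × dl v ≡ pos c)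
    dl-attained v with minT-attained n B (dlᶠ v)
    ... | inj₁ z = inj₁ z
    ... | inj₂ (c , c< , e) with ≺? v c
    ...   | yes v≺c = inj₂ (c , v≺c , sym e)
    ...   | no _    = inj₁ (sym e)

    dl≤B : ∀ v → dl v ≤ B
    dl≤B v = minT≤B n B (dlᶠ v)

    rel≤B : ∀ v → rel v ≤ B
    rel≤B v with rel-attained v
    ... | inj₁ z             = subst (_≤ B) (sym z) z≤n
    ... | inj₂ (c , c≺v , e) = subst (_≤ B) (sym e) (pos< (proj₁ (≺-bound c≺v)))

    K : ℕ
    K = suc B + n

    κ : ℕ → ℕ
    κ v = (dl v * K + rel v) * K + v

    κ-lex : ∀ {v u} → v < n → u < n → κ v ≤ κ u →
            dl v ≤ dl u × (dl v ≡ dl u → rel v ≤ rel u × (rel v ≡ rel u → v ≤ u))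
    κ-lex {v} {u} v< u< le with lex K (<-≤-trans v< (m≤n+m n (suc B))) (<-≤-trans u< (m≤n+m n (suc B))) le
    ... | le₁ , k₁ with lex K {dl v} {dl u} (≤-trans (s≤s (rel≤B v)) (m≤m+n (suc B) n)) (≤-trans (s≤s (rel≤B u)) (m≤m+n (suc B) n)) le₁
    ...   | le₂ , k₂ = le₂ , λ d≡ → k₂ d≡ , λ r≡ → k₁ (cong₂ (λ d r → d * K + r) d≡ r≡)

    Bad : (ℕ → ℕ) → ℕ → ℕ → Set
    Bad τ u v = C u ≡ false × C v ≡ false × τ v < τ u × κ u < κ v ×
                (∀ {a} → a < n → a ≺ u → τ a < τ v) × (∀ {b} → b < n → v ≺ b → τ u < τ b)

    bad? : ∀ τ u v → Dec (Bad τ u v)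
    bad? τ u v = (C u Data.Bool.≟ false) ×-dec (C v Data.Bool.≟ false) ×-dec (τ v <? τ u) ×-dec (κ u <? κ v)
      ×-dec allUpTo? (λ a → ≺? a u →-dec (τ a <? τ v)) n ×-dec allUpTo? (λ b → ≺? v b →-dec (τ u <? τ b)) n

    record Canon (τ : ℕ → ℕ) : Set where
      field
        feasible : Feasible M τ
        agrees   : ∀ c → C c ≡ true → τ c ≡ τ₀ c
        no-bad   : ∀ {u v} → u < n → v < n → ¬ Bad τ u v

    Φ : (ℕ → ℕ) → ℕ
    Φ τ = Σ< n (λ x → κ x * (M ∸ τ x))

    C-end : ∀ {a b} → a ≺ b → C a ≡ false → C b ≡ true
    C-end {a} a≺b ¬Ca = trans (sym (cong (_∨ C _) ¬Ca)) (cover a≺b)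

    C-start : ∀ {a b} → a ≺ b → C b ≡ false → C a ≡ true
    C-start {a} {b} a≺b ¬Cb with C a | cover a≺b
    ... | true  | _ = refl
    ... | false | e = contradiction (trans (sym e) ¬Cb) λ ()

    ≢-by-C : ∀ {x y} → C x ≡ true → C y ≡ false → x ≢ y
    ≢-by-C Cx Cy refl = contradiction (trans (sym Cx) Cy) λ ()

    module Swap {τ u v} (F : Feasible M τ) (ag : ∀ c → C c ≡ true → τ c ≡ τ₀ c)
                (u< : u < n) (v< : v < n) (bad : Bad τ u v) where

      ¬Cu = proj₁ bad
      ¬Cv = proj₁ (proj₂ bad)
      τv<τu = proj₁ (proj₂ (proj₂ bad))
      κu<κv = proj₁ (proj₂ (proj₂ (proj₂ bad)))
      before-u = proj₁ (proj₂ (proj₂ (proj₂ (proj₂ bad))))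
      after-v = proj₂ (proj₂ (proj₂ (proj₂ (proj₂ bad))))

      u≢v : u ≢ v
      u≢v refl = <-irrefl refl τv<τu

      τ′ : ℕ → ℕ
      τ′ = τ ∘ sw u v

      at-u : τ′ u ≡ τ v
      at-u = cong τ (sw-u u v)

      at-v : τ′ v ≡ τ u
      at-v = cong τ (sw-v u v)

      at-other : ∀ {x} → x ≢ u → x ≢ v → τ′ x ≡ τ x
      at-other {x} x≢u x≢v = cong τ (sw-other u v x x≢u x≢v)

      at-C : ∀ {x} → C x ≡ true → τ′ x ≡ τ x
      at-C Cx = at-other (≢-by-C Cx ¬Cu) (≢-by-C Cx ¬Cv)

      feasible′ : Feasible M τ′
      feasible′ = record { in-range = inr ; order = ord ; capacity = cap }
        where
        inr : ∀ x → x < n → τ′ x < M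
        inr x x< with x ≟ u
        ... | yes refl = subst (_< M) (sym at-u) (in-range F v v<)
        ... | no x≢u with x ≟ v
        ...   | yes refl = subst (_< M) (sym at-v) (in-range F u u<)
        ...   | no x≢v   = subst (_< M) (sym (at-other x≢u x≢v)) (in-range F x x<)
        ord : ∀ {a b} → a ≺ b → τ′ a < τ′ b
        ord {a} {b} a≺b with b ≟ u
        ... | yes refl = subst₂ _<_ (sym (at-C (C-start a≺b ¬Cu))) (sym at-u) (before-u (proj₁ (≺-bound a≺b)) a≺b)
        ... | no b≢u with b ≟ v
        ...   | yes refl = subst₂ _<_ (sym (at-C (C-start a≺b ¬Cv))) (sym at-v) (<-trans (order F a≺b) τv<τu)
        ...   | no b≢v with a ≟ u
        ...     | yes refl = subst₂ _<_ (sym at-u) (sym (at-other b≢u b≢v)) (<-trans τv<τu (order F a≺b))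
        ...     | no a≢u with a ≟ v
        ...       | yes refl = subst₂ _<_ (sym at-v) (sym (at-other b≢u b≢v)) (after-v (proj₂ (≺-bound a≺b)) a≺b)
        ...       | no a≢v   = subst₂ _<_ (sym (at-other a≢u a≢v)) (sym (at-other b≢u b≢v)) (order F a≺b)
        cap : ∀ s → # n (λ x → ind (τ′ x ≟ s)) ≤ m
        cap s = ≤-trans (≤-reflexive (Σ<-sw n (λ x → sg (ind (τ x ≟ s))) u v u< v< u≢v)) (capacity F s)

      agrees′ : ∀ c → C c ≡ true → τ′ c ≡ τ₀ c
      agrees′ c Cc = trans (at-C Cc) (ag c Cc)

      decreases : Φ τ′ < Φ τ
      decreases = Σ<-two-< n _ _ u v u< v< u≢v (λ x x≢u x≢v → cong (λ t → κ x * (M ∸ t)) (at-other x≢u x≢v))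
        (subst₂ (λ s t → κ u * (M ∸ s) + κ v * (M ∸ t) < κ u * (M ∸ τ u) + κ v * (M ∸ τ v)) (sym at-u) (sym at-v)
          (cross κu<κv (∸-monoʳ-< τv<τu (<⇒≤ (in-range F u u<)))))
        where
        cross : ∀ {a b x y} → a < b → x < y → a * y + b * x < a * x + b * y
        cross {a} {b} {x} {y} a<b x<y with m≤n⇒∃[o]m+o≡n a<b | m≤n⇒∃[o]m+o≡n x<y
        ... | d , refl | e , refl = subst (a * y + b * x <_) (merged a d x e) (s≤s (m≤m+n _ (d + e * suc d)))
          where
          merged : ∀ a d x e → suc (a * suc (x + e) + suc (a + d) * x + (d + e * suc d)) ≡ a * x + suc (a + d) * suc (x + e)
          merged = solve 4 (λ a d x e → con 1 :+ (a :* (con 1 :+ (x :+ e)) :+ (con 1 :+ (a :+ d)) :* x :+ (d :+ e :* (con 1 :+ d)))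
                 ⊜ a :* x :+ (con 1 :+ (a :+ d)) :* (con 1 :+ (x :+ e))) refl

    improve : ∀ k τ → Φ τ < k → Feasible M τ → (∀ c → C c ≡ true → τ c ≡ τ₀ c) → ∃[ τ′ ] Canon τ′
    improve (suc k) τ Φ< F ag with anyUpTo? (λ u → anyUpTo? (λ v → bad? τ u v) n) n
    ... | no none = τ , record { feasible = F ; agrees = ag ; no-bad = λ u< v< bad → none (_ , u< , _ , v< , bad) }
    ... | yes (u , u< , v , v< , bad) = improve k τ′ (<-≤-trans decreases (s≤s⁻¹ Φ<)) feasible′ agrees′
      where open Swap F ag u< v< bad

    canonical : ∃[ τ ] Canon τ
    canonical = improve (suc (Φ τ₀)) τ₀ ≤-refl F₀ (λ _ _ → refl)

    module Peeling {τ} (can : Canon τ) (t : ℕ) (U : ℕ → ℕ)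
      (U-open : ∀ x → x < n → U x ≢ 0 → C x ≡ false × (∀ {a} → a ≺ x → τ a < t) × (∀ {b} → x ≺ b → t ≤ τ b)) where

      open Canon can

      private
        D = state τ t

      done⇒ : ∀ {x} → x < n → (D ∋ x) ≡ true → τ x < t
      done⇒ {x} x< e = does-yes (τ x <? t) (trans (sym (∋-state τ t x x<)) e)

      undone⇒ : ∀ {x} → x < n → (D ∋ x) ≡ false → t ≤ τ x
      undone⇒ {x} x< e = ≮⇒≥ (does-no (τ x <? t) (trans (sym (∋-state τ t x x<)) e))

      feat-P : ∀ x₀ → x₀ < n → U x₀ ≢ 0 → (∀ y → y < n → U y ≢ 0 → rel y ≤ rel x₀) →
               ∃[ c ] c < 2 + n × (∀ x → x < n → U x ≢ 0 → (PF c x → rel x ≡ rel x₀) × (rel x ≡ rel x₀ → PF c x))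
      feat-P x₀ x₀< Ux₀ max with rel-attained x₀
      ... | inj₁ z = n , n≤1+n _ , λ x x< Ux → (λ _ → ≤-antisym (max x x< Ux) (subst (_≤ rel x) (sym z) z≤n)) , λ _ → inj₁ refl
      ... | inj₂ (c , c≺x₀ , e) = c , m≤n⇒m≤1+n (m≤n⇒m≤1+n c<) , λ x x< Ux → to x x< Ux , from x
        where
        c< = proj₁ (≺-bound c≺x₀)
        to : ∀ x → x < n → U x ≢ 0 → PF c x → rel x ≡ rel x₀
        to x x< Ux (inj₁ refl) = contradiction c< (<-irrefl refl)
        to x x< Ux (inj₂ c≺x)  = ≤-antisym (max x x< Ux) (subst (_≤ rel x) (sym e) (rel-≥ c≺x))
        from : ∀ x → rel x ≡ rel x₀ → PF c x
        from x r≡ with rel-attained x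
        ... | inj₁ z = contradiction (trans (sym z) (trans r≡ e)) λ ()
        ... | inj₂ (c₂ , c₂≺x , e₂) with pos-inj (proj₁ (≺-bound c₂≺x)) c< (suc-injective (trans (sym e₂) (trans r≡ e)))
        ...   | refl = inj₂ c₂≺x

      feat-S : ∀ y₀ → y₀ < n → U y₀ ≢ 0 → (∀ y → y < n → U y ≢ 0 → dl y₀ ≤ dl y) →
               ∃[ c ] c < 2 + n × (∀ x → x < n → U x ≢ 0 → (SF c x → dl x ≡ dl y₀) × (dl x ≡ dl y₀ → SF c x))
      feat-S y₀ y₀< Uy₀ min with dl-attained y₀
      ... | inj₁ z = n , n≤1+n _ , λ x x< Ux → (λ _ → ≤-antisym (subst (dl x ≤_) (sym z) (dl≤B x)) (min x x< Ux)) , λ _ → inj₁ refl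
      ... | inj₂ (c , y₀≺c , e) = c , m≤n⇒m≤1+n (m≤n⇒m≤1+n c<) , λ x x< Ux → to x x< Ux , from x
        where
        c< = proj₂ (≺-bound y₀≺c)
        to : ∀ x → x < n → U x ≢ 0 → SF c x → dl x ≡ dl y₀
        to x x< Ux (inj₁ refl) = contradiction c< (<-irrefl refl)
        to x x< Ux (inj₂ x≺c)  = ≤-antisym (subst (dl x ≤_) (sym e) (dl-≤ x≺c)) (min x x< Ux)
        from : ∀ x → dl x ≡ dl y₀ → SF c x
        from x d≡ with dl-attained x
        ... | inj₁ z = contradiction (trans (sym e) (trans (sym d≡) z)) (<⇒≢ (pos< c<))
        ... | inj₂ (c₂ , x≺c₂ , e₂) with pos-inj (proj₂ (≺-bound x≺c₂)) c< (trans (sym e₂) (trans d≡ e))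
        ...   | refl = inj₂ x≺c₂

      null-P : ∀ {x} → ¬ PF (suc n) x
      null-P (inj₁ e) = 1+n≢n e
      null-P (inj₂ l) = contradiction (proj₁ (≺-bound l)) (≤⇒≯ (n≤1+n n))

      null-S : ∀ {x} → ¬ SF (suc n) x
      null-S (inj₁ e) = 1+n≢n e
      null-S (inj₂ l) = contradiction (proj₂ (≺-bound l)) (≤⇒≯ (n≤1+n n))

      -- A job with the latest release in U that is done, and one with the
      -- earliest deadline that is not, could be swapped.
      exchange : ∀ x₀ y₀ → (∀ y → y < n → U y ≢ 0 → rel y ≤ rel x₀) → (∀ y → y < n → U y ≢ 0 → dl y₀ ≤ dl y) →
        ∀ v u → v < n → u < n → U v ≢ 0 → U u ≢ 0 → (D ∋ v) ≡ true → (D ∋ u) ≡ false →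
        rel v ≡ rel x₀ → dl u ≡ dl y₀ → dl v ≡ dl y₀ × rel u ≡ rel x₀ × v < u
      exchange x₀ y₀ max min v u v< u< Uv Uu Dv Du rv du
        with U-open v v< Uv | U-open u u< Uu
      ... | ¬Cv , v-rel , v-dl | ¬Cu , u-rel , u-dl = answer
        where
        τv<t = done⇒ v< Dv
        t≤τu = undone⇒ u< Du
        τv<τu = <-≤-trans τv<t t≤τu
        before-u : ∀ {a} → a < n → a ≺ u → τ a < τ v
        before-u {a} a< a≺u with rel-attained v
        ... | inj₁ z = contradiction (≤-trans (rel-≥ a≺u) (≤-trans (max u u< Uu) (≤-reflexive (trans (sym rv) z)))) λ ()
        ... | inj₂ (c , c≺v , e) = ≤-<-trans (subst₂ _≤_ (sym (agrees a (C-start a≺u ¬Cu))) (sym (agrees c (C-start c≺v ¬Cv)))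
                 (pos-≤ a< (proj₁ (≺-bound c≺v)) (s≤s⁻¹ (≤-trans (rel-≥ a≺u) (≤-trans (max u u< Uu) (≤-reflexive (trans (sym rv) e)))))))
               (order feasible c≺v)
        after-v : ∀ {b} → b < n → v ≺ b → τ u < τ b
        after-v {b} b< v≺b with dl-attained u
        ... | inj₁ z = contradiction (≤-<-trans (≤-trans (≤-reflexive (trans (sym z) du)) (≤-trans (min v v< Uv) (dl-≤ v≺b))) (pos< b<)) (<-irrefl refl)
        ... | inj₂ (c , u≺c , e) = <-≤-trans (order feasible u≺c)
               (subst₂ _≤_ (sym (agrees c (C-end u≺c ¬Cu))) (sym (agrees b (C-end v≺b ¬Cv)))
                 (pos-≤ (proj₂ (≺-bound u≺c)) b< (≤-trans (≤-reflexive (trans (sym e) du)) (≤-trans (min v v< Uv) (dl-≤ v≺b)))))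
        κv≤κu : κ v ≤ κ u
        κv≤κu = ≮⇒≥ λ κu<κv → no-bad u< v< (¬Cu , ¬Cv , τv<τu , κu<κv , before-u , after-v)
        answer : dl v ≡ dl y₀ × rel u ≡ rel x₀ × v < u
        answer with κ-lex v< u< κv≤κu
        ... | d≤ , k = dv , ru , ≤∧≢⇒< (proj₂ r≤ (trans rv (sym ru))) (λ { refl → <-irrefl refl τv<τu })
          where
          dv : dl v ≡ dl y₀
          dv = ≤-antisym (≤-trans d≤ (≤-reflexive du)) (min v v< Uv)
          r≤ = k (trans dv (sym du))
          ru : rel u ≡ rel x₀
          ru = ≤-antisym (max u u< Uu) (≤-trans (≤-reflexive (sym rv)) (proj₁ r≤))

      peelable-pair : (∃[ x ] x < n × U x ≢ 0) →
        ∃[ c ] ∃[ c′ ] c < 2 + n × c′ < 2 + n × Peelable D U c c′ × (∃[ x ] (x < n × U x ≢ 0 × (PF c x ⊎ SF c′ x)))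
      peelable-pair ne with extremal n U rel ne | extremal n U (λ x → B ∸ dl x) ne
      ... | x₀ , x₀< , Ux₀ , max | y₀ , y₀< , Uy₀ , min′ = cases
        where
        min : ∀ y → y < n → U y ≢ 0 → dl y₀ ≤ dl y
        min y y< Uy = ≮⇒≥ λ l → <⇒≱ (∸-monoʳ-< l (dl≤B y₀)) (min′ y y< Uy)
        P = feat-P x₀ x₀< Ux₀ max
        S = feat-S y₀ y₀< Uy₀ min
        c = proj₁ P
        c′ = proj₁ S
        pf : ∀ x → x < n → U x ≢ 0 → PF c x → rel x ≡ rel x₀
        pf x x< Ux = proj₁ (proj₂ (proj₂ P) x x< Ux)
        fp : ∀ x → x < n → U x ≢ 0 → rel x ≡ rel x₀ → PF c x
        fp x x< Ux = proj₂ (proj₂ (proj₂ P) x x< Ux)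
        sf : ∀ x → x < n → U x ≢ 0 → SF c′ x → dl x ≡ dl y₀
        sf x x< Ux = proj₁ (proj₂ (proj₂ S) x x< Ux)
        fs : ∀ x → x < n → U x ≢ 0 → dl x ≡ dl y₀ → SF c′ x
        fs x x< Ux = proj₂ (proj₂ (proj₂ S) x x< Ux)
        late? : Dec (∃[ v ] v < n × (U v ≢ 0 × (D ∋ v) ≡ true × rel v ≡ rel x₀))
        late? = anyUpTo? (λ v → ¬? (U v ≟ 0) ×-dec ((D ∋ v) Data.Bool.≟ true) ×-dec (rel v ≟ rel x₀)) n
        urgent? : Dec (∃[ u ] u < n × (U u ≢ 0 × (D ∋ u) ≡ false × dl u ≡ dl y₀))
        urgent? = anyUpTo? (λ u → ¬? (U u ≟ 0) ×-dec ((D ∋ u) Data.Bool.≟ false) ×-dec (dl u ≟ dl y₀)) n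
        cases : ∃[ c ] ∃[ c′ ] c < 2 + n × c′ < 2 + n × Peelable D U c c′ × (∃[ x ] (x < n × U x ≢ 0 × (PF c x ⊎ SF c′ x)))
        cases with late? | urgent?
        ... | no none | _ = c , suc n , proj₁ (proj₂ P) , ≤-refl ,
              ((λ v v< Uv Dv Pv → contradiction (v , v< , Uv , Dv , pf v v< Uv Pv) none) ,
               (λ u u< Uu Du Su → contradiction Su null-S) ,
               (λ v u v< u< Uv Dv Pv Uu Du Su → contradiction Su null-S)) ,
              x₀ , x₀< , Ux₀ , inj₁ (fp x₀ x₀< Ux₀ refl)
        ... | yes _ | no none = suc n , c′ , ≤-refl , proj₁ (proj₂ S) ,
              ((λ v v< Uv Dv Pv → contradiction Pv null-P) ,
               (λ u u< Uu Du Su → contradiction (u , u< , Uu , Du , sf u u< Uu Su) none) ,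
               (λ v u v< u< Uv Dv Pv → contradiction Pv null-P)) ,
              y₀ , y₀< , Uy₀ , inj₂ (fs y₀ y₀< Uy₀ refl)
        ... | yes (v₁ , v₁< , Uv₁ , Dv₁ , rv₁) | yes (u₁ , u₁< , Uu₁ , Du₁ , du₁) =
              c , c′ , proj₁ (proj₂ P) , proj₁ (proj₂ S) ,
              ((λ v v< Uv Dv Pv → fs v v< Uv (proj₁ (exchange x₀ y₀ max min v u₁ v< u₁< Uv Uu₁ Dv Du₁ (pf v v< Uv Pv) du₁))) ,
               (λ u u< Uu Du Su → fp u u< Uu (proj₁ (proj₂ (exchange x₀ y₀ max min v₁ u v₁< u< Uv₁ Uu Dv₁ Du rv₁ (sf u u< Uu Su))))) ,
               (λ v u v< u< Uv Dv Pv Uu Du Su → proj₂ (proj₂ (exchange x₀ y₀ max min v u v< u< Uv Uu Dv Du (pf v v< Uv Pv) (sf u u< Uu Su))))) ,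
              x₀ , x₀< , Ux₀ , inj₁ (fp x₀ x₀< Ux₀ refl)

-- Feature vectors of jobs

module Family
  (n : ℕ) (_≺_ : ℕ → ℕ → Set) (≺? : ∀ u v → Dec (u ≺ v))
  (≺-bound : ∀ {u v} → u ≺ v → u < n × v < n) (C : ℕ → Bool) where

  pf sf : ℕ → ℕ → Bool
  pf c x = does (c ≟ n) ∨ does (≺? c x)
  sf c x = does (c ≟ n) ∨ does (≺? x c)

  -- The jobs in C are labelled first.
  key : ℕ → ℕ
  key x = if C x then x else n + x

  key-C : ∀ {x} → C x ≡ true → key x ≡ x
  key-C Cx = cong (if_then _ else _) Cx

  key-¬C : ∀ {x} → C x ≡ false → key x ≡ n + x
  key-¬C ¬Cx = cong (if_then _ else _) ¬Cx

  record Alive (g D x : ℕ) : Set where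
    field
      outside  : C x ≡ false
      labelled : key x < g
      released : ∀ {a} → a ≺ x → (D ∋ a) ≡ true
      open-end : ∀ {b} → x ≺ b → (D ∋ b) ≡ false
  open Alive public

  record Consistent (g D : ℕ) (α : ℕ → ℤ) : Set where
    field
      support : ∀ x → x < n → α x ≢ 0ℤ → Alive g D x
      pos-in  : ∀ x → x < n → 0ℤ <ℤ α x → (D ∋ x) ≡ true
      neg-out : ∀ x → x < n → α x <ℤ 0ℤ → (D ∋ x) ≡ false
      sum-p   : ∀ c → Σℤ n (λ x → b2z (pf c x) *ℤ α x) ≡ 0ℤ
      sum-s   : ∀ c → Σℤ n (λ x → b2z (sf c x) *ℤ α x) ≡ 0ℤ
      sum-px  : ∀ c → Σℤ n (λ x → b2z (pf c x) *ℤ int x *ℤ α x) ≡ 0ℤ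

  record Good (md : Bool) (g D : ℕ) : Set where
    field
      unlabelled : ∀ x → x < n → g ≤ key x → (D ∋ x) ≡ false
      closed     : ∀ {u v} → u ≺ v → key u < g → key v < g → (D ∋ v) ≡ true → (D ∋ u) ≡ true
      unstuck    : md ≡ true → ∀ α → Consistent g D α → ∀ x → x < n → α x ≡ 0ℤ

  module Cover (cover : ∀ {u v} → u ≺ v → C u ∨ C v ≡ true) where

    C-pred : ∀ {a b} → a ≺ b → C b ≡ false → C a ≡ true
    C-pred {a} {b} a≺b ¬Cb with C a | cover a≺b
    ... | true  | _ = refl
    ... | false | e = contradiction (trans (sym e) ¬Cb) λ ()

    C-succ : ∀ {a b} → a ≺ b → C a ≡ false → C b ≡ true
    C-succ a≺b ¬Ca = trans (sym (cong (_∨ C _) ¬Ca)) (cover a≺b)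

    rows : ℕ → List (ℕ → ℤ)
    rows zero    = (λ x → 1ℤ) ∷ (λ x → int x) ∷ []
    rows (suc c) = if C c
      then (λ x → b2z (pf c x)) ∷ (λ x → b2z (sf c x)) ∷ (λ x → b2z (pf c x) *ℤ int x) ∷ rows c
      else rows c

    length-rows : ∀ c → length (rows c) ≡ 3 * card c C + 2
    length-rows zero = refl
    length-rows (suc c) with C c
    ... | true  = trans (cong (λ z → 3 + z) (length-rows c)) (trans (sym (+-assoc 3 (3 * card c C) 2))
                    (cong (_+ 2) (sym (trans (*-distribˡ-+ 3 (card c C) 1) (+-comm (3 * card c C) 3)))))
    ... | false = trans (length-rows c) (cong (λ z → 3 * z + 2) (sym (+-identityʳ (card c C))))

    module _ (α : ℕ → ℤ) where

      Ortho : (ℕ → ℤ) → Set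
      Ortho r = Σℤ n (λ x → r x *ℤ α x) ≡ 0ℤ

      universal-row : ∀ c → All Ortho (rows c) → Ortho (λ _ → 1ℤ) × Ortho (λ x → int x)
      universal-row zero (p ∷ q ∷ []) = p , q
      universal-row (suc c) a with C c | a
      ... | true  | _ ∷ _ ∷ _ ∷ as = universal-row c as
      ... | false | as             = universal-row c as

      feature-rows : ∀ k → All Ortho (rows k) → ∀ c → c < k → C c ≡ true →
                     Ortho (λ x → b2z (pf c x)) × Ortho (λ x → b2z (sf c x)) × Ortho (λ x → b2z (pf c x) *ℤ int x)
      feature-rows (suc k) a c c< Cc with c ≟ k
      feature-rows (suc k) a c c< Cc | yes refl with C c | a | Cc
      ... | true | p ∷ q ∷ r ∷ _ | _ = p , q , r
      feature-rows (suc k) a c c< Cc | no c≢k with C k | a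
      ... | true  | _ ∷ _ ∷ _ ∷ as = feature-rows k as c (≤∧≢⇒< (s≤s⁻¹ c<) c≢k) Cc
      ... | false | as             = feature-rows k as c (≤∧≢⇒< (s≤s⁻¹ c<) c≢k) Cc

      -- Only the features in C and the universal one are not constantly 0
      -- on the jobs outside C.
      all-features : (∀ x → x < n → α x ≢ 0ℤ → C x ≡ false) → All Ortho (rows n) → ∀ c →
                     Ortho (λ x → b2z (pf c x)) × Ortho (λ x → b2z (sf c x)) × Ortho (λ x → b2z (pf c x) *ℤ int x)
      all-features supp a c = go (c ≟ n) (c <? n) (C c) refl
        where
        Rows : Bool → Set
        Rows b = Ortho (λ x → b2z (b ∨ does (≺? c x))) × Ortho (λ x → b2z (b ∨ does (≺? x c))) × Ortho (λ x → b2z (b ∨ does (≺? c x)) *ℤ int x)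
        u = universal-row n a
        go : Dec (c ≡ n) → Dec (c < n) → ∀ b → C c ≡ b → Rows (does (c ≟ n))
        go (yes e) _ _ _ = subst Rows (sym (dec-true (c ≟ n) e))
          (proj₁ u , proj₁ u , trans (Σℤ-cong n (λ x _ → cong (_*ℤ α x) (ℤ.*-identityˡ (int x)))) (proj₂ u))
        go (no c≢n) (no c≮n) _ _ = subst Rows (sym (dec-false (c ≟ n) c≢n))
          ( Σℤ-0 n (λ x x< → cong (λ b → b2z b *ℤ α x) (dec-false (≺? c x) (λ l → c≮n (proj₁ (≺-bound l)))))
          , Σℤ-0 n (λ x x< → cong (λ b → b2z b *ℤ α x) (dec-false (≺? x c) (λ l → c≮n (proj₂ (≺-bound l)))))
          , Σℤ-0 n (λ x x< → cong (λ b → b2z b *ℤ int x *ℤ α x) (dec-false (≺? c x) (λ l → c≮n (proj₁ (≺-bound l))))))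
        go (no c≢n) (yes c<n) true Cc = feature-rows n a c c<n Cc
        go (no c≢n) (yes c<n) false Cc = subst Rows (sym (dec-false (c ≟ n) c≢n))
          ( Σℤ-0 n (zero′ (λ x → b2z (does (≺? c x))) (λ x e → cong b2z (dec-false (≺? c x) e)) no-p)
          , Σℤ-0 n (zero′ (λ x → b2z (does (≺? x c))) (λ x e → cong b2z (dec-false (≺? x c) e)) no-s)
          , Σℤ-0 n (zero′ (λ x → b2z (does (≺? c x)) *ℤ int x) (λ x e → cong (λ b → b2z b *ℤ int x) (dec-false (≺? c x) e)) no-p))
          where
          no-p : ∀ x → C x ≡ false → ¬ (c ≺ x)
          no-p x ¬Cx l = contradiction (trans (sym (C-pred l ¬Cx)) Cc) λ ()
          no-s : ∀ x → C x ≡ false → ¬ (x ≺ c)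
          no-s x ¬Cx l = contradiction (trans (sym (C-succ l ¬Cx)) Cc) λ ()
          zero′ : ∀ {P : ℕ → Set} (r : ℕ → ℤ) → (∀ x → ¬ P x → r x ≡ 0ℤ) → (∀ x → C x ≡ false → ¬ P x) →
                  ∀ x → x < n → r x *ℤ α x ≡ 0ℤ
          zero′ r r0 none x x< with α x ℤ.≟ 0ℤ
          ... | yes z = trans (cong (r x *ℤ_) z) (ℤ.*-zeroʳ (r x))
          ... | no nz = cong (_*ℤ α x) (r0 x (none x (supp x x< nz)))

    positive : ℤ → Bool
    positive (int (suc _)) = true
    positive _         = false

    positive⇒ : ∀ {a} → 0ℤ <ℤ a → positive a ≡ true
    positive⇒ {int (suc _)} (+<+ _) = refl

    negative⇒ : ∀ {a} → a <ℤ 0ℤ → positive a ≡ false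
    negative⇒ { -[1+ _ ]} _ = refl
    negative⇒ {int _} (+<+ ())

    no-shatter : ∀ g (F : ℕ → ℕ) → (∀ D → D < 2 ^ n → F D ≢ 0 → Good true g D) → NoShatter n F C (3 * card n C + 2)
    no-shatter g F good S S∩C d< γ with anyUpTo? dead? n
      where
      LabelledAlive : ℕ → Set
      LabelledAlive x = key x < g × (∀ {a} → a < n → a ≺ x → γ a ≡ true) × (∀ {b} → b < n → x ≺ b → γ b ≡ false)
      alive? : ∀ x → Dec (LabelledAlive x)
      alive? x = (key x <? g) ×-dec allUpTo? (λ a → ≺? a x →-dec (γ a Data.Bool.≟ true)) n
                              ×-dec allUpTo? (λ b → ≺? x b →-dec (γ b Data.Bool.≟ false)) n
      dead? : ∀ x → Dec (S x ≡ true × ¬ LabelledAlive x)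
      dead? x = (S x Data.Bool.≟ true) ×-dec ¬? (alive? x)
    ... | yes (x , x< , Sx , dead) = refute (key x <? g)
      where
      ¬Cx = S∩C x Sx
      keep : ∀ b y → C y ≡ true → (γ [ x ↦ᵇ b ]) y ≡ γ y
      keep b y Cy = updᵇ-diff γ x b y λ { refl → contradiction (trans (sym Cy) ¬Cx) λ () }
      Result = Σ[ h ∈ (ℕ → Bool) ] (∀ y → C y ≡ true → h y ≡ γ y) ×
               (∀ D → D < 2 ^ n → F D ≢ 0 → ¬ (∀ y → y < n → C y ∨ S y ≡ true → (D ∋ y) ≡ h y))
      in-S : C x ∨ S x ≡ true
      in-S = cong₂ _∨_ ¬Cx Sx
      in-C : ∀ {y} → C y ≡ true → C y ∨ S y ≡ true
      in-C Cy = cong (_∨ S _) Cy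
      at : ∀ b {D} → (∀ y → y < n → C y ∨ S y ≡ true → (D ∋ y) ≡ (γ [ x ↦ᵇ b ]) y) → (D ∋ x) ≡ b
      at b agree = trans (agree x x< in-S) (updᵇ-same γ x b)
      at-C : ∀ b {D y} → (∀ y → y < n → C y ∨ S y ≡ true → (D ∋ y) ≡ (γ [ x ↦ᵇ b ]) y) → y < n → C y ≡ true → (D ∋ y) ≡ γ y
      at-C b {y = y} agree y< Cy = trans (agree y y< (in-C Cy)) (keep b y Cy)
      key< : ∀ {y} → y < n → C y ≡ true → key x < g → key y < g
      key< {y} y< Cy kx = <-trans (subst₂ _<_ (sym (key-C Cy)) (sym (key-¬C ¬Cx)) (≤-trans y< (m≤m+n n x))) kx
      refute : Dec (key x < g) → Result
      refute (no k≮g) = (γ [ x ↦ᵇ true ]) , keep true , λ D D< FD agree →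
        contradiction (trans (sym (at true agree)) (Good.unlabelled (good D D< FD) x x< (≮⇒≥ k≮g))) λ ()
      refute (yes k<g) with anyUpTo? (λ a → ≺? a x ×-dec (γ a Data.Bool.≟ false)) n | anyUpTo? (λ b → ≺? x b ×-dec (γ b Data.Bool.≟ true)) n
      ... | yes (a , a< , a≺x , γa) | _ = (γ [ x ↦ᵇ true ]) , keep true , λ D D< FD agree →
        contradiction (trans (sym (trans (at-C true agree a< (C-pred a≺x ¬Cx)) γa))
          (Good.closed (good D D< FD) a≺x (key< a< (C-pred a≺x ¬Cx) k<g) k<g (at true agree))) λ ()
      ... | no _ | yes (b , b< , x≺b , γb) = (γ [ x ↦ᵇ false ]) , keep false , λ D D< FD agree →
        contradiction (trans (sym (at false agree)) (Good.closed (good D D< FD) x≺b k<g (key< b< (C-succ x≺b ¬Cx) k<g)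
          (trans (at-C false agree b< (C-succ x≺b ¬Cx)) γb))) λ ()
      ... | no no-a | no no-b = contradiction (k<g , (λ {a} a< l → flip′ (γ a) λ e → no-a (a , a< , l , e)) ,
                                  (λ {b} b< l → flip″ (γ b) λ e → no-b (b , b< , l , e))) dead
        where
        flip′ : ∀ b → b ≢ false → b ≡ true
        flip′ true  _ = refl
        flip′ false k = contradiction refl k
        flip″ : ∀ b → b ≢ true → b ≡ false
        flip″ false _ = refl
        flip″ true  k = contradiction refl k
    ... | no all-alive with relation n _ (rows n) S refl (subst (_< card n S) (sym (length-rows n)) d<)
    ...   | α , supp , (z , z< , αz) , ortho = h , keep , refute
      where
      h : ℕ → Bool
      h x = if C x then γ x else positive (α x)
      keep : ∀ x → C x ≡ true → h x ≡ γ x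
      keep x Cx = cong (if_then γ x else positive (α x)) Cx
      in-S : ∀ {x} → α x ≢ 0ℤ → S x ≡ true
      in-S {x} αx with S x in Sx
      ... | true  = refl
      ... | false = contradiction (supp x Sx) αx
      refute : ∀ D → D < 2 ^ n → F D ≢ 0 → ¬ (∀ y → y < n → C y ∨ S y ≡ true → (D ∋ y) ≡ h y)
      refute D D< FD agree = αz (Good.unstuck (good D D< FD) refl α consistent z z<)
        where
        label : ∀ x → x < n → α x ≢ 0ℤ → (D ∋ x) ≡ positive (α x)
        label x x< αx = trans (agree x x< (cong₂ _∨_ ¬Cx (in-S αx))) (cong (if_then γ x else positive (α x)) ¬Cx)
          where ¬Cx = S∩C x (in-S αx)
        on-C : ∀ {y} → y < n → C y ≡ true → (D ∋ y) ≡ γ y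
        on-C {y} y< Cy = trans (agree y y< (cong (_∨ S y) Cy)) (keep y Cy)
        alive : ∀ x → x < n → α x ≢ 0ℤ → Alive g D x
        alive x x< αx with key x <? g | S∩C x (in-S αx)
        ... | k? | ¬Cx = record
          { outside = ¬Cx
          ; labelled = byContra k? (λ k≮g → all-alive (x , x< , in-S αx , λ l → k≮g (proj₁ l)))
          ; released = λ {a} a≺x → trans (on-C (proj₁ (≺-bound a≺x)) (C-pred a≺x ¬Cx))
                         (byContra (γ a Data.Bool.≟ true) (λ ne → all-alive (x , x< , in-S αx , λ l → ne (proj₁ (proj₂ l) (proj₁ (≺-bound a≺x)) a≺x))))
          ; open-end = λ {b} x≺b → trans (on-C (proj₂ (≺-bound x≺b)) (C-succ x≺b ¬Cx))
                         (byContra (γ b Data.Bool.≟ false) (λ ne → all-alive (x , x< , in-S αx , λ l → ne (proj₂ (proj₂ l) (proj₂ (≺-bound x≺b)) x≺b))))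
          }
          where
          byContra : ∀ {P : Set} → Dec P → ¬ ¬ P → P
          byContra (yes p) _ = p
          byContra (no ¬p) k = contradiction ¬p k
        feats = all-features α (λ x x< αx → S∩C x (in-S αx)) ortho
        consistent : Consistent g D α
        consistent = record
          { support = alive
          ; pos-in  = λ x x< l → trans (label x x< (λ e → ℤ.<-irrefl (sym e) l)) (positive⇒ l)
          ; neg-out = λ x x< l → trans (label x x< (λ e → ℤ.<-irrefl e l)) (negative⇒ l)
          ; sum-p   = λ c → proj₁ (feats c)
          ; sum-s   = λ c → proj₁ (proj₂ (feats c))
          ; sum-px  = λ c → proj₂ (proj₂ (feats c))
          }

-- A language of bounded loops and its compilation to the word RAM

Store : Set
Store = ℕ → ℕ → ℕ → ℕ

put-at : Store → ℕ → ℕ → ℕ → ℕ → Store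
put-at st a i j x a′ i′ j′ =
  if (a ≡ᵇ a′) ∧ (does (i ≟ i′) ∧ does (j ≟ j′)) then x else st a′ i′ j′

put-hit : ∀ st a i j x → put-at st a i j x a i j ≡ x
put-hit st a i j x
  with a ≡ᵇ a | ≡⇒≡ᵇ a a refl | i ≡ᵇ i | ≡⇒≡ᵇ i i refl | j ≡ᵇ j | ≡⇒≡ᵇ j j refl
... | true | _ | true | _ | true | _ = refl

put-miss : ∀ st a i j x a′ i′ j′ → (a ≡ a′ → i ≡ i′ → j ≢ j′) →
           put-at st a i j x a′ i′ j′ ≡ st a′ i′ j′
put-miss st a i j x a′ i′ j′ ne
  with a ≡ᵇ a′ | ≡ᵇ⇒≡ a a′ | i ≡ᵇ i′ | ≡ᵇ⇒≡ i i′ | j ≡ᵇ j′ | ≡ᵇ⇒≡ j j′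
... | true  | p | true  | q | true  | r = contradiction (r tt) (ne (p tt) (q tt))
... | false | _ | _     | _ | _     | _ = refl
... | true  | _ | false | _ | _     | _ = refl
... | true  | _ | true  | _ | false | _ = refl

data Tm (Γ : ℕ) : Set where
  var   : Fin Γ → Tm Γ
  nn mm : Tm Γ
  num   : ℕ → Tm Γ
  adj   : Tm Γ → Tm Γ → Tm Γ
  arr   : ℕ → Tm Γ → Tm Γ → Tm Γ
  bin   : BinOp → Tm Γ → Tm Γ → Tm Γ
  cnt   : Tm (suc Γ) → Tm Γ

data Bound (Γ : ℕ) : Set where
  times : ℕ → ℕ → Bound Γ
  len   : ℕ → Tm Γ → Bound Γ

infixr 5 _∙_
data Cmd (Γ : ℕ) : Set where
  skp  : Cmd Γ
  put  : ℕ → Tm Γ → Tm Γ → Tm Γ → Cmd Γ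
  _∙_  : Cmd Γ → Cmd Γ → Cmd Γ
  iff  : Tm Γ → Cmd Γ → Cmd Γ → Cmd Γ
  for  : Bound Γ → Cmd (suc Γ) → Cmd Γ
  lett : Tm Γ → Cmd (suc Γ) → Cmd Γ

iter : ℕ → (ℕ → Store → Store) → Store → Store
iter zero    f st = st
iter (suc k) f st = f k (iter k f st)

module Semantics (n m : ℕ) (A : ℕ → ℕ → ℕ) where

  val : ∀ {Γ} → Tm Γ → Vec ℕ Γ → Store → ℕ
  val (var i)     ρ st = lookup ρ i
  val nn          ρ st = n
  val mm          ρ st = m
  val (num k)     ρ st = k
  val (adj s t)   ρ st = A (val s ρ st) (val t ρ st)
  val (arr a s t) ρ st = st a (val s ρ st) (val t ρ st)
  val (bin o s t) ρ st = ⟦ o ⟧ᵒ (val s ρ st) (val t ρ st)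
  val (cnt t)     ρ st = # n (λ i → val t (i ∷ ρ) st)

  bval : ∀ {Γ} → Bound Γ → Vec ℕ Γ → Store → ℕ
  bval (times a k) ρ st = n * a + k
  bval (len a t)   ρ st = st a (val t ρ st) 0

  choose : ℕ → Store → Store → Store
  choose zero    s t = t
  choose (suc _) s t = s

  run : ∀ {Γ} → Cmd Γ → Vec ℕ Γ → Store → Store
  run skp           ρ st = st
  run (put a i j t) ρ st = put-at st a (val i ρ st) (val j ρ st) (val t ρ st)
  run (c ∙ d)       ρ st = run d ρ (run c ρ st)
  run (iff t c d)   ρ st = choose (val t ρ st) (run c ρ st) (run d ρ st)
  run (for b c)     ρ st = iter (bval b ρ st) (λ i → run c (i ∷ ρ)) st
  run (lett t c)    ρ st = run c (val t ρ st ∷ ρ) st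

  -- E bounds the bit length of every stored or bound value, Λ a the
  -- lengths read from array a by the loops.
  module Safety (E : ℕ) (Λ : ℕ → ℕ) where

    SafeB : ∀ {Γ} → Bound Γ → Vec ℕ Γ → Store → Set
    SafeB (times a k) ρ st = n * a + k < 2 ^ E
    SafeB (len a t)   ρ st = st a (val t ρ st) 0 ≤ Λ a

    Safe : ∀ {Γ} → Cmd Γ → Vec ℕ Γ → Store → Set
    Safe skp           ρ st = ⊤
    Safe (put a i j t) ρ st = val t ρ st < 2 ^ E
    Safe (c ∙ d)       ρ st = Safe c ρ st × Safe d ρ (run c ρ st)
    Safe (iff t c d)   ρ st = (val t ρ st ≢ 0 → Safe c ρ st) × (val t ρ st ≡ 0 → Safe d ρ st)
    Safe (for b c)     ρ st = SafeB b ρ st ×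
      (∀ i → i < bval b ρ st → Safe c (i ∷ ρ) (iter i (λ i → run c (i ∷ ρ)) st))
    Safe (lett t c)    ρ st = val t ρ st < 2 ^ E × Safe c (val t ρ st ∷ ρ) st

-- An array cell is addressed by the injective pairing
-- (i , j) ↦ (i + j)² + i, applied twice, above the n² input cells.

pairᴱ : Expr → Expr → Expr
pairᴱ x y = op add (op mul (op add x y) (op add x y)) x

addrᴱ : ℕ → Expr → Expr → Expr
addrᴱ a x y = op add (op mul (reg 0) (reg 0)) (pairᴱ (pairᴱ x y) (lit a))

adjᴱ : ℕ → Expr
adjᴱ f = op mul (op mul (op lt (reg f) (reg 0)) (op lt (reg (suc f)) (reg 0)))
                (load (op add (op mul (reg 0) (reg f)) (reg (suc f))))

ct : ∀ {Γ} → Tm Γ → Vec ℕ Γ → ℕ → Program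
ct (var i)     ν f = f := reg (lookup ν i)
ct nn          ν f = f := reg 0
ct mm          ν f = f := reg 1
ct (num k)     ν f = f := lit k
ct (adj s t)   ν f = ct s ν f ⨟ ct t ν (1 + f) ⨟ f := adjᴱ f
ct (arr a s t) ν f = ct s ν f ⨟ ct t ν (1 + f) ⨟ f := load (addrᴱ a (reg f) (reg (1 + f)))
ct (bin o s t) ν f = ct s ν f ⨟ ct t ν (1 + f) ⨟ f := op o (reg f) (reg (1 + f))
ct (cnt t)     ν f =
  f := lit 0 ⨟ (1 + f) := lit 0 ⨟
  while (op lt (reg (1 + f)) (reg 0))
    (ct t (1 + f ∷ ν) (2 + f) ⨟ f := op add (reg f) (op lt (lit 0) (reg (2 + f))) ⨟
     (1 + f) := op add (reg (1 + f)) (lit 1))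

cb : ∀ {Γ} → Bound Γ → Vec ℕ Γ → ℕ → Program
cb (times a k) ν f = f := op add (op mul (reg 0) (lit a)) (lit k)
cb (len a t)   ν f = ct (arr a t (num 0)) ν f

cc : ∀ {Γ} → Cmd Γ → Vec ℕ Γ → ℕ → Program
cc skp           ν f = skip
cc (put a i j t) ν f = ct i ν f ⨟ ct j ν (1 + f) ⨟ ct t ν (2 + f) ⨟
                       store (addrᴱ a (reg f) (reg (1 + f))) (reg (2 + f))
cc (c ∙ d)       ν f = cc c ν f ⨟ cc d ν f
cc (iff t c d)   ν f = ct t ν f ⨟ ifte (reg f) (cc c ν f) (cc d ν f)
cc (for b c)     ν f = cb b ν (1 + f) ⨟ f := lit 0 ⨟
                       while (op lt (reg f) (reg (1 + f)))
                         (cc c (f ∷ ν) (2 + f) ⨟ f := op add (reg f) (lit 1))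
cc (lett t c)    ν f = ct t ν f ⨟ cc c (f ∷ ν) (1 + f)

-- A value of size s has at most E * s bits if its inputs have E bits.

bs : Expr → ℕ
bs (lit k)    = suc k
bs (reg r)    = 1
bs (load e)   = suc (bs e)
bs (op o e f) = suc (bs e + bs f)

sz : ∀ {Γ} → Tm Γ → ℕ
sz (var i)     = 1
sz nn          = 1
sz mm          = 1
sz (num k)     = suc k
sz (adj s t)   = (sz s + sz t) * bs (adjᴱ 0)
sz (arr a s t) = (sz s + sz t) * bs (load (addrᴱ a (reg 0) (reg 1)))
sz (bin o s t) = (sz s + sz t) * 3
sz (cnt t)     = sz t * 6

szᶜ : ∀ {Γ} → Cmd Γ → ℕ
szᶜ skp           = 1
szᶜ (put a i j t) = (sz i + sz j + sz t) * bs (addrᴱ a (reg 0) (reg 1))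
szᶜ (c ∙ d)       = szᶜ c + szᶜ d
szᶜ (iff t c d)   = sz t + (szᶜ c + szᶜ d)
szᶜ (for (times a k) c) = suc (suc (suc (suc a)) + suc k) + (szᶜ c + 4)
szᶜ (for (len a t) c)   = sz (arr a t (num 0)) + (szᶜ c + 4)
szᶜ (lett t c)    = sz t + szᶜ c

module Cost (n : ℕ) (Λ : ℕ → ℕ) where

  tc : ∀ {Γ} → Tm Γ → ℕ
  tc (adj s t)   = tc s + (tc t + suc (cost (adjᴱ 0)))
  tc (arr a s t) = tc s + (tc t + suc (cost (load (addrᴱ a (reg 0) (reg 1)))))
  tc (bin o s t) = tc s + (tc t + 4)
  tc (cnt t)     = 8 + n * (tc t + 14)
  tc _           = 2

  bc : ∀ {Γ} → Bound Γ → ℕ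
  bc (times a k) = 6
  bc (len a t)   = tc (arr a t (num 0))

  bn : ∀ {Γ} → Bound Γ → ℕ
  bn (times a k) = n * a + k
  bn (len a t)   = Λ a

  time : ∀ {Γ} → Cmd Γ → ℕ
  time skp           = 1
  time (put a i j t) = tc i + (tc j + (tc t + suc (cost (addrᴱ a (reg 0) (reg 1)) + 1)))
  time (c ∙ d)       = time c + time d
  time (iff t c d)   = tc t + (2 + (time c + time d))
  time (for b c)     = bc b + (6 + bn b * (time c + 8))
  time (lett t c)    = tc t + time c

n<2^n : ∀ n → n < 2 ^ n
n<2^n zero    = s≤s z≤n
n<2^n (suc n) = begin-strict
  suc n         ≤⟨ n<2^n n ⟩
  2 ^ n         <⟨ m<m+n (2 ^ n) (m^n>0 2 n) ⟩
  2 ^ n + 2 ^ n ≡⟨ cong (2 ^ n +_) (+-identityʳ (2 ^ n)) ⟨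
  2 ^ suc n     ∎ where open ≤-Reasoning

<2^-mono : ∀ {x p q} → x < 2 ^ p → p ≤ q → x < 2 ^ q
<2^-mono x< p≤q = <-≤-trans x< (^-monoʳ-≤ 2 p≤q)

bit≤1 : ∀ b → bit b ≤ 1
bit≤1 true  = ≤-refl
bit≤1 false = z≤n

op-bound : ∀ o {x y} p q → x < 2 ^ p → y < 2 ^ q → ⟦ o ⟧ᵒ x y < 2 ^ suc (p + q)
op-bound o {x} {y} p q x< y< = go o
  where
  left : ∀ {z} → z ≤ x → z < 2 ^ suc (p + q)
  left z≤ = <2^-mono (≤-<-trans z≤ x<) (≤-trans (m≤m+n p q) (n≤1+n (p + q)))
  small : ∀ {z} → z ≤ 1 → z < 2 ^ suc (p + q)
  small z≤ = <2^-mono {p = 1} {q = suc (p + q)} (s≤s z≤) (s≤s z≤n)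
  go : ∀ o → ⟦ o ⟧ᵒ x y < 2 ^ suc (p + q)
  go add = begin-strict
    x + y                     <⟨ +-mono-< x< y< ⟩
    2 ^ p + 2 ^ q             ≤⟨ +-mono-≤ (^-monoʳ-≤ 2 (m≤m+n p q)) (^-monoʳ-≤ 2 (m≤n+m q p)) ⟩
    2 ^ (p + q) + 2 ^ (p + q) ≡⟨ cong (2 ^ (p + q) +_) (+-identityʳ (2 ^ (p + q))) ⟨
    2 ^ suc (p + q)           ∎ where open ≤-Reasoning
  go sub = left (m∸n≤m x y)
  go mul = begin-strict
    x * y            ≤⟨ *-monoʳ-≤ x (<⇒≤ y<) ⟩
    x * 2 ^ q        <⟨ *-monoˡ-< (2 ^ q) {{m^n≢0 2 q}} x< ⟩
    2 ^ p * 2 ^ q    ≡⟨ ^-distribˡ-+-* 2 p q ⟨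
    2 ^ (p + q)      ≤⟨ ^-monoʳ-≤ 2 (n≤1+n (p + q)) ⟩
    2 ^ suc (p + q)  ∎ where open ≤-Reasoning
  go div = left (div≤ y)
    where
    div≤ : ∀ y → ⟦ div ⟧ᵒ x y ≤ x
    div≤ zero    = z≤n
    div≤ (suc y) = m/n≤m x (suc y)
  go mod = left (mod≤ y)
    where
    mod≤ : ∀ y → ⟦ mod ⟧ᵒ x y ≤ x
    mod≤ zero    = ≤-refl
    mod≤ (suc y) = m%n≤m x (suc y)
  go lt = small (bit≤1 _)
  go eq = small (bit≤1 _)

ev : Expr → State → ℕ
ev (lit k)    σ = k
ev (reg r)    σ = regs σ r
ev (load e)   σ = mem σ (ev e σ)
ev (op o e f) σ = ⟦ o ⟧ᵒ (ev e σ) (ev f σ)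

RegsOK : Expr → State → ℕ → Set
RegsOK (lit k)    σ Q = ⊤
RegsOK (reg r)    σ Q = regs σ r < 2 ^ Q
RegsOK (load e)   σ Q = RegsOK e σ Q
RegsOK (op o e f) σ Q = RegsOK e σ Q × RegsOK f σ Q

wrap-id : ∀ w {x} → x < 2 ^ w → wrap w x ≡ x
wrap-id w x< = m<n⇒m%n≡m {{m^n≢0 2 w}} x<

eval-ev : ∀ w Q → 1 ≤ Q → ∀ e σ → (∀ x → mem σ x < 2 ^ Q) → RegsOK e σ Q → Q * bs e ≤ w →
          eval w e σ ≡ ev e σ × ev e σ < 2 ^ (Q * bs e)
eval-ev w Q 1≤Q (lit k) σ mB r q = wrap-id w (<2^-mono {p = Q * suc k} lt′ q) , lt′
  where
  lt′ : k < 2 ^ (Q * suc k)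
  lt′ = <2^-mono (n<2^n k) (≤-trans (n≤1+n k) (m≤n*m (suc k) Q {{>-nonZero 1≤Q}}))
eval-ev w Q 1≤Q (reg x) σ mB r q = refl , <2^-mono r (≤-reflexive (sym (*-identityʳ Q)))
eval-ev w Q 1≤Q (load e) σ mB r q with eval-ev w Q 1≤Q e σ mB r (≤-trans (*-monoʳ-≤ Q (n≤1+n _)) q)
... | e≡ , _ = cong (mem σ) e≡ , <2^-mono (mB _) (m≤m*n Q (suc (bs e)))
eval-ev w Q 1≤Q (op o e f) σ mB (re , rf) q
  with eval-ev w Q 1≤Q e σ mB re (≤-trans (*-monoʳ-≤ Q (≤-trans (m≤m+n _ (bs f)) (n≤1+n _))) q)
     | eval-ev w Q 1≤Q f σ mB rf (≤-trans (*-monoʳ-≤ Q (≤-trans (m≤n+m _ (bs e)) (n≤1+n _))) q)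
... | eq₁ , b₁ | eq₂ , b₂ =
  trans (cong₂ (λ x y → wrap w (⟦ o ⟧ᵒ x y)) eq₁ eq₂) (wrap-id w (<2^-mono b q)) , b
  where
  b : ⟦ o ⟧ᵒ (ev e σ) (ev f σ) < 2 ^ (Q * suc (bs e + bs f))
  b = <2^-mono (op-bound o (Q * bs e) (Q * bs f) b₁ b₂) (begin
        suc (Q * bs e + Q * bs f) ≡⟨ cong suc (*-distribˡ-+ Q (bs e) (bs f)) ⟨
        1 + Q * (bs e + bs f)     ≤⟨ +-monoˡ-≤ _ 1≤Q ⟩
        Q + Q * (bs e + bs f)     ≡⟨ *-suc Q (bs e + bs f) ⟨
        Q * suc (bs e + bs f)     ∎)
    where open ≤-Reasoning

pair : ℕ → ℕ → ℕ
pair x y = (x + y) * (x + y) + x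

pair-lt : ∀ {x y x′ y′} → x + y < x′ + y′ → pair x y < pair x′ y′
pair-lt {x} {y} {x′} {y′} l< = begin-strict
  (x + y) * (x + y) + x               <⟨ +-monoʳ-< ((x + y) * (x + y)) (s≤s (m≤m+n x y)) ⟩
  (x + y) * (x + y) + suc (x + y)     ≤⟨ +-monoˡ-≤ (suc (x + y)) (*-monoʳ-≤ (x + y) (n≤1+n (x + y))) ⟩
  (x + y) * suc (x + y) + suc (x + y) ≡⟨ +-comm _ (suc (x + y)) ⟩
  suc (x + y) * suc (x + y)           ≤⟨ *-mono-≤ l< l< ⟩
  (x′ + y′) * (x′ + y′)               ≤⟨ m≤m+n _ x′ ⟩
  pair x′ y′                          ∎ where open ≤-Reasoning

pair-inj : ∀ {x y x′ y′} → pair x y ≡ pair x′ y′ → x ≡ x′ × y ≡ y′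
pair-inj {x} {y} {x′} {y′} e≡ with <-cmp (x + y) (x′ + y′)
... | tri< l< _ _ = contradiction e≡ (<⇒≢ (pair-lt {x} {y} {x′} {y′} l<))
... | tri> _ _ gt = contradiction (sym e≡) (<⇒≢ (pair-lt {x′} {y′} {x} {y} gt))
... | tri≈ _ s _ = x≡ , +-cancelˡ-≡ x y y′ (trans s (cong (_+ y′) (sym x≡)))
  where
  x≡ : x ≡ x′
  x≡ = +-cancelˡ-≡ ((x + y) * (x + y)) x x′ (trans e≡ (cong (λ z → z * z + x′) (sym s)))

addr : ℕ → ℕ → ℕ → ℕ → ℕ
addr n a i j = n * n + pair (pair i j) a

addr-inj : ∀ n {a i j a′ i′ j′} → addr n a i j ≡ addr n a′ i′ j′ → a ≡ a′ × i ≡ i′ × j ≡ j′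
addr-inj n {a} {i} {j} {a′} {i′} {j′} e≡
  with pair-inj {pair i j} {a} {pair i′ j′} {a′} (+-cancelˡ-≡ (n * n) _ _ e≡)
... | ij , a≡ = a≡ , pair-inj {i} {j} {i′} {j′} ij

bit-< : ∀ {x y} → x < y → bit (does (x <? y)) ≡ 1
bit-< {x} {y} x<y with x <ᵇ y | <⇒<ᵇ x<y
... | true | _ = refl

bit-≮ : ∀ {x y} → y ≤ x → bit (does (x <? y)) ≡ 0
bit-≮ {x} {y} y≤x with x <ᵇ y | <ᵇ⇒< x y
... | true  | k = contradiction (k tt) (≤⇒≯ y≤x)
... | false | _ = refl

module Compiled
  (w n m : ℕ) (A : ℕ → ℕ → ℕ) (E : ℕ) (Λ : ℕ → ℕ)
  (1≤E : 1 ≤ E) (n<E : n < 2 ^ E) (m<E : m < 2 ^ E)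
  (A-out : ∀ u v → (n ≤ u ⊎ n ≤ v) → A u v ≡ 0) where

  open Semantics n m A
  open Safety E Λ
  open Cost n Λ

  record Holds (st : Store) (σ : State) : Set where
    field
      reg-n  : regs σ 0 ≡ n
      reg-m  : regs σ 1 ≡ m
      input  : ∀ u v → u < n → v < n → mem σ (n * u + v) ≡ A u v
      arrays : ∀ a i j → mem σ (addr n a i j) ≡ st a i j
      words  : ∀ x → mem σ x < 2 ^ E
  open Holds

  record Env {Γ} (ν ρ : Vec ℕ Γ) (f : ℕ) (σ : State) : Set where
    constructor env
    field at : ∀ i → lookup ν i < f × regs σ (lookup ν i) ≡ lookup ρ i × lookup ρ i < 2 ^ E

  frame-env : ∀ {Γ} {ν ρ : Vec ℕ Γ} {f σ σ′} → (∀ r → r < f → regs σ′ r ≡ regs σ r) →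
              Env ν ρ f σ → Env ν ρ f σ′
  frame-env {ν = ν} {ρ} {f} {σ} {σ′} fr (env e) = env go
    where
    go : ∀ i → lookup ν i < f × regs σ′ (lookup ν i) ≡ lookup ρ i × lookup ρ i < 2 ^ E
    go i with e i
    ... | l , e≡ , b = l , trans (fr _ l) e≡ , b

  weaken-env : ∀ {Γ} {ν ρ : Vec ℕ Γ} {f f′ σ} → f ≤ f′ → Env ν ρ f σ → Env ν ρ f′ σ
  weaken-env f≤ (env e) = env (λ i → <-≤-trans (proj₁ (e i)) f≤ , proj₂ (e i))

  cons-env : ∀ {Γ} {ν ρ : Vec ℕ Γ} {f f′ σ r x} → f ≤ f′ → r < f′ → regs σ r ≡ x → x < 2 ^ E →
             Env ν ρ f σ → Env (r ∷ ν) (x ∷ ρ) f′ σ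
  cons-env {ν = ν} {ρ} {f} {f′} {σ} {r} {x} f≤ r< e≡ b e = env go
    where
    go : ∀ i → lookup (r ∷ ν) i < f′ × regs σ (lookup (r ∷ ν) i) ≡ lookup (x ∷ ρ) i × lookup (x ∷ ρ) i < 2 ^ E
    go Fin.zero    = r< , e≡ , b
    go (Fin.suc i) = Env.at (weaken-env f≤ e) i

  frame-holds : ∀ {st σ σ′} f → 2 ≤ f → mem σ′ ≡ mem σ → (∀ r → r < f → regs σ′ r ≡ regs σ r) →
                Holds st σ → Holds st σ′
  frame-holds f 2≤f me fr h = record
    { reg-n  = trans (fr 0 (≤-trans (s≤s z≤n) 2≤f)) (reg-n h)
    ; reg-m  = trans (fr 1 2≤f) (reg-m h)
    ; input  = λ u v u< v< → trans (cong (λ M → M (n * u + v)) me) (input h u v u< v<)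
    ; arrays = λ a i j → trans (cong (λ M → M (addr n a i j)) me) (arrays h a i j)
    ; words  = λ x → subst (_< 2 ^ E) (cong (λ M → M x) (sym me)) (words h x)
    }

  record TmRun (p : Program) (f v T : ℕ) (σ : State) : Set where
    constructor tmrun
    field
      {σ′}   : State
      {s}    : ℕ
      exec   : w ⊢ p , σ ⇓[ s ] σ′
      s≤T    : s ≤ T
      mem≡   : mem σ′ ≡ mem σ
      frame  : ∀ r → r < f → regs σ′ r ≡ regs σ r
      result : regs σ′ f ≡ v

  assign-run : ∀ {f e v T σ} → eval w e σ ≡ v → suc (cost e) ≤ T → TmRun (f := e) f v T σ
  assign-run {f} {σ = σ} e≡ c≤ = tmrun assign⇓ c≤ refl
    (λ r r< → upd-diff (regs σ) f _ r (<⇒≢ r<)) (trans (upd-same (regs σ) f _) e≡)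

  _then-run_ : ∀ {p q f v v′ T T′ σ} (r : TmRun p f v T σ) →
               TmRun q f v′ T′ (TmRun.σ′ r) → TmRun (p ⨟ q) f v′ (T + T′) σ
  tmrun e c me fr _ then-run tmrun e′ c′ me′ fr′ res′ =
    tmrun (seq⇓ e e′) (+-mono-≤ c c′) (trans me′ me) (λ r r< → trans (fr′ r r<) (fr r r<)) res′

  lower : ∀ {p f v T σ} (r : TmRun p (suc f) v T σ) → TmRun p f (regs σ f) T σ
  lower (tmrun e c me fr _) = tmrun e c me (λ r r< → fr r (m≤n⇒m≤1+n r<)) (fr _ ≤-refl)

  sz≥1 : ∀ {Γ} (t : Tm Γ) → 1 ≤ sz t
  sz≥1 (var i)     = ≤-refl
  sz≥1 nn          = ≤-refl
  sz≥1 mm          = ≤-refl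
  sz≥1 (num k)     = s≤s z≤n
  sz≥1 (adj s t)   = *-mono-≤ {1} {_} {1} (≤-trans (sz≥1 s) (m≤m+n _ _)) (s≤s z≤n)
  sz≥1 (arr a s t) = *-mono-≤ {1} {_} {1} (≤-trans (sz≥1 s) (m≤m+n _ _)) (s≤s z≤n)
  sz≥1 (bin o s t) = *-mono-≤ {1} {_} {1} {3} (≤-trans (sz≥1 s) (m≤m+n _ _)) (s≤s z≤n)
  sz≥1 (cnt t)     = *-mono-≤ {1} {_} {1} {6} (sz≥1 t) (s≤s z≤n)

  E≤ : ∀ {x} → 1 ≤ x → E ≤ E * x
  E≤ {x} 1≤x = m≤m*n E x {{>-nonZero 1≤x}}

  A-bound : ∀ {st σ} → Holds st σ → ∀ u v → A u v < 2 ^ E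
  A-bound {σ = σ} h u v with u <? n | v <? n
  ... | yes u< | yes v< = subst (_< 2 ^ E) (input h u v u< v<) (words h _)
  ... | no u≮  | _      = subst (_< 2 ^ E) (sym (A-out u v (inj₁ (≮⇒≥ u≮)))) (m^n>0 2 E)
  ... | _      | no v≮  = subst (_< 2 ^ E) (sym (A-out u v (inj₂ (≮⇒≥ v≮)))) (m^n>0 2 E)

  val-bound : ∀ {Γ} (t : Tm Γ) {ν ρ : Vec ℕ Γ} {f st σ} → Holds st σ → Env ν ρ f σ →
              val t ρ st < 2 ^ (E * sz t)
  val-bound (var i) h en = <2^-mono (proj₂ (proj₂ (Env.at en i))) (E≤ ≤-refl)
  val-bound nn h en = <2^-mono n<E (E≤ ≤-refl)
  val-bound mm h en = <2^-mono m<E (E≤ ≤-refl)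
  val-bound (num k) h en =
    <2^-mono (n<2^n k) (≤-trans (n≤1+n k) (m≤n*m (suc k) E {{>-nonZero 1≤E}}))
  val-bound (adj s t) h en = <2^-mono (A-bound h _ _) (E≤ (sz≥1 (adj s t)))
  val-bound (arr a s t) {st = st} {σ} h en =
    <2^-mono (subst (_< 2 ^ E) (arrays h a _ _) (words h _)) (E≤ (sz≥1 (arr a s t)))
  val-bound (bin o s t) h en =
    <2^-mono (op-bound o (E * sz s) (E * sz t) (val-bound s h en) (val-bound t h en)) (begin
      suc (E * sz s + E * sz t)      ≡⟨ cong suc (*-distribˡ-+ E (sz s) (sz t)) ⟨
      1 + E * (sz s + sz t)          ≤⟨ +-monoˡ-≤ _ (*-mono-≤ 1≤E (≤-trans (sz≥1 s) (m≤m+n _ _))) ⟩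
      E * (sz s + sz t) + E * (sz s + sz t) ≤⟨ +-monoʳ-≤ (E * (sz s + sz t)) (m≤m+n (E * (sz s + sz t)) (E * (sz s + sz t))) ⟩
      E * (sz s + sz t) + (E * (sz s + sz t) + E * (sz s + sz t)) ≡⟨ three (E * (sz s + sz t)) ⟩
      E * (sz s + sz t) * 3          ≡⟨ *-assoc E _ 3 ⟩
      E * ((sz s + sz t) * 3)        ∎)
    where
    open ≤-Reasoning
    three : ∀ x → x + (x + x) ≡ x * 3
    three x = trans (cong (λ z → x + (x + z)) (sym (+-identityʳ x))) (*-comm 3 x)
  val-bound (cnt t) h en = <2^-mono (≤-<-trans (#≤ n _) n<E) (E≤ (sz≥1 (cnt t)))

  *-mono-size : ∀ {x y} → x ≤ y → E * y ≤ w → E * x ≤ w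
  *-mono-size x≤y = ≤-trans (*-monoʳ-≤ E x≤y)

  ind-bound : ∀ b {x} → x < 2 ^ E → E * 4 ≤ w → wrap w (x + bit b) ≡ x + bit b
  ind-bound b {x} x< 4≤w = wrap-id w (<2^-mono {p = suc (E + 1)}
    (op-bound add E 1 x< (s≤s (bit≤1 b)))
    (≤-trans (≤-trans (s≤s (+-monoʳ-≤ E 1≤E)) (≤-trans (+-monoˡ-≤ (E + E) 1≤E)
      (≤-trans (+-monoʳ-≤ E (+-monoʳ-≤ E (m≤m+n E E)))
        (≤-reflexive (trans (cong (λ z → E + (E + (E + z))) (sym (+-identityʳ E))) (*-comm 4 E)))))) 4≤w))

  eval-< : ∀ σ e₁ e₂ {x y} → eval w e₁ σ ≡ x → eval w e₂ σ ≡ y → E * 1 ≤ w →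
           eval w (op lt e₁ e₂) σ ≡ bit (does (x <? y))
  eval-< σ _ _ refl refl q = wrap-id w (<2^-mono {p = 1} (s≤s (bit≤1 _)) (≤-trans (*-mono-≤ {1} {E} {1} 1≤E ≤-refl) q))

  0<-sg : ∀ x → bit (does (0 <? x)) ≡ sg x
  0<-sg zero    = refl
  0<-sg (suc x) = refl

  lit-word : ∀ {k} → k ≤ 1 → E * 1 ≤ w → wrap w k ≡ k
  lit-word {k} k≤1 q = wrap-id w (<2^-mono {p = 1} (s≤s k≤1) (≤-trans (*-mono-≤ {1} {E} {1} 1≤E ≤-refl) q))

  guarded : ∀ f {st σ u v} → Holds st σ → regs σ f ≡ u → regs σ (suc f) ≡ v →
            ev (adjᴱ f) σ ≡ A u v
  guarded f {st} {σ} {u} {v} h refl refl rewrite reg-n h with u <? n | v <? n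
  ... | yes u< | yes v< rewrite bit-< u< | bit-< v< = trans (+-identityʳ _) (input h u v u< v<)
  ... | yes u< | no v≮  rewrite bit-< u< | bit-≮ (≮⇒≥ v≮) = sym (A-out u v (inj₂ (≮⇒≥ v≮)))
  ... | no u≮  | _      rewrite bit-≮ (≮⇒≥ u≮) = sym (A-out u v (inj₁ (≮⇒≥ u≮)))

  ev-addr : ∀ a {r r′ i j st σ} → Holds st σ → regs σ r ≡ i → regs σ r′ ≡ j →
            ev (addrᴱ a (reg r) (reg r′)) σ ≡ addr n a i j
  ev-addr a h refl refl rewrite reg-n h = refl

  ct-run : ∀ {Γ} (t : Tm Γ) (ν ρ : Vec ℕ Γ) f st σ → 2 ≤ f → Holds st σ → Env ν ρ f σ →
           E * sz t ≤ w → TmRun (ct t ν f) f (val t ρ st) (tc t) σ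

  two-run : ∀ {Γ} (s t : Tm Γ) (e : Expr) {v} (ν ρ : Vec ℕ Γ) f st σ → 2 ≤ f →
            Holds st σ → Env ν ρ f σ → E * ((sz s + sz t) * bs e) ≤ w → 1 ≤ bs e →
            (∀ σ′ → Holds st σ′ → regs σ′ f ≡ val s ρ st → regs σ′ (suc f) ≡ val t ρ st →
              ev e σ′ ≡ v × (∀ Q → regs σ′ 0 < 2 ^ Q → regs σ′ f < 2 ^ Q → regs σ′ (suc f) < 2 ^ Q →
                               RegsOK e σ′ Q)) →
            TmRun (ct s ν f ⨟ ct t ν (1 + f) ⨟ f := e) f v (tc s + (tc t + suc (cost e))) σ
  two-run s t e {v} ν ρ f st σ 2≤f h en q 1≤b k = R₁ then-run (lower R₂ then-run R₃)
    where
    le : ∀ {x y} → x ≤ y → x ≤ y * bs e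
    le {y = y} x≤ = ≤-trans x≤ (m≤m*n y (bs e) {{>-nonZero 1≤b}})
    R₁ = ct-run s ν ρ f st σ 2≤f h en (*-mono-size (le (m≤m+n _ (sz t))) q)
    open TmRun R₁ using () renaming (σ′ to σ₁; mem≡ to me₁; frame to fr₁)
    h₁ = frame-holds f 2≤f me₁ fr₁ h
    R₂ = ct-run t ν ρ (1 + f) st σ₁ (m≤n⇒m≤1+n 2≤f) h₁
           (weaken-env (n≤1+n f) (frame-env fr₁ en)) (*-mono-size (le (m≤n+m _ (sz s))) q)
    open TmRun R₂ using () renaming (σ′ to σ₂; mem≡ to me₂; frame to fr₂; result to res₂)
    h₂ = frame-holds (1 + f) (m≤n⇒m≤1+n 2≤f) me₂ fr₂ h₁
    f≡ : regs σ₂ f ≡ val s ρ st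
    f≡ = trans (fr₂ f ≤-refl) (TmRun.result R₁)
    Q = E * (sz s + sz t)
    up : ∀ {x} → x < 2 ^ E → x < 2 ^ Q
    up x< = <2^-mono x< (E≤ (≤-trans (sz≥1 s) (m≤m+n _ _)))
    R₃ : TmRun (f := e) f v (suc (cost e)) σ₂
    R₃ with k σ₂ h₂ f≡ res₂
    ... | ev≡ , ok = assign-run (trans (proj₁ (eval-ev w Q
            (*-mono-≤ {1} {E} {1} 1≤E (≤-trans (sz≥1 s) (m≤m+n _ _))) e σ₂ (λ x → up (words h₂ x))
            (ok Q (up (subst (_< 2 ^ E) (sym (reg-n h₂)) n<E))
                  (subst (_< 2 ^ Q) (sym f≡) (<2^-mono (val-bound s h en) (*-monoʳ-≤ E (m≤m+n _ _))))
                  (subst (_< 2 ^ Q) (sym res₂) (<2^-mono (val-bound t h en) (*-monoʳ-≤ E (m≤n+m _ _)))))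
            (≤-trans (≤-reflexive (*-assoc E _ _)) q))) ev≡) ≤-refl

  ct-run (var i) ν ρ f st σ 2≤f h en q = assign-run (proj₁ (proj₂ (Env.at en i))) ≤-refl
  ct-run nn ν ρ f st σ 2≤f h en q = assign-run (reg-n h) ≤-refl
  ct-run mm ν ρ f st σ 2≤f h en q = assign-run (reg-m h) ≤-refl
  ct-run (num k) ν ρ f st σ 2≤f h en q =
    assign-run (wrap-id w (<2^-mono (val-bound (num k) h en) q)) ≤-refl
  ct-run (adj s t) ν ρ f st σ 2≤f h en q =
    two-run s t (adjᴱ f) ν ρ f st σ 2≤f h en q (s≤s z≤n)
      (λ σ′ h′ e₁ e₂ → guarded f h′ e₁ e₂ , λ Q r₀ r₁ r₂ → ((r₁ , r₀) , (r₂ , r₀)) , ((r₀ , r₁) , r₂))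
  ct-run (arr a s t) ν ρ f st σ 2≤f h en q =
    two-run s t (load (addrᴱ a (reg f) (reg (1 + f)))) ν ρ f st σ 2≤f h en q (s≤s z≤n)
      (λ σ′ h′ e₁ e₂ → trans (cong (mem σ′) (ev-addr a h′ e₁ e₂)) (arrays h′ a _ _) ,
        λ Q r₀ r₁ r₂ → (r₀ , r₀) , (((((r₁ , r₂) , (r₁ , r₂)) , r₁) , tt) ,
          ((((r₁ , r₂) , (r₁ , r₂)) , r₁) , tt)) , (((r₁ , r₂) , (r₁ , r₂)) , r₁))
  ct-run (bin o s t) ν ρ f st σ 2≤f h en q =
    two-run s t (op o (reg f) (reg (1 + f))) ν ρ f st σ 2≤f h en q (s≤s z≤n)
      (λ σ′ h′ e₁ e₂ → cong₂ ⟦ o ⟧ᵒ e₁ e₂ , λ Q r₀ r₁ r₂ → r₁ , r₂)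
  ct-run {Γ} (cnt t) ν ρ f st σ 2≤f h en q =
    tmrun (seq⇓ assign⇓ (seq⇓ assign⇓ (TmRun.exec L)))
      (≤-trans (+-monoʳ-≤ 2 (+-monoʳ-≤ 2 (TmRun.s≤T L))) (≤-reflexive (arith n (tc t + 14))))
      (TmRun.mem≡ L) (λ r r< → trans (TmRun.frame L r r<) (fr₀ r r<)) (TmRun.result L)
    where
    arith : ∀ n x → 2 + (2 + (4 + n * x)) ≡ 8 + n * x
    arith n x = refl
    1≤w = *-mono-size {1} {sz t * 6} (*-mono-≤ {1} {_} {1} {6} (sz≥1 t) (s≤s z≤n)) q
    4≤w = *-mono-size {4} {sz t * 6} (*-mono-≤ {1} {_} {4} {6} (sz≥1 t) (s≤s (s≤s (s≤s (s≤s z≤n))))) q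
    tq  = *-mono-size {sz t} {sz t * 6} (m≤m*n (sz t) 6) q
    g : ℕ → ℕ
    g i = val t (i ∷ ρ) st
    σ₀ : State
    σ₀ = ⟨ (regs σ [ f ↦ wrap w 0 ]) [ 1 + f ↦ wrap w 0 ] , mem σ ⟩
    fr₀ : ∀ r → r < f → regs σ₀ r ≡ regs σ r
    fr₀ r r< = trans (upd-diff (regs σ [ f ↦ wrap w 0 ]) (1 + f) _ r (<⇒≢ (m≤n⇒m≤1+n r<))) (upd-diff (regs σ) f _ r (<⇒≢ r<))
    body = ct t (1 + f ∷ ν) (2 + f) ⨟ f := op add (reg f) (op lt (lit 0) (reg (2 + f))) ⨟
           (1 + f) := op add (reg (1 + f)) (lit 1)
    loop : ∀ k i σ′ → k + i ≡ n → Holds st σ′ → Env ν ρ f σ′ → regs σ′ f ≡ # i g → regs σ′ (1 + f) ≡ i →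
           TmRun (while (op lt (reg (1 + f)) (reg 0)) body) f (# n g) (4 + k * (tc t + 14)) σ′
    loop zero i σ′ refl h′ env′ acc ctr =
      tmrun (stop⇓ (trans (eval-< σ′ (reg (1 + f)) (reg 0) ctr (reg-n h′) 1≤w) (bit-≮ {i} {n} ≤-refl))) ≤-refl refl (λ _ _ → refl) acc
    loop (suc k) i σ′ e≡ h′ env′ acc ctr =
      tmrun (loop⇓ (λ z → 1+n≢0 (trans (sym (trans (eval-< σ′ (reg (1 + f)) (reg 0) ctr (reg-n h′) 1≤w) (bit-< i<n))) z))
                   (seq⇓ (TmRun.exec B) (seq⇓ assign⇓ assign⇓)) (TmRun.exec IH))
        (+-monoʳ-≤ 4 (≤-trans (+-mono-≤ (+-monoˡ-≤ 10 (TmRun.s≤T B)) (TmRun.s≤T IH))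
          (≤-reflexive (trans (+-assoc (tc t) 10 _) (sym (+-assoc (tc t) 14 _))))))
        (trans (TmRun.mem≡ IH) (TmRun.mem≡ B))
        (λ r r< → trans (TmRun.frame IH r r<) (fr₂ r r<)) (TmRun.result IH)
      where
      i<n : i < n
      i<n = ≤-trans (s≤s (m≤n+m i k)) (≤-reflexive e≡)
      i<E = <-trans i<n n<E
      B = ct-run t (1 + f ∷ ν) (i ∷ ρ) (2 + f) st σ′ (≤-trans 2≤f (≤-trans (n≤1+n _) (n≤1+n _))) h′
            (cons-env {ν = ν} {ρ} {f} {2 + f} {σ′} (≤-trans (n≤1+n _) (n≤1+n _)) ≤-refl ctr i<E env′) tq
      σ₁ = TmRun.σ′ B
      σ₂ : State
      σ₂ = ⟨ regs σ₁ [ f ↦ eval w (op add (reg f) (op lt (lit 0) (reg (2 + f)))) σ₁ ] , mem σ₁ ⟩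
      σ₃ : State
      σ₃ = ⟨ regs σ₂ [ 1 + f ↦ eval w (op add (reg (1 + f)) (lit 1)) σ₂ ] , mem σ₁ ⟩
      fr₂ : ∀ r → r < f → regs σ₃ r ≡ regs σ′ r
      fr₂ r r< = trans (upd-diff (regs σ₂) (1 + f) _ r (<⇒≢ (m≤n⇒m≤1+n r<))) (trans (upd-diff (regs σ₁) f _ r (<⇒≢ r<))
                   (TmRun.frame B r (≤-trans r< (≤-trans (n≤1+n _) (n≤1+n _)))))
      acc₃ : regs σ₃ f ≡ # (suc i) g
      acc₃ = trans (upd-diff (regs σ₂) (1 + f) _ f (<⇒≢ ≤-refl)) (trans (upd-same (regs σ₁) f _)
               (trans (cong₂ (λ x y → wrap w (x + y)) (trans (TmRun.frame B f (n≤1+n _)) acc)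
                        (trans (eval-< σ₁ (lit 0) (reg (2 + f)) (lit-word z≤n 1≤w) (TmRun.result B) 1≤w) refl))
               (trans (ind-bound (does (0 <? g i)) {# i g} (≤-<-trans (#≤ i g) i<E) 4≤w)
                 (cong (# i g +_) (0<-sg (g i))))))
      ctr₃ : regs σ₃ (1 + f) ≡ suc i
      ctr₃ = trans (upd-same (regs σ₂) (1 + f) _)
               (trans (cong₂ (λ x y → wrap w (x + y))
                        (trans (upd-diff (regs σ₁) f _ (1 + f) 1+n≢n) (trans (TmRun.frame B (1 + f) ≤-refl) ctr))
                        (lit-word ≤-refl 1≤w))
               (trans (ind-bound true i<E 4≤w) (+-comm i 1)))
      IH = loop k (suc i) σ₃ (trans (+-suc k i) e≡)
             (frame-holds f 2≤f (TmRun.mem≡ B) fr₂ h′) (frame-env fr₂ env′) acc₃ ctr₃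
    L = loop n 0 σ₀ (+-identityʳ n) (frame-holds f 2≤f refl fr₀ h) (frame-env fr₀ en)
          (trans (upd-diff (regs σ [ f ↦ wrap w 0 ]) (1 + f) _ f (<⇒≢ ≤-refl)) (trans (upd-same (regs σ) f _) (lit-word z≤n 1≤w)))
          (trans (upd-same (regs σ [ f ↦ wrap w 0 ]) (1 + f) _) (lit-word z≤n 1≤w))

  record CmdRun (p : Program) (f : ℕ) (st : Store) (T : ℕ) (σ : State) : Set where
    constructor cmdrun
    field
      {σ′}   : State
      {s}    : ℕ
      exec   : w ⊢ p , σ ⇓[ s ] σ′
      s≤T    : s ≤ T
      holds  : Holds st σ′
      frame  : ∀ r → r < f → regs σ′ r ≡ regs σ r

  holds-put : ∀ {st σ} a i j x → x < 2 ^ E → Holds st σ →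
              Holds (put-at st a i j x) ⟨ regs σ , mem σ [ addr n a i j ↦ x ] ⟩
  holds-put {st} {σ} a i j x x< h = record
    { reg-n  = reg-n h
    ; reg-m  = reg-m h
    ; input  = λ u v u< v< → trans (upd-diff (mem σ) (addr n a i j) x (n * u + v)
                 (<⇒≢ (<-≤-trans (inside u v u< v<) (m≤m+n (n * n) _)))) (input h u v u< v<)
    ; arrays = arr′
    ; words  = words′
    }
    where
    inside : ∀ u v → u < n → v < n → n * u + v < n * n
    inside u v u< v< = begin-strict
      n * u + v ≡⟨ +-comm (n * u) v ⟩
      v + n * u <⟨ +-monoˡ-< (n * u) v< ⟩
      n + n * u ≡⟨ *-suc n u ⟨
      n * suc u ≤⟨ *-monoʳ-≤ n u< ⟩
      n * n     ∎ where open ≤-Reasoning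
    inj′ : ∀ a′ i′ j′ → addr n a′ i′ j′ ≡ addr n a i j → a′ ≡ a × i′ ≡ i × j′ ≡ j
    inj′ a′ i′ j′ = addr-inj n {a′} {i′} {j′} {a} {i} {j}
    arr′ : ∀ a′ i′ j′ → (mem σ [ addr n a i j ↦ x ]) (addr n a′ i′ j′) ≡ put-at st a i j x a′ i′ j′
    arr′ a′ i′ j′ with a ≟ a′ | i ≟ i′ | j ≟ j′
    ... | yes refl | yes refl | yes refl =
      trans (upd-same (mem σ) (addr n a i j) x) (sym (put-hit st a i j x))
    ... | no a≢ | _ | _ = trans (upd-diff (mem σ) _ x _ (λ z → a≢ (sym (proj₁ (inj′ a′ i′ j′ z)))))
      (trans (arrays h a′ i′ j′) (sym (put-miss st a i j x a′ i′ j′ (λ z → contradiction z a≢))))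
    ... | _ | no i≢ | _ = trans (upd-diff (mem σ) _ x _ (λ z → i≢ (sym (proj₁ (proj₂ (inj′ a′ i′ j′ z))))))
      (trans (arrays h a′ i′ j′) (sym (put-miss st a i j x a′ i′ j′ (λ _ z → contradiction z i≢))))
    ... | _ | _ | no j≢ = trans (upd-diff (mem σ) _ x _ (λ z → j≢ (sym (proj₂ (proj₂ (inj′ a′ i′ j′ z))))))
      (trans (arrays h a′ i′ j′) (sym (put-miss st a i j x a′ i′ j′ (λ _ _ → j≢))))
    words′ : ∀ y → (mem σ [ addr n a i j ↦ x ]) y < 2 ^ E
    words′ y with y ≟ addr n a i j
    ... | yes refl = subst (_< 2 ^ E) (sym (upd-same (mem σ) y x)) x<
    ... | no y≢    = subst (_< 2 ^ E) (sym (upd-diff (mem σ) _ x y y≢)) (words h y)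

  szᶜ≥1 : ∀ {Γ} (c : Cmd Γ) → 1 ≤ szᶜ c
  szᶜ≥1 skp           = ≤-refl
  szᶜ≥1 (put a i j t) = *-mono-≤ {1} {_} {1} (≤-trans (sz≥1 i) (≤-trans (m≤m+n _ _) (m≤m+n _ _))) (s≤s z≤n)
  szᶜ≥1 (c ∙ d)       = ≤-trans (szᶜ≥1 c) (m≤m+n _ _)
  szᶜ≥1 (iff t c d)   = ≤-trans (sz≥1 t) (m≤m+n _ _)
  szᶜ≥1 (for (times a k) c) = s≤s z≤n
  szᶜ≥1 (for (len a t) c)   = ≤-trans (sz≥1 (arr a t (num 0))) (m≤m+n _ _)
  szᶜ≥1 (lett t c)    = ≤-trans (sz≥1 t) (m≤m+n _ _)

  cc-run : ∀ {Γ} (c : Cmd Γ) (ν ρ : Vec ℕ Γ) f st σ → 2 ≤ f → Holds st σ → Env ν ρ f σ →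
           E * szᶜ c ≤ w → Safe c ρ st → CmdRun (cc c ν f) f (run c ρ st) (time c) σ

  for-run : ∀ {Γ} (b : Bound Γ) (c : Cmd (suc Γ)) (ν ρ : Vec ℕ Γ) f st σ → 2 ≤ f → Holds st σ → Env ν ρ f σ →
            E * (szᶜ c + 4) ≤ w → bval b ρ st < 2 ^ E → bval b ρ st ≤ bn b →
            (∀ i → i < bval b ρ st → Safe c (i ∷ ρ) (iter i (λ i → run c (i ∷ ρ)) st)) →
            TmRun (cb b ν (1 + f)) (1 + f) (bval b ρ st) (bc b) σ →
            CmdRun (cc (for b c) ν f) f (run (for b c) ρ st) (time (for b c)) σ

  cc-run skp ν ρ f st σ 2≤f h en q _ = cmdrun skip⇓ ≤-refl h (λ _ _ → refl)
  cc-run (put a i j t) ν ρ f st σ 2≤f h en q safe =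
    cmdrun (seq⇓ (TmRun.exec R₁) (seq⇓ (TmRun.exec R₂) (seq⇓ (TmRun.exec R₃) store⇓)))
      (+-mono-≤ (TmRun.s≤T R₁) (+-mono-≤ (TmRun.s≤T R₂) (+-mono-≤ (TmRun.s≤T R₃) ≤-refl)))
      (subst (λ p → Holds (put-at st a (val i ρ st) (val j ρ st) (val t ρ st))
                      ⟨ regs (TmRun.σ′ R₃) , mem (TmRun.σ′ R₃) [ proj₁ p ↦ proj₂ p ] ⟩)
             (cong₂ _,_ (sym ad≡) (sym (TmRun.result R₃)))
             (holds-put a (val i ρ st) (val j ρ st) (val t ρ st) safe h₃))
      (λ r r< → trans (fr₃ r (m≤n⇒m≤1+n (m≤n⇒m≤1+n r<))) (trans (fr₂ r (m≤n⇒m≤1+n r<)) (fr₁ r r<)))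
    where
    b = bs (addrᴱ a (reg 0) (reg 1))
    S = sz i + sz j + sz t
    le : ∀ {x} → x ≤ S → E * x ≤ w
    le x≤ = *-mono-size (≤-trans x≤ (m≤m*n S b)) q
    ≤i = ≤-trans (m≤m+n (sz i) (sz j)) (m≤m+n _ (sz t))
    ≤j = ≤-trans (m≤n+m (sz j) (sz i)) (m≤m+n _ (sz t))
    2≤1+f = m≤n⇒m≤1+n 2≤f
    R₁ = ct-run i ν ρ f st σ 2≤f h en (le ≤i)
    open TmRun R₁ using () renaming (σ′ to σ₁; frame to fr₁)
    h₁ = frame-holds f 2≤f (TmRun.mem≡ R₁) fr₁ h
    en₁ = weaken-env (n≤1+n f) (frame-env fr₁ en)
    R₂ = ct-run j ν ρ (1 + f) st σ₁ 2≤1+f h₁ en₁ (le ≤j)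
    open TmRun R₂ using () renaming (σ′ to σ₂; frame to fr₂)
    h₂ = frame-holds (1 + f) 2≤1+f (TmRun.mem≡ R₂) fr₂ h₁
    en₂ = weaken-env (n≤1+n (1 + f)) (frame-env fr₂ en₁)
    R₃ = ct-run t ν ρ (2 + f) st σ₂ (m≤n⇒m≤1+n 2≤1+f) h₂ en₂ (le (m≤n+m (sz t) _))
    open TmRun R₃ using () renaming (σ′ to σ₃; frame to fr₃)
    h₃ = frame-holds (2 + f) (m≤n⇒m≤1+n 2≤1+f) (TmRun.mem≡ R₃) fr₃ h₂
    i≡ : regs σ₃ f ≡ val i ρ st
    i≡ = trans (fr₃ f (n≤1+n _)) (trans (fr₂ f ≤-refl) (TmRun.result R₁))
    j≡ : regs σ₃ (1 + f) ≡ val j ρ st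
    j≡ = trans (fr₃ (1 + f) ≤-refl) (TmRun.result R₂)
    Q = E * S
    1≤S : 1 ≤ S
    1≤S = ≤-trans (sz≥1 i) ≤i
    up : ∀ {x} → x < 2 ^ E → x < 2 ^ Q
    up x< = <2^-mono x< (E≤ 1≤S)
    r₀ : regs σ₃ 0 < 2 ^ Q
    r₀ = up (subst (_< 2 ^ E) (sym (reg-n h₃)) n<E)
    r₁ : regs σ₃ f < 2 ^ Q
    r₁ = subst (_< 2 ^ Q) (sym i≡) (<2^-mono (val-bound i h en) (*-monoʳ-≤ E ≤i))
    r₂ : regs σ₃ (1 + f) < 2 ^ Q
    r₂ = subst (_< 2 ^ Q) (sym j≡) (<2^-mono (val-bound j h en) (*-monoʳ-≤ E ≤j))
    ad≡ : eval w (addrᴱ a (reg f) (reg (1 + f))) σ₃ ≡ addr n a (val i ρ st) (val j ρ st)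
    ad≡ = trans (proj₁ (eval-ev w Q (*-mono-≤ {1} {E} {1} 1≤E 1≤S) (addrᴱ a (reg f) (reg (1 + f))) σ₃
                   (λ x → up (words h₃ x))
                   ((r₀ , r₀) , (((((r₁ , r₂) , (r₁ , r₂)) , r₁) , tt) ,
                     ((((r₁ , r₂) , (r₁ , r₂)) , r₁) , tt)) , (((r₁ , r₂) , (r₁ , r₂)) , r₁))
                   (≤-trans (≤-reflexive (*-assoc E S b)) q)))
                (ev-addr a h₃ i≡ j≡)
  cc-run (c ∙ d) ν ρ f st σ 2≤f h en q (sc , sd) =
    cmdrun (seq⇓ (CmdRun.exec R₁) (CmdRun.exec R₂)) (+-mono-≤ (CmdRun.s≤T R₁) (CmdRun.s≤T R₂))
      (CmdRun.holds R₂) (λ r r< → trans (CmdRun.frame R₂ r r<) (CmdRun.frame R₁ r r<))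
    where
    R₁ = cc-run c ν ρ f st σ 2≤f h en (*-mono-size (m≤m+n _ _) q) sc
    R₂ = cc-run d ν ρ f (run c ρ st) _ 2≤f (CmdRun.holds R₁) (frame-env (CmdRun.frame R₁) en)
           (*-mono-size (m≤n+m _ (szᶜ c)) q) sd
  cc-run (iff t c d) ν ρ f st σ 2≤f h en q (sc , sd) = go (val t ρ st) refl
    where
    R = ct-run t ν ρ f st σ 2≤f h en (*-mono-size (m≤m+n _ _) q)
    h₁ = frame-holds f 2≤f (TmRun.mem≡ R) (TmRun.frame R) h
    en₁ = frame-env (TmRun.frame R) en
    go : ∀ v → val t ρ st ≡ v → CmdRun (cc (iff t c d) ν f) f (choose v (run c ρ st) (run d ρ st)) (time (iff t c d)) σ
    go zero v≡ = cmdrun (seq⇓ (TmRun.exec R) (else⇓ (trans (TmRun.result R) v≡) (CmdRun.exec R₂)))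
      (+-mono-≤ (TmRun.s≤T R) (+-monoʳ-≤ 2 (≤-trans (CmdRun.s≤T R₂) (m≤n+m _ (time c)))))
      (CmdRun.holds R₂) (λ r r< → trans (CmdRun.frame R₂ r r<) (TmRun.frame R r r<))
      where
      R₂ = cc-run d ν ρ f st _ 2≤f h₁ en₁
             (*-mono-size (≤-trans (m≤n+m _ (szᶜ c)) (m≤n+m _ (sz t))) q) (sd v≡)
    go (suc v) v≡ = cmdrun (seq⇓ (TmRun.exec R) (then⇓ (λ z → 1+n≢0 (trans (sym (trans (TmRun.result R) v≡)) z)) (CmdRun.exec R₂)))
      (+-mono-≤ (TmRun.s≤T R) (+-monoʳ-≤ 2 (≤-trans (CmdRun.s≤T R₂) (m≤m+n _ (time d)))))
      (CmdRun.holds R₂) (λ r r< → trans (CmdRun.frame R₂ r r<) (TmRun.frame R r r<))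
      where
      R₂ = cc-run c ν ρ f st _ 2≤f h₁ en₁
             (*-mono-size (≤-trans (m≤m+n _ (szᶜ d)) (m≤n+m _ (sz t))) q) (sc (λ z → 1+n≢0 (trans (sym v≡) z)))
  cc-run (lett t c) ν ρ f st σ 2≤f h en q (st< , sc) =
    cmdrun (seq⇓ (TmRun.exec R) (CmdRun.exec R₂)) (+-mono-≤ (TmRun.s≤T R) (CmdRun.s≤T R₂))
      (CmdRun.holds R₂) (λ r r< → trans (CmdRun.frame R₂ r (m≤n⇒m≤1+n r<)) (TmRun.frame R r r<))
    where
    R = ct-run t ν ρ f st σ 2≤f h en (*-mono-size (m≤m+n _ _) q)
    R₂ = cc-run c (f ∷ ν) (val t ρ st ∷ ρ) (1 + f) st _ (m≤n⇒m≤1+n 2≤f)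
           (frame-holds f 2≤f (TmRun.mem≡ R) (TmRun.frame R) h)
           (cons-env (n≤1+n f) ≤-refl (TmRun.result R) st< (frame-env (TmRun.frame R) en))
           (*-mono-size (m≤n+m _ (sz t)) q) sc
  cc-run (for b@(times a k) c) ν ρ f st σ 2≤f h en q (sb , sc) =
    for-run b c ν ρ f st σ 2≤f h en (*-mono-size (m≤n+m _ (suc (suc (suc (suc a)) + suc k))) q) sb ≤-refl sc
      (assign-run (trans (proj₁ (eval-ev w E 1≤E (op add (op mul (reg 0) (lit a)) (lit k)) σ (words h)
          ((subst (_< 2 ^ E) (sym (reg-n h)) n<E , tt) , tt)
          (*-mono-size (≤-trans (≤-reflexive refl) (m≤m+n (suc (suc (suc (suc a)) + suc k)) (szᶜ c + 4))) q)))
          (cong (λ x → x * a + k) (reg-n h))) ≤-refl)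
  cc-run (for b@(len a t) c) ν ρ f st σ 2≤f h en q (sb , sc) =
    for-run b c ν ρ f st σ 2≤f h en (*-mono-size (m≤n+m _ (sz (arr a t (num 0)))) q)
      (subst (_< 2 ^ E) (arrays h a (val t ρ st) 0) (words h _)) sb sc
      (ct-run (arr a t (num 0)) ν ρ (1 + f) st σ (m≤n⇒m≤1+n 2≤f) h (weaken-env (n≤1+n f) en)
        (*-mono-size (m≤m+n _ _) q))

  for-run {Γ} b c ν ρ f st σ 2≤f h en q N<E N≤ sc R =
    cmdrun (seq⇓ (TmRun.exec R) (seq⇓ assign⇓ (CmdRun.exec L)))
      (+-mono-≤ (TmRun.s≤T R) (+-monoʳ-≤ 2 (≤-trans (CmdRun.s≤T L)
        (+-monoʳ-≤ 4 (*-monoˡ-≤ (time c + 8) N≤)))))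
      (CmdRun.holds L)
      (λ r r< → trans (CmdRun.frame L r r<) (fr₀ r r<))
    where
    N = bval b ρ st
    F : ℕ → Store → Store
    F i = run c (i ∷ ρ)
    1≤w = *-mono-size {1} {szᶜ c + 4} (≤-trans (szᶜ≥1 c) (m≤m+n _ 4)) q
    4≤w = *-mono-size {4} {szᶜ c + 4} (m≤n+m 4 _) q
    body = cc c (f ∷ ν) (2 + f) ⨟ f := op add (reg f) (lit 1)
    σ₁ = TmRun.σ′ R
    σ₀ : State
    σ₀ = ⟨ regs σ₁ [ f ↦ wrap w 0 ] , mem σ₁ ⟩
    fr₀ : ∀ r → r < f → regs σ₀ r ≡ regs σ r
    fr₀ r r< = trans (upd-diff (regs σ₁) f _ r (<⇒≢ r<)) (TmRun.frame R r (m≤n⇒m≤1+n r<))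
    loop : ∀ k i σ′ → k + i ≡ N → Holds (iter i F st) σ′ → Env ν ρ f σ′ → regs σ′ f ≡ i → regs σ′ (1 + f) ≡ N →
           CmdRun (while (op lt (reg f) (reg (1 + f))) body) f (iter N F st) (4 + k * (time c + 8)) σ′
    loop zero i σ′ refl h′ en′ ctr bnd =
      cmdrun (stop⇓ (trans (eval-< σ′ (reg f) (reg (1 + f)) ctr bnd 1≤w) (bit-≮ {i} {N} ≤-refl))) ≤-refl h′ (λ _ _ → refl)
    loop (suc k) i σ′ e≡ h′ en′ ctr bnd =
      cmdrun (loop⇓ (λ z → 1+n≢0 (trans (sym (trans (eval-< σ′ (reg f) (reg (1 + f)) ctr bnd 1≤w) (bit-< i<N))) z))
                    (seq⇓ (CmdRun.exec B) assign⇓) (CmdRun.exec IH))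
        (+-monoʳ-≤ 4 (≤-trans (+-mono-≤ (+-monoˡ-≤ 4 (CmdRun.s≤T B)) (CmdRun.s≤T IH))
          (≤-reflexive (trans (+-assoc (time c) 4 _) (sym (+-assoc (time c) 8 _))))))
        (CmdRun.holds IH)
        (λ r r< → trans (CmdRun.frame IH r r<) (fr₂ r r<))
      where
      i<N : i < N
      i<N = ≤-trans (s≤s (m≤n+m i k)) (≤-reflexive e≡)
      i<E = <-trans i<N N<E
      B = cc-run c (f ∷ ν) (i ∷ ρ) (2 + f) (iter i F st) σ′ (≤-trans 2≤f (≤-trans (n≤1+n _) (n≤1+n _))) h′
            (cons-env (≤-trans (n≤1+n _) (n≤1+n _)) (n≤1+n _) ctr i<E en′) (*-mono-size (m≤m+n _ 4) q) (sc i i<N)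
      σ₂ = CmdRun.σ′ B
      σ₃ : State
      σ₃ = ⟨ regs σ₂ [ f ↦ eval w (op add (reg f) (lit 1)) σ₂ ] , mem σ₂ ⟩
      fr₂ : ∀ r → r < f → regs σ₃ r ≡ regs σ′ r
      fr₂ r r< = trans (upd-diff (regs σ₂) f _ r (<⇒≢ r<))
                   (CmdRun.frame B r (≤-trans r< (≤-trans (n≤1+n _) (n≤1+n _))))
      IH = loop k (suc i) σ₃ (trans (+-suc k i) e≡)
             (frame-holds f 2≤f refl (λ r r< → upd-diff (regs σ₂) f _ r (<⇒≢ r<)) (CmdRun.holds B))
             (frame-env fr₂ en′)
             (trans (upd-same (regs σ₂) f _)
               (trans (cong₂ (λ x y → wrap w (x + y)) (trans (CmdRun.frame B f (n≤1+n _)) ctr) (lit-word ≤-refl 1≤w))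
               (trans (ind-bound true i<E 4≤w) (+-comm i 1))))
             (trans (upd-diff (regs σ₂) f _ (1 + f) 1+n≢n) (trans (CmdRun.frame B (1 + f) ≤-refl) bnd))
    L = loop N 0 σ₀ (+-identityʳ N)
          (frame-holds f 2≤f (TmRun.mem≡ R) fr₀ h) (frame-env fr₀ en)
          (trans (upd-same (regs σ₁) f _) (lit-word z≤n 1≤w))
          (trans (upd-diff (regs σ₁) f _ (1 + f) 1+n≢n) (TmRun.result R))

-- Reasoning about programs

record Ref (x : ℕ) (P : Set) : Set where
  constructor ref
  field
    to   : x ≢ 0 → P
    from : P → x ≢ 0
open Ref public

≡0⇒¬ : ∀ {x P} → Ref x P → x ≡ 0 → ¬ P
≡0⇒¬ r z p = from r p z

ref-map : ∀ {x P Q} → (P → Q) → (Q → P) → Ref x P → Ref x Q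
ref-map f g r = ref (λ nz → f (to r nz)) (λ q → from r (g q))

ref-nz : ∀ {x} → Ref x (x ≢ 0)
ref-nz = ref (λ z → z) (λ z → z)

ref-bit : ∀ {b} → Ref (bit b) (b ≡ true)
ref-bit {true}  = ref (λ _ → refl) (λ _ ())
ref-bit {false} = ref (λ z → contradiction refl z) (λ ())

ref-does : ∀ {P : Set} (d : Dec P) → Ref (bit (does d)) P
ref-does (yes p) = ref (λ _ → p) (λ _ ())
ref-does (no ¬p) = ref (λ z → contradiction refl z) (λ p → contradiction p ¬p)

ref-and : ∀ {x y P Q} → Ref x P → Ref y Q → Ref (x * y) (P × Q)
ref-and {x} {y} r s = ref (λ nz → to r (λ { refl → nz refl }) , to s (λ { refl → nz (*-zeroʳ x) }))
  (λ (p , q) z → case′ (m*n≡0⇒m≡0∨n≡0 x z) p q)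
  where
  case′ : x ≡ 0 ⊎ y ≡ 0 → _ → _ → _
  case′ (inj₁ z) p q = from r p z
  case′ (inj₂ z) p q = from s q z

ref-or : ∀ {x y P Q} → Ref x P → Ref y Q → Ref (x + y) (P ⊎ Q)
ref-or {x} {y} {P} {Q} r s = ref go λ { (inj₁ p) z → from r p (m+n≡0⇒m≡0 x z) ; (inj₂ q) z → from s q (m+n≡0⇒n≡0 x z) }
  where
  go : x + y ≢ 0 → P ⊎ Q
  go nz with x ≟ 0
  ... | no x≢ = inj₁ (to r x≢)
  ... | yes x≡ = inj₂ (to s (λ y≡ → nz (cong₂ _+_ x≡ y≡)))

ref-eq : ∀ {x y} → Ref (⟦ eq ⟧ᵒ x y) (x ≡ y)
ref-eq {x} {y} = ref-does (x ≟ y)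

ref-lt : ∀ {x y} → Ref (⟦ lt ⟧ᵒ x y) (x < y)
ref-lt {x} {y} = ref-does (x <? y)

ref-not : ∀ {x P} → Ref x P → Ref (⟦ eq ⟧ᵒ x 0) (¬ P)
ref-not {x} {P} r = ref (λ nz p → from r p (to ref-eq nz)) go
  where
  go : ¬ P → ⟦ eq ⟧ᵒ x 0 ≢ 0
  go ¬p = from ref-eq (zero? x refl)
    where
    zero? : ∀ y → x ≡ y → y ≡ 0
    zero? zero    _ = refl
    zero? (suc y) e = contradiction (to r (λ z → 1+n≢0 (trans (sym e) z))) ¬p

ref-le : ∀ {x y} → Ref (⟦ eq ⟧ᵒ (⟦ lt ⟧ᵒ y x) 0) (x ≤ y)
ref-le {x} {y} = ref-map ≮⇒≥ ≤⇒≯ (ref-not (ref-lt {y} {x}))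

ref-ex : ∀ n {f : ℕ → ℕ} {P : ℕ → Set} → (∀ i → i < n → Ref (f i) (P i)) → Ref (# n f) (∃[ i ] (i < n × P i))
ref-ex n {f} r = ref (λ nz → let (i , i< , fi) = #≢0⇒ n f nz in i , i< , to (r i i<) fi)
                     (λ (i , i< , p) → ⇒#≢0 n f i i< (from (r i i<) p))

keeps : ∀ {Γ} → ℕ → Cmd Γ → Bool
keeps a skp           = true
keeps a (put b i j t) = not (b ≡ᵇ a)
keeps a (c ∙ d)       = keeps a c ∧ keeps a d
keeps a (iff t c d)   = keeps a c ∧ keeps a d
keeps a (for b c)     = keeps a c
keeps a (lett t c)    = keeps a c

Same : ℕ → Store → Store → Set
Same a s st = ∀ i j → s a i j ≡ st a i j

∧-left : ∀ {a b} → T (a ∧ b) → T a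
∧-left {true} _ = tt

∧-right : ∀ {a b} → T (a ∧ b) → T b
∧-right {true} p = p

module Rules (n m : ℕ) (A : ℕ → ℕ → ℕ) (E : ℕ) (Λ : ℕ → ℕ) where

  open Semantics n m A public
  open Safety E Λ public

  keep : ∀ {Γ} a (c : Cmd Γ) → T (keeps a c) → ∀ ρ st → Same a (run c ρ st) st
  keep a skp k ρ st i j = refl
  keep a (put b x y t) k ρ st i j with b ≡ᵇ a
  ... | false = refl
  keep a (c ∙ d) k ρ st i j = trans (keep a d (∧-right {keeps a c} k) ρ (run c ρ st) i j) (keep a c (∧-left k) ρ st i j)
  keep a (iff t c d) k ρ st i j with val t ρ st
  ... | zero  = keep a d (∧-right {keeps a c} k) ρ st i j
  ... | suc _ = keep a c (∧-left k) ρ st i j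
  keep a (for b c) k ρ st i j = go (bval b ρ st)
    where
    go : ∀ N → iter N (λ i → run c (i ∷ ρ)) st a i j ≡ st a i j
    go zero    = refl
    go (suc N) = trans (keep a c k (N ∷ ρ) _ i j) (go N)
  keep a (lett t c) k ρ st i j = keep a c k (val t ρ st ∷ ρ) st i j

  record Tri {Γ} (c : Cmd Γ) (ρ : Vec ℕ Γ) (st : Store) (Q : Store → Set) : Set where
    constructor tri
    field
      safe : Safe c ρ st
      post : Q (run c ρ st)
  open Tri public

  module _ {Γ : ℕ} {ρ : Vec ℕ Γ} {st : Store} where

    conseq : ∀ {c Q R} → (Q (run c ρ st) → R (run c ρ st)) → Tri c ρ st Q → Tri c ρ st R
    conseq f (tri s q) = tri s (f q)

    do-skp : ∀ {Q : Store → Set} → Q st → Tri skp ρ st Q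
    do-skp q = tri tt q

    do-put : ∀ {a i j t} {Q : Store → Set} → val t ρ st < 2 ^ E →
             Q (put-at st a (val i ρ st) (val j ρ st) (val t ρ st)) → Tri (put a i j t) ρ st Q
    do-put b q = tri b q

    do-seq : ∀ {c d Q R} → Tri c ρ st Q → (Q (run c ρ st) → Tri d ρ (run c ρ st) R) → Tri (c ∙ d) ρ st R
    do-seq (tri s q) k with k q
    ... | tri s′ r = tri (s , s′) r

    do-if : ∀ {t c d} {Q : Store → Set} → (val t ρ st ≢ 0 → Tri c ρ st Q) → (val t ρ st ≡ 0 → Tri d ρ st Q) → Tri (iff t c d) ρ st Q
    do-if {t} {c} {d} {Q} yes′ no′ = tri (safe ∘ yes′ , safe ∘ no′) (go (val t ρ st) refl)
      where
      go : ∀ v → val t ρ st ≡ v → Q (choose v (run c ρ st) (run d ρ st))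
      go zero    e = post (no′ e)
      go (suc v) e = post (yes′ (λ z → 1+n≢0 (trans (sym e) z)))

    do-let : ∀ {t c} {Q : Store → Set} → val t ρ st < 2 ^ E → Tri c (val t ρ st ∷ ρ) st Q → Tri (lett t c) ρ st Q
    do-let b (tri s q) = tri (b , s) q

    do-for : ∀ {b c} (I : ℕ → Store → Set) → SafeB b ρ st → I 0 st →
             (∀ i s → i < bval b ρ st → (∀ a → T (keeps a c) → Same a s st) → I i s → Tri c (i ∷ ρ) s (I (suc i))) →
             Tri (for b c) ρ st (I (bval b ρ st))
    do-for {b} {c} I sb base step = tri (sb , λ i i< → safe (step i _ i< (kept i) (inv i (<⇒≤ i<)))) (inv _ ≤-refl)
      where
      F : ℕ → Store → Store
      F i = run c (i ∷ ρ)
      kept : ∀ i a → T (keeps a c) → Same a (iter i F st) st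
      kept zero    a k x y = refl
      kept (suc i) a k x y = trans (keep a c k (i ∷ ρ) _ x y) (kept i a k x y)
      inv : ∀ i → i ≤ bval b ρ st → I i (iter i F st)
      inv zero    _  = base
      inv (suc i) i< = post (step i _ i< (kept i) (inv i (<⇒≤ i<)))

-- The algorithm

private variable Γ : ℕ

andT orT leT ltT eqT addT : Tm Γ → Tm Γ → Tm Γ
andT = bin mul
orT  = bin add
addT = bin add
ltT  = bin lt
eqT  = bin eq
leT s t = bin eq (bin lt t s) (num 0)

notT : Tm Γ → Tm Γ
notT t = bin eq t (num 0)

cell : ℕ → Tm Γ → Tm Γ
cell a t = arr a t (num 0)

LEN LIST POW KEY MODE ALIVE REACH SLOT LEN₂ SEEN MATCH : ℕ
LEN   = 0
LIST  = 1
POW   = 2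
KEY   = 3
MODE  = 4
ALIVE = 5
REACH = 6
SLOT  = 7
LEN₂  = 8
SEEN  = 9
MATCH = 10

bitT : Tm Γ → Tm Γ → Tm Γ
bitT D v = bin mod (bin div D (cell POW v)) (num 2)

jobs : Bound Γ
jobs = times 1 0

v₀ : Tm (suc Γ)
v₀ = var zero

v₁ : Tm (suc (suc Γ))
v₁ = var (suc zero)

validT : (D g : Fin Γ) → Tm Γ
validT D g = notT (cnt (cnt (andT (adj v₁ v₀)
  (andT (leT (cell KEY v₁) (var (suc (suc g)))) (andT (leT (cell KEY v₀) (var (suc (suc g))))
    (andT (bitT (var (suc (suc D))) v₀) (notT (bitT (var (suc (suc D))) v₁))))))))

pfT sfT : Tm Γ → Tm Γ → Tm Γ
pfT c x = orT (eqT c nn) (adj c x)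
sfT c x = orT (eqT c nn) (adj x c)

peelT : (c c′ D : Fin Γ) → Tm Γ
peelT c c′ D = notT (orT
  (cnt (andT (cell ALIVE v₀) (andT (bitT (var (suc D)) v₀)
    (andT (pfT (var (suc c)) v₀) (notT (sfT (var (suc c′)) v₀))))))
  (orT
    (cnt (andT (cell ALIVE v₀) (andT (notT (bitT (var (suc D)) v₀))
      (andT (sfT (var (suc c′)) v₀) (notT (pfT (var (suc c)) v₀))))))
    (cnt (cnt (andT (andT (cell ALIVE v₁) (andT (bitT (var (suc (suc D))) v₁) (pfT (var (suc (suc c))) v₁)))
      (andT (andT (cell ALIVE v₀) (andT (notT (bitT (var (suc (suc D))) v₀)) (sfT (var (suc (suc c′))) v₀)))
        (notT (ltT v₁ v₀))))))))

aliveT : (D g x : Fin Γ) → Tm Γ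
aliveT D g x = andT (cell MODE (num 0)) (andT (leT nn (cell KEY (var x))) (andT (leT (cell KEY (var x)) (var g))
  (andT (notT (cnt (andT (adj v₀ (var (suc x))) (notT (bitT (var (suc D)) v₀)))))
        (notT (cnt (andT (adj (var (suc x)) v₀) (bitT (var (suc D)) v₀)))))))

removeC : (c c′ : Fin Γ) → Cmd Γ
removeC c c′ = for jobs (iff (orT (pfT (var (suc c)) v₀) (sfT (var (suc c′)) v₀)) (put ALIVE v₀ (num 0) (num 0)) skp)

peel₁C : (c c′ D : Fin Γ) → Cmd Γ
peel₁C c c′ D = iff (peelT c c′ D) (removeC c c′) skp

roundC : (D : Fin Γ) → Cmd Γ
roundC D = for (times 1 2) (for (times 1 2) (peel₁C (suc zero) zero (suc (suc D))))

initAliveC : (D g : Fin Γ) → Cmd Γ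
initAliveC D g = for jobs (iff (aliveT (suc D) (suc g) zero) (put ALIVE v₀ (num 0) (num 1)) (put ALIVE v₀ (num 0) (num 0)))

peelC : (D g : Fin Γ) → Cmd Γ
peelC D g = initAliveC D g ∙ for jobs (roundC (suc D))

recordC : (D g : Fin Γ) → Cmd Γ
recordC D g =
  put SEEN (var D) (addT (num 1) (var g)) (num 1) ∙
  put LIST (cell LEN (addT (num 1) (var g))) (addT (num 1) (var g)) (var D) ∙
  put LEN (addT (num 1) (var g)) (num 0) (addT (num 1) (cell LEN (addT (num 1) (var g))))

attemptC : (D g : Fin Γ) → Cmd Γ
attemptC D g = iff (validT D g)
  (peelC D g ∙ iff (andT (notT (cnt (cell ALIVE v₀))) (notT (arr SEEN (var D) (addT (num 1) (var g)))))
                   (recordC D g) skp)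
  skp

-- Under the variables s (index into generation g) and g.
growC : Cmd 2
growC =
  lett (arr LIST v₀ v₁) (attemptC zero (suc (suc zero))) ∙
  for jobs (iff (eqT (cell KEY v₀) (var (suc (suc zero))))
    (lett (addT (arr LIST v₁ (var (suc (suc zero)))) (cell POW v₀)) (attemptC zero (suc (suc (suc zero)))))
    skp)

enumC : Cmd 0
enumC = for (times 2 0) (for (len LEN v₀) growC)

2nT : Tm Γ
2nT = addT nn nn

stepT : (D D′ : Fin Γ) → Tm Γ
stepT D D′ = andT (notT (cnt (andT (bitT (var (suc D)) v₀) (notT (bitT (var (suc D′)) v₀)))))
  (andT (leT (cnt (andT (bitT (var (suc D′)) v₀) (notT (bitT (var (suc D)) v₀)))) mm)
    (notT (cnt (cnt (andT (adj v₁ v₀) (andT (bitT (var (suc (suc D′))) v₀)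
      (andT (notT (bitT (var (suc (suc D))) v₀)) (notT (bitT (var (suc (suc D))) v₁)))))))))

-- Under the variable t.
pairsC : Cmd 1
pairsC = for (len LEN₂ (num 0)) (lett (arr LIST v₀ 2nT)
  (for (len LEN₂ (num 0)) (lett (arr LIST v₀ 2nT)
    (iff (andT (arr REACH v₀ (var (suc (suc (suc (suc zero)))))) (stepT zero (suc (suc zero))))
      (put REACH (var (suc (suc zero))) (addT (num 1) (var (suc (suc (suc (suc zero)))))) (num 1))
      skp))))

-- Under D and t.
loadC : (D t : Fin Γ) → Cmd Γ
loadC D t = iff (arr REACH (var D) (var t)) (put SLOT (var D) (num 0) (num 1)) (put SLOT (var D) (num 0) (num 0)) ∙
            for jobs (put SLOT (var (suc D)) (addT (num 1) v₀) (num 0))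

extendT : (D v : Fin Γ) → Tm Γ
extendT D v = andT (notT (bitT (var D) (var v)))
                   (notT (cnt (andT (adj v₀ (var (suc v))) (notT (bitT (var (suc D)) v₀)))))

extendC : (D v : Fin Γ) → Cmd Γ
extendC D v = iff (extendT D v)
  (for jobs (iff (andT (ltT v₀ mm) (arr SLOT (var (suc D)) v₀))
    (put SLOT (addT (var (suc D)) (cell POW (var (suc v)))) (addT (num 1) v₀) (num 1)) skp)) skp

storeC : (D t : Fin Γ) → Cmd Γ
storeC D t = for (times 1 1) (iff (arr SLOT (var (suc D)) v₀) (put REACH (var (suc D)) (addT (num 1) (var (suc t))) (num 1)) skp)

allSets : Cmd (suc (suc Γ)) → Cmd Γ
allSets c = for (len LEN 2nT) (lett (arr LIST v₀ 2nT) c)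

levelT : (v h : Fin Γ) → Tm Γ
levelT v h = eqT (addT (cnt (adj v₀ (var (suc v)))) (addT (num 1) (var h))) nn

-- Under t.
slotsC : Cmd 1
slotsC = allSets (loadC zero (suc (suc zero))) ∙
  for jobs (for jobs (iff (levelT zero (suc zero)) (allSets (extendC zero (suc (suc zero)))) skp)) ∙
  allSets (storeC zero (suc (suc zero)))

dpC : Cmd 0
dpC = put REACH (num 0) (num 0) (num 1) ∙
  put LEN₂ (num 0) (num 0) (bin mul (cell MODE (num 0)) (cell LEN 2nT)) ∙
  for jobs (pairsC ∙ iff (cell MODE (num 0)) skp slotsC)

initC : Cmd 0
initC = put POW (num 0) (num 0) (num 1) ∙
  for jobs (put POW (addT (num 1) v₀) (num 0) (addT (cell POW v₀) (cell POW v₀))) ∙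
  for jobs (for jobs (iff (andT (adj v₁ v₀) (andT (notT (cell MATCH v₁)) (notT (cell MATCH v₀))))
    (put MATCH v₁ (num 0) (num 1) ∙ put MATCH v₀ (num 0) (num 1)) skp)) ∙
  put MODE (num 0) (num 0) (ltT (bin mul (num 60) (cnt (cell MATCH v₀))) nn) ∙
  for jobs (iff (andT (cell MODE (num 0)) (cell MATCH v₀)) (put KEY v₀ (num 0) v₀) (put KEY v₀ (num 0) (addT nn v₀))) ∙
  put LEN (num 0) (num 0) (num 1) ∙
  put SEEN (num 0) (num 0) (num 1)

mainC : Cmd 0
mainC = initC ∙ enumC ∙ dpC

resultT : Tm 0
resultT = cnt (notT (arr REACH (bin sub (cell POW nn) (num 1)) v₀))

-- Correctness of the peeling test

¬true : ∀ {b} → ¬ (b ≡ true) → b ≡ false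
¬true {true}  k = contradiction refl k
¬true {false} _ = refl

¬false : ∀ {b} → ¬ (b ≡ false) → b ≡ true
¬false {true}  _ = refl
¬false {false} k = contradiction refl k

true≢ : ∀ {b} → b ≡ false → ¬ (b ≡ true)
true≢ refl ()

module Setup
  (n m : ℕ) (A : ℕ → ℕ → ℕ) (E : ℕ) (Λ : ℕ → ℕ) (md : Bool) (C : ℕ → Bool)
  (A-bound : ∀ {u v} → A u v ≢ 0 → u < n × v < n) (A-irrefl : ∀ {u} → ¬ (A u u ≢ 0))
  (A-trans : ∀ {u v x} → A u v ≢ 0 → A v x ≢ 0 → A u x ≢ 0) (1≤m : 1 ≤ m)
  (E-big : 2 ^ n + (n + n + 2) < 2 ^ E) where

  infix 4 _≺_
  _≺_ : ℕ → ℕ → Set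
  u ≺ v = A u v ≢ 0

  ≺? : ∀ u v → Dec (u ≺ v)
  ≺? u v = ¬? (A u v ≟ 0)

  open Rules n m A E Λ public
  open Scheduling n m _≺_ ≺? A-bound A-irrefl A-trans 1≤m public
  open Family n _≺_ ≺? A-bound C public

  small : ∀ {x} → x ≤ n + n + 2 → x < 2 ^ E
  small x≤ = ≤-<-trans (≤-trans x≤ (m≤n+m _ (2 ^ n))) E-big

  small-set : ∀ {x} → x ≤ 2 ^ n + 1 → x < 2 ^ E
  small-set x≤ = ≤-<-trans (≤-trans x≤ (+-monoʳ-≤ (2 ^ n) (≤-trans (s≤s z≤n) (m≤n+m 2 (n + n))))) E-big

  1<E : 1 < 2 ^ E
  1<E = small (≤-trans (s≤s z≤n) (m≤n+m 2 (n + n)))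

  0<E : 0 < 2 ^ E
  0<E = small z≤n

  record Stat (st : Store) : Set where
    field
      pow  : ∀ v → v ≤ n → st POW v 0 ≡ 2 ^ v
      keys : ∀ x → x < n → st KEY x 0 ≡ key x
      mode : st MODE 0 0 ≡ bit md
  open Stat public

  stat-same : ∀ {s st} → Same POW s st → Same KEY s st → Same MODE s st → Stat st → Stat s
  stat-same p k o S = record
    { pow  = λ v v≤ → trans (p v 0) (pow S v v≤)
    ; keys = λ x x< → trans (k x 0) (keys S x x<)
    ; mode = trans (o 0 0) (mode S)
    }

  ref-member : ∀ {st} → Stat st → ∀ D v → v < n → Ref (⟦ mod ⟧ᵒ (⟦ div ⟧ᵒ D (st POW v 0)) 2) ((D ∋ v) ≡ true)
  ref-member S D v v< = subst (λ x → Ref x ((D ∋ v) ≡ true))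
    (sym (trans (cong (λ p → ⟦ mod ⟧ᵒ (⟦ div ⟧ᵒ D p) 2) (pow S v (<⇒≤ v<))) (testbit D v))) ref-bit

  ref-nonmember : ∀ {st} → Stat st → ∀ D v → v < n →
                  Ref (⟦ eq ⟧ᵒ (⟦ mod ⟧ᵒ (⟦ div ⟧ᵒ D (st POW v 0)) 2) 0) ((D ∋ v) ≡ false)
  ref-nonmember S D v v< = ref-map ¬true true≢ (ref-not (ref-member S D v v<))

  ref-pf : ∀ c x → Ref (⟦ eq ⟧ᵒ c n + A c x) (PF c x)
  ref-pf c x = ref-or ref-eq ref-nz

  ref-sf : ∀ c x → Ref (⟦ eq ⟧ᵒ c n + A x c) (SF c x)
  ref-sf c x = ref-or ref-eq ref-nz

  PF? : ∀ c x → Dec (PF c x)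
  PF? c x = (c ≟ n) ⊎-dec ≺? c x

  SF? : ∀ c x → Dec (SF c x)
  SF? c x = (c ≟ n) ⊎-dec ≺? x c

  module _ {Γ} {ρ : Vec ℕ Γ} {st : Store} (S : Stat st) (c c′ D : Fin Γ) where

    private
      d  = lookup ρ D
      k  = lookup ρ c
      k′ = lookup ρ c′
      U : ℕ → ℕ
      U x = st ALIVE x 0

    ref-peelable : Ref (val (peelT c c′ D) ρ st) (Peelable d U k k′)
    ref-peelable = ref-map to′ from′ (ref-not (ref-or
      (ref-ex n (λ v v< → ref-and (ref-nz {U v}) (ref-and (ref-member S d v v<) (ref-and (ref-pf k v) (ref-not (ref-sf k′ v))))))
      (ref-or
        (ref-ex n (λ u u< → ref-and (ref-nz {U u}) (ref-and (ref-nonmember S d u u<) (ref-and (ref-sf k′ u) (ref-not (ref-pf k u))))))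
        (ref-ex n (λ v v< → ref-ex n (λ u u< →
          ref-and (ref-and (ref-nz {U v}) (ref-and (ref-member S d v v<) (ref-pf k v)))
            (ref-and (ref-and (ref-nz {U u}) (ref-and (ref-nonmember S d u u<) (ref-sf k′ u)))
              (ref-not (ref-lt {v} {u})))))))))
      where
      to′ : _ → Peelable d U k k′
      to′ none = (λ v v< Uv Dv P → decidable-stable (SF? k′ v) (λ ¬S → none (inj₁ (v , v< , Uv , Dv , P , ¬S)))) ,
                 (λ u u< Uu Du S → decidable-stable (PF? k u) (λ ¬P → none (inj₂ (inj₁ (u , u< , Uu , Du , S , ¬P))))) ,
                 (λ v u v< u< Uv Dv P Uu Du S → decidable-stable (v <? u)
                   (λ v≮u → none (inj₂ (inj₂ (v , v< , u , u< , (Uv , Dv , P) , (Uu , Du , S) , v≮u)))))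
      from′ : Peelable d U k k′ → _
      from′ (p , q , r) (inj₁ (v , v< , Uv , Dv , P , ¬S)) = ¬S (p v v< Uv Dv P)
      from′ (p , q , r) (inj₂ (inj₁ (u , u< , Uu , Du , S , ¬P))) = ¬P (q u u< Uu Du S)
      from′ (p , q , r) (inj₂ (inj₂ (v , v< , u , u< , (Uv , Dv , P) , (Uu , Du , S) , v≮u))) = v≮u (r v u v< u< Uv Dv P Uu Du S)

    Removed : (ℕ → ℕ) → Set
    Removed U′ = ∀ x → x < n → Ref (U′ x) (U x ≢ 0 × ¬ (Peelable d U k k′ × (PF k x ⊎ SF k′ x)))

    peel₁-spec : Tri (peel₁C c c′ D) ρ st (λ s → Removed (λ x → s ALIVE x 0))
    peel₁-spec = do-if
      (λ nz → conseq (λ I x x< → ref-map (λ (Ux , k) → Ux , λ (_ , f) → k (subst (x <_) (sym n*1+0) x< , f))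
                                         (λ (Ux , k) → Ux , λ (_ , f) → k (to ref-peelable nz , f)) (I x x<))
        (do-for (λ i s → ∀ x → x < n → Ref (s ALIVE x 0) (U x ≢ 0 × ¬ (x < i × (PF k x ⊎ SF k′ x))))
          (small (≤-trans (≤-reflexive n*1+0) (≤-trans (m≤m+n n n) (m≤m+n _ 2))))
          (λ x x< → ref (λ Ux → Ux , λ ()) proj₁)
          (λ i s i< _ I → do-if
            (λ hit → do-put 0<E λ x x< → zeroed i s x x< (to (ref-or (ref-pf k i) (ref-sf k′ i)) hit) (I x x<))
            (λ miss → do-skp λ x x< → kept i s x (≡0⇒¬ (ref-or (ref-pf k i) (ref-sf k′ i)) miss) (I x x<)))))
      (λ z → do-skp λ x x< → ref (λ Ux → Ux , λ (p , _) → ≡0⇒¬ ref-peelable z p) proj₁)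
      where
      n*1+0 : n * 1 + 0 ≡ n
      n*1+0 = trans (+-identityʳ _) (*-identityʳ n)
      zeroed : ∀ i s x → x < n → PF k i ⊎ SF k′ i → Ref (s ALIVE x 0) (U x ≢ 0 × ¬ (x < i × (PF k x ⊎ SF k′ x))) →
               Ref (put-at s ALIVE i 0 0 ALIVE x 0) (U x ≢ 0 × ¬ (x < suc i × (PF k x ⊎ SF k′ x)))
      zeroed i s x x< f r with i ≟ x
      ... | yes refl = subst (λ y → Ref y _) (sym (put-hit s ALIVE i 0 0))
                         (ref (λ z → contradiction refl z) (λ (_ , g) → contradiction (≤-refl , f) g))
      ... | no i≢x = subst (λ y → Ref y _) (sym (put-miss s ALIVE i 0 0 ALIVE x 0 (λ _ e → contradiction e i≢x)))
                       (ref-map (λ (Ux , g) → Ux , λ (l , f) → g (≤∧≢⇒< (s≤s⁻¹ l) (i≢x ∘ sym) , f))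
                                (λ (Ux , g) → Ux , λ (l , f) → g (m≤n⇒m≤1+n l , f)) r)
      kept : ∀ i s x → ¬ (PF k i ⊎ SF k′ i) → Ref (s ALIVE x 0) (U x ≢ 0 × ¬ (x < i × (PF k x ⊎ SF k′ x))) →
             Ref (s ALIVE x 0) (U x ≢ 0 × ¬ (x < suc i × (PF k x ⊎ SF k′ x)))
      kept i s x ¬f = ref-map (λ (Ux , g) → Ux , λ (l , f) → go l f g) (λ (Ux , g) → Ux , λ (l , f) → g (m≤n⇒m≤1+n l , f))
        where
        go : x < suc i → PF k x ⊎ SF k′ x → ¬ (x < i × (PF k x ⊎ SF k′ x)) → _
        go l f g with x ≟ i
        ... | yes refl = ¬f f
        ... | no x≢i = g (≤∧≢⇒< (s≤s⁻¹ l) x≢i , f)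

  pf⇒ : ∀ {c x} → pf c x ≡ true → PF c x
  pf⇒ {c} {x} e with c ≡ᵇ n | ≡ᵇ⇒≡ c n
  ... | true  | k = inj₁ (k tt)
  ... | false | _ = inj₂ (does-yes (≺? c x) e)

  ⇒pf : ∀ {c x} → PF c x → pf c x ≡ true
  ⇒pf {c} {x} (inj₁ e) = cong (_∨ does (≺? c x)) (dec-true (c ≟ n) e)
  ⇒pf {c} {x} (inj₂ l) with c ≡ᵇ n
  ... | true  = refl
  ... | false = dec-true (≺? c x) l

  sf⇒ : ∀ {c x} → sf c x ≡ true → SF c x
  sf⇒ {c} {x} e with c ≡ᵇ n | ≡ᵇ⇒≡ c n
  ... | true  | k = inj₁ (k tt)
  ... | false | _ = inj₂ (does-yes (≺? x c) e)

  ⇒sf : ∀ {c x} → SF c x → sf c x ≡ true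
  ⇒sf {c} {x} (inj₁ e) = cong (_∨ does (≺? x c)) (dec-true (c ≟ n) e)
  ⇒sf {c} {x} (inj₂ l) with c ≡ᵇ n
  ... | true  = refl
  ... | false = dec-true (≺? x c) l

  Covers : (U : ℕ → ℕ) (α : ℕ → ℤ) → Set
  Covers U α = ∀ x → x < n → α x ≢ 0ℤ → U x ≢ 0

  peel-relation : ∀ {g D α U c c′} → Consistent g D α → Covers U α → Peelable D U c c′ →
                  ∀ x → x < n → α x ≢ 0ℤ → ¬ (PF c x ⊎ SF c′ x)
  peel-relation {g} {D} {α} {U} {c} {c′} cons cov (p , q , r) x x< αx f = αx
    (peel-sound n (pf c) (sf c′) α
      (λ v v< l e → ⇒sf (p v v< (cov v v< (pos≢ l)) (Consistent.pos-in cons v v< l) (pf⇒ e)))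
      (λ u u< l e → ⇒pf (q u u< (cov u u< (neg≢ l)) (Consistent.neg-out cons u u< l) (sf⇒ e)))
      (λ v u v< u< l e l′ e′ → r v u v< u< (cov v v< (pos≢ l)) (Consistent.pos-in cons v v< l) (pf⇒ e)
                                  (cov u u< (neg≢ l′)) (Consistent.neg-out cons u u< l′) (sf⇒ e′))
      (Consistent.sum-p cons c) (Consistent.sum-s cons c′) (Consistent.sum-px cons c) x x<
      ([ (λ P → cong (_∨ sf c′ x) (⇒pf P)) , (λ S → trans (cong (pf c x ∨_) (⇒sf S)) (∨-true (pf c x))) ]′ f))
    where
    pos≢ : ∀ {a} → 0ℤ <ℤ a → a ≢ 0ℤ
    pos≢ l refl = ℤ.<-irrefl refl l
    neg≢ : ∀ {a} → a <ℤ 0ℤ → a ≢ 0ℤ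
    neg≢ l refl = ℤ.<-irrefl refl l
    ∨-true : ∀ b → b ∨ true ≡ true
    ∨-true true  = refl
    ∨-true false = refl

  peelable-cong : ∀ {D U U′ c c′} → (∀ x → x < n → U′ x ≢ 0 → U x ≢ 0) → Peelable D U c c′ → Peelable D U′ c c′
  peelable-cong s (p , q , r) = (λ v v< Uv → p v v< (s v v< Uv)) , (λ u u< Uu → q u u< (s u u< Uu)) ,
    (λ v u v< u< Uv Dv P Uu → r v u v< u< (s v v< Uv) Dv P (s u u< Uu))

  n*1 : n * 1 + 0 ≡ n
  n*1 = trans (+-identityʳ _) (*-identityʳ n)

  n*1+2 : n * 1 + 2 ≡ 2 + n
  n*1+2 = trans (cong (_+ 2) (*-identityʳ n)) (+-comm n 2)

  safe-jobs : n * 1 + 0 < 2 ^ E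
  safe-jobs = small (≤-trans (≤-reflexive n*1) (≤-trans (m≤m+n n n) (m≤m+n _ 2)))

  safe-features : n * 1 + 2 < 2 ^ E
  safe-features = small (≤-trans (≤-reflexive (cong (_+ 2) (*-identityʳ n))) (+-monoˡ-≤ 2 (m≤m+n n n)))

  alive : Store → ℕ → ℕ
  alive s x = s ALIVE x 0

  record PeelInv (g D : ℕ) (s : Store) : Set where
    field
      still-alive   : ∀ x → x < n → alive s x ≢ 0 → md ≡ true × Alive (suc g) D x
      sound : md ≡ true → ∀ α → Consistent (suc g) D α → Covers (alive s) α
  open PeelInv

  Shrinks : Store → Store → Set
  Shrinks s₀ s = ∀ x → x < n → alive s x ≢ 0 → alive s₀ x ≢ 0

  Lost : Store → Store → Set
  Lost s₀ s = ∃[ y ] (y < n × alive s₀ y ≢ 0 × alive s y ≡ 0)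

  Fires : (D : ℕ) (s₀ : Store) (c c′ : ℕ) → Set
  Fires D s₀ c c′ = Peelable D (alive s₀) c c′ × (∃[ x ] (x < n × alive s₀ x ≢ 0 × (PF c x ⊎ SF c′ x)))

  peel₁-inv : ∀ {Γ} {ρ : Vec ℕ Γ} {s₀ s} g (c c′ D : Fin Γ) → Stat s → PeelInv g (lookup ρ D) s → Shrinks s₀ s →
    Tri (peel₁C c c′ D) ρ s (λ s′ → PeelInv g (lookup ρ D) s′ × Shrinks s₀ s′ × (Lost s₀ s → Lost s₀ s′) ×
      (Fires (lookup ρ D) s₀ (lookup ρ c) (lookup ρ c′) → Lost s₀ s′))
  peel₁-inv {Γ} {ρ} {s₀} {s} g c c′ D S inv sh = conseq finish (peel₁-spec S c c′ D)
    where
    d = lookup ρ D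
    s′ = run (peel₁C c c′ D) ρ s
    finish : Removed {ρ = ρ} S c c′ D (λ x → s′ ALIVE x 0) → _
    finish R = record
      { still-alive   = λ x x< nz → still-alive inv x x< (proj₁ (to (R x x<) nz))
      ; sound = λ e α cons x x< αx → from (R x x<)
                  (sound inv e α cons x x< αx , λ (p , f) → peel-relation cons (sound inv e α cons) p x x< αx f)
      } , (λ x x< nz → sh x x< (proj₁ (to (R x x<) nz))) , lost′ , fires
      where
      gone : ∀ {x} → x < n → ¬ (alive s x ≢ 0 × ¬ (Peelable d (alive s) (lookup ρ c) (lookup ρ c′) × (PF (lookup ρ c) x ⊎ SF (lookup ρ c′) x))) → alive s′ x ≡ 0
      gone {x} x< k = decidable-stable (alive s′ x ≟ 0) (λ nz → k (to (R x x<) nz))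
      lost′ : Lost s₀ s → Lost s₀ s′
      lost′ (y , y< , s₀y , sy) = y , y< , s₀y , gone y< (λ (nz , _) → nz sy)
      fires : Fires d s₀ (lookup ρ c) (lookup ρ c′) → Lost s₀ s′
      fires (p , x , x< , s₀x , f) with anyUpTo? (λ y → ¬? (alive s₀ y ≟ 0) ×-dec (alive s y ≟ 0)) n
      ... | yes (y , y< , s₀y , sy) = lost′ (y , y< , s₀y , sy)
      ... | no none = x , x< , s₀x , gone x< (λ (_ , k) → k (peelable-cong sh p , f))

  round-spec : ∀ {Γ} {ρ : Vec ℕ Γ} {s₀} g (D : Fin Γ) → Stat s₀ → PeelInv g (lookup ρ D) s₀ →
    Tri (roundC D) ρ s₀ (λ s → PeelInv g (lookup ρ D) s × Shrinks s₀ s ×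
      (∀ c c′ → c < 2 + n → c′ < 2 + n → Fires (lookup ρ D) s₀ c c′ → Lost s₀ s))
  round-spec {Γ} {ρ} {s₀} g D S inv = conseq
    (λ (i , sh , l) → i , sh , λ c c′ c< c′< → l c c′ (subst (c <_) (sym n*1+2) c<) c′<)
    (do-for I₁ safe-features (inv , (λ x x< nz → nz) , λ c c′ ()) outer)
    where
    d = lookup ρ D
    I₁ : ℕ → Store → Set
    I₁ i s = PeelInv g d s × Shrinks s₀ s × (∀ c c′ → c < i → c′ < 2 + n → Fires d s₀ c c′ → Lost s₀ s)
    I₂ : ℕ → ℕ → Store → Set
    I₂ i j s = PeelInv g d s × Shrinks s₀ s × (∀ c c′ → c < i → c′ < 2 + n → Fires d s₀ c c′ → Lost s₀ s) ×
               (∀ c′ → c′ < j → Fires d s₀ i c′ → Lost s₀ s)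
    outer : ∀ i s → i < n * 1 + 2 → _ → I₁ i s → Tri (for (times 1 2) (peel₁C (suc zero) zero (suc (suc D)))) (i ∷ ρ) s (I₁ (suc i))
    outer i s i< same (inv₁ , sh₁ , l₁) = conseq
      (λ (inv₂ , sh₂ , l₂ , l₂′) → inv₂ , sh₂ , λ c c′ c< c′< → pick {run (for (times 1 2) (peel₁C (suc zero) zero (suc (suc D)))) (i ∷ ρ) s} c c′ c< c′< l₂ l₂′)
      (do-for (I₂ i) safe-features (inv₁ , sh₁ , l₁ , λ c′ ()) inner)
      where
      S₁ : Stat s
      S₁ = stat-same (same POW tt) (same KEY tt) (same MODE tt) S
      pick : ∀ {s} c c′ → c < suc i → c′ < 2 + n → (∀ c c′ → c < i → c′ < 2 + n → Fires d s₀ c c′ → Lost s₀ s) →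
             (∀ c′ → c′ < n * 1 + 2 → Fires d s₀ i c′ → Lost s₀ s) → Fires d s₀ c c′ → Lost s₀ s
      pick c c′ c< c′< l l′ with c ≟ i
      ... | yes refl = l′ c′ (subst (c′ <_) (sym n*1+2) c′<)
      ... | no c≢i = l c c′ (≤∧≢⇒< (s≤s⁻¹ c<) c≢i) c′<
      inner : ∀ j s₂ → j < n * 1 + 2 → (∀ a → T (keeps a (peel₁C {suc (suc Γ)} (suc zero) zero (suc (suc D)))) → Same a s₂ s) → I₂ i j s₂ →
              Tri (peel₁C (suc zero) zero (suc (suc D))) (j ∷ i ∷ ρ) s₂ (I₂ i (suc j))
      inner j s₂ j< same₂ (inv₂ , sh₂ , l₂ , l₂′) = conseq
        (λ (inv₃ , sh₃ , l₃ , f₃) → inv₃ , sh₃ , (λ c c′ c< c′< fr → l₃ (l₂ c c′ c< c′< fr)) , λ c′ c′< → now {run (peel₁C (suc zero) zero (suc (suc D))) (j ∷ i ∷ ρ) s₂} l₃ f₃ c′ c′<)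
        (peel₁-inv {s₀ = s₀} g (suc zero) zero (suc (suc D)) (stat-same (same₂ POW tt) (same₂ KEY tt) (same₂ MODE tt) S₁) inv₂ sh₂)
        where
        now : ∀ {s₃} → (Lost s₀ s₂ → Lost s₀ s₃) → (Fires d s₀ i j → Lost s₀ s₃) → ∀ c′ → c′ < suc j → Fires d s₀ i c′ → Lost s₀ s₃
        now l₃ f₃ c′ c′< fr with c′ ≟ j
        ... | yes refl = f₃ fr
        ... | no c′≢j = l₃ (l₂′ c′ (≤∧≢⇒< (s≤s⁻¹ c′<) c′≢j) fr)

  CanPeel : ℕ → ℕ → Set
  CanPeel g D = md ≡ true → ∀ (U : ℕ → ℕ) → (∀ x → x < n → U x ≢ 0 → Alive (suc g) D x) → (∃[ x ] x < n × U x ≢ 0) →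
    ∃[ c ] ∃[ c′ ] c < 2 + n × c′ < 2 + n × Peelable D U c c′ × (∃[ x ] (x < n × U x ≢ 0 × (PF c x ⊎ SF c′ x)))

  ref-alive : ∀ {Γ} {ρ : Vec ℕ Γ} {st} → Stat st → ∀ (D g x : Fin Γ) → lookup ρ x < n →
              Ref (val (aliveT D g x) ρ st) (md ≡ true × Alive (suc (lookup ρ g)) (lookup ρ D) (lookup ρ x))
  ref-alive {ρ = ρ} {st} S D g x x< = ref-map to′ from′
    (ref-and mode-ref (ref-and (ref-le {n} {st KEY i 0}) (ref-and (ref-le {st KEY i 0} {lookup ρ g})
      (ref-and (ref-not (ref-ex n (λ a a< → ref-and (ref-nz {A a i}) (ref-nonmember S d a a<))))
               (ref-not (ref-ex n (λ b b< → ref-and (ref-nz {A i b}) (ref-member S d b b<))))))))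
    where
    i = lookup ρ x
    d = lookup ρ D
    mode-ref : Ref (st MODE 0 0) (md ≡ true)
    mode-ref = subst (λ z → Ref z (md ≡ true)) (sym (mode S)) ref-bit
    to′ : _ → md ≡ true × Alive (suc (lookup ρ g)) d i
    to′ (e , n≤k , k≤g , no-pred , no-succ) = e , record
      { outside  = ¬true (λ Ci → <⇒≱ x< (≤-trans n≤k (≤-reflexive (trans (keys S i x<) (key-C Ci)))))
      ; labelled = s≤s (subst (_≤ lookup ρ g) (keys S i x<) k≤g)
      ; released = λ {a} a≺i → ¬false (λ a∉ → no-pred (a , proj₁ (A-bound a≺i) , a≺i , a∉))
      ; open-end = λ {b} i≺b → ¬true (λ b∈ → no-succ (b , proj₂ (A-bound i≺b) , i≺b , b∈))
      }
    from′ : md ≡ true × Alive (suc (lookup ρ g)) d i → _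
    from′ (e , al) = e , ≤-trans (m≤m+n n i) (≤-reflexive (sym (trans (keys S i x<) (key-¬C (outside al))))) ,
      subst (_≤ lookup ρ g) (sym (keys S i x<)) (s≤s⁻¹ (labelled al)) ,
      (λ (a , _ , a≺i , a∉) → true≢ a∉ (released al a≺i)) ,
      (λ (b , _ , i≺b , b∈) → true≢ (open-end al i≺b) b∈)

  init-alive-spec : ∀ {Γ} {ρ : Vec ℕ Γ} {st} → Stat st → ∀ (D g : Fin Γ) →
    Tri (initAliveC D g) ρ st (λ s → ∀ x → x < n → Ref (alive s x) (md ≡ true × Alive (suc (lookup ρ g)) (lookup ρ D) x))
  init-alive-spec {Γ} {ρ} {st} S D g = conseq (λ I x x< → I x x< (subst (x <_) (sym n*1) x<))
    (do-for (λ i s → ∀ x → x < n → x < i → Ref (alive s x) (P x)) safe-jobs (λ x _ ()) body)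
    where
    P : ℕ → Set
    P x = md ≡ true × Alive (suc (lookup ρ g)) (lookup ρ D) x
    written : ∀ s i b → Ref b (P i) → (∀ x → x < n → x < i → Ref (alive s x) (P x)) →
              ∀ x → x < n → x < suc i → Ref (put-at s ALIVE i 0 b ALIVE x 0) (P x)
    written s i b r I x x< x<i with i ≟ x
    ... | yes refl = subst (λ y → Ref y (P x)) (sym (put-hit s ALIVE i 0 b)) r
    ... | no i≢x = subst (λ y → Ref y (P x)) (sym (put-miss s ALIVE i 0 b ALIVE x 0 (λ _ e → contradiction e i≢x)))
                     (I x x< (≤∧≢⇒< (s≤s⁻¹ x<i) (i≢x ∘ sym)))
    body : ∀ i s → i < n * 1 + 0 → _ → _ → Tri (iff (aliveT (suc D) (suc g) zero) (put ALIVE v₀ (num 0) (num 1)) (put ALIVE v₀ (num 0) (num 0))) (i ∷ ρ) s _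
    body i s i< same I = do-if
      (λ nz → do-put 1<E (written s i 1 (ref (λ _ → to r nz) (λ _ ())) I))
      (λ z → do-put 0<E (written s i 0 (ref (λ k → contradiction refl k) (λ p → contradiction p (≡0⇒¬ r z))) I))
      where
      r = ref-alive {ρ = i ∷ ρ} {st = s} (stat-same (same POW tt) (same KEY tt) (same MODE tt) S) (suc D) (suc g) zero (subst (i <_) n*1 i<)

  peel-spec : ∀ {Γ} {ρ : Vec ℕ Γ} {st} → Stat st → ∀ (D g : Fin Γ) →
    Tri (peelC D g) ρ st (λ s → PeelInv (lookup ρ g) (lookup ρ D) s ×
                                (CanPeel (lookup ρ g) (lookup ρ D) → ∀ x → x < n → alive s x ≡ 0))
  peel-spec {Γ} {ρ} {st} S D g = do-seq (init-alive-spec S D g) λ R → conseq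
      (λ (inv , small) → inv , λ can → #≡0⇒ n _ (n≤0⇒n≡0 (≤-trans (small can) (≤-reflexive (trans (cong (n ∸_) n*1) (n∸n≡0 n))))))
      (do-for (λ r s → PeelInv gv d s × (CanPeel gv d → # n (alive s) ≤ n ∸ r)) safe-jobs
        (record { still-alive = λ x x< nz → to (R x x<) nz
                ; sound = λ e α cons x x< αx → from (R x x<) (e , Consistent.support cons x x< αx) } ,
         λ _ → #≤ n _)
        λ r s r< same (inv , cnt≤) → conseq
          (λ (inv′ , sh , fires) → inv′ , λ can → step r s (run (roundC (suc D)) (r ∷ ρ) s) inv sh fires can (cnt≤ can))
          (round-spec gv (suc D) (stat-same (λ i j → trans (same POW tt i j) (keep POW (initAliveC D g) tt ρ st i j))
                                            (λ i j → trans (same KEY tt i j) (keep KEY (initAliveC D g) tt ρ st i j))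
                                            (λ i j → trans (same MODE tt i j) (keep MODE (initAliveC D g) tt ρ st i j)) S) inv))
    where
    gv = lookup ρ g
    d = lookup ρ D
    step : ∀ r s s′ → PeelInv gv d s → Shrinks s s′ →
           (∀ c c′ → c < 2 + n → c′ < 2 + n → Fires d s c c′ → Lost s s′) → CanPeel gv d → # n (alive s) ≤ n ∸ r → # n (alive s′) ≤ n ∸ suc r
    step r s s′ inv sh fires can le with anyUpTo? (λ x → ¬? (alive s x ≟ 0)) n
    ... | no none = ≤-trans (≤-reflexive (⇒#≡0 n _ (λ x x< → decidable-stable (alive s′ x ≟ 0) (λ nz → none (x , x< , sh x x< nz))))) z≤n
    ... | yes (x , x< , sx) with can (proj₁ (still-alive inv x x< sx)) (alive s) (λ y y< sy → proj₂ (still-alive inv y y< sy)) (x , x< , sx)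
    ...   | c , c′ , c< , c′< , p , hit with fires c c′ c< c′< (p , hit)
    ...     | y , y< , sy , s′y = ≤-trans (pred-mono-≤ (≤-trans (#-mono-< n sh y y< s′y sy) le))
                                    (≤-reflexive (pred[m∸n]≡m∸[1+n] n r))

-- Correctness of the enumeration

module Enumeration
  (n m : ℕ) (A : ℕ → ℕ → ℕ) (E : ℕ) (Λ : ℕ → ℕ) (md : Bool) (C : ℕ → Bool)
  (A-bound : ∀ {u v} → A u v ≢ 0 → u < n × v < n) (A-irrefl : ∀ {u} → ¬ (A u u ≢ 0))
  (A-trans : ∀ {u v x} → A u v ≢ 0 → A v x ≢ 0 → A u x ≢ 0) (1≤m : 1 ≤ m)
  (E-big : 2 ^ n + (n + n + 2) < 2 ^ E) where

  open Setup n m A E Λ md C A-bound A-irrefl A-trans 1≤m E-big public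

  Closed : ℕ → ℕ → Set
  Closed g D = ∀ {u v} → u ≺ v → key u < g → key v < g → (D ∋ v) ≡ true → (D ∋ u) ≡ true

  ref-valid : ∀ {Γ} {ρ : Vec ℕ Γ} {st} → Stat st → ∀ (D g : Fin Γ) →
              Ref (val (validT D g) ρ st) (Closed (suc (lookup ρ g)) (lookup ρ D))
  ref-valid {ρ = ρ} {st} S D g = ref-map to′ from′
    (ref-not (ref-ex n λ u u< → ref-ex n λ v v< → ref-and (ref-nz {A u v})
      (ref-and (ref-le {st KEY u 0} {lookup ρ g}) (ref-and (ref-le {st KEY v 0} {lookup ρ g})
        (ref-and (ref-member S d v v<) (ref-not (ref-member S d u u<)))))))
    where
    d = lookup ρ D
    to′ : _ → Closed (suc (lookup ρ g)) d
    to′ none {u} {v} u≺v ku kv v∈ = decidable-stable ((d ∋ u) Data.Bool.≟ true) λ u∉ → none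
      (u , u< , v , v< , u≺v , subst (_≤ lookup ρ g) (sym (keys S u u<)) (s≤s⁻¹ ku) ,
        subst (_≤ lookup ρ g) (sym (keys S v v<)) (s≤s⁻¹ kv) , v∈ , u∉)
      where
      u< = proj₁ (A-bound u≺v)
      v< = proj₂ (A-bound u≺v)
    from′ : Closed (suc (lookup ρ g)) d → _
    from′ cl (u , u< , v , v< , u≺v , ku , kv , v∈ , u∉) =
      u∉ (cl u≺v (s≤s (subst (_≤ lookup ρ g) (keys S u u<) ku)) (s≤s (subst (_≤ lookup ρ g) (keys S v v<) kv)) v∈)

  record GenOK (h : ℕ) (s : Store) : Set where
    field
      members  : ∀ i → i < s LEN h 0 → s SEEN (s LIST i h) h ≢ 0
      distinct : ∀ i j → i < s LEN h 0 → j < s LEN h 0 → s LIST i h ≡ s LIST j h → i ≡ j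
      seen     : ∀ D → s SEEN D h ≢ 0 → D < 2 ^ n × Good md h D × (∃[ i ] (i < s LEN h 0 × s LIST i h ≡ D))
  open GenOK public

  record Elsewhere (h : ℕ) (s s′ : Store) : Set where
    field
      list≡ : ∀ i j → j ≢ h → s′ LIST i j ≡ s LIST i j
      len≡  : ∀ j → j ≢ h → s′ LEN j 0 ≡ s LEN j 0
      seen≡ : ∀ i j → j ≢ h → s′ SEEN i j ≡ s SEEN i j
      grow  : ∀ D → s SEEN D h ≢ 0 → s′ SEEN D h ≢ 0
  open Elsewhere public

  elsewhere-refl : ∀ {h s} → Elsewhere h s s
  elsewhere-refl = record { list≡ = λ _ _ _ → refl ; len≡ = λ _ _ → refl ; seen≡ = λ _ _ _ → refl ; grow = λ _ x → x }

  elsewhere-trans : ∀ {h s s′ s″} → Elsewhere h s s′ → Elsewhere h s′ s″ → Elsewhere h s s″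
  elsewhere-trans p q = record
    { list≡ = λ i j j≢ → trans (list≡ q i j j≢) (list≡ p i j j≢)
    ; len≡  = λ j j≢ → trans (len≡ q j j≢) (len≡ p j j≢)
    ; seen≡ = λ i j j≢ → trans (seen≡ q i j j≢) (seen≡ p i j j≢)
    ; grow  = λ D x → grow q D (grow p D x)
    }

  genOK-cong : ∀ {h s s′} → (∀ i → s′ LIST i h ≡ s LIST i h) → s′ LEN h 0 ≡ s LEN h 0 → (∀ i → s′ SEEN i h ≡ s SEEN i h) →
               GenOK h s → GenOK h s′
  genOK-cong {h} {s} {s′} li le se G = record
    { members  = λ i i< z → members G i (subst (i <_) le i<) (trans (sym (trans (se _) (cong (λ D → s SEEN D h) (li i)))) z)
    ; distinct = λ i j i< j< e → distinct G i j (subst (i <_) le i<) (subst (j <_) le j<) (trans (sym (li i)) (trans e (li j)))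
    ; seen     = λ D nz → let (D< , good , i , i< , e) = seen G D (λ z → nz (trans (se D) z)) in
                          D< , good , i , subst (i <_) (sym le) i< , trans (li i) e
    }

  genOK-elsewhere : ∀ {h h′ s s′} → h ≢ h′ → Elsewhere h′ s s′ → GenOK h s → GenOK h s′
  genOK-elsewhere h≢ e = genOK-cong (λ i → list≡ e i _ h≢) (len≡ e _ h≢) (λ i → seen≡ e i _ h≢)

  len≤count : ∀ {h s} → GenOK h s → s LEN h 0 ≤ # (2 ^ n) (λ D → s SEEN D h)
  len≤count {h} {s} G = #-inj (s LEN h 0) (2 ^ n) (λ D → s SEEN D h) (λ i → s LIST i h) (distinct G)
    (λ i i< → proj₁ (seen G _ (members G i i<)) , members G i i<)

  record-spec : ∀ {Γ} {ρ : Vec ℕ Γ} {s} (D g : Fin Γ) → GenOK (suc (lookup ρ g)) s → lookup ρ D < 2 ^ n →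
    Good md (suc (lookup ρ g)) (lookup ρ D) → s SEEN (lookup ρ D) (suc (lookup ρ g)) ≡ 0 →
    Tri (recordC D g) ρ s (λ s′ → GenOK (suc (lookup ρ g)) s′ × Elsewhere (suc (lookup ρ g)) s s′ ×
                                  s′ SEEN (lookup ρ D) (suc (lookup ρ g)) ≢ 0)
  record-spec {Γ} {ρ} {s} D g G d< good new =
    do-seq {Q = λ _ → ⊤} (do-put 1<E tt) λ _ → do-seq {Q = λ _ → ⊤} (do-put (small-set (≤-trans (<⇒≤ d<) (m≤m+n _ 1))) tt) λ _ →
    do-put (small-set (≤-trans (s≤s (≤-trans (len≤count G) (#≤ (2 ^ n) _))) (≤-reflexive (+-comm 1 (2 ^ n))))) (
      record { members = listed ; distinct = dis ; seen = see } ,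
      record { list≡ = λ i j j≢ → put-miss s₁ LIST ℓ h d LIST i j (λ _ _ → j≢ ∘ sym)
             ; len≡  = λ j j≢ → put-miss s₂ LEN h 0 (suc ℓ) LEN j 0 (λ _ e → contradiction (sym e) j≢)
             ; seen≡ = λ i j j≢ → put-miss s SEEN d h 1 SEEN i j (λ _ _ → j≢ ∘ sym)
             ; grow  = mono } ,
      λ z → 1+n≢0 (trans (sym (put-hit s SEEN d h 1)) z))
    where
    d = lookup ρ D
    h = suc (lookup ρ g)
    ℓ = s LEN h 0
    s₁ = put-at s SEEN d h 1
    s₂ = put-at s₁ LIST ℓ h d
    s₃ = put-at s₂ LEN h 0 (suc ℓ)
    len₃ : s₃ LEN h 0 ≡ suc ℓ
    len₃ = put-hit s₂ LEN h 0 (suc ℓ)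
    last : s₃ LIST ℓ h ≡ d
    last = put-hit s₁ LIST ℓ h d
    old : ∀ i → i ≢ ℓ → s₃ LIST i h ≡ s LIST i h
    old i i≢ = put-miss s₁ LIST ℓ h d LIST i h (λ _ e → contradiction (sym e) i≢)
    mono : ∀ D → s SEEN D h ≢ 0 → s₃ SEEN D h ≢ 0
    mono D nz z with D ≟ d
    ... | yes refl = 1+n≢0 (trans (sym (put-hit s SEEN d h 1)) z)
    ... | no D≢ = nz (trans (sym (put-miss s SEEN d h 1 SEEN D h (λ _ e → contradiction (sym e) D≢))) z)
    listed : ∀ i → i < s₃ LEN h 0 → s₃ SEEN (s₃ LIST i h) h ≢ 0
    listed i i< with i ≟ ℓ
    ... | yes refl = subst (λ D → s₃ SEEN D h ≢ 0) (sym last) (λ z → 1+n≢0 (trans (sym (put-hit s SEEN d h 1)) z))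
    ... | no i≢ = subst (λ D → s₃ SEEN D h ≢ 0) (sym (old i i≢))
                    (mono _ (members G i (≤∧≢⇒< (s≤s⁻¹ (subst (i <_) len₃ i<)) i≢)))
    below : ∀ i → i < s₃ LEN h 0 → i ≢ ℓ → i < ℓ
    below i i< i≢ = ≤∧≢⇒< (s≤s⁻¹ (subst (i <_) len₃ i<)) i≢
    fresh : ∀ i → i < s₃ LEN h 0 → i ≢ ℓ → s₃ LIST i h ≢ d
    fresh i i< i≢ e = members G i (below i i< i≢) (trans (cong (λ D → s SEEN D h) (trans (sym (old i i≢)) e)) new)
    dis : ∀ i j → i < s₃ LEN h 0 → j < s₃ LEN h 0 → s₃ LIST i h ≡ s₃ LIST j h → i ≡ j
    dis i j i< j< e with i ≟ ℓ | j ≟ ℓ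
    ... | yes refl | yes refl = refl
    ... | yes refl | no j≢    = contradiction (trans (sym e) last) (fresh j j< j≢)
    ... | no i≢    | yes refl = contradiction (trans e last) (fresh i i< i≢)
    ... | no i≢    | no j≢    = distinct G i j (below i i< i≢) (below j j< j≢) (trans (sym (old i i≢)) (trans e (old j j≢)))
    see : ∀ D → s₃ SEEN D h ≢ 0 → D < 2 ^ n × Good md h D × (∃[ i ] (i < s₃ LEN h 0 × s₃ LIST i h ≡ D))
    see D nz with D ≟ d
    ... | yes refl = d< , good , ℓ , subst (ℓ <_) (sym len₃) ≤-refl , last
    ... | no D≢ with seen G D (λ z → nz (trans (put-miss s SEEN d h 1 SEEN D h (λ _ e → contradiction (sym e) D≢)) z))
    ...   | D< , good′ , i , i< , e = D< , good′ , i , subst (i <_) (sym len₃) (m≤n⇒m≤1+n i<) , trans (old i (<⇒≢ i<)) e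

  Accept : ℕ → ℕ → Set
  Accept g D = Closed (suc g) D × CanPeel g D

  attempt-spec : ∀ {Γ} {ρ : Vec ℕ Γ} {s} (D g : Fin Γ) → Stat s → GenOK (suc (lookup ρ g)) s → lookup ρ D < 2 ^ n →
    (∀ x → x < n → suc (lookup ρ g) ≤ key x → (lookup ρ D ∋ x) ≡ false) →
    Tri (attemptC D g) ρ s (λ s′ → GenOK (suc (lookup ρ g)) s′ × Elsewhere (suc (lookup ρ g)) s s′ ×
                                   (Accept (lookup ρ g) (lookup ρ D) → s′ SEEN (lookup ρ D) (suc (lookup ρ g)) ≢ 0))
  attempt-spec {Γ} {ρ} {s} D g S G d< unl = do-if
    (λ nz → do-seq (peel-spec S D g) λ (inv , empties) →
      let s₁ = run (peelC D g) ρ s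
          k : ∀ a → T (keeps a (peelC D g)) → Same a s₁ s
          k a t = keep a (peelC D g) t ρ s
          G₁ : GenOK h s₁
          G₁ = genOK-cong (λ i → k LIST tt i h) (k LEN tt h 0) (λ i → k SEEN tt i h) G
          e₁ : Elsewhere h s s₁
          e₁ = record { list≡ = λ i j _ → k LIST tt i j ; len≡ = λ j _ → k LEN tt j 0 ; seen≡ = λ i j _ → k SEEN tt i j
                      ; grow = λ D nz z → nz (trans (sym (k SEEN tt D h)) z) }
          r = ref-and (ref-not (ref-ex n λ x _ → ref-nz {alive s₁ x})) (ref-not (ref-nz {s₁ SEEN d h}))
      in do-if
        (λ hit → let (none , new) = to r hit in conseq
          (λ (G₂ , e₂ , now) → G₂ , elsewhere-trans e₁ e₂ , λ _ → now)
          (record-spec D g G₁ d< (record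
            { unlabelled = unl
            ; closed     = to (ref-valid {ρ = ρ} S D g) nz
            ; unstuck    = λ e α cons x x< → decidable-stable (α x ℤ.≟ 0ℤ) λ αx → none (x , x< , PeelInv.sound inv e α cons x x< αx)
            }) (decidable-stable (_ ≟ 0) new)))
        (λ miss → do-skp (G₁ , e₁ , λ (_ , can) z → ≡0⇒¬ r miss ((λ (x , x< , nz) → nz (empties can x x<)) , λ nz → nz z))))
    (λ z → do-skp (G , elsewhere-refl , λ (cl , _) → contradiction (λ {u} {v} → cl {u} {v}) (≡0⇒¬ (ref-valid {ρ = ρ} S D g) z)))
    where
    d = lookup ρ D
    h = suc (lookup ρ g)

  Cand : ℕ → ℕ → ℕ → Set
  Cand g D₀ D = D ≡ D₀ ⊎ (∃[ v ] v < n × key v ≡ g × D ≡ D₀ + 2 ^ v)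

  grow-spec : ∀ {i g s} → Stat s → i < s LEN g 0 → GenOK g s → GenOK (suc g) s →
    Tri growC (i ∷ g ∷ []) s (λ s′ → GenOK (suc g) s′ × Elsewhere (suc g) s s′ ×
      (∀ D → Cand g (s LIST i g) D → Accept g D → s′ SEEN D (suc g) ≢ 0))
  grow-spec {i} {g} {s} S i< Gg G = do-seq
      (do-let (small-set (≤-trans (<⇒≤ D₀<) (m≤m+n _ 1)))
        (attempt-spec zero (suc (suc zero)) S G D₀< (λ x x< le → Good.unlabelled good x x< (≤-trans (n≤1+n g) le))))
      λ (G₁ , e₁ , acc₁) → let s₁ = run (lett (arr LIST v₀ v₁) (attemptC zero (suc (suc zero)))) (i ∷ g ∷ []) s in conseq
        (λ (G₂ , e₂ , keep₀ , acc₂) → G₂ , e₂ , λ { D (inj₁ refl) a → keep₀ (acc₁ a)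
                                              ; D (inj₂ (v , v< , kv , refl)) a → acc₂ v v< (subst (v <_) (sym n*1) v<) kv a })
        (do-for (λ w s′ → GenOK (suc g) s′ × Elsewhere (suc g) s s′ × (s₁ SEEN D₀ (suc g) ≢ 0 → s′ SEEN D₀ (suc g) ≢ 0) ×
                          (∀ v → v < n → v < w → key v ≡ g → Accept g (D₀ + 2 ^ v) → s′ SEEN (D₀ + 2 ^ v) (suc g) ≢ 0))
          safe-jobs (G₁ , e₁ , (λ x → x) , λ v _ ())
          (body s₁ (stat-same (keep POW first tt (i ∷ g ∷ []) s) (keep KEY first tt (i ∷ g ∷ []) s) (keep MODE first tt (i ∷ g ∷ []) s) S)))
    where
    first : Cmd 2
    first = lett (arr LIST v₀ v₁) (attemptC zero (suc (suc zero)))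
    D₀ = s LIST i g
    D₀< = proj₁ (seen Gg D₀ (members Gg i i<))
    good = proj₁ (proj₂ (seen Gg D₀ (members Gg i i<)))
    I : Store → ℕ → Store → Set
    I s₁ w s′ = GenOK (suc g) s′ × Elsewhere (suc g) s s′ × (s₁ SEEN D₀ (suc g) ≢ 0 → s′ SEEN D₀ (suc g) ≢ 0) ×
                (∀ v → v < n → v < w → key v ≡ g → Accept g (D₀ + 2 ^ v) → s′ SEEN (D₀ + 2 ^ v) (suc g) ≢ 0)
    second : Cmd 3
    second = iff (eqT (cell KEY v₀) (var (suc (suc zero))))
      (lett (addT (arr LIST v₁ (var (suc (suc zero)))) (cell POW v₀)) (attemptC zero (suc (suc (suc zero))))) skp
    body : ∀ s₁ → Stat s₁ → ∀ v s₂ → v < n * 1 + 0 → (∀ a → T (keeps a second) → Same a s₂ s₁) →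
           I s₁ v s₂ → Tri second (v ∷ i ∷ g ∷ []) s₂ (I s₁ (suc v))
    body s₁ S₁ v s₂ v<′ same (G₂ , e₂ , keep₀ , acc₂) = do-if hit miss
      where
      v< : v < n
      v< = subst (v <_) n*1 v<′
      S₂ : Stat s₂
      S₂ = stat-same (same POW tt) (same KEY tt) (same MODE tt) S₁
      D′ = s₂ LIST i g + s₂ POW v 0
      D′≡ : D′ ≡ D₀ + 2 ^ v
      D′≡ = cong₂ _+_ (list≡ e₂ i g (λ e → 1+n≢n (sym e))) (pow S₂ v (<⇒≤ v<))
      hit : ⟦ eq ⟧ᵒ (s₂ KEY v 0) g ≢ 0 → Tri _ _ s₂ (I s₁ (suc v))
      hit nz = do-let (small-set (≤-trans (<⇒≤ D′<) (m≤m+n _ 1)))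
        (conseq (λ (G₃ , e₃ , acc₃) → G₃ , elsewhere-trans e₂ e₃ , (λ x → grow e₃ D₀ (keep₀ x)) , done e₃ acc₃)
          (attempt-spec zero (suc (suc (suc zero))) S₂ G₂ D′< unl))
        where
        kv : key v ≡ g
        kv = trans (sym (keys S₂ v v<)) (to ref-eq nz)
        v∉ : (D₀ ∋ v) ≡ false
        v∉ = Good.unlabelled good v v< (≤-reflexive (sym kv))
        D′< : D′ < 2 ^ n
        D′< = subst (_< 2 ^ n) (sym D′≡) (add-bit< n D₀ v v< D₀< v∉)
        unl : ∀ x → x < n → suc g ≤ key x → (D′ ∋ x) ≡ false
        unl x x< le = trans (cong (_∋ x) D′≡) (trans (add-bit-other D₀ v v∉ x (λ { refl → <-irrefl (sym kv) le }))
                        (Good.unlabelled good x x< (≤-trans (n≤1+n g) le)))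
        done : ∀ {s₃} → Elsewhere (suc g) s₂ s₃ → (Accept g D′ → s₃ SEEN D′ (suc g) ≢ 0) →
               ∀ u → u < n → u < suc v → key u ≡ g → Accept g (D₀ + 2 ^ u) → s₃ SEEN (D₀ + 2 ^ u) (suc g) ≢ 0
        done {s₃} e₃ acc₃ u u< u<v ku a with u ≟ v
        ... | yes refl = subst (λ D → s₃ SEEN D (suc g) ≢ 0) D′≡ (acc₃ (subst (Accept g) (sym D′≡) a))
        ... | no u≢v = grow e₃ _ (acc₂ u u< (≤∧≢⇒< (s≤s⁻¹ u<v) u≢v) ku a)
      miss : ⟦ eq ⟧ᵒ (s₂ KEY v 0) g ≡ 0 → Tri skp _ s₂ (I s₁ (suc v))
      miss z = do-skp (G₂ , e₂ , keep₀ , skipped)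
        where
        skipped : ∀ u → u < n → u < suc v → key u ≡ g → Accept g (D₀ + 2 ^ u) → s₂ SEEN (D₀ + 2 ^ u) (suc g) ≢ 0
        skipped u u< u<v ku a with u ≟ v
        ... | yes refl = contradiction (trans (keys S₂ v v<) ku) (≡0⇒¬ ref-eq z)
        ... | no u≢v = acc₂ u u< (≤∧≢⇒< (s≤s⁻¹ u<v) u≢v) ku a

  data InFam : ℕ → ℕ → Set where
    start  : InFam 0 0
    extend : ∀ {g D₀ D} → InFam g D₀ → Cand g D₀ D → Accept g D → InFam (suc g) D

  record EnumInv (g : ℕ) (s : Store) : Set where
    field
      current  : GenOK g s
      no-len   : ∀ h → g < h → s LEN h 0 ≡ 0
      no-seen  : ∀ h D → g < h → s SEEN D h ≡ 0
      complete : ∀ D → InFam g D → s SEEN D g ≢ 0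
  open EnumInv public

  module _ (size : ∀ h F → (∀ D → D < 2 ^ n → F D ≢ 0 → Good md h D) → # (2 ^ n) F ≤ Λ LEN) where

    len≤Λ : ∀ {h s} → GenOK h s → s LEN h 0 ≤ Λ LEN
    len≤Λ G = ≤-trans (len≤count G) (size _ _ (λ D _ nz → proj₁ (proj₂ (seen G D nz))))

    n*2 : n * 2 + 0 ≡ n + n
    n*2 = trans (+-identityʳ _) (trans (*-comm n 2) (cong (n +_) (+-identityʳ n)))

    enum-spec : ∀ {s} → Stat s → EnumInv 0 s → Tri enumC [] s (EnumInv (n + n))
    enum-spec {s} S inv = conseq (subst (λ N → EnumInv N (run enumC [] s)) n*2)
      (do-for EnumInv (small (≤-trans (≤-reflexive n*2) (m≤m+n _ 2))) inv generation)
      where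
      generation : ∀ g s₁ → g < n * 2 + 0 → (∀ a → T (keeps a (for (len LEN (v₀ {0})) growC)) → Same a s₁ s) → EnumInv g s₁ →
                   Tri (for (len LEN v₀) growC) (g ∷ []) s₁ (EnumInv (suc g))
      generation g s₁ g< same inv₁ = conseq finish
        (do-for (λ i s₂ → GenOK (suc g) s₂ × Elsewhere (suc g) s₁ s₂ ×
                          (∀ j D → j < i → Cand g (s₁ LIST j g) D → Accept g D → s₂ SEEN D (suc g) ≢ 0))
          (len≤Λ (current inv₁)) (empty , elsewhere-refl , λ _ _ ()) body)
        where
        S₁ : Stat s₁
        S₁ = stat-same (same POW tt) (same KEY tt) (same MODE tt) S
        g≢ : g ≢ suc g
        g≢ e = 1+n≢n (sym e)
        empty : GenOK (suc g) s₁
        empty = record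
          { members  = λ i i< → contradiction (subst (i <_) (no-len inv₁ (suc g) ≤-refl) i<) λ ()
          ; distinct = λ i j i< → contradiction (subst (i <_) (no-len inv₁ (suc g) ≤-refl) i<) λ ()
          ; seen     = λ D nz → contradiction (no-seen inv₁ (suc g) D ≤-refl) nz
          }
        body : ∀ i s₂ → i < s₁ LEN g 0 → (∀ a → T (keeps a growC) → Same a s₂ s₁) →
               GenOK (suc g) s₂ × Elsewhere (suc g) s₁ s₂ × (∀ j D → j < i → Cand g (s₁ LIST j g) D → Accept g D → s₂ SEEN D (suc g) ≢ 0) →
               Tri growC (i ∷ g ∷ []) s₂ (λ s₃ → GenOK (suc g) s₃ × Elsewhere (suc g) s₁ s₃ ×
                          (∀ j D → j < suc i → Cand g (s₁ LIST j g) D → Accept g D → s₃ SEEN D (suc g) ≢ 0))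
        body i s₂ i< same₂ (G₂ , e₂ , acc₂) = conseq
          (λ (G₃ , e₃ , acc₃) → G₃ , elsewhere-trans e₂ e₃ , all e₃ acc₃)
          (grow-spec (stat-same (same₂ POW tt) (same₂ KEY tt) (same₂ MODE tt) S₁)
            (subst (i <_) (sym (len≡ e₂ g g≢)) i<) (genOK-elsewhere g≢ e₂ (current inv₁)) G₂)
          where
          all : ∀ {s₃} → Elsewhere (suc g) s₂ s₃ → (∀ D → Cand g (s₂ LIST i g) D → Accept g D → s₃ SEEN D (suc g) ≢ 0) →
                ∀ j D → j < suc i → Cand g (s₁ LIST j g) D → Accept g D → s₃ SEEN D (suc g) ≢ 0
          all e₃ acc₃ j D j< c a with j ≟ i
          ... | yes refl = acc₃ D (subst (λ D₀ → Cand g D₀ D) (sym (list≡ e₂ j g g≢)) c) a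
          ... | no j≢i = grow e₃ D (acc₂ j D (≤∧≢⇒< (s≤s⁻¹ j<) j≢i) c a)
        finish : ∀ {s₂} → GenOK (suc g) s₂ × Elsewhere (suc g) s₁ s₂ ×
                 (∀ j D → j < s₁ LEN g 0 → Cand g (s₁ LIST j g) D → Accept g D → s₂ SEEN D (suc g) ≢ 0) → EnumInv (suc g) s₂
        finish {s₂} (G₂ , e₂ , acc₂) = record
          { current  = G₂
          ; no-len   = λ h g<h → trans (len≡ e₂ h (λ e → <-irrefl (sym e) g<h)) (no-len inv₁ h (<-trans ≤-refl g<h))
          ; no-seen  = λ h D g<h → trans (seen≡ e₂ D h (λ e → <-irrefl (sym e) g<h)) (no-seen inv₁ h D (<-trans ≤-refl g<h))
          ; complete = comp
          }
          where
          comp : ∀ D → InFam (suc g) D → s₂ SEEN D (suc g) ≢ 0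
          comp D (extend {D₀ = D₀} fam c a) with seen (current inv₁) D₀ (complete inv₁ D₀ fam)
          ... | _ , _ , j , j< , e = acc₂ j D j< (subst (λ D₀ → Cand g D₀ D) (sym e) c) a

-- Correctness of the dynamic program

module DynamicProgram
  (n m : ℕ) (A : ℕ → ℕ → ℕ) (E : ℕ) (Λ : ℕ → ℕ) (md : Bool) (C : ℕ → Bool)
  (A-bound : ∀ {u v} → A u v ≢ 0 → u < n × v < n) (A-irrefl : ∀ {u} → ¬ (A u u ≢ 0))
  (A-trans : ∀ {u v x} → A u v ≢ 0 → A v x ≢ 0 → A u x ≢ 0) (1≤m : 1 ≤ m)
  (E-big : 2 ^ n + (n + n + 2) < 2 ^ E) (L : ℕ) (lst : ℕ → ℕ)
  (lst< : ∀ i → i < L → lst i < 2 ^ n) (L≤ : L ≤ Λ LEN) (L≤₂ : bit md * L ≤ Λ LEN₂) (L≤2^n : L ≤ 2 ^ n) where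

  open Enumeration n m A E Λ md C A-bound A-irrefl A-trans 1≤m E-big public

  Mem : ℕ → Set
  Mem D = ∃[ i ] i < L × lst i ≡ D

  mem< : ∀ {D} → Mem D → D < 2 ^ n
  mem< (i , i< , refl) = lst< i i<

  record Stat₂ (s : Store) : Set where
    field
      stat  : Stat s
      len-L : s LEN (n + n) 0 ≡ L
      list  : ∀ i → s LIST i (n + n) ≡ lst i
  open Stat₂ public

  stat₂-same : ∀ {s st} → (∀ a → a ≡ POW ⊎ a ≡ KEY ⊎ a ≡ MODE ⊎ a ≡ LEN ⊎ a ≡ LIST → Same a s st) → Stat₂ st → Stat₂ s
  stat₂-same f S = record
    { stat  = stat-same (f POW (inj₁ refl)) (f KEY (inj₂ (inj₁ refl))) (f MODE (inj₂ (inj₂ (inj₁ refl)))) (stat S)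
    ; len-L = trans (f LEN (inj₂ (inj₂ (inj₂ (inj₁ refl)))) _ _) (len-L S)
    ; list  = λ i → trans (f LIST (inj₂ (inj₂ (inj₂ (inj₂ refl)))) _ _) (list S i)
    }

  keepsAll : ∀ {Γ} → Cmd Γ → Bool
  keepsAll c = keeps POW c ∧ keeps KEY c ∧ keeps MODE c ∧ keeps LEN c ∧ keeps LIST c

  stat₂-kept : ∀ {Γ s st} (c : Cmd Γ) → T (keepsAll c) → (∀ a → T (keeps a c) → Same a s st) → Stat₂ st → Stat₂ s
  stat₂-kept {s = s} {st} c t f = stat₂-same λ where
    a (inj₁ refl) → f a (∧-left t)
    a (inj₂ (inj₁ refl)) → f a (∧-left (∧-right {keeps POW c} t))
    a (inj₂ (inj₂ (inj₁ refl))) → f a (∧-left (∧-right {keeps KEY c} (∧-right {keeps POW c} t)))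
    a (inj₂ (inj₂ (inj₂ (inj₁ refl)))) → f a (∧-left (∧-right {keeps MODE c} (∧-right {keeps KEY c} (∧-right {keeps POW c} t))))
    a (inj₂ (inj₂ (inj₂ (inj₂ refl)))) → f a (∧-right {keeps LEN c} (∧-right {keeps MODE c} (∧-right {keeps KEY c} (∧-right {keeps POW c} t))))

  stat₂-run : ∀ {Γ} (c : Cmd Γ) → T (keepsAll c) → ∀ ρ s → Stat₂ s → Stat₂ (run c ρ s)
  stat₂-run c t ρ s = stat₂-kept c t (λ a k → keep a c k ρ s)

  set-word : ∀ {x} → x < 2 ^ n → x < 2 ^ E
  set-word x< = small-set (≤-trans (<⇒≤ x<) (m≤m+n _ 1))

  for-list : ∀ {Γ} {ρ : Vec ℕ Γ} {st} {b : Bound Γ} {c : Cmd (suc (suc Γ))} → bval b ρ st ≡ L → SafeB b ρ st → Stat₂ st → T (keepsAll c) →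
    (I : ℕ → Store → Set) → I 0 st →
    (∀ i s → i < L → Stat₂ s → (∀ a → T (keeps a c) → Same a s st) → I i s → Tri c (lst i ∷ i ∷ ρ) s (I (suc i))) →
    Tri (for b (lett (arr LIST v₀ 2nT) c)) ρ st (I L)
  for-list {ρ = ρ} {st} {b} {c} b≡ sb S k I base step = conseq (subst (λ N → I N (run (for b (lett (arr LIST v₀ 2nT) c)) ρ st)) b≡)
    (do-for I sb base λ i s i< same Ii →
      let i<L = subst (i <_) b≡ i<
          S′ = stat₂-kept c k same S
      in do-let (subst (_< 2 ^ E) (sym (list S′ i)) (set-word (lst< i i<L)))
                (subst (λ D → Tri c (D ∷ i ∷ ρ) s (I (suc i))) (sym (list S′ i)) (step i s i<L S′ same Ii)))

  all-sets : ∀ {Γ} {ρ : Vec ℕ Γ} {st} {c : Cmd (suc (suc Γ))} → Stat₂ st → T (keepsAll c) →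
    (I : ℕ → Store → Set) → I 0 st →
    (∀ i s → i < L → Stat₂ s → (∀ a → T (keeps a c) → Same a s st) → I i s → Tri c (lst i ∷ i ∷ ρ) s (I (suc i))) →
    Tri (allSets c) ρ st (I L)
  all-sets S = for-list (len-L S) (subst (_≤ Λ LEN) (sym (len-L S)) L≤) S

  Sound : ℕ → Store → Set
  Sound t s = ∀ D τ → s REACH D τ ≢ 0 → τ ≤ t × Prefix τ D

  data Path : ℕ → ℕ → Set where
    start : Mem 0 → Path 0 0
    next  : ∀ {τ D D′} → Path τ D → Mem D′ → Step D D′ → Path (suc τ) D′

  path-mem : ∀ {τ D} → Path τ D → Mem D
  path-mem (start e)    = e
  path-mem (next _ e _) = e

  Complete : ℕ → Store → Set
  Complete t s = ∀ D τ → τ ≤ t → Path τ D → s REACH D τ ≢ 0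

  ref-step : ∀ {Γ} {ρ : Vec ℕ Γ} {s} → Stat s → ∀ (D D′ : Fin Γ) →
             Ref (val (stepT D D′) ρ s) (Step (lookup ρ D) (lookup ρ D′))
  ref-step {ρ = ρ} {s} S D D′ = ref-map to′ from′ (ref-and
      (ref-not (ref-ex n λ v v< → ref-and (ref-member S d v v<) (ref-nonmember S d′ v v<)))
      (ref-and (ref-le {# n (λ v → tb d′ v * ⟦ eq ⟧ᵒ (tb d v) 0)} {m})
        (ref-not (ref-ex n λ u u< → ref-ex n λ v v< → ref-and (ref-nz {A u v}) (ref-and (ref-member S d′ v v<)
          (ref-and (ref-nonmember S d v v<) (ref-nonmember S d u u<)))))))
    where
    d = lookup ρ D
    d′ = lookup ρ D′
    tb : ℕ → ℕ → ℕ
    tb x v = ⟦ mod ⟧ᵒ (⟦ div ⟧ᵒ x (s POW v 0)) 2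
    same-count : # n (λ v → tb d′ v * ⟦ eq ⟧ᵒ (tb d v) 0) ≡ # n (λ v → bit (d′ ∋ v) * bit (not (d ∋ v)))
    same-count = ≤-antisym
      (#-mono n λ v v< nz → from (ref-and ref-bit (ref-bit {not (d ∋ v)})) (let (a , b) = to (r v v<) nz in a , cong not b))
      (#-mono n λ v v< nz → from (r v v<) (let (a , b) = to (ref-and ref-bit (ref-bit {not (d ∋ v)})) nz in a , not-true b))
      where
      r : ∀ v → v < n → Ref (tb d′ v * ⟦ eq ⟧ᵒ (tb d v) 0) ((d′ ∋ v) ≡ true × (d ∋ v) ≡ false)
      r v v< = ref-and (ref-member S d′ v v<) (ref-nonmember S d v v<)
      not-true : ∀ {b} → not b ≡ true → b ≡ false
      not-true {false} _ = refl
    Spelled = ¬ (∃[ v ] (v < n × (d ∋ v) ≡ true × (d′ ∋ v) ≡ false)) ×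
              # n (λ v → tb d′ v * ⟦ eq ⟧ᵒ (tb d v) 0) ≤ m ×
              ¬ (∃[ u ] (u < n × (∃[ v ] (v < n × u ≺ v × (d′ ∋ v) ≡ true × (d ∋ v) ≡ false × (d ∋ u) ≡ false))))
    to′ : Spelled → Step d d′
    to′ (g , f , r) = record
      { grows = λ v v< v∈ → ¬false λ v∉ → g (v , v< , v∈ , v∉)
      ; fits  = subst (_≤ m) same-count f
      ; ready = λ {u} {v} u≺v v∈ v∉ → ¬false λ u∉ → r (u , proj₁ (A-bound u≺v) , v , proj₂ (A-bound u≺v) , u≺v , v∈ , v∉ , u∉)
      }
    from′ : Step d d′ → Spelled
    from′ st = (λ (v , v< , v∈ , v∉) → true≢ v∉ (Step.grows st v v< v∈)) , subst (_≤ m) (sym same-count) (Step.fits st) ,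
               (λ (u , _ , v , _ , u≺v , v∈ , v∉ , u∉) → true≢ u∉ (Step.ready st u≺v v∈ v∉))

  reach-put : ∀ {s D t} → s REACH D t ≢ 0 → ∀ D′ t′ → put-at s REACH D′ t′ 1 REACH D t ≢ 0
  reach-put {s} {D} {t} nz D′ t′ z with D′ ≟ D | t′ ≟ t
  ... | yes refl | yes refl = 1+n≢0 (trans (sym (put-hit s REACH D′ t′ 1)) z)
  ... | no D≢ | _ = nz (trans (sym (put-miss s REACH D′ t′ 1 REACH D t (λ _ e → contradiction e D≢))) z)
  ... | _ | no t≢ = nz (trans (sym (put-miss s REACH D′ t′ 1 REACH D t (λ _ _ → t≢))) z)

  sound-put : ∀ {t s D′} → Sound (suc t) s → Prefix (suc t) D′ → Sound (suc t) (put-at s REACH D′ (suc t) 1)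
  sound-put {t} {s} {D′} snd p D τ nz with D′ ≟ D | suc t ≟ τ
  ... | yes refl | yes refl = ≤-refl , p
  ... | no D≢ | _ = snd D τ (λ z → nz (trans (put-miss s REACH D′ (suc t) 1 REACH D τ (λ _ e → contradiction e D≢)) z))
  ... | _ | no t≢ = snd D τ (λ z → nz (trans (put-miss s REACH D′ (suc t) 1 REACH D τ (λ _ _ → t≢)) z))

  Grows : Store → Store → Set
  Grows s₀ s = ∀ D τ → s₀ REACH D τ ≢ 0 → s REACH D τ ≢ 0

  sound-suc : ∀ {t s} → Sound t s → Sound (suc t) s
  sound-suc snd D τ nz = let (l , p) = snd D τ nz in m≤n⇒m≤1+n l , p

  -- Entries at time t only ever come from the store before the round.
  Frozen : ℕ → Store → Store → Set
  Frozen t s₀ s = ∀ D → s REACH D t ≡ s₀ REACH D t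

  pairs-spec : ∀ {t s₀} → Stat₂ s₀ → s₀ LEN₂ 0 0 ≡ bit md * L → Sound t s₀ →
    Tri pairsC (t ∷ []) s₀ (λ s → Sound (suc t) s × Grows s₀ s × Frozen t s₀ s ×
      (md ≡ true → ∀ {D D′} → Mem D → Mem D′ → s₀ REACH D t ≢ 0 → Step D D′ → s REACH D′ (suc t) ≢ 0))
  pairs-spec {t} {s₀} S len₂ snd = by-mode md refl
    where
    body₂ : Cmd 5
    body₂ = iff (andT (arr REACH v₀ (var (suc (suc (suc (suc zero)))))) (stepT zero (suc (suc zero))))
              (put REACH (var (suc (suc zero))) (addT (num 1) (var (suc (suc (suc (suc zero)))))) (num 1)) skp
    Goal : Store → Set
    Goal s = Sound (suc t) s × Grows s₀ s × Frozen t s₀ s ×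
      (md ≡ true → ∀ {D D′} → Mem D → Mem D′ → s₀ REACH D t ≢ 0 → Step D D′ → s REACH D′ (suc t) ≢ 0)
    I : ℕ → Store → Set
    I i s = Sound (suc t) s × Grows s₀ s × Frozen t s₀ s ×
      (∀ i′ D → i′ < i → Mem D → s₀ REACH D t ≢ 0 → Step D (lst i′) → s REACH (lst i′) (suc t) ≢ 0)
    K : ℕ → ℕ → Store → Set
    K i j s = I i s × (∀ j′ → j′ < j → s₀ REACH (lst j′) t ≢ 0 → Step (lst j′) (lst i) → s REACH (lst i) (suc t) ≢ 0)
    by-mode : ∀ b → md ≡ b → Tri pairsC (t ∷ []) s₀ Goal
    by-mode false e = conseq (λ (a , b , c) → a , b , c , λ e′ → contradiction (trans (sym e) e′) λ ())
      (do-for (λ i s → Sound (suc t) s × Grows s₀ s × Frozen t s₀ s) (subst (_≤ Λ LEN₂) (sym len₂) L≤₂)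
        (sound-suc {s = s₀} snd , (λ _ _ z → z) , λ _ → refl)
        (λ i s i< _ _ → contradiction (subst (i <_) (trans len₂ (cong (λ b → bit b * L) e)) i<) λ ()))
    by-mode true e = conseq
      (λ (a , b , c , d) → a , b , c , λ { _ Dm (i , i< , refl) nz st → d i _ i< Dm nz st })
      (for-list len≡L sb S tt I (sound-suc {s = s₀} snd , (λ _ _ z → z) , (λ _ → refl) , λ _ _ ()) outer)
      where
      len≡L : s₀ LEN₂ 0 0 ≡ L
      len≡L = trans len₂ (trans (cong (λ b → bit b * L) e) (*-identityˡ L))
      sb : s₀ LEN₂ 0 0 ≤ Λ LEN₂
      sb = subst (_≤ Λ LEN₂) (sym len₂) L≤₂
      outer : ∀ i s → i < L → Stat₂ s → (∀ a → T (keeps a (for (len LEN₂ (num {3} 0)) (lett (arr LIST v₀ 2nT) body₂))) → Same a s s₀) → I i s →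
              Tri (for (len LEN₂ (num 0)) (lett (arr LIST v₀ 2nT) body₂)) (lst i ∷ i ∷ t ∷ []) s (I (suc i))
      outer i s i< S₁ same Ii = conseq (finish {run (for (len LEN₂ (num 0)) (lett (arr LIST v₀ 2nT) body₂)) (lst i ∷ i ∷ t ∷ []) s})
        (for-list (trans (same LEN₂ tt 0 0) len≡L) (subst (_≤ Λ LEN₂) (sym (same LEN₂ tt 0 0)) sb) S₁ tt (K i) (Ii , λ _ ()) inner)
        where
        finish : ∀ {s} → K i L s → I (suc i) s
        finish {s} ((a , b , c , d) , now) = a , b , c , all
          where
          all : ∀ i′ D → i′ < suc i → Mem D → s₀ REACH D t ≢ 0 → Step D (lst i′) → s REACH (lst i′) (suc t) ≢ 0
          all i′ D i′< Dm nz st with i′ ≟ i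
          all i′ D i′< (j , j< , refl) nz st | yes refl = now j j< nz st
          ... | no i≢ = d i′ D (≤∧≢⇒< (s≤s⁻¹ i′<) i≢) Dm nz st
        inner : ∀ j s → j < L → Stat₂ s → _ → K i j s → Tri body₂ (lst j ∷ j ∷ lst i ∷ i ∷ t ∷ []) s (K i (suc j))
        inner j s j< S₂ _ ((a , b , c , d) , now) = do-if
          (λ hit → let (nz , st) = to r hit in
            do-put 1<E ((sound-put {s = s} a (prefix-step (proj₂ (a _ t nz)) st) ,
                         (λ D τ z → reach-put {s} (b D τ z) (lst i) (suc t)) ,
                         (λ D → trans (put-miss s REACH (lst i) (suc t) 1 REACH D t (λ _ _ → 1+n≢n)) (c D)) ,
                         λ i′ D i′< Dm nz st → reach-put {s} (d i′ D i′< Dm nz st) (lst i) (suc t)) ,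
                        λ j′ j′< _ _ z → 1+n≢0 (trans (sym (put-hit s REACH (lst i) (suc t) 1)) z)))
          (λ miss → do-skp ((a , b , c , d) , skipped miss))
          where
          r : Ref (s REACH (lst j) t * val (stepT zero (suc (suc zero))) (lst j ∷ j ∷ lst i ∷ i ∷ t ∷ []) s) (s REACH (lst j) t ≢ 0 × Step (lst j) (lst i))
          r = ref-and ref-nz (ref-step {ρ = lst j ∷ j ∷ lst i ∷ i ∷ t ∷ []} (stat S₂) zero (suc (suc zero)))
          skipped : _ ≡ 0 → ∀ j′ → j′ < suc j → s₀ REACH (lst j′) t ≢ 0 → Step (lst j′) (lst i) → s REACH (lst i) (suc t) ≢ 0
          skipped miss j′ j′< nz st with j′ ≟ j
          ... | yes refl = contradiction ((λ z → nz (trans (sym (c (lst j))) z)) , st) (≡0⇒¬ r miss)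
          ... | no j≢ = now j′ (≤∧≢⇒< (s≤s⁻¹ j′<) j≢) nz st

  -- The transition without C: the jobs of a time slot are added one by
  -- one in order of decreasing rank (number of predecessors), so no job
  -- can be added after one of its successors; a set is extended by v when
  -- all predecessors of v are in it already.

  n∸-rank : ∀ {v} → v < n → npred v < n
  n∸-rank {v} v< = <-≤-trans (#-mono-< n {g = λ _ → 1} (λ _ _ _ → λ ()) v v< (ind-no (≺? v v) A-irrefl) (λ ())) (#≤ n (λ _ → 1))

  added : ℕ → ℕ → ℕ
  added D D′ = # n (λ v → bit (D′ ∋ v) * bit (not (D ∋ v)))

  ref-added : ∀ {D D′ v} → Ref (bit (D′ ∋ v) * bit (not (D ∋ v))) ((D′ ∋ v) ≡ true × (D ∋ v) ≡ false)
  ref-added {D} {D′} {v} = ref-map (λ (a , b) → a , not-true b) (λ (a , b) → a , cong not b) (ref-and ref-bit ref-bit)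
    where
    not-true : ∀ {b} → not b ≡ true → b ≡ false
    not-true {false} _ = refl

  added-bit : ∀ {D D₁ v} → v < n → (D ∋ v) ≡ false → (D₁ ∋ v) ≡ false → added D (D₁ + 2 ^ v) ≡ suc (added D D₁)
  added-bit {D} {D₁} {v} v< v∉D v∉D₁ = begin
    Σ< n f                          ≡⟨ Σ<-pick n f v v< ⟩
    f v + Σ< n (f [ v ↦ 0 ])        ≡⟨ cong₂ _+_ fv (Σ<-cong n λ i _ → rest i) ⟩
    1 + (0 + Σ< n (g [ v ↦ 0 ]))    ≡⟨ cong (λ z → suc (z + Σ< n (g [ v ↦ 0 ]))) gv ⟨
    1 + (g v + Σ< n (g [ v ↦ 0 ]))  ≡⟨ cong suc (Σ<-pick n g v v<) ⟨
    1 + Σ< n g                      ∎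
    where
    open ≡-Reasoning
    f g : ℕ → ℕ
    f x = sg (bit (D₁ + 2 ^ v ∋ x) * bit (not (D ∋ x)))
    g x = sg (bit (D₁ ∋ x) * bit (not (D ∋ x)))
    fv : f v ≡ 1
    fv = cong₂ (λ a b → sg (bit a * bit (not b))) (add-bit-same D₁ v v∉D₁) v∉D
    gv : g v ≡ 0
    gv = cong (λ a → sg (bit a * bit (not (D ∋ v)))) v∉D₁
    rest : ∀ i → (f [ v ↦ 0 ]) i ≡ (g [ v ↦ 0 ]) i
    rest i with i ≟ v
    ... | yes refl = trans (upd-same f v 0) (sym (upd-same g v 0))
    ... | no i≢ = trans (upd-diff f v 0 i i≢) (trans (cong (λ a → sg (bit a * bit (not (D ∋ i)))) (add-bit-other D₁ v v∉D₁ i i≢)) (sym (upd-diff g v 0 i i≢)))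

  slot-put-grows : ∀ {s D c} → s SLOT D c ≢ 0 → ∀ D′ c′ → put-at s SLOT D′ c′ 1 SLOT D c ≢ 0
  slot-put-grows {s} {D} {c} nz D′ c′ z with D′ ≟ D | c′ ≟ c
  ... | yes refl | yes refl = 1+n≢0 (trans (sym (put-hit s SLOT D′ c′ 1)) z)
  ... | no D≢ | _ = nz (trans (sym (put-miss s SLOT D′ c′ 1 SLOT D c (λ _ e → contradiction e D≢))) z)
  ... | _ | no c≢ = nz (trans (sym (put-miss s SLOT D′ c′ 1 SLOT D c (λ _ _ → c≢))) z)

  slot-put-cases : ∀ {s D c} D′ c′ → put-at s SLOT D′ c′ 1 SLOT D c ≢ 0 → (D ≡ D′ × c ≡ c′) ⊎ s SLOT D c ≢ 0
  slot-put-cases {s} {D} {c} D′ c′ nz with D′ ≟ D | c′ ≟ c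
  ... | yes refl | yes refl = inj₁ (refl , refl)
  ... | no D≢ | _ = inj₂ λ z → nz (trans (put-miss s SLOT D′ c′ 1 SLOT D c (λ _ e → contradiction e D≢)) z)
  ... | _ | no c≢ = inj₂ λ z → nz (trans (put-miss s SLOT D′ c′ 1 SLOT D c (λ _ _ → c≢)) z)

  module _ (t : ℕ) (s₀ : Store) (S₀ : Stat₂ s₀) (distinct-lst : ∀ i j → i < L → j < L → lst i ≡ lst j → i ≡ j)
    (reach-t : ∀ D → s₀ REACH D t ≢ 0 → Prefix t D) (snd : Sound (suc t) s₀) (mem-closed : ∀ {D u v} → Mem D → u ≺ v → (D ∋ v) ≡ true → (D ∋ u) ≡ true)
    (all-closed : ∀ D → D < 2 ^ n → (∀ {u v} → u ≺ v → (D ∋ v) ≡ true → (D ∋ u) ≡ true) → Mem D) where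

    Loaded : Store → Set
    Loaded s = ∀ D → Mem D → (s₀ REACH D t ≢ 0 → s SLOT D 0 ≢ 0) ×
                              (∀ c → c ≤ n → s SLOT D c ≢ 0 → c ≡ 0 × s₀ REACH D t ≢ 0)

    load-spec : Tri (allSets (loadC zero (suc (suc zero)))) (t ∷ []) s₀ Loaded
    load-spec = conseq (λ I D (i , i< , e) → subst (OK (run (allSets (loadC zero (suc (suc zero)))) (t ∷ []) s₀)) e (I i i<))
      (all-sets S₀ tt (λ i s → ∀ i′ → i′ < i → OK s (lst i′)) (λ _ ()) body)
      where
      OK : Store → ℕ → Set
      OK s D = (s₀ REACH D t ≢ 0 → s SLOT D 0 ≢ 0) × (∀ c → c ≤ n → s SLOT D c ≢ 0 → c ≡ 0 × s₀ REACH D t ≢ 0)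
      body : ∀ i s → i < L → Stat₂ s → (∀ a → T (keeps a (loadC {3} zero (suc (suc zero)))) → Same a s s₀) → (∀ i′ → i′ < i → OK s (lst i′)) →
             Tri (loadC zero (suc (suc zero))) (lst i ∷ i ∷ t ∷ []) s (λ s′ → ∀ i′ → i′ < suc i → OK s′ (lst i′))
      body i s i< S₁ same old = do-seq {Q = First} first then-clear
        where
        D = lst i
        ρ = lst i ∷ i ∷ t ∷ []
        Others : Store → Set
        Others s′ = ∀ D′ c → D′ ≢ D → s′ SLOT D′ c ≡ s SLOT D′ c
        First : Store → Set
        First s′ = Others s′ × Ref (s′ SLOT D 0) (s₀ REACH D t ≢ 0)
        c₁ c₂ : Cmd 3
        c₁ = iff (arr REACH (var zero) (var (suc (suc zero)))) (put SLOT (var zero) (num 0) (num 1)) (put SLOT (var zero) (num 0) (num 0))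
        c₂ = for jobs (put SLOT (var (suc zero)) (addT (num 1) v₀) (num 0))
        first : Tri c₁ ρ s First
        first = do-if
          (λ nz → do-put 1<E ((λ D′ c D≢ → put-miss s SLOT D 0 1 SLOT D′ c (λ _ e → contradiction (sym e) D≢)) ,
                     ref (λ _ z → nz (trans (same REACH tt D t) z)) (λ _ z → 1+n≢0 (trans (sym (put-hit s SLOT D 0 1)) z))))
          (λ z → do-put 0<E ((λ D′ c D≢ → put-miss s SLOT D 0 0 SLOT D′ c (λ _ e → contradiction (sym e) D≢)) ,
                     ref (λ nz → contradiction (put-hit s SLOT D 0 0) nz) (λ nz → contradiction (trans (sym (same REACH tt D t)) z) nz)))
        then-clear : First (run c₁ ρ s) → Tri c₂ ρ (run c₁ ρ s) (λ s′ → ∀ i′ → i′ < suc i → OK s′ (lst i′))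
        then-clear (oth , r) = conseq (finish {run c₂ ρ (run c₁ ρ s)})
          (do-for (λ k s′ → Others s′ × Ref (s′ SLOT D 0) (s₀ REACH D t ≢ 0) × (∀ c → c < k → s′ SLOT D (suc c) ≡ 0))
            safe-jobs (oth , r , λ _ ())
            (λ k s′ k< _ (oth′ , r′ , z′) → do-put 0<E
              ((λ D′ c D≢ → trans (put-miss s′ SLOT D (suc k) 0 SLOT D′ c (λ _ e → contradiction (sym e) D≢)) (oth′ D′ c D≢)) ,
               subst (λ x → Ref x _) (sym (put-miss s′ SLOT D (suc k) 0 SLOT D 0 (λ _ _ ()))) r′ ,
               λ c c< → cleared k s′ z′ c c<)))
          where
          cleared : ∀ k s′ → (∀ c → c < k → s′ SLOT D (suc c) ≡ 0) → ∀ c → c < suc k → put-at s′ SLOT D (suc k) 0 SLOT D (suc c) ≡ 0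
          cleared k s′ z′ c c< with c ≟ k
          ... | yes refl = put-hit s′ SLOT D (suc c) 0
          ... | no c≢ = trans (put-miss s′ SLOT D (suc k) 0 SLOT D (suc c) (λ _ _ e → c≢ (suc-injective (sym e)))) (z′ c (≤∧≢⇒< (s≤s⁻¹ c<) c≢))
          finish : ∀ {s′} → Others s′ × Ref (s′ SLOT D 0) (s₀ REACH D t ≢ 0) × (∀ c → c < n * 1 + 0 → s′ SLOT D (suc c) ≡ 0) →
                   ∀ i′ → i′ < suc i → OK s′ (lst i′)
          finish {s′} (oth′ , r′ , z′) i′ i′< with i′ ≟ i
          ... | yes refl = from r′ , λ { zero _ nz → refl , to r′ nz
                                       ; (suc c) c≤ nz → contradiction (z′ c (subst (c <_) (sym n*1) c≤)) nz }
          ... | no i≢ with old i′ (≤∧≢⇒< (s≤s⁻¹ i′<) i≢)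
          ...   | a , b = (λ nz z → a nz (trans (sym (oth′ _ 0 D≢)) z)) ,
                          λ c c≤ nz → b c c≤ (λ z → nz (trans (oth′ _ c D≢) z))
            where
            D≢ : lst i′ ≢ D
            D≢ e = i≢ (distinct-lst i′ i (<-≤-trans i′< i<) i< e)

    record Justified (h D′ c : ℕ) : Set where
      field
        base    : ℕ
        reached : s₀ REACH base t ≢ 0
        ⊆D′     : ∀ x → x < n → (base ∋ x) ≡ true → (D′ ∋ x) ≡ true
        count   : added base D′ ≡ c
        c≤m     : c ≤ m
        level   : ∀ x → x < n → (D′ ∋ x) ≡ true → (base ∋ x) ≡ false → n ≤ npred x + h
        ready   : ∀ {u x} → u ≺ x → (D′ ∋ x) ≡ true → (base ∋ x) ≡ false → (base ∋ u) ≡ true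

    AllJustified : ℕ → Store → Set
    AllJustified h s = ∀ D → Mem D → ∀ c → c ≤ n → s SLOT D c ≢ 0 → Justified h D c

    justified-weaken : ∀ {h D c} → Justified h D c → Justified (suc h) D c
    justified-weaken {h} j = record
      { base = base ; reached = reached ; ⊆D′ = ⊆D′ ; count = count ; c≤m = c≤m
      ; level = λ x x< a b → ≤-trans (level x x< a b) (+-monoʳ-≤ (npred x) (n≤1+n h))
      ; ready = λ {u} {x} → ready {u} {x} }
      where open Justified j

    Extensible : ℕ → ℕ → Set
    Extensible v D = (D ∋ v) ≡ false × (∀ {a} → a ≺ v → (D ∋ a) ≡ true)

    justified-add : ∀ {h v D c} → v < n → npred v + suc h ≡ n → Extensible v D → suc c ≤ m →
                    Justified (suc h) D c → Justified (suc h) (D + 2 ^ v) (suc c)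
    justified-add {h} {v} {D} {c} v< lev (v∉ , preds) c<m j = record
      { base    = base
      ; reached = reached
      ; ⊆D′     = λ x x< x∈ → trans (add-bit-other D v v∉ x λ { refl → true≢ v∉ (⊆D′ x x< x∈) }) (⊆D′ x x< x∈)
      ; count   = trans (added-bit v< v∉base v∉) (cong suc count)
      ; c≤m     = c<m
      ; level   = lvl
      ; ready   = rdy
      }
      where
      open Justified j
      v∉base : (base ∋ v) ≡ false
      v∉base = ¬true λ v∈ → true≢ v∉ (⊆D′ v v< v∈)
      lvl : ∀ x → x < n → (D + 2 ^ v ∋ x) ≡ true → (base ∋ x) ≡ false → n ≤ npred x + suc h
      lvl x x< x∈ x∉ with x ≟ v
      ... | yes refl = ≤-reflexive (sym lev)
      ... | no x≢ = level x x< (trans (sym (add-bit-other D v v∉ x x≢)) x∈) x∉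
      rdy : ∀ {u x} → u ≺ x → (D + 2 ^ v ∋ x) ≡ true → (base ∋ x) ≡ false → (base ∋ u) ≡ true
      rdy {u} {x} u≺x x∈ x∉ with x ≟ v
      ... | no x≢ = ready u≺x (trans (sym (add-bit-other D v v∉ x x≢)) x∈) x∉
      ... | yes refl = ¬false λ u∉ → <⇒≱ (<-≤-trans (+-monoˡ-< (suc h) (npred-mono u≺x)) (≤-reflexive lev))
                                        (level u (proj₁ (A-bound u≺x)) (preds u≺x) u∉)

    SlotGrows : Store → Store → Set
    SlotGrows s s′ = ∀ D c → s SLOT D c ≢ 0 → s′ SLOT D c ≢ 0

    ref-extensible : ∀ {Γ} {ρ : Vec ℕ Γ} {s} → Stat s → ∀ (D v : Fin Γ) → lookup ρ v < n →
                     Ref (val (extendT D v) ρ s) (Extensible (lookup ρ v) (lookup ρ D))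
    ref-extensible {ρ = ρ} {s} S D v v< = ref-map
      (λ (a , none) → a , λ {x} l → ¬false λ x∉ → none (x , proj₁ (A-bound l) , l , x∉))
      (λ (a , all) → a , λ (x , _ , l , x∉) → true≢ x∉ (all l))
      (ref-and (ref-nonmember S (lookup ρ D) (lookup ρ v) v<)
        (ref-not (ref-ex n λ x x< → ref-and (ref-nz {A x (lookup ρ v)}) (ref-nonmember S (lookup ρ D) x x<))))

    extend-spec : ∀ {h Γ} {ρ : Vec ℕ Γ} {s} (D v : Fin Γ) → Stat₂ s → Mem (lookup ρ D) → lookup ρ v < n →
      npred (lookup ρ v) + suc h ≡ n → AllJustified (suc h) s →
      Tri (extendC D v) ρ s (λ s′ → AllJustified (suc h) s′ × SlotGrows s s′ ×
        (Extensible (lookup ρ v) (lookup ρ D) → ∀ c → c < n → c < m → s SLOT (lookup ρ D) c ≢ 0 →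
          s′ SLOT (lookup ρ D + 2 ^ lookup ρ v) (suc c) ≢ 0))
    extend-spec {h} {Γ} {ρ} {s} D v S Dm v< lev Y = do-if
      (λ nz → conseq (λ (Y′ , gr , all) → Y′ , gr , λ _ c c< → all c c< (subst (c <_) (sym n*1) c<))
        (do-for (λ i s′ → AllJustified (suc h) s′ × SlotGrows s s′ ×
                          (∀ c → c < n → c < i → c < m → s SLOT d c ≢ 0 → s′ SLOT (d + 2 ^ w) (suc c) ≢ 0))
          safe-jobs (Y , (λ _ _ z → z) , λ _ _ ()) (body (to ext-ref nz))))
      (λ z → do-skp (Y , (λ _ _ z → z) , λ ext → contradiction ext (≡0⇒¬ ext-ref z)))
      where
      d = lookup ρ D
      w = lookup ρ v
      ext-ref = ref-extensible {ρ = ρ} (stat S) D v v<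
      inner : Cmd (suc Γ)
      inner = iff (andT (ltT v₀ mm) (arr SLOT (var (suc D)) v₀))
                (put SLOT (addT (var (suc D)) (cell POW (var (suc v)))) (addT (num 1) v₀) (num 1)) skp
      body : Extensible w d → ∀ c s₁ → c < n * 1 + 0 → (∀ a → T (keeps a inner) → Same a s₁ s) →
             AllJustified (suc h) s₁ × SlotGrows s s₁ × (∀ c′ → c′ < n → c′ < c → c′ < m → s SLOT d c′ ≢ 0 → s₁ SLOT (d + 2 ^ w) (suc c′) ≢ 0) →
             Tri inner (c ∷ ρ) s₁ (λ s′ → AllJustified (suc h) s′ × SlotGrows s s′ ×
                          (∀ c′ → c′ < n → c′ < suc c → c′ < m → s SLOT d c′ ≢ 0 → s′ SLOT (d + 2 ^ w) (suc c′) ≢ 0))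
      body ext c s₁ c<′ same (Y₁ , gr₁ , all₁) = do-if
        (λ hit → do-put 1<E (subst (λ p → Goal (put-at s₁ SLOT (d + p) (suc c) 1)) (sym (pow (stat S₁) w (<⇒≤ v<))) (written (to r hit))))
        (λ miss → do-skp (Y₁ , gr₁ , skipped miss))
        where
        c< = subst (c <_) n*1 c<′
        S₁ : Stat₂ s₁
        S₁ = stat₂-kept inner tt same S
        r : Ref (⟦ Defs.lt ⟧ᵒ c m * s₁ SLOT d c) (c < m × s₁ SLOT d c ≢ 0)
        r = ref-and (ref-lt {c} {m}) ref-nz
        Goal : Store → Set
        Goal s′ = AllJustified (suc h) s′ × SlotGrows s s′ ×
                  (∀ c′ → c′ < n → c′ < suc c → c′ < m → s SLOT d c′ ≢ 0 → s′ SLOT (d + 2 ^ w) (suc c′) ≢ 0)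
        written : c < m × s₁ SLOT d c ≢ 0 → Goal (put-at s₁ SLOT (d + 2 ^ w) (suc c) 1)
        written (c<m , nz) = Y₂ , (λ D c′ z → slot-put-grows {s₁} (gr₁ D c′ z) (d + 2 ^ w) (suc c)) , all₂
          where
          Y₂ : AllJustified (suc h) (put-at s₁ SLOT (d + 2 ^ w) (suc c) 1)
          Y₂ D′ Dm′ c′ c′≤ nz′ with slot-put-cases {s₁} {D′} {c′} (d + 2 ^ w) (suc c) nz′
          ... | inj₁ (refl , refl) = justified-add v< lev ext c<m (Y₁ d Dm c (<⇒≤ c<) nz)
          ... | inj₂ old = Y₁ D′ Dm′ c′ c′≤ old
          all₂ : ∀ c′ → c′ < n → c′ < suc c → c′ < m → s SLOT d c′ ≢ 0 → put-at s₁ SLOT (d + 2 ^ w) (suc c) 1 SLOT (d + 2 ^ w) (suc c′) ≢ 0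
          all₂ c′ c′<n c′< c′<m z with c′ ≟ c
          ... | yes refl = λ y → 1+n≢0 (trans (sym (put-hit s₁ SLOT (d + 2 ^ w) (suc c) 1)) y)
          ... | no c≢ = slot-put-grows {s₁} (all₁ c′ c′<n (≤∧≢⇒< (s≤s⁻¹ c′<) c≢) c′<m z) (d + 2 ^ w) (suc c)
        skipped : _ ≡ 0 → ∀ c′ → c′ < n → c′ < suc c → c′ < m → s SLOT d c′ ≢ 0 → s₁ SLOT (d + 2 ^ w) (suc c′) ≢ 0
        skipped miss c′ c′<n c′< c′<m z with c′ ≟ c
        ... | yes refl = contradiction (c′<m , gr₁ d c′ z) (≡0⇒¬ r miss)
        ... | no c≢ = all₁ c′ c′<n (≤∧≢⇒< (s≤s⁻¹ c′<) c≢) c′<m z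

    -- The part of D′ reached from D just before round (h , v).
    passed : ℕ → ℕ → ℕ → Bool
    passed h v x = does (n <? npred x + suc h) ∨ (does (npred x + suc h ≟ n) ∧ does (x <? v))

    same-pass : ∀ h v x → x ≢ v → passed h (suc v) x ≡ passed h v x
    same-pass h v x x≢ = cong (λ b → does (n <? npred x + suc h) ∨ (does (npred x + suc h ≟ n) ∧ b)) (go (x <? v))
      where
      go : Dec (x < v) → does (x <? suc v) ≡ does (x <? v)
      go (yes l) = trans (dec-true (x <? suc v) (m≤n⇒m≤1+n l)) (sym (dec-true (x <? v) l))
      go (no ¬l) = trans (dec-false (x <? suc v) (λ l → ¬l (≤∧≢⇒< (s≤s⁻¹ l) x≢))) (sym (dec-false (x <? v) ¬l))

    inter : ℕ → ℕ → ℕ → ℕ → ℕ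
    inter D D′ h v = set n (λ x → (D ∋ x) ∨ ((D′ ∋ x) ∧ passed h v x))

    ∋-inter : ∀ D D′ h v x → x < n → (inter D D′ h v ∋ x) ≡ (D ∋ x) ∨ ((D′ ∋ x) ∧ passed h v x)
    ∋-inter D D′ h v x x< = ∋-set n _ x x<

    Track : ℕ → ℕ → Store → Set
    Track h v s = ∀ D D′ → s₀ REACH D t ≢ 0 → Mem D → Mem D′ → Step D D′ →
                  s SLOT (inter D D′ h v) (added D (inter D D′ h v)) ≢ 0

    inter-start : ∀ {D} D′ → D < 2 ^ n → inter D D′ 0 0 ≡ D
    inter-start {D} D′ D< = ∋-ext n _ _ (set< n _) D< λ x x< → trans (∋-inter D D′ 0 0 x x<)
      (trans (cong (λ b → (D ∋ x) ∨ ((D′ ∋ x) ∧ b)) (not-yet x x<)) (trans (cong ((D ∋ x) ∨_) (∧-zeroʳ (D′ ∋ x))) (∨-identityʳ (D ∋ x))))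
      where
      not-yet : ∀ x → x < n → passed 0 0 x ≡ false
      not-yet x x< = cong₂ _∨_ (dec-false (n <? npred x + 1) (≤⇒≯ (≤-trans (≤-reflexive (+-comm (npred x) 1)) (n∸-rank x<))))
                               (∧-zeroʳ (does (npred x + 1 ≟ n)))

    inter-end : ∀ {D D′} → D′ < 2 ^ n → Step D D′ → inter D D′ n 0 ≡ D′
    inter-end {D} {D′} D′< st = ∋-ext n _ _ (set< n _) D′< λ x x< → trans (∋-inter D D′ n 0 x x<)
      (trans (cong (λ b → (D ∋ x) ∨ ((D′ ∋ x) ∧ (b ∨ (does (npred x + suc n ≟ n) ∧ does (x <? 0))))) (dec-true (n <? npred x + suc n) (m≤n+m (suc n) (npred x))))
        (go x x< (D ∋ x) refl))
      where
      go : ∀ x → x < n → ∀ b → (D ∋ x) ≡ b → b ∨ ((D′ ∋ x) ∧ true) ≡ (D′ ∋ x)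
      go x x< true  e = sym (Step.grows st x x< e)
      go x x< false e = ∧-identityʳ (D′ ∋ x)

    inter-next : ∀ D D′ h → inter D D′ h n ≡ inter D D′ (suc h) 0
    inter-next D D′ h = ∋-ext n _ _ (set< n _) (set< n _) λ x x< → trans (∋-inter D D′ h n x x<)
      (trans (cong (λ b → (D ∋ x) ∨ ((D′ ∋ x) ∧ b)) (eq′ x x<)) (sym (∋-inter D D′ (suc h) 0 x x<)))
      where
      eq′ : ∀ x → x < n → passed h n x ≡ passed (suc h) 0 x
      eq′ x x< with <-≤-connex n (npred x + suc h)
      ... | inj₁ l = trans (cong (_∨ (does (npred x + suc h ≟ n) ∧ does (x <? n))) (dec-true (n <? npred x + suc h) l))
                       (sym (cong (_∨ (does (npred x + suc (suc h) ≟ n) ∧ does (x <? 0))) (dec-true (n <? npred x + suc (suc h)) (<-≤-trans l (+-monoʳ-≤ (npred x) (n≤1+n (suc h)))))))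
      ... | inj₂ ge with npred x + suc h ≟ n
      ...   | yes e = trans (cong₂ (λ a b → a ∨ (b ∧ does (x <? n))) (dec-false (n <? npred x + suc h) (≤⇒≯ ge)) (dec-true (npred x + suc h ≟ n) e))
                        (trans (dec-true (x <? n) x<) (sym (cong (_∨ (does (npred x + suc (suc h) ≟ n) ∧ does (x <? 0))) (dec-true (n <? npred x + suc (suc h))
                          (≤-reflexive (trans (cong suc (sym e)) (sym (+-suc (npred x) (suc h)))))))))
      ...   | no ne = trans (cong₂ (λ a b → a ∨ (b ∧ does (x <? n))) (dec-false (n <? npred x + suc h) (≤⇒≯ ge)) (dec-false (npred x + suc h ≟ n) ne))
                        (sym (trans (cong₂ _∨_ (dec-false (n <? npred x + suc (suc h))
                          (≤⇒≯ (≤-trans (≤-reflexive (+-suc (npred x) (suc h))) (≤∧≢⇒< ge ne)))) (∧-zeroʳ (does (npred x + suc (suc h) ≟ n)))) refl))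

    inter-skip : ∀ D D′ h v → (npred v + suc h ≢ n ⊎ (D ∋ v) ≡ true ⊎ (D′ ∋ v) ≡ false) → inter D D′ h (suc v) ≡ inter D D′ h v
    inter-skip D D′ h v off = ∋-ext n _ _ (set< n _) (set< n _) λ x x< → trans (∋-inter D D′ h (suc v) x x<)
      (trans (go x off) (sym (∋-inter D D′ h v x x<)))
      where
      go : ∀ x → (npred v + suc h ≢ n ⊎ (D ∋ v) ≡ true ⊎ (D′ ∋ v) ≡ false) →
           (D ∋ x) ∨ ((D′ ∋ x) ∧ passed h (suc v) x) ≡ (D ∋ x) ∨ ((D′ ∋ x) ∧ passed h v x)
      go x off with x ≟ v
      ... | no x≢ = cong (λ b → (D ∋ x) ∨ ((D′ ∋ x) ∧ b)) (same-pass h v x x≢)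
      go x (inj₁ ne) | yes refl = cong (λ b → (D ∋ x) ∨ ((D′ ∋ x) ∧ (does (n <? npred x + suc h) ∨ b)))
        (trans (cong (_∧ does (x <? suc x)) (dec-false (npred x + suc h ≟ n) ne)) (sym (cong (_∧ does (x <? x)) (dec-false (npred x + suc h ≟ n) ne))))
      go x (inj₂ (inj₁ v∈)) | yes refl = trans (cong (_∨ ((D′ ∋ x) ∧ passed h (suc x) x)) v∈) (sym (cong (_∨ ((D′ ∋ x) ∧ passed h x x)) v∈))
      go x (inj₂ (inj₂ v∉)) | yes refl = cong ((D ∋ x) ∨_) (trans (cong (_∧ passed h (suc x) x) v∉) (sym (cong (_∧ passed h x x) v∉)))

    inter-misses : ∀ {D D′ h v} → v < n → npred v + suc h ≡ n → (D ∋ v) ≡ false → (inter D D′ h v ∋ v) ≡ false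
    inter-misses {D} {D′} {h} {v} v< lev v∉ = trans (∋-inter D D′ h v v v<) (trans (cong₂ (λ a b → a ∨ ((D′ ∋ v) ∧ b)) v∉
      (trans (cong₂ (λ a b → a ∨ (does (npred v + suc h ≟ n) ∧ b)) (dec-false (n <? npred v + suc h) (≤⇒≯ (≤-reflexive lev))) (dec-false (v <? v) (<-irrefl refl)))
        (∧-zeroʳ _))) (∧-zeroʳ _))

    inter-add : ∀ {D D′ h v} → v < n → npred v + suc h ≡ n → (D ∋ v) ≡ false → (D′ ∋ v) ≡ true →
                inter D D′ h (suc v) ≡ inter D D′ h v + 2 ^ v
    inter-add {D} {D′} {h} {v} v< lev v∉ v∈ = ∋-ext n _ _ (set< n _) (add-bit< n _ v v< (set< n _) miss) λ x x< → go x x<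
      where
      miss = inter-misses {D} {D′} v< lev v∉
      go : ∀ x → x < n → (inter D D′ h (suc v) ∋ x) ≡ (inter D D′ h v + 2 ^ v ∋ x)
      go x x< with x ≟ v
      ... | yes refl = trans (trans (∋-inter D D′ h (suc x) x x<) (trans (cong₂ (λ a b → (D ∋ x) ∨ (a ∧ (does (n <? npred x + suc h) ∨ b))) v∈
                         (cong₂ _∧_ (dec-true (npred x + suc h ≟ n) lev) (dec-true (x <? suc x) ≤-refl)))
                         (trans (cong (λ b → (D ∋ x) ∨ b) (∨-true (does (n <? npred x + suc h)))) (∨-true (D ∋ x)))))
                       (sym (add-bit-same _ x miss))
        where
        ∨-true : ∀ b → b ∨ true ≡ true
        ∨-true true  = refl
        ∨-true false = refl
      ... | no x≢ = trans (trans (∋-inter D D′ h (suc v) x x<) (trans (cong (λ b → (D ∋ x) ∨ ((D′ ∋ x) ∧ b)) (same-pass h v x x≢)) (sym (∋-inter D D′ h v x x<))))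
                      (sym (add-bit-other _ v miss x x≢))

    inter-⊆ : ∀ {D D′} → Step D D′ → ∀ h v x → x < n → (inter D D′ h v ∋ x) ≡ true → (D′ ∋ x) ≡ true
    inter-⊆ {D} {D′} st h v x x< e with D ∋ x in ex | trans (sym (∋-inter D D′ h v x x<)) e
    ... | true  | _ = Step.grows st x x< ex
    ... | false | p with D′ ∋ x
    ...   | true = refl

    inter-⊇ : ∀ D D′ h v x → x < n → (D ∋ x) ≡ true → (inter D D′ h v ∋ x) ≡ true
    inter-⊇ D D′ h v x x< e = trans (∋-inter D D′ h v x x<) (cong (_∨ ((D′ ∋ x) ∧ passed h v x)) e)

    inter-mem : ∀ {D D′} → Mem D → Step D D′ → ∀ h v → Mem (inter D D′ h v)
    inter-mem {D} {D′} Dm st h v = all-closed _ (set< n _) cl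
      where
      cl : ∀ {a b} → a ≺ b → (inter D D′ h v ∋ b) ≡ true → (inter D D′ h v ∋ a) ≡ true
      cl {a} {b} a≺b b∈ with D ∋ b in eb
      ... | true  = inter-⊇ D D′ h v a (proj₁ (A-bound a≺b)) (mem-closed Dm a≺b eb)
      ... | false = inter-⊇ D D′ h v a (proj₁ (A-bound a≺b)) (Step.ready st a≺b (inter-⊆ st h v b (proj₂ (A-bound a≺b)) b∈) eb)

    inter-count : ∀ {D D′ h v} → Step D D′ → v < n → npred v + suc h ≡ n → (D ∋ v) ≡ false → (D′ ∋ v) ≡ true →
                  added D (inter D D′ h v) < added D D′
    inter-count {D} {D′} {h} {v} st v< lev v∉ v∈ = #-mono-< n
      (λ x x< nz → let (a , b) = to (ref-added {D} {inter D D′ h v} {x}) nz in from (ref-added {D} {D′} {x}) (inter-⊆ st h v x x< a , b))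
      v v< (cong (λ b → bit b * bit (not (D ∋ v))) (inter-misses {D} {D′} v< lev v∉)) (from (ref-added {D} {D′} {v}) (v∈ , v∉))

    pred-count : ∀ v → # n (λ a → A a v) ≡ npred v
    pred-count v = ≤-antisym (#-mono n λ a _ nz → from (ref-does (≺? a v)) nz) (#-mono n λ a _ nz → to (ref-does (≺? a v)) nz)

    justified-start : ∀ s → Loaded s → AllJustified 0 s
    justified-start s ld D Dm c c≤ nz with proj₂ (ld D Dm) c c≤ nz
    ... | refl , r = record
      { base = D ; reached = r ; ⊆D′ = λ _ _ z → z ; count = added-self D ; c≤m = z≤n
      ; level = λ x _ a b → contradiction a (true≢ b) ; ready = λ _ a b → contradiction a (true≢ b) }
      where
      added-self : ∀ D → added D D ≡ 0
      added-self D = ⇒#≡0 n _ (λ x _ → go (D ∋ x))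
        where
        go : ∀ b → bit b * bit (not b) ≡ 0
        go true  = refl
        go false = refl

    track-start : ∀ s → Loaded s → Track 0 0 s
    track-start s ld D D′ r Dm _ _ = subst₂ (λ I c → s SLOT I c ≢ 0) (sym i≡) (sym (trans (cong (added D) i≡) (added-self D))) (proj₁ (ld D Dm) r)
      where
      i≡ = inter-start D′ (mem< Dm)
      added-self : ∀ D → added D D ≡ 0
      added-self D = ⇒#≡0 n _ (λ x _ → go (D ∋ x))
        where
        go : ∀ b → bit b * bit (not b) ≡ 0
        go true  = refl
        go false = refl

    track-cong : ∀ s h v h′ v′ → (∀ D D′ → inter D D′ h′ v′ ≡ inter D D′ h v) → Track h v s → Track h′ v′ s
    track-cong s h v h′ v′ e tr D D′ r Dm Dm′ st = subst (λ I → s SLOT I (added D I) ≢ 0) (sym (e D D′)) (tr D D′ r Dm Dm′ st)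

    sweepC : Cmd 3
    sweepC = iff (levelT zero (suc zero)) (allSets (extendC zero (suc (suc zero)))) skp

    sweep-spec : ∀ {h v s} → v < n → Stat₂ s → AllJustified (suc h) s → Track h v s →
      Tri sweepC (v ∷ h ∷ t ∷ []) s (λ s′ → AllJustified (suc h) s′ × Track h (suc v) s′)
    sweep-spec {h} {v} {s} v< S Y tr = do-if hit miss
      where
      lev-ref : Ref (⟦ eq ⟧ᵒ (# n (λ a → A a v) + suc h) n) (npred v + suc h ≡ n)
      lev-ref = ref-map (trans (cong (_+ suc h) (sym (pred-count v)))) (trans (cong (_+ suc h) (pred-count v))) ref-eq
      miss : ⟦ eq ⟧ᵒ (# n (λ a → A a v) + suc h) n ≡ 0 → Tri skp (v ∷ h ∷ t ∷ []) s (λ s′ → AllJustified (suc h) s′ × Track h (suc v) s′)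
      miss z = do-skp (Y , track-cong s h v h (suc v) (λ D D′ → inter-skip D D′ h v (inj₁ (≡0⇒¬ lev-ref z))) tr)
      hit : ⟦ eq ⟧ᵒ (# n (λ a → A a v) + suc h) n ≢ 0 → Tri (allSets (extendC zero (suc (suc zero)))) (v ∷ h ∷ t ∷ []) s (λ s′ → AllJustified (suc h) s′ × Track h (suc v) s′)
      hit nz = conseq (finish {run (allSets (extendC zero (suc (suc zero)))) (v ∷ h ∷ t ∷ []) s}) (all-sets S tt
          (λ i s′ → AllJustified (suc h) s′ × SlotGrows s s′ × (∀ i′ → i′ < i → Pushed s′ (lst i′)))
          (Y , (λ _ _ z → z) , λ _ ())
          λ i s₁ i< S₁ _ (Y₁ , gr₁ , p₁) → conseq
            (λ (Y₂ , gr₂ , now) → Y₂ , (λ D c z → gr₂ D c (gr₁ D c z)) , all i s₁ (run (extendC zero (suc (suc zero))) (lst i ∷ i ∷ v ∷ h ∷ t ∷ []) s₁) gr₁ gr₂ now p₁)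
            (extend-spec zero (suc (suc zero)) S₁ (i , i< , refl) v< lev Y₁))
        where
        lev : npred v + suc h ≡ n
        lev = to lev-ref nz
        Pushed : Store → ℕ → Set
        Pushed s′ D = Extensible v D → ∀ c → c < n → c < m → s SLOT D c ≢ 0 → s′ SLOT (D + 2 ^ v) (suc c) ≢ 0
        all : ∀ i s₁ s₂ → SlotGrows s s₁ → SlotGrows s₁ s₂ →
              (Extensible v (lst i) → ∀ c → c < n → c < m → s₁ SLOT (lst i) c ≢ 0 → s₂ SLOT (lst i + 2 ^ v) (suc c) ≢ 0) →
              (∀ i′ → i′ < i → Pushed s₁ (lst i′)) → ∀ i′ → i′ < suc i → Pushed s₂ (lst i′)
        all i s₁ s₂ gr₁ gr₂ now old i′ i′< ext c c< c<m z with i′ ≟ i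
        ... | yes refl = now ext c c< c<m (gr₁ _ c z)
        ... | no i≢ = gr₂ _ _ (old i′ (≤∧≢⇒< (s≤s⁻¹ i′<) i≢) ext c c< c<m z)
        finish : ∀ {s′} → AllJustified (suc h) s′ × SlotGrows s s′ × (∀ i′ → i′ < L → Pushed s′ (lst i′)) → AllJustified (suc h) s′ × Track h (suc v) s′
        finish {s′} (Y′ , gr , pushed) = Y′ , track
          where
          track : Track h (suc v) s′
          track D D′ r Dm Dm′ st with D ∋ v in eD | D′ ∋ v in eD′
          ... | true  | _     = subst (λ I → s′ SLOT I (added D I) ≢ 0) (sym (inter-skip D D′ h v (inj₂ (inj₁ eD)))) (gr _ _ (tr D D′ r Dm Dm′ st))
          ... | false | false = subst (λ I → s′ SLOT I (added D I) ≢ 0) (sym (inter-skip D D′ h v (inj₂ (inj₂ eD′)))) (gr _ _ (tr D D′ r Dm Dm′ st))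
          ... | false | true  = subst₂ (λ I c → s′ SLOT I c ≢ 0) (sym (inter-add v< lev eD eD′))
                                  (sym (trans (cong (added D) (inter-add v< lev eD eD′)) (added-bit v< eD v∉I)))
                                  (push (inter-mem Dm st h v))
            where
            I = inter D D′ h v
            v∉I : (I ∋ v) ≡ false
            v∉I = inter-misses {D} {D′} v< lev eD
            c< : added D I < added D D′
            c< = inter-count st v< lev eD eD′
            push : Mem I → s′ SLOT (I + 2 ^ v) (suc (added D I)) ≢ 0
            push (i , i< , e) = subst (λ J′ → s′ SLOT (J′ + 2 ^ v) (suc (added D I)) ≢ 0) e
              (pushed i i< (subst (Extensible v) (sym e) (v∉I , λ {a} l → inter-⊇ D D′ h v a (proj₁ (A-bound l)) (Step.ready st l eD′ eD)))
                (added D I) (<-≤-trans c< (#≤ n _)) (<-≤-trans c< (Step.fits st))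
                (subst (λ J′ → s SLOT J′ (added D I) ≢ 0) (sym e) (tr D D′ r Dm Dm′ st)))

    store-spec : ∀ {s₁} → Stat₂ s₁ → (∀ D τ → s₁ REACH D τ ≡ s₀ REACH D τ) → AllJustified n s₁ →
      Tri (allSets (storeC zero (suc (suc zero)))) (t ∷ []) s₁ (λ s → Sound (suc t) s × Grows s₀ s ×
        (∀ D → Mem D → ∀ c → c ≤ n → s₁ SLOT D c ≢ 0 → s REACH D (suc t) ≢ 0))
    store-spec {s₁} S₁ reach≡ Y = conseq (λ (a , b , c) → a , b , λ { _ (i , i< , refl) → c i i< })
      (all-sets S₁ tt (λ i s → Sound (suc t) s × Grows s₀ s × (∀ i′ → i′ < i → Stored s (lst i′)))
        ((λ D τ nz → snd D τ (λ z → nz (trans (reach≡ D τ) z))) , (λ D τ nz z → nz (trans (sym (reach≡ D τ)) z)) , λ _ ())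
        body)
      where
      Stored : Store → ℕ → Set
      Stored s D = ∀ c → c ≤ n → s₁ SLOT D c ≢ 0 → s REACH D (suc t) ≢ 0
      prefix : ∀ {D c} → Mem D → Justified n D c → Prefix (suc t) D
      prefix {D} {c} Dm j = prefix-step (reach-t base reached) record
        { grows = ⊆D′ ; fits = ≤-trans (≤-reflexive count) c≤m ; ready = λ {u} {x} → ready {u} {x} }
        where open Justified j
      n*1+1 : n * 1 + 1 ≡ suc n
      n*1+1 = trans (cong (_+ 1) (*-identityʳ n)) (+-comm n 1)
      cell₁ : Cmd 4
      cell₁ = iff (arr SLOT (var (suc zero)) v₀) (put REACH (var (suc zero)) (addT (num 1) (var (suc (suc (suc zero))))) (num 1)) skp
      body : ∀ i s → i < L → Stat₂ s → (∀ a → T (keeps a (storeC {3} zero (suc (suc zero)))) → Same a s s₁) →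
             Sound (suc t) s × Grows s₀ s × (∀ i′ → i′ < i → Stored s (lst i′)) →
             Tri (storeC zero (suc (suc zero))) (lst i ∷ i ∷ t ∷ []) s (λ s′ → Sound (suc t) s′ × Grows s₀ s′ × (∀ i′ → i′ < suc i → Stored s′ (lst i′)))
      body i s i< S same (snd₁ , gr₁ , old) = conseq
        (λ (a , b , g , d) → a , b , all (run (storeC zero (suc (suc zero))) (lst i ∷ i ∷ t ∷ []) s) g (λ c c≤ → d c (subst (c <_) (sym n*1+1) (s≤s c≤))))
        (do-for (λ k s′ → Sound (suc t) s′ × Grows s₀ s′ × (∀ D → s REACH D (suc t) ≢ 0 → s′ REACH D (suc t) ≢ 0) ×
                          (∀ c → c < k → s₁ SLOT (lst i) c ≢ 0 → s′ REACH (lst i) (suc t) ≢ 0))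
          (small (≤-trans (≤-reflexive n*1+1) (≤-trans (s≤s (m≤m+n n n)) (≤-trans (n≤1+n _) (≤-reflexive (+-comm 2 (n + n)))))))
          (snd₁ , gr₁ , (λ _ z → z) , λ _ ()) inner)
        where
        all : ∀ s′ → (∀ D → s REACH D (suc t) ≢ 0 → s′ REACH D (suc t) ≢ 0) → Stored s′ (lst i) → ∀ i′ → i′ < suc i → Stored s′ (lst i′)
        all s′ g now i′ i′< c c≤ z with i′ ≟ i
        ... | yes refl = now c c≤ z
        ... | no i≢ = g _ (old i′ (≤∧≢⇒< (s≤s⁻¹ i′<) i≢) c c≤ z)
        inner : ∀ k s₂ → k < n * 1 + 1 → (∀ a → T (keeps a cell₁) → Same a s₂ s) →
                Sound (suc t) s₂ × Grows s₀ s₂ × (∀ D → s REACH D (suc t) ≢ 0 → s₂ REACH D (suc t) ≢ 0) ×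
                  (∀ c → c < k → s₁ SLOT (lst i) c ≢ 0 → s₂ REACH (lst i) (suc t) ≢ 0) →
                Tri cell₁ (k ∷ lst i ∷ i ∷ t ∷ []) s₂ (λ s′ → Sound (suc t) s′ × Grows s₀ s′ ×
                  (∀ D → s REACH D (suc t) ≢ 0 → s′ REACH D (suc t) ≢ 0) ×
                  (∀ c → c < suc k → s₁ SLOT (lst i) c ≢ 0 → s′ REACH (lst i) (suc t) ≢ 0))
        inner k s₂ k< same₂ (a , b , g , d) = do-if
          (λ nz → do-put 1<E
            ( sound-put {s = s₂} a (prefix (i , i< , refl) (Y (lst i) (i , i< , refl) k (s≤s⁻¹ (subst (k <_) n*1+1 k<)) (λ z → nz (trans (slot≡ k) z))))
            , (λ D τ z → reach-put {s₂} (b D τ z) (lst i) (suc t))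
            , (λ D z → reach-put {s₂} (g D z) (lst i) (suc t))
            , λ _ _ _ z → 1+n≢0 (trans (sym (put-hit s₂ REACH (lst i) (suc t) 1)) z)))
          (λ z → do-skp (a , b , g , λ c c< nz → skipped z c c< nz))
          where
          slot≡ : ∀ c → s₂ SLOT (lst i) c ≡ s₁ SLOT (lst i) c
          slot≡ c = trans (same₂ SLOT tt (lst i) c) (same SLOT tt (lst i) c)
          skipped : s₂ SLOT (lst i) k ≡ 0 → ∀ c → c < suc k → s₁ SLOT (lst i) c ≢ 0 → s₂ REACH (lst i) (suc t) ≢ 0
          skipped z c c< nz with c ≟ k
          ... | yes refl = contradiction (trans (sym (slot≡ c)) z) nz
          ... | no c≢ = d c (≤∧≢⇒< (s≤s⁻¹ c<) c≢) nz

    slots-spec : Tri slotsC (t ∷ []) s₀ (λ s → Sound (suc t) s × Grows s₀ s ×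
      (∀ {D D′} → Mem D → Mem D′ → s₀ REACH D t ≢ 0 → Step D D′ → s REACH D′ (suc t) ≢ 0))
    slots-spec = do-seq load-spec λ ld → let s₁ = run c₁ (t ∷ []) s₀; S₁ = stat₂-run c₁ tt (t ∷ []) s₀ S₀ in
      do-seq (sweeps s₁ S₁ ld) λ (Y , tr) → conseq
        (λ (a , b , c) → a , b , λ {D} {D′} Dm Dm′ r st → c D′ Dm′ (added D D′) (#≤ n _)
          (subst (λ I → run c₂ (t ∷ []) s₁ SLOT I (added D I) ≢ 0) (inter-end (mem< Dm′) st) (tr D D′ r Dm Dm′ st)))
        (store-spec (stat₂-run c₂ tt (t ∷ []) s₁ S₁)
          (λ D τ → trans (keep REACH c₂ tt (t ∷ []) s₁ D τ) (keep REACH c₁ tt (t ∷ []) s₀ D τ)) Y)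
      where
      c₁ c₂ : Cmd 1
      c₁ = allSets (loadC zero (suc (suc zero)))
      c₂ = for jobs (for jobs sweepC)
      sweeps : ∀ s₁ → Stat₂ s₁ → Loaded s₁ → Tri c₂ (t ∷ []) s₁ (λ s → AllJustified n s × Track n 0 s)
      sweeps s₁ S₁ ld = conseq (subst (λ N → AllJustified N (run c₂ (t ∷ []) s₁) × Track N 0 (run c₂ (t ∷ []) s₁)) n*1)
        (do-for (λ h s → AllJustified h s × Track h 0 s) safe-jobs (justified-start s₁ ld , track-start s₁ ld) outer)
        where
        outer : ∀ h s → h < n * 1 + 0 → (∀ a → T (keeps a (for jobs sweepC)) → Same a s s₁) → AllJustified h s × Track h 0 s →
                Tri (for jobs sweepC) (h ∷ t ∷ []) s (λ s′ → AllJustified (suc h) s′ × Track (suc h) 0 s′)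
        outer h s h< same (Y , tr) = conseq
          (λ (Y′ , tr′) → Y′ , track-cong (run (for jobs sweepC) (h ∷ t ∷ []) s) h n (suc h) 0 (λ D D′ → sym (inter-next D D′ h)) (subst (λ N → Track h N (run (for jobs sweepC) (h ∷ t ∷ []) s)) n*1 tr′))
          (do-for (λ v s → AllJustified (suc h) s × Track h v s) safe-jobs
            ((λ D Dm c c≤ nz → justified-weaken (Y D Dm c c≤ nz)) , tr)
            λ v s₂ v< same₂ (Y₂ , tr₂) → sweep-spec (subst (v <_) n*1 v<) (stat₂-kept sweepC tt same₂ (stat₂-kept (for jobs sweepC) tt same S₁)) Y₂ tr₂)

  distinct-members : Set
  distinct-members = ∀ i j → i < L → j < L → lst i ≡ lst j → i ≡ j

  module _ (distinct-lst : distinct-members)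
    (without-C : md ≡ false → (∀ {D u v} → Mem D → u ≺ v → (D ∋ v) ≡ true → (D ∋ u) ≡ true) ×
                             (∀ D → D < 2 ^ n → (∀ {u v} → u ≺ v → (D ∋ v) ≡ true → (D ∋ u) ≡ true) → Mem D)) where

    roundC′ : Cmd 1
    roundC′ = pairsC ∙ iff (cell MODE (num 0)) skp slotsC

    advance : ∀ {t} s s′ → Complete t s → Grows s s′ →
      (∀ {D D′} → Mem D → Mem D′ → s REACH D t ≢ 0 → Step D D′ → s′ REACH D′ (suc t) ≢ 0) → Complete (suc t) s′
    advance {t} s s′ cmp gr now D τ τ≤ p with τ ≟ suc t
    ... | no τ≢ = gr D τ (cmp D τ (s≤s⁻¹ (≤∧≢⇒< τ≤ τ≢)) p)
    advance {t} s s′ cmp gr now D .(suc t) τ≤ (next p Dm st) | yes refl = now (path-mem p) Dm (cmp _ t ≤-refl p) st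

    round-dp : ∀ {t s} → Stat₂ s → s LEN₂ 0 0 ≡ bit md * L → Sound t s → Complete t s →
               Tri roundC′ (t ∷ []) s (λ s′ → Sound (suc t) s′ × Complete (suc t) s′)
    round-dp {t} {s} S len₂ snd cmp = do-seq (pairs-spec S len₂ snd) λ (snd₁ , gr₁ , fr , now) →
      let s₁ = run pairsC (t ∷ []) s
          S₁ = stat₂-run pairsC tt (t ∷ []) s S
          md-ref : Ref (s₁ MODE 0 0) (md ≡ true)
          md-ref = subst (λ x → Ref x (md ≡ true)) (sym (mode (stat S₁))) ref-bit
      in do-if
        (λ nz → do-skp (snd₁ , advance s s₁ cmp gr₁ (now (to md-ref nz))))
        (λ z → let (cl , all) = without-C (¬true (≡0⇒¬ md-ref z)) in conseq
          (λ (snd₂ , gr₂ , now₂) → snd₂ , advance s (run slotsC (t ∷ []) s₁) cmp (λ D τ r → gr₂ D τ (gr₁ D τ r))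
            (λ {D} Dm Dm′ r st → now₂ Dm Dm′ (λ z → r (trans (sym (fr D)) z)) st))
          (slots-spec t s₁ S₁ distinct-lst (λ D r → proj₂ (snd D t (λ z → r (trans (fr D) z)))) snd₁ (λ {D} {u} {v} → cl {D} {u} {v}) all))

    dp-spec : ∀ {s} → Stat₂ s → (∀ D τ → s REACH D τ ≡ 0) → Tri dpC [] s (λ s′ → Sound n s′ × Complete n s′)
    dp-spec {s} S zeros = do-seq {Q = λ _ → ⊤} (do-put 1<E tt) λ _ → do-seq {Q = λ _ → ⊤} (do-put len₂< tt) λ _ →
      conseq (subst (λ N → Sound N (run dpC [] s) × Complete N (run dpC [] s)) n*1)
        (do-for (λ t s′ → Sound t s′ × Complete t s′) safe-jobs (snd₀ , cmp₀)
          λ t s′ t< same (a , b) → round-dp (stat₂-kept roundC′ tt same S₂)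
            (trans (same LEN₂ tt 0 0) (trans (put-hit s₁ LEN₂ 0 0 _) len₂≡)) a b)
      where
      s₁ = put-at s REACH 0 0 1
      s₂ = put-at s₁ LEN₂ 0 0 (s MODE 0 0 * s LEN (n + n) 0)
      S₂ : Stat₂ s₂
      S₂ = record { stat = record { pow = pow (stat S) ; keys = keys (stat S) ; mode = mode (stat S) } ; len-L = len-L S ; list = list S }
      len₂≡ : s MODE 0 0 * s LEN (n + n) 0 ≡ bit md * L
      len₂≡ = cong₂ _*_ (mode (stat S)) (len-L S)
      len₂< : s MODE 0 0 * s LEN (n + n) 0 < 2 ^ E
      len₂< = small-set (≤-trans (≤-reflexive len₂≡) (≤-trans (*-monoˡ-≤ L (bit≤1 md)) (≤-trans (≤-reflexive (*-identityˡ L)) (≤-trans L≤2^n (m≤m+n _ 1)))))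
      snd₀ : Sound 0 s₂
      snd₀ D τ nz with 0 ≟ D | 0 ≟ τ
      ... | yes refl | yes refl = z≤n , prefix-∅
      ... | no D≢ | _ = contradiction (trans (put-miss s REACH 0 0 1 REACH D τ (λ _ e → contradiction e D≢)) (zeros D τ)) nz
      ... | _ | no τ≢ = contradiction (trans (put-miss s REACH 0 0 1 REACH D τ (λ _ _ → τ≢)) (zeros D τ)) nz
      cmp₀ : Complete 0 s₂
      cmp₀ D .0 z≤n (start _) z = 1+n≢0 (trans (sym (put-hit s REACH 0 0 1)) z)

-- Correctness of the greedy matching

ends : List (ℕ × ℕ) → ℕ → Bool
ends []             x = false
ends ((a , b) ∷ ps) x = does (x ≟ a) ∨ (does (x ≟ b) ∨ ends ps x)

NoDup : ℕ → List (ℕ × ℕ) → Set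
NoDup n []             = ⊤
NoDup n ((a , b) ∷ ps) = a < n × b < n × a ≢ b × ends ps a ≡ false × ends ps b ≡ false × NoDup n ps

∨-false : ∀ {a b} → a ∨ b ≡ false → a ≡ false × b ≡ false
∨-false {false} e = refl , e

∨-introʳ : ∀ a {b} → b ≡ true → a ∨ b ≡ true
∨-introʳ true  _ = refl
∨-introʳ false e = e

disjoint : ∀ n ps X → (∀ x → ends ps x ≡ true → X x ≡ false) → NoDup n ps → Disjoint n X ps
disjoint n [] X avoid nd = tt
disjoint n ((a , b) ∷ ps) X avoid (a< , b< , a≢b , a∉ , b∉ , nd) =
  a< , b< , a≢b , avoid a (cong (_∨ (does (a ≟ b) ∨ ends ps a)) (dec-true (a ≟ a) refl)) ,
  avoid b (∨-introʳ (does (b ≟ a)) (cong (_∨ ends ps b) (dec-true (b ≟ b) refl))) ,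
  disjoint n ps _ avoid′ nd
  where
  avoid′ : ∀ x → ends ps x ≡ true → ((X [ a ↦ᵇ true ]) [ b ↦ᵇ true ]) x ≡ false
  avoid′ x x∈ = trans (updᵇ-diff (X [ a ↦ᵇ true ]) b true x (λ { refl → true≢ b∉ x∈ }))
    (trans (updᵇ-diff X a true x (λ { refl → true≢ a∉ x∈ }))
      (avoid x (∨-introʳ (does (x ≟ a)) (∨-introʳ (does (x ≟ b)) x∈))))

#-insert : ∀ n (f g : ℕ → ℕ) a → a < n → g a ≡ 0 → f a ≢ 0 → (∀ x → x ≢ a → f x ≡ g x) → # n f ≡ suc (# n g)
#-insert n f g a a< ga fa rest = begin
  Σ< n f′                        ≡⟨ Σ<-pick n f′ a a< ⟩
  f′ a + Σ< n (f′ [ a ↦ 0 ])     ≡⟨ cong₂ _+_ (sg≢0 fa) (Σ<-cong n λ x _ → go x) ⟩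
  1 + (0 + Σ< n (g′ [ a ↦ 0 ]))  ≡⟨ cong (λ z → suc (sg z + Σ< n (g′ [ a ↦ 0 ]))) ga ⟨
  1 + (g′ a + Σ< n (g′ [ a ↦ 0 ])) ≡⟨ cong suc (Σ<-pick n g′ a a<) ⟨
  suc (Σ< n g′)                  ∎
  where
  open ≡-Reasoning
  f′ g′ : ℕ → ℕ
  f′ = sg ∘ f
  g′ = sg ∘ g
  go : ∀ x → (f′ [ a ↦ 0 ]) x ≡ (g′ [ a ↦ 0 ]) x
  go x with x ≟ a
  ... | yes refl = trans (upd-same f′ a 0) (sym (upd-same g′ a 0))
  ... | no x≢ = trans (upd-diff f′ a 0 x x≢) (trans (cong sg (rest x x≢)) (sym (upd-diff g′ a 0 x x≢)))

card-ends : ∀ n ps → NoDup n ps → card n (ends ps) ≡ length ps + length ps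
card-ends n [] nd = ⇒#≡0 n _ (λ _ _ → refl)
card-ends n ((a , b) ∷ ps) (a< , b< , a≢b , a∉ , b∉ , nd) = begin
  card n (ends ((a , b) ∷ ps)) ≡⟨ #-insert n _ (bit ∘ mid) a a< (cong bit (trans (cong (_∨ ends ps a) (dec-false (a ≟ b) a≢b)) a∉))
                                    (λ z → 1+n≢0 (trans (sym (cong (λ c → bit (c ∨ mid a)) (dec-true (a ≟ a) refl))) z))
                                    (λ x x≢ → cong (λ c → bit (c ∨ mid x)) (dec-false (x ≟ a) x≢)) ⟩
  suc (card n mid)             ≡⟨ cong suc (#-insert n _ (bit ∘ ends ps) b b< (cong bit b∉)
                                    (λ z → 1+n≢0 (trans (sym (cong (λ c → bit (c ∨ ends ps b)) (dec-true (b ≟ b) refl))) z))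
                                    (λ x x≢ → cong (λ c → bit (c ∨ ends ps x)) (dec-false (x ≟ b) x≢))) ⟩
  suc (suc (card n (ends ps))) ≡⟨ cong (λ z → 2 + z) (card-ends n ps nd) ⟩
  suc (suc (length ps + length ps)) ≡⟨ cong suc (+-suc (length ps) (length ps)) ⟨
  suc (length ps) + suc (length ps) ∎
  where
  open ≡-Reasoning
  mid : ℕ → Bool
  mid x = does (x ≟ b) ∨ ends ps x

module Initialisation
  (n m : ℕ) (A : ℕ → ℕ → ℕ) (E : ℕ) (Λ : ℕ → ℕ)
  (A-bound : ∀ {u v} → A u v ≢ 0 → u < n × v < n) (A-irrefl : ∀ {u} → ¬ (A u u ≢ 0))
  (A-trans : ∀ {u v x} → A u v ≢ 0 → A v x ≢ 0 → A u x ≢ 0) (1≤m : 1 ≤ m)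
  (E-big : 2 ^ n + (n + n + 2) < 2 ^ E) where

  open Setup n m A E Λ false (λ _ → false) A-bound A-irrefl A-trans 1≤m E-big

  powC matchC keyC : Cmd 0
  powC = for jobs (put POW (addT (num 1) v₀) (num 0) (addT (cell POW v₀) (cell POW v₀)))
  matchC = for jobs (for jobs (iff (andT (adj v₁ v₀) (andT (notT (cell MATCH v₁)) (notT (cell MATCH v₀))))
    (put MATCH v₁ (num 0) (num 1) ∙ put MATCH v₀ (num 0) (num 1)) skp))
  keyC = for jobs (iff (andT (cell MODE (num 0)) (cell MATCH v₀)) (put KEY v₀ (num 0) v₀) (put KEY v₀ (num 0) (addT nn v₀)))

  pow-spec : ∀ {s} → s POW 0 0 ≡ 1 → Tri powC [] s (λ s′ → ∀ v → v ≤ n → s′ POW v 0 ≡ 2 ^ v)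
  pow-spec {s} p₀ = conseq (λ I v v≤ → I v (subst (v ≤_) (sym n*1) v≤))
    (do-for (λ i s′ → ∀ v → v ≤ i → s′ POW v 0 ≡ 2 ^ v) safe-jobs (λ { zero z≤n → p₀ }) body)
    where
    body : ∀ i s′ → i < n * 1 + 0 → _ → (∀ v → v ≤ i → s′ POW v 0 ≡ 2 ^ v) →
           Tri (put POW (addT (num 1) v₀) (num 0) (addT (cell POW v₀) (cell POW v₀))) (i ∷ []) s′ (λ s″ → ∀ v → v ≤ suc i → s″ POW v 0 ≡ 2 ^ v)
    body i s′ i< _ I = do-put (small-set (≤-trans (≤-reflexive dbl) (≤-trans (^-monoʳ-≤ 2 (subst (i <_) n*1 i<)) (m≤m+n _ 1)))) next
      where
      dbl : s′ POW i 0 + s′ POW i 0 ≡ 2 ^ suc i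
      dbl = trans (cong (λ x → x + x) (I i ≤-refl)) (cong (2 ^ i +_) (sym (+-identityʳ (2 ^ i))))
      next : ∀ v → v ≤ suc i → put-at s′ POW (suc i) 0 (s′ POW i 0 + s′ POW i 0) POW v 0 ≡ 2 ^ v
      next v v≤ with v ≟ suc i
      ... | yes refl = trans (put-hit s′ POW (suc i) 0 _) dbl
      ... | no v≢ = trans (put-miss s′ POW (suc i) 0 _ POW v 0 (λ _ e → contradiction (sym e) v≢)) (I v (s≤s⁻¹ (≤∧≢⇒< v≤ v≢)))

  record Matching (s : Store) : Set where
    field
      pairs   : List (ℕ × ℕ)
      no-dup  : NoDup n pairs
      ordered : All (λ p → proj₁ p ≺ proj₂ p) pairs
      marked  : ∀ x → Ref (s MATCH x 0) (ends pairs x ≡ true)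
  open Matching public

  Covered : Store → ℕ → ℕ → Set
  Covered s u v = u ≺ v → s MATCH u 0 ≢ 0 ⊎ s MATCH v 0 ≢ 0

  MatchGrows : Store → Store → Set
  MatchGrows s s′ = ∀ x → s MATCH x 0 ≢ 0 → s′ MATCH x 0 ≢ 0

  covered-grows : ∀ s s′ {u v} → MatchGrows s s′ → Covered s u v → Covered s′ u v
  covered-grows s s′ g c l = [ (λ z → inj₁ (g _ z)) , (λ z → inj₂ (g _ z)) ]′ (c l)

  matchStep : Cmd 2
  matchStep = iff (andT (adj v₁ v₀) (andT (notT (cell MATCH v₁)) (notT (cell MATCH v₀))))
    (put MATCH v₁ (num 0) (num 1) ∙ put MATCH v₀ (num 0) (num 1)) skp

  match-step : ∀ {s u v} → Matching s →
    Tri matchStep (v ∷ u ∷ []) s (λ s′ → Matching s′ × MatchGrows s s′ × Covered s′ u v)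
  match-step {s} {u} {v} M = do-if
    (λ nz → let (u≺v , u-free , v-free) = to r nz in
      do-seq {Q = λ _ → ⊤} (do-put 1<E tt) λ _ → do-put 1<E (added-pair u≺v u-free v-free))
    (λ z → do-skp (M , (λ _ z → z) , λ u≺v → either u≺v (≡0⇒¬ r z)))
    where
    r : Ref (A u v * (⟦ eq ⟧ᵒ (s MATCH u 0) 0 * ⟦ eq ⟧ᵒ (s MATCH v 0) 0)) (A u v ≢ 0 × (¬ (s MATCH u 0 ≢ 0)) × (¬ (s MATCH v 0 ≢ 0)))
    r = ref-and ref-nz (ref-and (ref-not ref-nz) (ref-not ref-nz))
    either : u ≺ v → ¬ (A u v ≢ 0 × (¬ (s MATCH u 0 ≢ 0)) × (¬ (s MATCH v 0 ≢ 0))) → s MATCH u 0 ≢ 0 ⊎ s MATCH v 0 ≢ 0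
    either u≺v k with s MATCH u 0 ≟ 0 | s MATCH v 0 ≟ 0
    ... | no nz | _ = inj₁ nz
    ... | _ | no nz = inj₂ nz
    ... | yes z | yes z′ = contradiction (u≺v , (λ nz → nz z) , (λ nz → nz z′)) k
    added-pair : u ≺ v → ¬ (s MATCH u 0 ≢ 0) → ¬ (s MATCH v 0 ≢ 0) → _
    added-pair u≺v u-free v-free = record
        { pairs   = (u , v) ∷ pairs M
        ; no-dup  = proj₁ (A-bound u≺v) , proj₂ (A-bound u≺v) , (λ { refl → A-irrefl u≺v }) ,
                    ¬true (λ e → u-free (from (marked M u) e)) , ¬true (λ e → v-free (from (marked M v) e)) , no-dup M
        ; ordered = u≺v ∷ ordered M
        ; marked  = mk
        } , gr , λ _ → inj₂ (λ z → 1+n≢0 (trans (sym (put-hit s₁ MATCH v 0 1)) z))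
      where
      s₁ = put-at s MATCH u 0 1
      s₂ = put-at s₁ MATCH v 0 1
      mk : ∀ x → Ref (s₂ MATCH x 0) (ends ((u , v) ∷ pairs M) x ≡ true)
      mk x with x ≟ v
      ... | yes refl = ref (λ _ → ∨-introʳ (does (x ≟ u)) (cong (_∨ ends (pairs M) x) (dec-true (x ≟ x) refl)))
                           (λ _ z → 1+n≢0 (trans (sym (put-hit s₁ MATCH x 0 1)) z))
      ... | no x≢v = subst₂ (λ y b → Ref y (does (x ≟ u) ∨ (b ∨ ends (pairs M) x) ≡ true))
                       (sym (put-miss s₁ MATCH v 0 1 MATCH x 0 (λ _ e → contradiction (sym e) x≢v))) (sym (dec-false (x ≟ v) x≢v)) rest
        where
        rest : Ref (s₁ MATCH x 0) (does (x ≟ u) ∨ ends (pairs M) x ≡ true)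
        rest with x ≟ u
        ... | yes refl = ref (λ _ → cong (_∨ ends (pairs M) x) (dec-true (x ≟ x) refl))
                             (λ _ z → 1+n≢0 (trans (sym (put-hit s MATCH x 0 1)) z))
        ... | no x≢u = subst₂ (λ y b → Ref y (b ∨ ends (pairs M) x ≡ true))
                         (sym (put-miss s MATCH u 0 1 MATCH x 0 (λ _ e → contradiction (sym e) x≢u))) (sym (dec-false (x ≟ u) x≢u)) (marked M x)
      gr : MatchGrows s s₂
      gr x nz with x ≟ v
      ... | yes refl = λ z → 1+n≢0 (trans (sym (put-hit s₁ MATCH x 0 1)) z)
      ... | no x≢v with x ≟ u
      ...   | yes refl = λ z → 1+n≢0 (trans (sym (trans (put-miss s₁ MATCH v 0 1 MATCH x 0 (λ _ e → contradiction (sym e) x≢v)) (put-hit s MATCH x 0 1))) z)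
      ...   | no x≢u = λ z → nz (trans (sym (trans (put-miss s₁ MATCH v 0 1 MATCH x 0 (λ _ e → contradiction (sym e) x≢v))
                                                   (put-miss s MATCH u 0 1 MATCH x 0 (λ _ e → contradiction (sym e) x≢u)))) z)

  match-spec : ∀ {s} → (∀ x → s MATCH x 0 ≡ 0) → Tri matchC [] s (λ s′ → Matching s′ × (∀ {u v} → Covered s′ u v))
  match-spec {s} zeros = conseq
    (λ (M , c) → M , λ {u} {v} l → c u v (subst (u <_) (sym n*1) (proj₁ (A-bound l))) l)
    (do-for (λ i s′ → Matching s′ × (∀ u v → u < i → Covered s′ u v)) safe-jobs
      (record { pairs = [] ; no-dup = tt ; ordered = [] ; marked = λ x → ref (λ nz → contradiction (zeros x) nz) λ () } , λ _ _ ()) outer)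
    where
    outer : ∀ i s₁ → i < n * 1 + 0 → (∀ a → T (keeps a (for jobs matchStep)) → Same a s₁ s) → Matching s₁ × (∀ u v → u < i → Covered s₁ u v) →
            Tri (for jobs matchStep) (i ∷ []) s₁ (λ s′ → Matching s′ × (∀ u v → u < suc i → Covered s′ u v))
    outer i s₁ i< _ (M₁ , c₁) = conseq (λ (M₂ , gr , c₂) → M₂ , all gr c₂)
      (do-for (λ j s′ → Matching s′ × MatchGrows s₁ s′ × (∀ v → v < j → Covered s′ i v)) safe-jobs (M₁ , (λ _ z → z) , λ _ ())
        λ j s₂ j< _ (M₂ , gr₂ , c₂) → conseq
          (λ (M₃ , gr₃ , c₃) → M₃ , (λ x z → gr₃ x (gr₂ x z)) , inner j s₂ (run matchStep (j ∷ i ∷ []) s₂) gr₃ c₃ c₂)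
          (match-step M₂))
      where
      s′ = run (for jobs matchStep) (i ∷ []) s₁
      all : MatchGrows s₁ s′ → (∀ v → v < n * 1 + 0 → Covered s′ i v) → ∀ u v → u < suc i → Covered s′ u v
      all gr c₂ u v u< l with u ≟ i
      ... | yes refl = c₂ v (subst (v <_) (sym n*1) (proj₂ (A-bound l))) l
      ... | no u≢ = covered-grows s₁ s′ gr (c₁ u v (≤∧≢⇒< (s≤s⁻¹ u<) u≢)) l
      inner : ∀ j s₂ s₃ → MatchGrows s₂ s₃ → Covered s₃ i j → (∀ v → v < j → Covered s₂ i v) → ∀ v → v < suc j → Covered s₃ i v
      inner j s₂ s₃ gr now old v v< l with v ≟ j
      ... | yes refl = now l
      ... | no v≢ = covered-grows s₂ s₃ gr (old v (≤∧≢⇒< (s≤s⁻¹ v<) v≢)) l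

  keyOf : Bool → (ℕ → Bool) → ℕ → ℕ
  keyOf md M x = if md ∧ M x then x else n + x

  key-spec : ∀ {s md M} → s MODE 0 0 ≡ bit md → (∀ x → Ref (s MATCH x 0) (M x ≡ true)) →
             Tri keyC [] s (λ s′ → ∀ x → x < n → s′ KEY x 0 ≡ keyOf md M x)
  key-spec {s} {md} {M} mode≡ mk = conseq (λ I x x< → I x (subst (x <_) (sym n*1) x<))
    (do-for (λ i s′ → ∀ x → x < i → s′ KEY x 0 ≡ keyOf md M x) safe-jobs (λ _ ()) body)
    where
    keyStep : Cmd 1
    keyStep = iff (andT (cell MODE (num 0)) (cell MATCH v₀)) (put KEY v₀ (num 0) v₀) (put KEY v₀ (num 0) (addT nn v₀))
    body : ∀ i s′ → i < n * 1 + 0 → (∀ a → T (keeps a keyStep) → Same a s′ s) → (∀ x → x < i → s′ KEY x 0 ≡ keyOf md M x) →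
           Tri keyStep (i ∷ []) s′ (λ s″ → ∀ x → x < suc i → s″ KEY x 0 ≡ keyOf md M x)
    body i s′ i<′ same I = do-if
      (λ nz → do-put (small (≤-trans (<⇒≤ i<) (≤-trans (m≤m+n n n) (m≤m+n _ 2))))
        (written i (let (a , b) = to r nz in sym (cong₂ (λ c d → if c ∧ d then i else n + i) a b))))
      (λ z → do-put (small (≤-trans (+-monoʳ-≤ n (<⇒≤ i<)) (m≤m+n _ 2))) (written (n + i) (sym (off md (M i) refl refl (≡0⇒¬ r z)))))
      where
      i< = subst (i <_) n*1 i<′
      r : Ref (s′ MODE 0 0 * s′ MATCH i 0) (md ≡ true × M i ≡ true)
      r = ref-and (subst (λ y → Ref y (md ≡ true)) (sym (trans (same MODE tt 0 0) mode≡)) ref-bit)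
                  (subst (λ y → Ref y (M i ≡ true)) (sym (same MATCH tt i 0)) (mk i))
      off : ∀ c d → md ≡ c → M i ≡ d → ¬ (md ≡ true × M i ≡ true) → keyOf md M i ≡ n + i
      off true  true  e e′ k = contradiction (e , e′) k
      off true  false e e′ k = cong₂ (λ c d → if c ∧ d then i else n + i) e e′
      off false d     e e′ k = cong (λ c → if c ∧ M i then i else n + i) e
      written : ∀ k → k ≡ keyOf md M i → ∀ x → x < suc i → put-at s′ KEY i 0 k KEY x 0 ≡ keyOf md M x
      written k k≡ x x< with x ≟ i
      ... | yes refl = trans (put-hit s′ KEY x 0 k) k≡
      ... | no x≢ = trans (put-miss s′ KEY i 0 k KEY x 0 (λ _ e → contradiction (sym e) x≢)) (I x (≤∧≢⇒< (s≤s⁻¹ x<) x≢))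

  ∅-store : Store
  ∅-store _ _ _ = 0

  record Initialised (s : Store) : Set where
    field
      matching : Matching s
      covered  : ∀ {u v} → Covered s u v
      powers   : ∀ v → v ≤ n → s POW v 0 ≡ 2 ^ v
      exact    : Bool
      exact≡   : exact ≡ does (60 * # n (λ x → s MATCH x 0) <? n)
      mode≡    : s MODE 0 0 ≡ bit exact
      key≡     : ∀ x → x < n → s KEY x 0 ≡ keyOf exact (ends (pairs matching)) x
      len-0    : s LEN 0 0 ≡ 1
      len-suc  : ∀ h → s LEN (suc h) 0 ≡ 0
      seen-0   : s SEEN 0 0 ≡ 1
      seen-∅   : ∀ D h → (D ≢ 0 ⊎ h ≢ 0) → s SEEN D h ≡ 0
      list-0   : ∀ i j → s LIST i j ≡ 0
      reach-0  : ∀ i j → s REACH i j ≡ 0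

  init-spec : Tri initC [] ∅-store Initialised
  init-spec = do-seq {Q = λ _ → ⊤} (do-put 1<E tt) λ _ →
    do-seq (pow-spec refl) λ pows →
    do-seq (match-spec (λ x → keep MATCH powC tt [] s₁ x 0)) λ (M , cov) →
    do-seq {Q = λ _ → ⊤} (do-put (≤-<-trans (bit≤1 _) 1<E) tt) λ _ →
    do-seq (key-spec {md = does (60 * # n (λ x → s₃ MATCH x 0) <? n)} refl (marked M)) λ ks →
    do-seq {Q = λ _ → ⊤} (do-put 1<E tt) λ _ →
    do-put 1<E (record
      { matching = record { pairs = pairs M ; no-dup = no-dup M ; ordered = ordered M
                          ; marked = λ x → subst (λ y → Ref y _) (sym (k₄ MATCH tt x 0)) (marked M x) }
      ; covered  = λ {u} {v} l → [ (λ z → inj₁ (λ y → z (trans (sym (k₄ MATCH tt u 0)) y))) , (λ z → inj₂ (λ y → z (trans (sym (k₄ MATCH tt v 0)) y))) ]′ (cov l)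
      ; powers   = λ v v≤ → trans (k₄ POW tt v 0) (trans (keep POW matchC tt [] s₂ v 0) (pows v v≤))
      ; exact    = does (60 * # n (λ x → s₃ MATCH x 0) <? n)
      ; exact≡   = cong (λ z → does (60 * z <? n)) (#-cong n λ x _ → sym (k₄ MATCH tt x 0))
      ; mode≡    = k₄ MODE tt 0 0
      ; key≡     = ks
      ; len-0    = put-hit s₅ LEN 0 0 1
      ; len-suc  = λ h → trans (put-miss s₅ LEN 0 0 1 LEN (suc h) 0 (λ _ ())) (old LEN tt tt tt (suc h) 0)
      ; seen-0   = put-hit s₆ SEEN 0 0 1
      ; seen-∅   = λ D h ne → trans (put-miss s₆ SEEN 0 0 1 SEEN D h (miss ne)) (old SEEN tt tt tt D h)
      ; list-0   = λ i j → old LIST tt tt tt i j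
      ; reach-0  = λ i j → old REACH tt tt tt i j
      })
    where
    s₁ = put-at ∅-store POW 0 0 1
    s₂ = run powC [] s₁
    s₃ = run matchC [] s₂
    s₄ = put-at s₃ MODE 0 0 (⟦ Defs.lt ⟧ᵒ (60 * # n (λ x → s₃ MATCH x 0)) n)
    s₅ = run keyC [] s₄
    s₆ = put-at s₅ LEN 0 0 1
    k₄ : ∀ a → T (keeps a keyC) → Same a s₅ s₄
    k₄ a k = keep a keyC k [] s₄
    miss : ∀ {D h} → D ≢ 0 ⊎ h ≢ 0 → SEEN ≡ SEEN → 0 ≡ D → 0 ≢ h
    miss (inj₁ D≢) _ e = contradiction (sym e) D≢
    miss (inj₂ h≢) _ _ e = h≢ (sym e)
    old : ∀ a → T (keeps a keyC) → T (keeps a matchC) → T (keeps a powC ∧ not (MODE ≡ᵇ a) ∧ not (POW ≡ᵇ a)) → ∀ i j → s₅ a i j ≡ 0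
    old a k k′ k″ i j = trans (k₄ a k i j) (trans (put-miss s₃ MODE 0 0 _ a i j (λ e → contradiction e (≢-of (∧-left (∧-right {keeps a powC} k″)))))
      (trans (keep a matchC k′ [] s₂ i j) (trans (keep a powC (∧-left k″) [] s₁ i j)
        (put-miss ∅-store POW 0 0 1 a i j (λ e → contradiction e (≢-of (∧-right {not (MODE ≡ᵇ a)} (∧-right {keeps a powC} k″)))))))
      )
      where
      ≢-of : ∀ {b} → T (not (b ≡ᵇ a)) → b ≢ a
      ≢-of {b} t refl with b ≡ᵇ b | ≡⇒≡ᵇ b b refl
      ... | true | _ = t

-- Optimality and list sizes

-- Bounds on the number of listed sets: all down-sets, when at least n / 120
-- disjoint comparable pairs exist, and the peelable ones otherwise.
sets₁ sets₂ : ℕ → ℕ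
sets₁ n = ((3 ^ (n / 120) * 2 ^ n) / 4 ^ (n / 120)) {{m^n≢0 4 (n / 120)}}
sets₂ n = ((2 ^ (n / 60) * (16 ^ (3 * (n / 60) + 2) * 17 ^ n)) / 16 ^ n) {{m^n≢0 16 n}}

lengths₁ lengths₂ : ℕ → ℕ → ℕ
lengths₁ n zero    = sets₁ n
lengths₁ n (suc _) = 0
lengths₂ n _       = sets₂ n

lengths : Bool → ℕ → ℕ → ℕ
lengths false = lengths₁
lengths true  = lengths₂

*≤⇒≤/ : ∀ x y d .{{_ : NonZero d}} → x * d ≤ y → x ≤ y / d
*≤⇒≤/ x y d le = ≤-trans (≤-reflexive (sym (m*n/n≡m x d))) (/-monoˡ-≤ d le)

count-below : ∀ n f M → (∀ t → t < n → f t ≢ 0 → t < M) → # n f ≤ M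
count-below zero    f M b = z≤n
count-below (suc n) f M b with f n in e
... | zero  = ≤-trans (≤-reflexive (+-identityʳ _)) (count-below n f M (λ t t< → b t (m≤n⇒m≤1+n t<)))
... | suc _ = ≤-trans (+-monoˡ-≤ 1 (#≤ n f)) (≤-trans (≤-reflexive (+-comm n 1)) (b n ≤-refl (λ z → 1+n≢0 (trans (sym e) z))))

count-above : ∀ n f k → k < n → (∀ t → t ≤ k → f t ≢ 0) → k < # n f
count-above n f k k<n b with m≤n⇒∃[o]m+o≡n k<n
... | o , refl = subst (suc k ≤_) (sym (Σ<-append (suc k) o (sg ∘ f))) (≤-trans (≤-reflexive (sym ones)) (m≤m+n _ _))
  where
  ones : # (suc k) f ≡ suc k
  ones = trans (Σ<-cong (suc k) (λ t t< → sg≢0 (b t (s≤s⁻¹ t<)))) (trans (Σ<-const (suc k) 1) (*-identityʳ (suc k)))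

module Solution
  (n m : ℕ) (A : ℕ → ℕ → ℕ) (E : ℕ)
  (A-bound : ∀ {u v} → A u v ≢ 0 → u < n × v < n) (A-irrefl : ∀ {u} → ¬ (A u u ≢ 0))
  (A-trans : ∀ {u v x} → A u v ≢ 0 → A v x ≢ 0 → A u x ≢ 0) (1≤m : 1 ≤ m)
  (E-big : 2 ^ n + (n + n + 2) < 2 ^ E) where

  open Initialisation n m A E (λ _ → 0) A-bound A-irrefl A-trans 1≤m E-big
    using (Initialised; module Initialised; Matching; module Matching)

  module Basic = Setup n m A E (λ _ → 0) false (λ _ → false) A-bound A-irrefl A-trans 1≤m E-big

  record Optimal (s : Store) : Set where
    field
      attained : ∃[ τ ] Basic.Feasible (Basic.val resultT [] s) τ
      least    : ∀ {M τ} → Basic.Feasible M τ → Basic.val resultT [] s ≤ M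

  module Search (s₁ : Store) (initialised : Initialised s₁) where

    open Initialised initialised

    ps : List (ℕ × ℕ)
    ps = Matching.pairs matching

    md : Bool
    md = exact

    C : ℕ → Bool
    C x = md ∧ ends ps x

    Λ : ℕ → ℕ
    Λ = lengths md n

    open Enumeration n m A E Λ md C A-bound A-irrefl A-trans 1≤m E-big

    stat₁ : Stat s₁
    stat₁ = record { pow = powers ; keys = key≡ ; mode = mode≡ }

    matched≡ : # n (λ x → s₁ MATCH x 0) ≡ card n (ends ps)
    matched≡ = ≤-antisym (#-mono n λ x _ nz → from ref-bit (to (Matching.marked matching x) nz))
                         (#-mono n λ x _ nz → from (Matching.marked matching x) (to ref-bit nz))

    cover : md ≡ true → ∀ {u v} → u ≺ v → C u ∨ C v ≡ true
    cover e {u} {v} l with covered l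
    ... | inj₁ z = cong₂ (λ a b → (a ∧ b) ∨ C v) e (to (Matching.marked matching u) z)
    ... | inj₂ z = ∨-introʳ (C u) (cong₂ _∧_ e (to (Matching.marked matching v) z))

    -- Without C: each matched pair excludes one of its four labellings.
    size₁ : md ≡ false → ∀ h F → (∀ D → D < 2 ^ n → F D ≢ 0 → Good md h D) → # (2 ^ n) F ≤ sets₁ n
    size₁ e h F good = *≤⇒≤/ (# (2 ^ n) F) (3 ^ q * 2 ^ n) (4 ^ q) {{m^n≢0 4 q}} (*-cancelʳ-≤ _ _ (4 ^ r) {{m^n≢0 4 r}} (begin
        # (2 ^ n) F * 4 ^ q * 4 ^ r      ≡⟨ *-assoc (# (2 ^ n) F) (4 ^ q) (4 ^ r) ⟩
        # (2 ^ n) F * (4 ^ q * 4 ^ r)    ≡⟨ cong (# (2 ^ n) F *_) (trans (sym (^-distribˡ-+-* 4 q r)) (cong (4 ^_) q+r)) ⟩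
        # (2 ^ n) F * 4 ^ μ              ≤⟨ counted ⟩
        3 ^ μ * 2 ^ n                    ≡⟨ cong (_* 2 ^ n) (trans (cong (3 ^_) (sym q+r)) (^-distribˡ-+-* 3 q r)) ⟩
        3 ^ q * 3 ^ r * 2 ^ n            ≤⟨ *-monoˡ-≤ (2 ^ n) (*-monoʳ-≤ (3 ^ q) (^-monoˡ-≤ r (n≤1+n 3))) ⟩
        3 ^ q * 4 ^ r * 2 ^ n            ≡⟨ trans (*-assoc (3 ^ q) (4 ^ r) (2 ^ n)) (trans (cong (3 ^ q *_) (*-comm (4 ^ r) (2 ^ n))) (sym (*-assoc (3 ^ q) (2 ^ n) (4 ^ r)))) ⟩
        3 ^ q * 2 ^ n * 4 ^ r            ∎))
      where
      open ≤-Reasoning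
      μ = length ps
      q = n / 120
      n≤120μ : n ≤ μ * 120
      n≤120μ = ≤-trans (≮⇒≥ (does-no (60 * # n (λ x → s₁ MATCH x 0) <? n) (trans (sym exact≡) e)))
        (≤-reflexive (trans (cong (60 *_) (trans matched≡ (trans (card-ends n ps (Matching.no-dup matching)) (cong (μ +_) (sym (+-identityʳ μ))))))
          (trans (sym (*-assoc 60 2 μ)) (*-comm 120 μ))))
      q≤μ : q ≤ μ
      q≤μ = *-cancelʳ-≤ q μ 120 (≤-trans (m/n*n≤m n 120) n≤120μ)
      r = μ ∸ q
      q+r : q + r ≡ μ
      q+r = m+[n∸m]≡n q≤μ
      excl : ∀ D → D < 2 ^ n → F D ≢ 0 → ∀ a b → (a , b) ∈ ps → (D ∋ b) ≡ true → (D ∋ a) ≡ does (key a <? h)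
      excl D D< nz a b ab∈ b∈ with key a <? h | key b <? h | All.lookup (Matching.ordered matching) ab∈
      ... | yes ka | yes kb | a≺b = trans (Good.closed (good D D< nz) a≺b ka kb b∈) (sym (dec-true (key a <? h) ka))
      ... | no ka  | _      | a≺b = trans (Good.unlabelled (good D D< nz) a (proj₁ (A-bound a≺b)) (≮⇒≥ ka)) (sym (dec-false (key a <? h) ka))
      ... | _      | no kb  | a≺b = contradiction b∈ (true≢ (Good.unlabelled (good D D< nz) b (proj₂ (A-bound a≺b)) (≮⇒≥ kb)))
      counted : # (2 ^ n) F * 4 ^ μ ≤ 3 ^ μ * 2 ^ n
      counted = subst (λ z → # (2 ^ n) F * 4 ^ μ ≤ 3 ^ μ * 2 ^ z) (trans (Σ<-const n 1) (*-identityʳ n))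
        (pair-count n ps F (λ _ → false) (λ _ → false) (λ a → does (key a <? h))
          (disjoint n ps (λ _ → false) (λ _ _ → refl) (Matching.no-dup matching))
          (λ _ _ _ _ _ ()) excl)

    size₂ : md ≡ true → ∀ h F → (∀ D → D < 2 ^ n → F D ≢ 0 → Good md h D) → # (2 ^ n) F ≤ sets₂ n
    size₂ e h F good = *≤⇒≤/ (# (2 ^ n) F) _ (16 ^ n) {{m^n≢0 16 n}} (begin
        # (2 ^ n) F * 16 ^ n                         ≤⟨ sauer 16 (s≤s z≤n) n F C (3 * k + 2) (Cover.no-shatter (cover e) h F (λ D D< nz → subst (λ b → Good b h D) e (good D D< nz))) ⟩
        2 ^ k * (16 ^ (3 * k + 2) * 17 ^ n)          ≤⟨ *-mono-≤ (^-monoʳ-≤ 2 k≤) (*-monoˡ-≤ (17 ^ n) (^-monoʳ-≤ 16 (+-monoˡ-≤ 2 (*-monoʳ-≤ 3 k≤)))) ⟩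
        2 ^ (n / 60) * (16 ^ (3 * (n / 60) + 2) * 17 ^ n) ∎)
      where
      open ≤-Reasoning
      k = card n C
      k≡ : k ≡ # n (λ x → s₁ MATCH x 0)
      k≡ = trans (#-cong n (λ x _ → cong (λ b → bit (b ∧ ends ps x)) e)) (sym matched≡)
      k≤ : k ≤ n / 60
      k≤ = *≤⇒≤/ k n 60 (<⇒≤ (subst (_< n) (trans (cong (60 *_) (sym k≡)) (*-comm 60 k)) (does-yes (60 * # n (λ x → s₁ MATCH x 0) <? n) (trans (sym exact≡) e))))

    size : ∀ h F → (∀ D → D < 2 ^ n → F D ≢ 0 → Good md h D) → # (2 ^ n) F ≤ Λ LEN
    size h F good = go md refl
      where
      go : ∀ b → md ≡ b → # (2 ^ n) F ≤ lengths b n LEN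
      go false e = size₁ e h F good
      go true  e = size₂ e h F good

    start-inv : EnumInv 0 s₁
    start-inv = record
      { current = record
        { members  = λ i i< z → 1+n≢0 (trans (sym seen-0) (trans (cong (λ D → s₁ SEEN D 0) (sym (list-0 i 0))) z))
        ; distinct = λ i j i< j< _ → trans (n<1⇒n≡0 (subst (i <_) len-0 i<)) (sym (n<1⇒n≡0 (subst (j <_) len-0 j<)))
        ; seen     = λ { zero nz → m^n>0 2 n , empty-good , 0 , subst (0 <_) (sym len-0) (s≤s z≤n) , list-0 0 0
                       ; (suc D) nz → contradiction (seen-∅ (suc D) 0 (inj₁ λ ())) nz }
        }
      ; no-len   = λ { (suc h) _ → len-suc h }
      ; no-seen  = λ { (suc h) D _ → seen-∅ D (suc h) (inj₂ λ ()) }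
      ; complete = λ { .0 start z → 1+n≢0 (trans (sym seen-0) z) }
      }
      where
      open import Data.Integer using (0ℤ)
      import Data.Integer.Properties as ℤ
      empty-good : Good md 0 0
      empty-good = record
        { unlabelled = λ x _ _ → ∅∌ x
        ; closed     = λ _ ()
        ; unstuck    = λ _ α cons x x< → decidable-stable (α x ℤ.≟ 0ℤ) λ αx → contradiction (labelled (Consistent.support cons x x< αx)) λ ()
        }

    key-inj : ∀ {x y} → x < n → y < n → key x ≡ key y → x ≡ y
    key-inj {x} {y} x< y< e with C x | C y
    ... | true  | true  = e
    ... | false | false = +-cancelˡ-≡ n x y e
    ... | true  | false = contradiction (subst (_< n) e x<) (≤⇒≯ (m≤m+n n y))
    ... | false | true  = contradiction (subst (_< n) (sym e) y<) (≤⇒≯ (m≤m+n n x))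

    key< : ∀ {x} → x < n → key x < n + n
    key< {x} x< with C x
    ... | true  = <-≤-trans x< (m≤m+n n n)
    ... | false = +-monoʳ-< n x<

    part : ℕ → ℕ → ℕ
    part g D = set n (λ x → (D ∋ x) ∧ does (key x <? g))

    ∋-part : ∀ g D x → x < n → (part g D ∋ x) ≡ (D ∋ x) ∧ does (key x <? g)
    ∋-part g D x x< = ∋-set n _ x x<

    part-labelled : ∀ {g D x} → x < n → key x < g → (part g D ∋ x) ≡ (D ∋ x)
    part-labelled {g} {D} {x} x< kx = trans (∋-part g D x x<) (trans (cong ((D ∋ x) ∧_) (dec-true (key x <? g) kx)) (∧-identityʳ (D ∋ x)))

    part-unlabelled : ∀ {g D x} → x < n → g ≤ key x → (part g D ∋ x) ≡ false
    part-unlabelled {g} {D} {x} x< kx = trans (∋-part g D x x<) (trans (cong ((D ∋ x) ∧_) (dec-false (key x <? g) (≤⇒≯ kx))) (∧-zeroʳ (D ∋ x)))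

    part-full : ∀ D → D < 2 ^ n → part (n + n) D ≡ D
    part-full D D< = ∋-ext n _ _ (set< n _) D< λ x x< → part-labelled x< (key< x<)

    part-same : ∀ g D → (∀ v → v < n → key v ≡ g → (D ∋ v) ≡ false) → part (suc g) D ≡ part g D
    part-same g D none = ∋-ext n _ _ (set< n _) (set< n _) go
      where
      go : ∀ x → x < n → (part (suc g) D ∋ x) ≡ (part g D ∋ x)
      go x x< with key x <? g
      ... | yes l = trans (part-labelled x< (m≤n⇒m≤1+n l)) (sym (part-labelled x< l))
      ... | no ¬l with key x ≟ g
      ...   | yes e = trans (part-labelled x< (s≤s (≤-reflexive e))) (trans (none x x< e) (sym (part-unlabelled x< (≮⇒≥ ¬l))))
      ...   | no ne = trans (part-unlabelled x< (≤∧≢⇒< (≮⇒≥ ¬l) (ne ∘ sym))) (sym (part-unlabelled x< (≮⇒≥ ¬l)))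

    part-add : ∀ g D v → v < n → key v ≡ g → (D ∋ v) ≡ true → part (suc g) D ≡ part g D + 2 ^ v
    part-add g D v v< kv v∈ = ∋-ext n _ _ (set< n _) (add-bit< n _ v v< (set< n _) v∉) go
      where
      v∉ : (part g D ∋ v) ≡ false
      v∉ = part-unlabelled v< (≤-reflexive (sym kv))
      go : ∀ x → x < n → (part (suc g) D ∋ x) ≡ (part g D + 2 ^ v ∋ x)
      go x x< with x ≟ v
      ... | yes refl = trans (part-labelled x< (s≤s (≤-reflexive kv))) (trans v∈ (sym (add-bit-same _ x v∉)))
      ... | no x≢ = trans (old (key x <? g)) (sym (add-bit-other _ v v∉ x x≢))
        where
        old : Dec (key x < g) → (part (suc g) D ∋ x) ≡ (part g D ∋ x)
        old (yes l) = trans (part-labelled x< (m≤n⇒m≤1+n l)) (sym (part-labelled x< l))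
        old (no ¬l) = trans (part-unlabelled x< (≤∧≢⇒< (≮⇒≥ ¬l) (λ e → x≢ (key-inj x< v< (trans (sym e) (sym kv))))))
                        (sym (part-unlabelled x< (≮⇒≥ ¬l)))

    Down : ℕ → Set
    Down D = ∀ {u v} → u ≺ v → (D ∋ v) ≡ true → (D ∋ u) ≡ true

    in-family : ∀ D → Down D → (∀ g → CanPeel g (part (suc g) D)) → ∀ g → InFam g (part g D)
    in-family D down can zero = subst (InFam 0) (∋-ext n 0 _ (m^n>0 2 n) (set< n _) λ x x< → trans (∅∌ x) (sym (part-unlabelled {0} {D} x< z≤n))) start
    in-family D down can (suc g) = extend (in-family D down can g) cand (cl , can g)
      where
      cl : Closed (suc g) (part (suc g) D)
      cl u≺v ku kv v∈ = trans (part-labelled (proj₁ (A-bound u≺v)) ku) (down u≺v (trans (sym (part-labelled (proj₂ (A-bound u≺v)) kv)) v∈))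
      cand : Cand g (part g D) (part (suc g) D)
      cand with anyUpTo? (λ v → key v ≟ g) n
      ... | no none = inj₁ (part-same g D λ v v< kv → contradiction (v , v< , kv) none)
      ... | yes (v , v< , kv) with D ∋ v in e
      ...   | true  = inj₂ (v , v< , kv , part-add g D v v< kv e)
      ...   | false = inj₁ (part-same g D λ x x< kx → trans (cong (D ∋_) (key-inj x< v< (trans kx (sym kv)))) e)

    state-down : ∀ {M τ} → Feasible M τ → ∀ t → Down (state τ t)
    state-down {τ = τ} F t {u} {v} u≺v v∈ = trans (∋-state τ t u (proj₁ (A-bound u≺v)))
      (dec-true (τ u <? t) (<-trans (order F u≺v) (does-yes (τ v <? t) (trans (sym (∋-state τ t v (proj₂ (A-bound u≺v)))) v∈))))

    module Exact (e : md ≡ true) {M τ₀} (F₀ : Feasible M τ₀) where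

      open Canonical C (cover e) M τ₀ F₀

      τ : ℕ → ℕ
      τ = proj₁ canonical

      can : Canon τ
      can = proj₂ canonical

      can-peel : ∀ t g → CanPeel g (part (suc g) (state τ t))
      can-peel t g _ U U-alive ne = transfer (Peeling.peelable-pair can t U U-open ne)
        where
        D = state τ t
        same : ∀ x → x < n → U x ≢ 0 → (part (suc g) D ∋ x) ≡ (D ∋ x)
        same x x< Ux = part-labelled x< (labelled (U-alive x x< Ux))
        key-below : ∀ {b x} → x < n → U x ≢ 0 → b < n → C b ≡ true → key b < suc g
        key-below {b} {x} x< Ux b< Cb = <-trans (subst₂ _<_ (sym (key-C Cb)) (sym (key-¬C (outside (U-alive x x< Ux)))) (≤-trans b< (m≤m+n n x)))
                                                (labelled (U-alive x x< Ux))
        U-open : ∀ x → x < n → U x ≢ 0 → C x ≡ false × (∀ {a} → a ≺ x → τ a < t) × (∀ {b} → x ≺ b → t ≤ τ b)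
        U-open x x< Ux = ¬Cx ,
          (λ {a} a≺x → let a< = proj₁ (A-bound a≺x) in does-yes (τ a <? t) (trans (sym (∋-state τ t a a<))
             (trans (sym (part-labelled a< (key-below x< Ux a< (C-start a≺x ¬Cx)))) (released (U-alive x x< Ux) a≺x)))) ,
          (λ {b} x≺b → let b< = proj₂ (A-bound x≺b) in ≮⇒≥ (does-no (τ b <? t) (trans (sym (∋-state τ t b b<))
             (trans (sym (part-labelled b< (key-below x< Ux b< (C-end x≺b ¬Cx)))) (open-end (U-alive x x< Ux) x≺b)))))
          where ¬Cx = outside (U-alive x x< Ux)
        transfer : ∃[ c ] ∃[ c′ ] c < 2 + n × c′ < 2 + n × Peelable D U c c′ × (∃[ x ] (x < n × U x ≢ 0 × (PF c x ⊎ SF c′ x))) →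
                   ∃[ c ] ∃[ c′ ] c < 2 + n × c′ < 2 + n × Peelable (part (suc g) D) U c c′ × (∃[ x ] (x < n × U x ≢ 0 × (PF c x ⊎ SF c′ x)))
        transfer (c , c′ , c< , c′< , (p , q , r) , hit) = c , c′ , c< , c′< ,
          ((λ v v< Uv Dv → p v v< Uv (trans (sym (same v v< Uv)) Dv)) ,
           (λ u u< Uu Du → q u u< Uu (trans (sym (same u u< Uu)) Du)) ,
           (λ v u v< u< Uv Dv P Uu Du → r v u v< u< Uv (trans (sym (same v v< Uv)) Dv) P Uu (trans (sym (same u u< Uu)) Du))) , hit

    enumerated : Tri enumC [] s₁ (EnumInv (n + n))
    enumerated = enum-spec size stat₁ start-inv

    module Tabulate (s₂ : Store) (inv₂ : EnumInv (n + n) s₂) (stat₂′ : Stat s₂) (reach₂ : ∀ D τ → s₂ REACH D τ ≡ 0) where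

      L : ℕ
      L = s₂ LEN (n + n) 0

      lst : ℕ → ℕ
      lst i = s₂ LIST i (n + n)

      lst-seen : ∀ i → i < L → _
      lst-seen i i< = seen (current inv₂) (lst i) (members (current inv₂) i i<)

      L≤ : L ≤ Λ LEN
      L≤ = len≤Λ size (current inv₂)

      L≤₂ : bit md * L ≤ Λ LEN₂
      L≤₂ = go md refl
        where
        go : ∀ b → md ≡ b → bit b * L ≤ Λ LEN₂
        go false e = z≤n
        go true  e = ≤-trans (≤-reflexive (*-identityˡ L)) (≤-trans L≤ (≤-reflexive (cong (λ b → lengths b n LEN) e ⟨ trans ⟩ cong (λ b → lengths b n LEN₂) (sym e))))
          where open import Function.Base using (_⟨_⟩_)

      module DPn = DynamicProgram n m A E Λ md C A-bound A-irrefl A-trans 1≤m E-big L lst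
        (λ i i< → proj₁ (lst-seen i i<)) L≤ L≤₂ (≤-trans (len≤count (current inv₂)) (#≤ (2 ^ n) _))

      open DPn using (Mem; Path; start; next; Stat₂; dp-spec; Sound; Complete)

      listed : ∀ D → D < 2 ^ n → Down D → (∀ g → CanPeel g (part (suc g) D)) → Mem D
      listed D D< down can with seen (current inv₂) (part (n + n) D) (complete inv₂ _ (in-family D down can (n + n)))
      ... | _ , _ , i , i< , e = i , i< , trans e (part-full D D<)

      without-C : md ≡ false → (∀ {D u v} → Mem D → u ≺ v → (D ∋ v) ≡ true → (D ∋ u) ≡ true) ×
                              (∀ D → D < 2 ^ n → (∀ {u v} → u ≺ v → (D ∋ v) ≡ true → (D ∋ u) ≡ true) → Mem D)
      without-C e = closed′ , λ D D< down → listed D D< down (λ g e′ → contradiction (trans (sym e) e′) λ ())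
        where
        closed′ : ∀ {D u v} → Mem D → u ≺ v → (D ∋ v) ≡ true → (D ∋ u) ≡ true
        closed′ (i , i< , refl) u≺v = Good.closed (proj₁ (proj₂ (lst-seen i i<))) u≺v (key< (proj₁ (A-bound u≺v))) (key< (proj₂ (A-bound u≺v)))

      stat₂ : Stat₂ s₂
      stat₂ = record
        { stat  = stat₂′
        ; len-L = refl
        ; list  = λ i → refl
        }

      programmed : Tri dpC [] s₂ (λ s → Sound n s × Complete n s)
      programmed = dp-spec (distinct (current inv₂)) without-C stat₂ reach₂

      module Answer (s₃ : Store) (sound : Sound n s₃) (complete₃ : Complete n s₃) (pow₃ : s₃ POW n 0 ≡ 2 ^ n) where

        full : ℕ
        full = s₃ POW n 0 ∸ 1

        all-jobs : ℕ
        all-jobs = set n (λ _ → true)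

        all-jobs≡ : ∀ k → suc (set k (λ _ → true)) ≡ 2 ^ k
        all-jobs≡ zero    = refl
        all-jobs≡ (suc k) = trans (cong suc (sym (+-suc (set k (λ _ → true)) (set k (λ _ → true)))))
          (trans (cong (λ z → z + z) (all-jobs≡ k)) (cong (2 ^ k +_) (sym (+-identityʳ (2 ^ k)))))

        full≡ : full ≡ all-jobs
        full≡ = cong (_∸ 1) (trans pow₃ (sym (all-jobs≡ n)))

        path-states : ∀ {M τ} → Feasible M τ → (∀ t → Mem (state τ t)) → ∀ t → Path t (state τ t)
        path-states {τ = τ} F ms zero = subst (Path 0) (∋-ext n _ _ (m^n>0 2 n) (set< n _) λ x x< → trans (∅∌ x) (sym (trans (∋-state τ 0 x x<) (dec-false (τ x <? 0) λ ()))))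
          (start (subst Mem (∋-ext n _ _ (set< n _) (m^n>0 2 n) λ x x< → trans (trans (∋-state τ 0 x x<) (dec-false (τ x <? 0) λ ())) (sym (∅∌ x))) (ms 0)))
        path-states F ms (suc t) = next (path-states F ms t) (ms (suc t)) (state-step F t)

        some-path : ∀ {M τ} → Feasible M τ → Path M full
        some-path {M} {τ} F = go md refl
          where
          finish : ∀ {τ′} → Feasible M τ′ → Path M (state τ′ M) → Path M full
          finish {τ′} F′ = subst (Path M) (trans (∋-ext n _ _ (set< n _) (set< n _) λ x x< →
            trans (∋-state τ′ M x x<) (trans (dec-true (τ′ x <? M) (in-range F′ x x<)) (sym (∋-set n (λ _ → true) x x<)))) (sym full≡))
          go : ∀ b → md ≡ b → Path M full
          go false e = finish F (path-states F (λ t → proj₂ (without-C e) _ (set< n _) (state-down F t)) M)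
          go true  e = finish (Canonical.Canon.feasible X.can) (path-states (Canonical.Canon.feasible X.can) (λ t → listed _ (set< n _) (state-down (Canonical.Canon.feasible X.can) t) (λ g → X.can-peel t g)) M)
            where module X = Exact e F

        makespan : ℕ
        makespan = val resultT [] s₃

        reach-ref : ∀ t → Ref (⟦ eq ⟧ᵒ (s₃ REACH full t) 0) (s₃ REACH full t ≡ 0)
        reach-ref t = ref-eq

        feasible-at : ∀ t → s₃ REACH full t ≢ 0 → ∃[ τ ] Feasible t τ
        feasible-at t nz = let p = proj₂ (sound full t nz) in
          _ , prefix-full (λ x x< → subst (λ D → (D ∋ x) ≡ true) (sym full≡) (∋-set n _ x x<)) p

        reach-at : ∀ {M τ} → Feasible M τ → ∀ t → M ≤ t → t ≤ n → s₃ REACH full t ≢ 0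
        reach-at F t M≤t t≤n = complete₃ full t t≤n (some-path record
          { in-range = λ x x< → <-≤-trans (in-range F x x<) M≤t ; order = λ {u} {v} → order F {u} {v} ; capacity = capacity F })

        makespan-least : ∀ {M τ} → Feasible M τ → makespan ≤ M
        makespan-least {M} F = count-below n _ M λ t t< nz → ≰⇒> λ M≤t → reach-at F t M≤t (<⇒≤ t<) (to (reach-ref t) nz)

        makespan-feasible : ∃[ τ ] Feasible makespan τ
        makespan-feasible with makespan <? n
        ... | no ge = subst (λ k → ∃[ τ ] Feasible k τ) (≤-antisym (≮⇒≥ ge) (#≤ n _)) sequential
        ... | yes lt′ with s₃ REACH full makespan ≟ 0
        ...   | no nz = feasible-at makespan nz
        ...   | yes z = contradiction (count-above n _ makespan lt′ λ t t≤ → from (reach-ref t) (decidable-stable (s₃ REACH full t ≟ 0) λ nz →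
                          reach-at (proj₂ (feasible-at t nz)) makespan t≤ (<⇒≤ lt′) z)) (<-irrefl refl)

        optimal : Optimal s₃
        optimal = record { attained = makespan-feasible ; least = makespan-least }

      tabulated : Tri dpC [] s₂ Optimal
      tabulated = conseq (λ (snd , cmp) → Answer.optimal (run dpC [] s₂) snd cmp (trans (keep POW dpC tt [] s₂ n 0) (pow stat₂′ n ≤-refl))) programmed

    searched : Tri (enumC ∙ dpC) [] s₁ Optimal
    searched = do-seq enumerated λ inv₂ → Tabulate.tabulated (run enumC [] s₁) inv₂
      (stat-same (keep POW enumC tt [] s₁) (keep KEY enumC tt [] s₁) (keep MODE enumC tt [] s₁) stat₁)
      (λ D τ → trans (keep REACH enumC tt [] s₁ D τ) (reach-0 D τ))

  ∅-store : Store
  ∅-store _ _ _ = 0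

  initial : ∀ Λ → Rules.Tri n m A E Λ initC [] ∅-store Initialised
  initial Λ = Rules.tri (Rules.Tri.safe (Initialisation.init-spec n m A E Λ A-bound A-irrefl A-trans 1≤m E-big))
                        (Rules.Tri.post (Initialisation.init-spec n m A E (λ _ → 0) A-bound A-irrefl A-trans 1≤m E-big))

  optimum : ∃[ b ] Rules.Tri n m A E (lengths b n) mainC [] ∅-store Optimal
  optimum = Initialised.exact i , Rules.do-seq n m A E Λ {c = initC} {d = enumC ∙ dpC} {Q = λ _ → ⊤} {R = Optimal}
      (Rules.tri (Rules.Tri.safe (initial Λ)) tt) (λ _ → Search.searched _ i)
    where
    i = Rules.Tri.post (initial (λ _ → 0))
    Λ = lengths (Initialised.exact i) n

-- Running time

-- Exponents of n + 1 and of the two list lengths.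
record Degree : Set where
  constructor deg
  field
    dn dp dq : ℕ
open Degree

_⊔ᵈ_ : Degree → Degree → Degree
deg a b c ⊔ᵈ deg a′ b′ c′ = deg (a ⊔ a′) (b ⊔ b′) (c ⊔ c′)

const-deg : Degree
const-deg = deg 0 0 0

up-n up-p up-q : Degree → Degree
up-n (deg a b c) = deg (suc a) b c
up-p (deg a b c) = deg a (suc b) c
up-q (deg a b c) = deg a b (suc c)

degT : ∀ {Γ} → Tm Γ → Degree
degT (adj s t)   = degT s ⊔ᵈ degT t
degT (arr a s t) = degT s ⊔ᵈ degT t
degT (bin o s t) = degT s ⊔ᵈ degT t
degT (cnt t)     = up-n (degT t)
degT _           = const-deg

coT : ∀ {Γ} → Tm Γ → ℕ
coT (adj s t)   = coT s + (coT t + suc (cost (adjᴱ 0)))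
coT (arr a s t) = coT s + (coT t + suc (cost (load (addrᴱ a (reg 0) (reg 1)))))
coT (bin o s t) = coT s + (coT t + 4)
coT (cnt t)     = 8 + (coT t + 14)
coT _           = 2

degB : ∀ {Γ} → Bound Γ → Degree → Degree
degB (times a k)     d = up-n d
degB (len zero t)    d = degT t ⊔ᵈ up-p d
degB (len (suc a) t) d = degT t ⊔ᵈ up-q d

coB : ∀ {Γ} → Bound Γ → ℕ → ℕ
coB (times a k) c = 6 + (6 + (a + k) * (c + 8))
coB (len a t)   c = coT (arr a t (num 0)) + (6 + (c + 8))

degC : ∀ {Γ} → Cmd Γ → Degree
degC skp           = const-deg
degC (put a i j t) = degT i ⊔ᵈ (degT j ⊔ᵈ degT t)
degC (c ∙ d)       = degC c ⊔ᵈ degC d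
degC (iff t c d)   = degT t ⊔ᵈ (degC c ⊔ᵈ degC d)
degC (for b c)     = degB b (degC c)
degC (lett t c)    = degT t ⊔ᵈ degC c

coC : ∀ {Γ} → Cmd Γ → ℕ
coC skp           = 1
coC (put a i j t) = coT i + (coT j + (coT t + suc (cost (addrᴱ a (reg 0) (reg 1)) + 1)))
coC (c ∙ d)       = coC c + coC d
coC (iff t c d)   = coT t + (2 + (coC c + coC d))
coC (for b c)     = coB b (coC c)
coC (lett t c)    = coT t + coC c

⊔-const : ∀ d → d ⊔ᵈ const-deg ≡ d
⊔-const (deg a b c) rewrite ⊔-identityʳ a | ⊔-identityʳ b | ⊔-identityʳ c = refl

module CostBound (n : ℕ) (Λ : ℕ → ℕ) (P Q : ℕ) (1≤P : 1 ≤ P) (1≤Q : 1 ≤ Q)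
                  (Λ≤P : Λ 0 ≤ P) (Λ≤Q : ∀ a → Λ (suc a) ≤ Q) where

  open Cost n Λ

  N : ℕ
  N = suc n

  mono : Degree → ℕ
  mono (deg a b c) = N ^ a * (P ^ b * Q ^ c)

  1≤mono : ∀ d → 1 ≤ mono d
  1≤mono (deg a b c) = *-mono-≤ (m^n>0 N a) (*-mono-≤ (m^n>0 P {{>-nonZero 1≤P}} b) (m^n>0 Q {{>-nonZero 1≤Q}} c))

  left : ∀ d e → mono d ≤ mono (d ⊔ᵈ e)
  left (deg a b c) (deg a′ b′ c′) = *-mono-≤ (^-monoʳ-≤ N (m≤m⊔n a a′))
    (*-mono-≤ (^-monoʳ-≤ P {{>-nonZero 1≤P}} (m≤m⊔n b b′)) (^-monoʳ-≤ Q {{>-nonZero 1≤Q}} (m≤m⊔n c c′)))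

  right : ∀ d e → mono e ≤ mono (d ⊔ᵈ e)
  right (deg a b c) (deg a′ b′ c′) = *-mono-≤ (^-monoʳ-≤ N (m≤n⊔m a a′))
    (*-mono-≤ (^-monoʳ-≤ P {{>-nonZero 1≤P}} (m≤n⊔m b b′)) (^-monoʳ-≤ Q {{>-nonZero 1≤Q}} (m≤n⊔m c c′)))

  record _≲_ (x : ℕ) (b : ℕ × Degree) : Set where
    constructor bounded
    field bound : x ≤ proj₁ b * mono (proj₂ b)
  open _≲_ public

  const-≲ : ∀ k {d} → k ≲ (k , d)
  const-≲ k {d} = bounded (m≤m*n k (mono d) {{>-nonZero (1≤mono d)}})

  raise : ∀ {x c d e} → mono d ≤ mono e → x ≲ (c , d) → x ≲ (c , e)
  raise {c = c} l p = bounded (≤-trans (bound p) (*-monoʳ-≤ c l))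

  sum-same : ∀ {x y c c′ d} → x ≲ (c , d) → y ≲ (c′ , d) → (x + y) ≲ (c + c′ , d)
  sum-same {c = c} {c′} {d} p q = bounded (≤-trans (+-mono-≤ (bound p) (bound q)) (≤-reflexive (sym (*-distribʳ-+ (mono d) c c′))))

  sum-≲ : ∀ {x y c c′ d e} → x ≲ (c , d) → y ≲ (c′ , e) → (x + y) ≲ (c + c′ , (d ⊔ᵈ e))
  sum-≲ {d = d} {e} p q = sum-same (raise (left d e) p) (raise (right d e) q)

  scale : ∀ {x y c d e} k → x ≤ k → y ≲ (c , d) → k * mono d ≡ mono e → (x * y) ≲ (c , e)
  scale {x} {y} {c} {d} {e} k x≤ p m≡ = bounded (begin
    x * y             ≤⟨ *-mono-≤ x≤ (bound p) ⟩
    k * (c * mono d)  ≡⟨ solve 3 (λ k c m → k :* (c :* m) ⊜ c :* (k :* m)) refl k c (mono d) ⟩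
    c * (k * mono d)  ≡⟨ cong (c *_) m≡ ⟩
    c * mono e        ∎) where open ≤-Reasoning

  mono-n : ∀ d → N * mono d ≡ mono (up-n d)
  mono-n (deg a b c) = sym (*-assoc N (N ^ a) _)

  mono-p : ∀ d → P * mono d ≡ mono (up-p d)
  mono-p (deg a b c) = solve 4 (λ p x y z → p :* (x :* (y :* z)) ⊜ x :* (p :* y :* z)) refl P (N ^ a) (P ^ b) (Q ^ c)

  mono-q : ∀ d → Q * mono d ≡ mono (up-q d)
  mono-q (deg a b c) = solve 4 (λ q x y z → q :* (x :* (y :* z)) ⊜ x :* (y :* (q :* z))) refl Q (N ^ a) (P ^ b) (Q ^ c)

  two-≲ : ∀ {x y c c′ d e} k → x ≲ (c , d) → y ≲ (c′ , e) → (x + (y + k)) ≲ (c + (c′ + k) , (d ⊔ᵈ e))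
  two-≲ k p q = sum-≲ p (sum-same q (const-≲ k))

  tc-≲ : ∀ {Γ} (t : Tm Γ) → tc t ≲ (coT t , degT t)
  tc-≲ (var i)     = const-≲ 2
  tc-≲ nn          = const-≲ 2
  tc-≲ mm          = const-≲ 2
  tc-≲ (num k)     = const-≲ 2
  tc-≲ (adj s t)   = two-≲ (suc (cost (adjᴱ 0))) (tc-≲ s) (tc-≲ t)
  tc-≲ (arr a s t) = two-≲ (suc (cost (load (addrᴱ a (reg 0) (reg 1))))) (tc-≲ s) (tc-≲ t)
  tc-≲ (bin o s t) = two-≲ 4 (tc-≲ s) (tc-≲ t)
  tc-≲ (cnt t)     = sum-same (const-≲ 8) (scale N (n≤1+n n) (sum-same (tc-≲ t) (const-≲ 14)) (mono-n (degT t)))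

  time-≲ : ∀ {Γ} (c : Cmd Γ) → time c ≲ (coC c , degC c)
  time-≲ skp           = const-≲ 1
  time-≲ (put a i j t) = sum-≲ (tc-≲ i) (sum-≲ (tc-≲ j) (sum-same (tc-≲ t) (const-≲ _)))
  time-≲ (c ∙ d)       = sum-≲ (time-≲ c) (time-≲ d)
  time-≲ (iff t c d)   = sum-≲ (tc-≲ t) (sum-same (const-≲ 2) (sum-≲ (time-≲ c) (time-≲ d)))
  time-≲ (lett t c)    = sum-≲ (tc-≲ t) (time-≲ c)
  time-≲ (for (times a k) c) = sum-same (const-≲ 6) (sum-same (const-≲ 6)
      (bounded (≤-trans (*-monoˡ-≤ (time c + 8) rounds) (≤-trans (≤-reflexive (*-assoc (a + k) N (time c + 8)))
        (≤-trans (*-monoʳ-≤ (a + k) (bound body)) (≤-reflexive (sym (*-assoc (a + k) (coC c + 8) (mono (up-n (degC c)))))))))))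
    where
    rounds : n * a + k ≤ (a + k) * N
    rounds = begin
      n * a + k          ≤⟨ +-mono-≤ (*-monoˡ-≤ a (n≤1+n n)) (m≤n*m k N) ⟩
      N * a + N * k      ≡⟨ *-distribˡ-+ N a k ⟨
      N * (a + k)        ≡⟨ *-comm N (a + k) ⟩
      (a + k) * N        ∎ where open ≤-Reasoning
    body : (N * (time c + 8)) ≲ (coC c + 8 , up-n (degC c))
    body = scale N ≤-refl (sum-same (time-≲ c) (const-≲ 8)) (mono-n (degC c))
  time-≲ (for (len zero t) c) = sum-≲ {d = degT t} {up-p (degC c)} (raise {d = degT t ⊔ᵈ const-deg} (≤-reflexive (cong mono (⊔-const (degT t)))) (tc-≲ (arr zero t (num 0))))
    (sum-same (const-≲ 6) (scale P Λ≤P (sum-same (time-≲ c) (const-≲ 8)) (mono-p (degC c))))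
  time-≲ (for (len (suc a) t) c) = sum-≲ {d = degT t} {up-q (degC c)} (raise {d = degT t ⊔ᵈ const-deg} (≤-reflexive (cong mono (⊔-const (degT t)))) (tc-≲ (arr (suc a) t (num 0))))
    (sum-same (const-≲ 6) (scale Q (Λ≤Q a) (sum-same (time-≲ c) (const-≲ 8)) (mono-q (degC c))))

^-distribʳ-* : ∀ n x y → (x * y) ^ n ≡ x ^ n * y ^ n
^-distribʳ-* zero    x y = refl
^-distribʳ-* (suc n) x y = trans (cong (x * y *_) (^-distribʳ-* n x y))
  (solve 4 (λ x y u v → x :* y :* (u :* v) ⊜ x :* u :* (y :* v)) refl x y (x ^ n) (y ^ n))

record Bounded (f : ℕ → ℕ) (a b : ℕ) : Set where
  constructor bounded-by
  field
    factor : ℕ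
    bound  : ∀ n → f n * b ^ n ≤ factor * a ^ n

bounded-≤ : ∀ {f g a b} → (∀ n → f n ≤ g n) → Bounded g a b → Bounded f a b
bounded-≤ {b = b} f≤g (bounded-by c p) = bounded-by c λ n → ≤-trans (*-monoˡ-≤ (b ^ n) (f≤g n)) (p n)

bounded-const : ∀ k → Bounded (λ _ → k) 1 1
bounded-const k = bounded-by k λ n → ≤-refl

bounded-+ : ∀ {f g a b} → Bounded f a b → Bounded g a b → Bounded (λ n → f n + g n) a b
bounded-+ {f} {g} {a} {b} (bounded-by c p) (bounded-by d q) = bounded-by (c + d) λ n → begin
  (f n + g n) * b ^ n        ≡⟨ *-distribʳ-+ (b ^ n) (f n) (g n) ⟩
  f n * b ^ n + g n * b ^ n  ≤⟨ +-mono-≤ (p n) (q n) ⟩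
  c * a ^ n + d * a ^ n      ≡⟨ *-distribʳ-+ (a ^ n) c d ⟨
  (c + d) * a ^ n            ∎ where open ≤-Reasoning

bounded-* : ∀ {f g a b a′ b′} → Bounded f a b → Bounded g a′ b′ → Bounded (λ n → f n * g n) (a * a′) (b * b′)
bounded-* {f} {g} {a} {b} {a′} {b′} (bounded-by c p) (bounded-by d q) = bounded-by (c * d) λ n → begin
  f n * g n * (b * b′) ^ n         ≡⟨ cong (f n * g n *_) (^-distribʳ-* n b b′) ⟩
  f n * g n * (b ^ n * b′ ^ n)     ≡⟨ *-*-interchange (f n) (g n) (b ^ n) (b′ ^ n) ⟩
  f n * b ^ n * (g n * b′ ^ n)     ≤⟨ *-mono-≤ (p n) (q n) ⟩
  c * a ^ n * (d * a′ ^ n)         ≡⟨ *-*-interchange c (a ^ n) d (a′ ^ n) ⟩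
  c * d * (a ^ n * a′ ^ n)         ≡⟨ cong (c * d *_) (^-distribʳ-* n a a′) ⟨
  c * d * (a * a′) ^ n             ∎
  where
  open ≤-Reasoning
  *-*-interchange : ∀ x y z w → x * y * (z * w) ≡ x * z * (y * w)
  *-*-interchange = solve 4 (λ x y z w → x :* y :* (z :* w) ⊜ x :* z :* (y :* w)) refl

bounded-^ : ∀ {f a b} k → Bounded f a b → Bounded (λ n → f n ^ k) (a ^ k) (b ^ k)
bounded-^ zero    p = bounded-const 1
bounded-^ (suc k) p = bounded-* p (bounded-^ k p)

bounded-weaken : ∀ {f a b a′ b′} → 1 ≤ b → a * b′ ≤ a′ * b → Bounded f a b → Bounded f a′ b′
bounded-weaken {f} {a} {b} {a′} {b′} 1≤b l (bounded-by c p) = bounded-by c λ n →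
  *-cancelʳ-≤ _ _ (b ^ n) {{>-nonZero (m^n>0 b {{>-nonZero 1≤b}} n)}} (begin
    f n * b′ ^ n * b ^ n     ≡⟨ swap (f n) (b′ ^ n) (b ^ n) ⟩
    f n * b ^ n * b′ ^ n     ≤⟨ *-monoˡ-≤ (b′ ^ n) (p n) ⟩
    c * a ^ n * b′ ^ n       ≡⟨ *-assoc c (a ^ n) (b′ ^ n) ⟩
    c * (a ^ n * b′ ^ n)     ≡⟨ cong (c *_) (^-distribʳ-* n a b′) ⟨
    c * (a * b′) ^ n         ≤⟨ *-monoʳ-≤ c (^-monoˡ-≤ n l) ⟩
    c * (a′ * b) ^ n         ≡⟨ cong (c *_) (^-distribʳ-* n a′ b) ⟩
    c * (a′ ^ n * b ^ n)     ≡⟨ *-assoc c (a′ ^ n) (b ^ n) ⟨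
    c * a′ ^ n * b ^ n       ∎)
  where
  open ≤-Reasoning
  swap : ∀ x y z → x * y * z ≡ x * z * y
  swap x y z = trans (*-assoc x y z) (trans (cong (x *_) (*-comm y z)) (sym (*-assoc x z y)))

bounded-suc : ∀ {f a b} → b ≤ a → Bounded f a b → Bounded (λ n → suc (f n)) a b
bounded-suc {a = a} {b} b≤a = bounded-+ (bounded-weaken {a = 1} {1} ≤-refl (≤-trans (≤-reflexive (*-identityˡ b)) (≤-trans b≤a (≤-reflexive (sym (*-identityʳ a))))) (bounded-const 1))

linear-bounded : ∀ K → 1 ≤ K → Bounded suc (suc K) K
linear-bounded K 1≤K = bounded-by K go
  where
  open ≤-Reasoning
  go : ∀ n → suc n * K ^ n ≤ K * suc K ^ n
  go zero    = ≤-trans 1≤K (≤-reflexive (sym (*-identityʳ K)))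
  go (suc n) = begin
    suc (suc n) * K ^ suc n               ≡⟨ solve 3 (λ m K k → (con 1 :+ m) :* (K :* k) ⊜ K :* (m :* k) :+ K :* k) refl (suc n) K (K ^ n) ⟩
    K * (suc n * K ^ n) + K * K ^ n       ≤⟨ +-mono-≤ (*-monoʳ-≤ K (go n)) (*-monoʳ-≤ K (^-monoˡ-≤ n (n≤1+n K))) ⟩
    K * (K * suc K ^ n) + K * suc K ^ n   ≡⟨ solve 2 (λ K x → K :* (K :* x) :+ K :* x ⊜ K :* ((con 1 :+ K) :* x)) refl K (suc K ^ n) ⟩
    K * suc K ^ suc n                     ∎

block-power : ∀ s t a b k .{{_ : NonZero k}} → 1 ≤ a → 1 ≤ b → s * b ^ k ≤ t * a ^ k → ∀ n →
              s ^ (n / k) * b ^ n ≤ b ^ k * (t ^ (n / k) * a ^ n)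
block-power s t a b k 1≤a 1≤b l n = begin
  s ^ q * b ^ n                  ≡⟨ cong (λ z → s ^ q * b ^ z) (m≡m%n+[m/n]*n n k) ⟩
  s ^ q * b ^ (r + q * k)        ≡⟨ split s b ⟩
  b ^ r * (s * b ^ k) ^ q        ≤⟨ *-mono-≤ (^-monoʳ-≤ b {{>-nonZero 1≤b}} (<⇒≤ (m%n<n n k))) (^-monoˡ-≤ q l) ⟩
  b ^ k * (t * a ^ k) ^ q        ≤⟨ *-monoʳ-≤ (b ^ k) (m≤n*m _ (a ^ r) {{>-nonZero (m^n>0 a {{>-nonZero 1≤a}} r)}}) ⟩
  b ^ k * (a ^ r * (t * a ^ k) ^ q) ≡⟨ cong (b ^ k *_) (split t a) ⟨
  b ^ k * (t ^ q * a ^ (r + q * k)) ≡⟨ cong (λ z → b ^ k * (t ^ q * a ^ z)) (m≡m%n+[m/n]*n n k) ⟨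
  b ^ k * (t ^ q * a ^ n)        ∎
  where
  open ≤-Reasoning
  q = n / k
  r = n % k
  split : ∀ s b → s ^ q * b ^ (r + q * k) ≡ b ^ r * (s * b ^ k) ^ q
  split s b = begin-equality
    s ^ q * b ^ (r + q * k)         ≡⟨ cong (s ^ q *_) (^-distribˡ-+-* b r (q * k)) ⟩
    s ^ q * (b ^ r * b ^ (q * k))   ≡⟨ cong (λ z → s ^ q * (b ^ r * b ^ z)) (*-comm q k) ⟩
    s ^ q * (b ^ r * b ^ (k * q))   ≡⟨ cong (λ z → s ^ q * (b ^ r * z)) (^-*-assoc b k q) ⟨
    s ^ q * (b ^ r * (b ^ k) ^ q)   ≡⟨ solve 3 (λ x y z → x :* (y :* z) ⊜ y :* (x :* z)) refl (s ^ q) (b ^ r) ((b ^ k) ^ q) ⟩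
    b ^ r * (s ^ q * (b ^ k) ^ q)   ≡⟨ cong (b ^ r *_) (^-distribʳ-* q s (b ^ k)) ⟨
    b ^ r * (s * b ^ k) ^ q         ∎

sets₁-bounded : Bounded sets₁ (2 * 9977) 10000
sets₁-bounded = bounded-by (10000 ^ 120) λ n → go n (10000 ^ 120) 10000 9977 (block-power 3 4 9977 10000 120 (s≤s z≤n) (s≤s z≤n) (toWitness {a? = 3 * 10000 ^ 120 ≤? 4 * 9977 ^ 120} _) n)
  where
  open ≤-Reasoning
  go : ∀ n c b a → 3 ^ (n / 120) * b ^ n ≤ c * (4 ^ (n / 120) * a ^ n) → sets₁ n * b ^ n ≤ c * (2 * a) ^ n
  go n c b a l = *-cancelʳ-≤ _ _ (4 ^ q) {{m^n≢0 4 q}} (begin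
    sets₁ n * b ^ n * 4 ^ q       ≡⟨ solve 3 (λ x y z → x :* y :* z ⊜ x :* z :* y) refl (sets₁ n) (b ^ n) (4 ^ q) ⟩
    sets₁ n * 4 ^ q * b ^ n       ≤⟨ *-monoˡ-≤ (b ^ n) (m/n*n≤m _ (4 ^ q) {{m^n≢0 4 q}}) ⟩
    3 ^ q * 2 ^ n * b ^ n         ≡⟨ solve 3 (λ x y z → x :* y :* z ⊜ y :* (x :* z)) refl (3 ^ q) (2 ^ n) (b ^ n) ⟩
    2 ^ n * (3 ^ q * b ^ n)       ≤⟨ *-monoʳ-≤ (2 ^ n) l ⟩
    2 ^ n * (c * (4 ^ q * a ^ n)) ≡⟨ solve 4 (λ x c y z → x :* (c :* (y :* z)) ⊜ c :* (x :* z) :* y) refl (2 ^ n) c (4 ^ q) (a ^ n) ⟩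
    c * (2 ^ n * a ^ n) * 4 ^ q   ≡⟨ cong (λ z → c * z * 4 ^ q) (^-distribʳ-* n 2 a) ⟨
    c * (2 * a) ^ n * 4 ^ q       ∎)
    where q = n / 120

sets₂-bounded : Bounded sets₂ (1163 * 17) (1000 * 16)
sets₂-bounded = bounded-by (16 ^ 2 * 1000 ^ 60) λ n → go n (1000 ^ 60) 1000 1163
    (block-power (2 ^ 13) 1 1163 1000 60 (s≤s z≤n) (s≤s z≤n) (toWitness {a? = 2 ^ 13 * 1000 ^ 60 ≤? 1 * 1163 ^ 60} _) n)
  where
  open ≤-Reasoning
  powers : ∀ h → 2 ^ h * 16 ^ (3 * h + 2) ≡ 16 ^ 2 * (2 ^ 13) ^ h
  powers h = begin-equality
    2 ^ h * 16 ^ (3 * h + 2)            ≡⟨ cong (2 ^ h *_) (^-distribˡ-+-* 16 (3 * h) 2) ⟩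
    2 ^ h * (16 ^ (3 * h) * 16 ^ 2)     ≡⟨ solve 3 (λ x y z → x :* (y :* z) ⊜ z :* (x :* y)) refl (2 ^ h) (16 ^ (3 * h)) (16 ^ 2) ⟩
    16 ^ 2 * (2 ^ h * 16 ^ (3 * h))     ≡⟨ cong (λ z → 16 ^ 2 * (2 ^ h * z)) (^-*-assoc 16 3 h) ⟨
    16 ^ 2 * (2 ^ h * (16 ^ 3) ^ h)     ≡⟨ cong (16 ^ 2 *_) (^-distribʳ-* h 2 (16 ^ 3)) ⟨
    16 ^ 2 * (2 ^ 13) ^ h               ∎
  go : ∀ n c b a → (2 ^ 13) ^ (n / 60) * b ^ n ≤ c * (1 ^ (n / 60) * a ^ n) → sets₂ n * (b * 16) ^ n ≤ 16 ^ 2 * c * (a * 17) ^ n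
  go n c b a l = begin
    sets₂ n * (b * 16) ^ n                        ≡⟨ cong (sets₂ n *_) (^-distribʳ-* n b 16) ⟩
    sets₂ n * (b ^ n * 16 ^ n)                    ≡⟨ solve 3 (λ x y z → x :* (y :* z) ⊜ x :* z :* y) refl (sets₂ n) (b ^ n) (16 ^ n) ⟩
    sets₂ n * 16 ^ n * b ^ n                      ≤⟨ *-monoˡ-≤ (b ^ n) (m/n*n≤m _ (16 ^ n) {{m^n≢0 16 n}}) ⟩
    2 ^ h * (16 ^ (3 * h + 2) * 17 ^ n) * b ^ n   ≡⟨ solve 4 (λ x y z w → x :* (y :* z) :* w ⊜ x :* y :* (z :* w)) refl (2 ^ h) (16 ^ (3 * h + 2)) (17 ^ n) (b ^ n) ⟩
    2 ^ h * 16 ^ (3 * h + 2) * (17 ^ n * b ^ n)   ≡⟨ cong (_* (17 ^ n * b ^ n)) (powers h) ⟩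
    16 ^ 2 * (2 ^ 13) ^ h * (17 ^ n * b ^ n)      ≡⟨ rearrange (16 ^ 2) ((2 ^ 13) ^ h) (17 ^ n) (b ^ n) ⟩
    16 ^ 2 * 17 ^ n * ((2 ^ 13) ^ h * b ^ n)      ≤⟨ *-monoʳ-≤ (16 ^ 2 * 17 ^ n) l ⟩
    16 ^ 2 * 17 ^ n * (c * (1 ^ h * a ^ n))       ≡⟨ cong (λ z → 16 ^ 2 * 17 ^ n * (c * z)) (trans (cong (_* a ^ n) (^-zeroˡ h)) (*-identityˡ (a ^ n))) ⟩
    16 ^ 2 * 17 ^ n * (c * a ^ n)                 ≡⟨ rearrange₂ (16 ^ 2) (17 ^ n) c (a ^ n) ⟩
    16 ^ 2 * c * (a ^ n * 17 ^ n)                 ≡⟨ cong (16 ^ 2 * c *_) (^-distribʳ-* n a 17) ⟨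
    16 ^ 2 * c * (a * 17) ^ n                     ∎
    where
    h = n / 60
    rearrange : ∀ x y z w → x * y * (z * w) ≡ x * z * (y * w)
    rearrange = solve 4 (λ x y z w → x :* y :* (z :* w) ⊜ x :* z :* (y :* w)) refl
    rearrange₂ : ∀ x y z w → x * y * (z * w) ≡ x * z * (w * y)
    rearrange₂ = solve 4 (λ x y z w → x :* y :* (z :* w) ⊜ x :* z :* (w :* y)) refl

monomial-bounded : ∀ {P Q a b a′ b′} K d → 1 ≤ K → Bounded P a b → Bounded Q a′ b′ →
  Bounded (λ n → suc n ^ dn d * (P n ^ dp d * Q n ^ dq d))
    (suc K ^ dn d * (a ^ dp d * a′ ^ dq d)) (K ^ dn d * (b ^ dp d * b′ ^ dq d))
monomial-bounded K (deg x y z) 1≤K p q = bounded-* (bounded-^ x (linear-bounded K 1≤K)) (bounded-* (bounded-^ y p) (bounded-^ z q))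

bounded-scale : ∀ {f a b} k → Bounded f a b → Bounded (λ n → k * f n) a b
bounded-scale {f} {a} {b} k (bounded-by c p) = bounded-by (k * c) λ n →
  ≤-trans (≤-reflexive (*-assoc k (f n) (b ^ n))) (≤-trans (*-monoʳ-≤ k (p n)) (≤-reflexive (sym (*-assoc k c (a ^ n)))))

search-time : Bool → ℕ → ℕ
search-time b n = Cost.time n (lengths b n) mainC + Cost.tc n (lengths b n) resultT

-- Opaque, since comparing terms would unroll a product by this large number.
abstract
  factorOf : Cmd 0 → Tm 0 → ℕ
  factorOf c t = coC c + coT t

  program-time-≤ : ∀ c t {d} → degC c ⊔ᵈ degT t ≡ d → ∀ n Λ {P Q} → 1 ≤ P → 1 ≤ Q → Λ 0 ≤ P → (∀ a → Λ (suc a) ≤ Q) →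
                   Cost.time n Λ c + Cost.tc n Λ t ≤ factorOf c t * (suc n ^ dn d * (P ^ dp d * Q ^ dq d))
  program-time-≤ c t refl n Λ {P} {Q} 1≤P 1≤Q p q = bound (sum-≲ {d = degC c} {degT t} (time-≲ c) (tc-≲ t))
    where open CostBound n Λ P Q 1≤P 1≤Q p q

program-time-bounded : ∀ c t {e} → degC c ⊔ᵈ degT t ≡ e → ∀ K {Λ : ℕ → ℕ → ℕ} {P Q : ℕ → ℕ} {x y x′ y′} a b → 1 ≤ K →
  (∀ n → 1 ≤ P n) → (∀ n → 1 ≤ Q n) → (∀ n → Λ n 0 ≤ P n) → (∀ n a → Λ n (suc a) ≤ Q n) →
  Bounded P x y → Bounded Q x′ y′ →
  1 ≤ K ^ dn e * (y ^ dp e * y′ ^ dq e) →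
  suc K ^ dn e * (x ^ dp e * x′ ^ dq e) * b ≤ a * (K ^ dn e * (y ^ dp e * y′ ^ dq e)) →
  Bounded (λ n → Cost.time n (Λ n) c + Cost.tc n (Λ n) t) a b
program-time-bounded c t {e} deg≡ K {Λ} a b 1≤K 1≤P 1≤Q p q bp bq pos le =
  bounded-≤ (λ n → program-time-≤ c t deg≡ n (Λ n) (1≤P n) (1≤Q n) (p n) (q n))
    (bounded-scale (factorOf c t) (bounded-weaken pos le (monomial-bounded K e 1≤K bp bq)))

-- The polynomial factors are absorbed by (20001 / 20000) ^ n.
search-time-bounded : ∀ b → Bounded (search-time b) 1997 1000
search-time-bounded false = program-time-bounded mainC resultT {deg 7 1 2} refl 20000 {lengths false} {λ n → suc (sets₁ n)} {λ n → 1} {2 * 9977} {10000} {1} {1} 1997 1000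
  (s≤s z≤n) (λ n → s≤s z≤n) (λ n → ≤-refl) (λ n → n≤1+n _) (λ n a → z≤n)
  (bounded-suc (≤ᵇ⇒≤ 10000 (2 * 9977) _) sets₁-bounded) (bounded-const 1) (≤ᵇ⇒≤ 1 _ _) (≤ᵇ⇒≤ _ _ _)
search-time-bounded true = program-time-bounded mainC resultT {deg 7 1 2} refl 20000 {lengths true} {λ n → suc (sets₂ n)} {λ n → suc (sets₂ n)} {1163 * 17} {1000 * 16} {1163 * 17} {1000 * 16} 1997 1000
  (s≤s z≤n) (λ n → s≤s z≤n) (λ n → s≤s z≤n) (λ n → n≤1+n _) (λ n a → n≤1+n _)
  sets₂′ sets₂′ (≤ᵇ⇒≤ 1 _ _) (≤ᵇ⇒≤ _ _ _)
  where
  sets₂′ : Bounded (λ n → suc (sets₂ n)) (1163 * 17) (1000 * 16)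
  sets₂′ = bounded-suc (≤ᵇ⇒≤ (1000 * 16) (1163 * 17) _) sets₂-bounded

-- Instances and schedules as data

∣tabulate∣ : ∀ n (b : ℕ → Bool) → ∣ tabulate {n = n} (b ∘ toℕ) ∣ ≡ # n (bit ∘ b)
∣tabulate∣ zero    b = refl
∣tabulate∣ (suc n) b = trans (head (b 0) (tabulate {n = n} (b ∘ toℕ ∘ suc)))
  (trans (cong₂ _+_ (sym (sg-bit (b 0))) (∣tabulate∣ n (b ∘ suc))) (sym (Σ<-append 1 n (sg ∘ bit ∘ b))))
  where
  head : ∀ x (p : Subset n) → ∣ x ∷ p ∣ ≡ bit x + ∣ p ∣
  head true  p = refl
  head false p = refl

module Adjacency {n : ℕ} (I : Instance n) where

  open Instance I
  open IsDecStrictPartialOrder isDecStrictPartialOrder using (irrefl) renaming (trans to ≺-trans)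

  A : ℕ → ℕ → ℕ
  A u v with u <? n | v <? n
  ... | yes u< | yes v< = bit (does (fromℕ< u< ≺? fromℕ< v<))
  ... | _      | _      = 0

  A-toℕ : ∀ i j → A (toℕ i) (toℕ j) ≡ bit (does (i ≺? j))
  A-toℕ i j with toℕ i <? n | toℕ j <? n
  ... | yes i< | yes j< rewrite fromℕ<-toℕ i i< | fromℕ<-toℕ j j< = refl
  ... | no i≮  | _      = contradiction (toℕ<n i) i≮
  ... | yes _  | no j≮  = contradiction (toℕ<n j) j≮

  edge⇒ : ∀ {u v} → A u v ≢ 0 → ∃[ i ] ∃[ j ] (toℕ i ≡ u × toℕ j ≡ v × i ≺ j)
  edge⇒ {u} {v} e with u <? n | v <? n
  ... | yes u< | yes v< = fromℕ< u< , fromℕ< v< , toℕ-fromℕ< u< , toℕ-fromℕ< v< , ind⇒ (fromℕ< u< ≺? fromℕ< v<) e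
  ... | no _   | _      = contradiction refl e
  ... | yes _  | no _   = contradiction refl e

  ⇒edge : ∀ {i j} → i ≺ j → A (toℕ i) (toℕ j) ≢ 0
  ⇒edge {i} {j} l z = 1+n≢0 (trans (sym (ind-yes (i ≺? j) l)) (trans (sym (A-toℕ i j)) z))

  A-bound : ∀ {u v} → A u v ≢ 0 → u < n × v < n
  A-bound e with edge⇒ e
  ... | i , j , refl , refl , _ = toℕ<n i , toℕ<n j

  A-out : ∀ u v → n ≤ u ⊎ n ≤ v → A u v ≡ 0
  A-out u v out with u <? n | v <? n | out
  ... | yes u< | yes v< | inj₁ n≤u = contradiction n≤u (<⇒≱ u<)
  ... | yes u< | yes v< | inj₂ n≤v = contradiction n≤v (<⇒≱ v<)
  ... | no _   | _      | _        = refl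
  ... | yes _  | no _   | _        = refl

  A-irrefl : ∀ {u} → ¬ (A u u ≢ 0)
  A-irrefl e with edge⇒ e
  ... | i , j , refl , j≡ , l = irrefl (sym (toℕ-injective j≡)) l

  A-trans : ∀ {u v x} → A u v ≢ 0 → A v x ≢ 0 → A u x ≢ 0
  A-trans e e′ with edge⇒ e | edge⇒ e′
  ... | i , j , refl , refl , l | j′ , k , j≡ , refl , l′ with toℕ-injective j≡
  ...   | refl = ⇒edge (≺-trans l l′)

  encode-edge : ∀ i j → mem (encode I) (n * toℕ i + toℕ j) ≡ A (toℕ i) (toℕ j)
  encode-edge i j = trans edge (sym (A-toℕ i j))
    where
    edge : mem (encode I) (n * toℕ i + toℕ j) ≡ bit (does (i ≺? j))
    edge with n * toℕ i + toℕ j <? n * n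
    ... | no big = contradiction (subst (_< n * n) (toℕ-combine i j) (toℕ<n (combine i j))) big
    ... | yes l = cong (λ p → bit (does (proj₁ p ≺? proj₂ p)))
      (trans (cong (remQuot {n} n) (toℕ-injective {i = fromℕ< l} {combine i j} (trans (toℕ-fromℕ< l) (sym (toℕ-combine i j))))) (remQuot-combine i j))

  encode-rest : ∀ x → mem (encode I) (n * n + x) ≡ 0
  encode-rest x with n * n + x <? n * n
  ... | no _  = refl
  ... | yes l = contradiction l (≤⇒≯ (m≤m+n (n * n) x))

  encode≤1 : ∀ x → mem (encode I) x ≤ 1
  encode≤1 x with x <? n * n
  ... | no _  = z≤n
  ... | yes l = bit≤1 _

module Timetable {n : ℕ} (I : Instance n) where

  open Instance I
  open Adjacency I

  -- More than n + 1 machines are of no use, and their number might exceed 2 ^ E.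
  m′ : ℕ
  m′ = suc n ⊓ m

  1≤m′ : 1 ≤ m′
  1≤m′ = ⊓-glb (s≤s z≤n) (>-nonZero⁻¹ m)

  open module S = Scheduling n m′ (λ u v → A u v ≢ 0) (λ u v → ¬? (A u v ≟ 0)) A-bound A-irrefl A-trans 1≤m′
    using (does-yes; Feasible; in-range; order; capacity)

  to-schedule : ∀ {M τ} → Feasible M τ → Schedule I M
  to-schedule {M} {τ} F = record
    { T        = slot
    ; disjoint = λ { {i} {j} i≢j (x , x∈) → let p , q = x∈p∩q⁻ (slot i) (slot j) x∈ in
                   i≢j (toℕ-injective (trans (sym (∈-slot i x p)) (∈-slot j x q))) }
    ; covers   = λ v → fromℕ< (in-range F (toℕ v) (toℕ<n v)) , slot-∈ _ v (sym (toℕ-fromℕ< (in-range F (toℕ v) (toℕ<n v))))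
    ; capacity = λ i → ≤-trans (≤-reflexive (∣tabulate∣ n (λ x → does (τ x ≟ toℕ i)))) (≤-trans (capacity F (toℕ i)) (m⊓n≤n (suc n) m))
    ; respects = λ {u} {v} {i} {j} u∈ v∈ l → subst₂ _<_ (∈-slot i u u∈) (∈-slot j v v∈) (order F (⇒edge l))
    }
    where
    slot : Fin M → Subset n
    slot i = tabulate λ v → does (τ (toℕ v) ≟ toℕ i)
    ∈-slot : ∀ i v → v ∈ˢ slot i → τ (toℕ v) ≡ toℕ i
    ∈-slot i v v∈ = does-yes (τ (toℕ v) ≟ toℕ i) (trans (sym (lookup∘tabulate (λ v → does (τ (toℕ v) ≟ toℕ i)) v)) ([]=⇒lookup v∈))
    slot-∈ : ∀ i v → τ (toℕ v) ≡ toℕ i → v ∈ˢ slot i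
    slot-∈ i v e = lookup⇒[]= v (slot i) (trans (lookup∘tabulate (λ v → does (τ (toℕ v) ≟ toℕ i)) v) (dec-true (τ (toℕ v) ≟ toℕ i) e))

  from-schedule : ∀ {M} → Schedule I M → ∃[ τ ] Feasible M τ
  from-schedule {M} S = τ , record
    { in-range = λ x x< → subst (λ y → τ y < M) (toℕ-fromℕ< x<) (subst (_< M) (sym (τ-toℕ (fromℕ< x<))) (toℕ<n _))
    ; order    = λ e → ordered (edge⇒ e)
    ; capacity = λ s → ⊓-glb (≤-trans (#≤ n _) (n≤1+n n)) (cap s)
    }
    where
    open Schedule S using (disjoint; covers; respects) renaming (T to slots; capacity to |slots|≤m)
    τ : ℕ → ℕ
    τ x with x <? n
    ... | yes x< = toℕ (proj₁ (covers (fromℕ< x<)))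
    ... | no _   = 0
    τ-toℕ : ∀ v → τ (toℕ v) ≡ toℕ (proj₁ (covers v))
    τ-toℕ v with toℕ v <? n
    ... | yes v< rewrite fromℕ<-toℕ v v< = refl
    ... | no v≮  = contradiction (toℕ<n v) v≮
    ordered : ∀ {u v} → ∃[ i ] ∃[ j ] (toℕ i ≡ u × toℕ j ≡ v × i ≺ j) → τ u < τ v
    ordered (i , j , refl , refl , l) = subst₂ _<_ (sym (τ-toℕ i)) (sym (τ-toℕ j)) (respects (proj₂ (covers i)) (proj₂ (covers j)) l)
    cap : ∀ s → # n (λ x → ind (τ x ≟ s)) ≤ m
    cap s with s <? M
    ... | yes s< = ≤-trans (≤-reflexive (sym (∣tabulate∣ n (λ x → does (τ x ≟ s))))) (≤-trans (p⊆q⇒∣p∣≤∣q∣ inside) (|slots|≤m (fromℕ< s<)))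
      where
      inside : ∀ {v} → v ∈ˢ tabulate (λ v → does (τ (toℕ v) ≟ s)) → v ∈ˢ slots (fromℕ< s<)
      inside {v} v∈ = subst (λ i → v ∈ˢ slots i) (toℕ-injective (trans (sym (τ-toℕ v)) (trans e (sym (toℕ-fromℕ< s<))))) (proj₂ (covers v))
        where e = does-yes (τ (toℕ v) ≟ s) (trans (sym (lookup∘tabulate (λ v → does (τ (toℕ v) ≟ s)) v)) ([]=⇒lookup v∈))
    ... | no s≮ = ≤-trans (≤-reflexive (⇒#≡0 n _ λ x x< → ind-no (τ x ≟ s) λ e → s≮
                    (subst (_< M) (trans (sym (τ-toℕ (fromℕ< x<))) (trans (cong τ (toℕ-fromℕ< x<)) e)) (toℕ<n _)))) z≤n

  E : ℕ
  E = 4 * suc n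

  3*2^n<2^E : 3 * 2 ^ n < 2 ^ E
  3*2^n<2^E = begin-strict
    3 * 2 ^ n        <⟨ *-monoˡ-< (2 ^ n) {{m^n≢0 2 n}} {3} {4} ≤-refl ⟩
    4 * 2 ^ n        ≡⟨ ^-distribˡ-+-* 2 2 n ⟨
    2 ^ (2 + n)      ≤⟨ ^-monoʳ-≤ 2 {2 + n} {E} (≤-trans (≤-reflexive (+-comm 1 (suc n))) (+-monoʳ-≤ (suc n) (s≤s z≤n))) ⟩
    2 ^ E            ∎ where open ≤-Reasoning

  E-big : 2 ^ n + (n + n + 2) < 2 ^ E
  E-big = ≤-<-trans (+-monoʳ-≤ (2 ^ n) (begin
    n + n + 2             ≡⟨ solve 1 (λ n → n :+ n :+ con 2 ⊜ (con 1 :+ n) :+ ((con 1 :+ n) :+ con 0)) refl n ⟩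
    suc n + (suc n + 0)   ≤⟨ *-monoʳ-≤ 2 (n<2^n n) ⟩
    2 * 2 ^ n             ∎)) 3*2^n<2^E
    where open ≤-Reasoning

  suc-n<2^E : suc n < 2 ^ E
  suc-n<2^E = ≤-<-trans (≤-trans (n<2^n n) (m≤m+n (2 ^ n) (2 * 2 ^ n))) 3*2^n<2^E

  module Sol = Solution n m′ A E A-bound A-irrefl A-trans 1≤m′ E-big

  optimal⇒ : ∀ s → Sol.Optimal s → IsMinMakespan I (Sol.Basic.val resultT [] s)
  optimal⇒ s opt = to-schedule (proj₂ (Sol.Optimal.attained opt)) , λ M′ S → Sol.Optimal.least opt (proj₂ (from-schedule S))

program : Cmd 0 → Tm 0 → Program
program c t = ifte (op lt (reg 0) (reg 1)) (1 := op add (reg 0) (lit 1)) skip ⨟ cc c [] 2 ⨟ ct t [] 2 ⨟ 0 := reg 2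

abstract
  width : Cmd 0 → Tm 0 → ℕ
  width c t = 4 * (szᶜ c + sz t)

  width-c : ∀ c t n w → width c t * suc n ≤ w → 4 * suc n * szᶜ c ≤ w
  width-c c t n w = ≤-trans (≤-trans (*-monoʳ-≤ (4 * suc n) (m≤m+n (szᶜ c) (sz t)))
    (≤-reflexive (solve 2 (λ x n → con 4 :* n :* x ⊜ con 4 :* x :* n) refl (szᶜ c + sz t) (suc n))))

  width-t : ∀ c t n w → width c t * suc n ≤ w → 4 * suc n * sz t ≤ w
  width-t c t n w = ≤-trans (≤-trans (*-monoʳ-≤ (4 * suc n) (m≤n+m (sz t) (szᶜ c)))
    (≤-reflexive (solve 2 (λ x n → con 4 :* n :* x ⊜ con 4 :* x :* n) refl (szᶜ c + sz t) (suc n))))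

module Execution {n : ℕ} (I : Instance n) (w : ℕ) (c : Cmd 0) (t : Tm 0) (wide : width c t * suc n ≤ w) (m<w : Instance.m I < 2 ^ w)
                 (Λ : ℕ → ℕ) where

  open Instance I using (m)
  open Adjacency I
  open Timetable I using (m′; E; suc-n<2^E)

  1≤E : 1 ≤ E
  1≤E = s≤s z≤n

  n<E : n < 2 ^ E
  n<E = ≤-trans (n≤1+n _) suc-n<2^E

  open Compiled w n m′ A E Λ 1≤E n<E (≤-<-trans (m⊓n≤m (suc n) m) suc-n<2^E) A-out
  open Semantics n m′ A
  open Safety E Λ
  open Cost n Λ

  ∅ : Store
  ∅ _ _ _ = 0

  E≤w : E ≤ w
  E≤w = ≤-trans (E≤ (sz≥1 t)) (width-t c t n w wide)

  machines : ∃[ σ ] ∃[ s ] (w ⊢ ifte (op lt (reg 0) (reg 1)) (1 := op add (reg 0) (lit 1)) skip , encode I ⇓[ s ] σ) ×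
               s ≤ 9 × regs σ 0 ≡ n × regs σ 1 ≡ m′ × mem σ ≡ mem (encode I)
  machines with n <? m
  ... | yes n<m = _ , _ , then⇓ (λ z → 1+n≢0 (trans (sym (trans test (bit-< n<m))) z)) assign⇓ , n≤1+n 8 , refl , trans sum (sym (m≤n⇒m⊓n≡m n<m)) , refl
    where
    test : eval w (op lt (reg 0) (reg 1)) (encode I) ≡ bit (does (n <? m))
    test = eval-< (encode I) (reg 0) (reg 1) refl refl (≤-trans (≤-reflexive (*-identityʳ E)) E≤w)
    sum : wrap w (n + wrap w 1) ≡ suc n
    sum = trans (cong (λ x → wrap w (n + x)) (wrap-id w (<2^-mono {1} {1} (s≤s (s≤s z≤n)) (≤-trans 1≤E E≤w))))
            (trans (cong (wrap w) (+-comm n 1)) (wrap-id w (<2^-mono suc-n<2^E E≤w)))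
  ... | no n≮m = _ , _ , else⇓ (trans test (bit-≮ (≮⇒≥ n≮m))) skip⇓ , ≤ᵇ⇒≤ 5 9 _ , refl , sym (m≥n⇒m⊓n≡n (m≤n⇒m≤1+n (≮⇒≥ n≮m))) , refl
    where
    test : eval w (op lt (reg 0) (reg 1)) (encode I) ≡ bit (does (n <? m))
    test = eval-< (encode I) (reg 0) (reg 1) refl refl (≤-trans (≤-reflexive (*-identityʳ E)) E≤w)

  execution : Safe c [] ∅ → ∃[ s ] ∃[ σ ] (w ⊢ program c t , encode I ⇓[ s ] σ) × s ≤ 11 + (time c + tc t) × regs σ 0 ≡ val t [] (run c [] ∅)
  execution safe = go machines
    where
    go : (∃[ σ ] ∃[ s ] (w ⊢ ifte (op lt (reg 0) (reg 1)) (1 := op add (reg 0) (lit 1)) skip , encode I ⇓[ s ] σ) ×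
           s ≤ 9 × regs σ 0 ≡ n × regs σ 1 ≡ m′ × mem σ ≡ mem (encode I)) → _
    go (σ , s , ex , s≤ , r₀ , r₁ , me) = _ , _ , seq⇓ ex (seq⇓ (CmdRun.exec R₁) (seq⇓ (TmRun.exec R₂) assign⇓)) , steps , TmRun.result R₂
      where
      holds : Holds ∅ σ
      holds = record
        { reg-n  = r₀
        ; reg-m  = r₁
        ; input  = λ u v u< v< → trans (cong (λ f → f (n * u + v)) me)
                     (subst₂ (λ u v → mem (encode I) (n * u + v) ≡ A u v) (toℕ-fromℕ< u<) (toℕ-fromℕ< v<) (encode-edge (fromℕ< u<) (fromℕ< v<)))
        ; arrays = λ a i j → trans (cong (λ f → f (addr n a i j)) me) (encode-rest _)
        ; words  = λ x → ≤-<-trans (≤-trans (≤-reflexive (cong (λ f → f x) me)) (encode≤1 x)) (≤-<-trans (s≤s z≤n) suc-n<2^E)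
        }
      R₁ : CmdRun (cc c [] 2) 2 (run c [] ∅) (time c) σ
      R₁ = cc-run c [] [] 2 ∅ σ ≤-refl holds (env λ ()) (width-c c t n w wide) safe
      R₂ : TmRun (ct t [] 2) 2 (val t [] (run c [] ∅)) (tc t) (CmdRun.σ′ R₁)
      R₂ = ct-run t [] [] 2 (run c [] ∅) _ ≤-refl (CmdRun.holds R₁) (env λ ()) (width-t c t n w wide)
      steps : s + (CmdRun.s R₁ + (TmRun.s R₂ + 2)) ≤ 11 + (time c + tc t)
      steps = ≤-trans (+-mono-≤ s≤ (+-mono-≤ (CmdRun.s≤T R₁) (+-monoˡ-≤ 2 (TmRun.s≤T R₂))))
        (≤-reflexive (solve 2 (λ x y → con 9 :+ (x :+ (y :+ con 2)) ⊜ con 11 :+ (x :+ y)) refl (time c) (tc t)))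

total-time : ℕ → ℕ
total-time n = 11 + (search-time false n + search-time true n)

total-time-∈O : total-time ∈O[ 1997 / 1000 ]^n
total-time-∈O = ∈O (bounded-+ (bounded-weaken ≤-refl (≤ᵇ⇒≤ (1 * 1000) (1997 * 1) _) (bounded-const 11))
                              (bounded-+ (search-time-bounded false) (search-time-bounded true)))
  where
  ∈O : ∀ {f} → Bounded f 1997 1000 → f ∈O[ 1997 / 1000 ]^n
  ∈O (bounded-by c p) = c , 0 , λ n _ → p n

search-time-≤-total : ∀ b n → 11 + search-time b n ≤ total-time n
search-time-≤-total false n = +-monoʳ-≤ 11 (m≤m+n (search-time false n) (search-time true n))
search-time-≤-total true  n = +-monoʳ-≤ 11 (m≤n+m (search-time true n) (search-time false n))

computes-optimum : ∀ {n} (I : Instance n) w c t → width c t * suc n ≤ w → Instance.m I < 2 ^ w → ∀ Λ →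
  Rules.Tri n (Timetable.m′ I) (Adjacency.A I) (Timetable.E I) Λ c [] (λ _ _ _ → 0)
    (λ st → IsMinMakespan I (Semantics.val n (Timetable.m′ I) (Adjacency.A I) t [] st)) →
  ∃[ s ] ∃[ σ ] (w ⊢ program c t , encode I ⇓[ s ] σ) × s ≤ 11 + (Cost.time n Λ c + Cost.tc n Λ t) × IsMinMakespan I (regs σ 0)
computes-optimum I w c t wide m< Λ searched =
  let s , σ , ex , s≤ , result = Execution.execution I w c t wide m< Λ (Rules.Tri.safe searched)
  in s , σ , ex , s≤ , subst (IsMinMakespan I) (sym result) (Rules.Tri.post searched)

conseq-all : ∀ {n m A E Λ Γ} {c : Cmd Γ} {ρ st} (Q R : Store → Set) → (∀ s → Q s → R s) → Rules.Tri n m A E Λ c ρ st Q → Rules.Tri n m A E Λ c ρ st R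
conseq-all {n} {m} {A} {E} {Λ} Q R f (Rules.tri s q) = Rules.tri s (f _ q)

optimum-found : ∀ {n} (I : Instance n) → ∃[ b ] Rules.Tri n (Timetable.m′ I) (Adjacency.A I) (Timetable.E I) (lengths b n) mainC [] (λ _ _ _ → 0)
    (λ st → IsMinMakespan I (Semantics.val n (Timetable.m′ I) (Adjacency.A I) resultT [] st))
optimum-found {n} I = go Sol.optimum
  where
  open Timetable I
  open Adjacency I
  go : ∃[ b ] Rules.Tri n m′ A E (lengths b n) mainC [] (λ _ _ _ → 0) Sol.Optimal → _
  go (b , searched) = b , conseq-all Sol.Optimal (λ st → IsMinMakespan I (Semantics.val n m′ A resultT [] st)) optimal⇒ searched

computes : ComputesMinMakespanInTime (program mainC resultT) total-time
computes = width mainC resultT , λ n I w wide m< →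
  let b , searched = optimum-found I
      s , σ , ex , s≤ , optimal = computes-optimum I w mainC resultT wide m< (lengths b n) searched
  in s , σ , ex , ≤-trans s≤ (search-time-≤-total b n) , optimal

theorem1p2 : ∃[ p ] ∃[ time ] ComputesMinMakespanInTime p time × time ∈O[ 1997 / 1000 ]^n
theorem1p2 = program mainC resultT , total-time , computes , total-time-∈O
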